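{- Let $k\geq2$ and $C_0\geq1$. There are constants $c_{k,C_0},C'_{k,C_0}>0$ such that the following holds. Let $N\geq 1$, let $0<\delta<c_{k,C_0}$, let $H$ be a positive integer, set $B=N/H$, and assume $$B\geq C'_{k,C_0}\delta^{ -1},\qquad H\geq C'_{k,C_0}\delta^{ -2^{k-1}}.$$ Let $\lambda\colon\mathbb Z^k\to\mathbb C$ be $1$-bounded and supported on $([-C_0B,C_0B]\cap\mathbb Z)^k$, and let $f_1,\ldots,f_k\colon\mathbb Z\to\mathbb C$ be $1$-bounded and supported on $[N]$. If $$|R_H(\lambda;f_1,\ldots,f_k)|\geq\delta B^k\frac{N^2}{B},$$ then, for every $1\leq i\leq k$, $$\|f_i\|_{U^k[N]}\gg_{k,C_0}\frac{\delta^{2^{k-1}}}{(\log(2/\delta))^{(2^{k-1}-1)/2^k}}.$$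
   Context: For a real number $X\geq1$, $[X]=\{1,\ldots,\lfloor X\rfloor\}$. A function is $1$-bounded if its values have modulus at most $1$. $X\gg_{k,C_0}Y$ means $X\geq c\,Y$ with $c>0$ depending only on $k,C_0$. Counting operator: $\displaystyle R_H(\lambda;f_1,\ldots,f_k)=\sum_{\mathbf b\in\mathbb Z^k}\lambda(\mathbf b)\sum_{x\in\mathbb Z}\sum_{m\in[H]}\prod_{i=1}^kf_i(x+b_im).$ Gowers norms: for finitely supported $f\colon\mathbb Z\to\mathbb C$, $$\|f\|_{U^s(\mathbb Z)}=\Bigl(\sum_{x,h_1,\ldots,h_s\in\mathbb Z}\prod_{\omega\in\{0,1\}^s}\mathcal C^{|\omega|}f(x+\omega\cdot\mathbf h)\Bigr)^{1/2^s},$$ where $\mathcal C$ is complex conjugation, $|\omega|=\sum_j\omega_j$ and $\omega\cdot\mathbf h=\sum_j\omega_jh_j$; and $\|f\|_{U^s[N]}=\|f1_{[N]}\|_{U^s(\mathbb Z)}/\|1_{[N]}\|_{U^s(\mathbb Z)}$. -}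

module Defs where

open import Data.Bool using (Bool; true; false)
open import Data.Empty using (⊥; ⊥-elim)
open import Data.Fin using (Fin)
open import Data.Integer as ℤ using (ℤ; +_)
import Data.Integer.Properties as ℤ
open import Data.List using (List; []; _∷_; map; upTo; allFin; cartesianProductWith)
open import Data.List.Membership.Propositional using (_∈_)
open import Data.List.Membership.Propositional.Properties
  using (∈-map⁺; ∈-upTo⁺; ∈-cartesianProductWith⁺)
open import Data.List.Relation.Unary.Any using (here; there)
open import Data.Nat as ℕ using (ℕ; zero; suc)
import Data.Nat.Properties as ℕ
import Data.Nat.Coprimality as ℕ
open import Data.Product using (Σ; ∃; _×_; _,_; proj₁; proj₂)
open import Data.Rational
  using (ℚ; mkℚ; 0ℚ; 1ℚ; ½; _+_; _*_; _-_; -_; _≤_; _<_; ∣_∣; _⊔_; ↥_; 1/_; *≤*; *<*)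
import Data.Rational as ℚ
import Data.Rational.Properties as ℚ
open import Data.Rational.Solver using (module +-*-Solver)
open import Data.Sum using (_⊎_; inj₁; inj₂)
open import Data.Vec as Vec using (Vec; []; _∷_)
open import Data.Vec.Relation.Unary.All as All using (All; []; _∷_)
open import Function using (const)
open import Relation.Binary.PropositionalEquality
  using (_≡_; refl; sym; trans; cong; cong₂; subst; subst₂)
open import Relation.Nullary using (¬_; Dec; yes; no; contradiction)
open import Relation.Nullary.Decidable using (_×-dec_)

module _ where
  open +-*-Solver

  le : ∀ {p q d} → 0ℚ ≤ d → p + d ≡ q → p ≤ q
  le {p} {q} {d} 0≤d eq =
    subst₂ _≤_ (ℚ.+-identityʳ p) eq (ℚ.+-monoʳ-≤ p 0≤d)

  nn-sub : ∀ {p q} → p ≤ q → 0ℚ ≤ q - p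
  nn-sub {p} {q} p≤q =
    subst (_≤ q - p) (ℚ.+-inverseʳ p) (ℚ.+-monoˡ-≤ (- p) p≤q)

  nn+ : ∀ {p q} → 0ℚ ≤ p → 0ℚ ≤ q → 0ℚ ≤ p + q
  nn+ 0≤p 0≤q = ℚ.+-mono-≤ 0≤p 0≤q

  nn* : ∀ {p q} → 0ℚ ≤ p → 0ℚ ≤ q → 0ℚ ≤ p * q
  nn* {p} {q} 0≤p 0≤q =
    subst (_≤ p * q) (ℚ.*-zeroʳ p)
      (ℚ.*-monoˡ-≤-nonNeg p {{ℚ.nonNegative 0≤p}} 0≤q)

  pos* : ∀ {p q} → 0ℚ < p → 0ℚ < q → 0ℚ < p * q
  pos* {p} {q} 0<p 0<q =
    subst (_< p * q) (ℚ.*-zeroʳ p)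
      (ℚ.*-monoʳ-<-pos p {{ℚ.positive 0<p}} 0<q)

  pos+ : ∀ {p q} → 0ℚ < p → 0ℚ ≤ q → 0ℚ < p + q
  pos+ 0<p 0≤q = ℚ.+-mono-<-≤ 0<p 0≤q

  mono* : ∀ {p q r s} → 0ℚ ≤ p → 0ℚ ≤ r → p ≤ q → r ≤ s → p * r ≤ q * s
  mono* {p} {q} {r} {s} 0≤p 0≤r p≤q r≤s =
    le (nn+ (nn* (nn-sub p≤q) (ℚ.≤-trans 0≤r r≤s)) (nn* 0≤p (nn-sub r≤s)))
       (solve 4 (λ p q r s → p :* r :+ ((q :- p) :* s :+ p :* (s :- r)) := q :* s)
          refl p q r s)

  ≤∣∣ : ∀ p → p ≤ ∣ p ∣
  ≤∣∣ p with ℚ.≤-total 0ℚ p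
  ... | inj₁ 0≤p = ℚ.≤-reflexive (sym (ℚ.0≤p⇒∣p∣≡p 0≤p))
  ... | inj₂ p≤0 = ℚ.≤-trans p≤0 (ℚ.0≤∣p∣ p)

  -≤∣∣ : ∀ p → - p ≤ ∣ p ∣
  -≤∣∣ p = subst (- p ≤_) (ℚ.∣-p∣≡∣p∣ p) (≤∣∣ (- p))

  ∣∣≤ : ∀ {p e} → p ≤ e → - p ≤ e → ∣ p ∣ ≤ e
  ∣∣≤ {p} p≤e -p≤e with ℚ.∣p∣≡p∨∣p∣≡-p p
  ... | inj₁ eq = subst (_≤ _) (sym eq) p≤e
  ... | inj₂ eq = subst (_≤ _) (sym eq) -p≤e

  ∣∣⇒≤ : ∀ {p q e} → ∣ p - q ∣ ≤ e → p ≤ q + e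
  ∣∣⇒≤ {p} {q} {e} h =
    le (nn-sub (ℚ.≤-trans (≤∣∣ (p - q)) h))
       (solve 3 (λ p q e → p :+ (e :- (p :- q)) := q :+ e) refl p q e)

  ≤⇒∣∣ : ∀ {p q e} → p ≤ q + e → q ≤ p + e → ∣ p - q ∣ ≤ e
  ≤⇒∣∣ {p} {q} {e} h₁ h₂ = ∣∣≤
    (le (nn-sub h₁) (solve 3 (λ p q e → (p :- q) :+ ((q :+ e) :- p) := e) refl p q e))
    (le (nn-sub h₂) (solve 3 (λ p q e → (:- (p :- q)) :+ ((p :+ e) :- q) := e) refl p q e))

  ∣∣-swap : ∀ p q → ∣ p - q ∣ ≡ ∣ q - p ∣
  ∣∣-swap p q = trans (cong ∣_∣ (solve 2 (λ p q → p :- q := :- (q :- p)) refl p q))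
                      (ℚ.∣-p∣≡∣p∣ (q - p))

  ι : ℕ → ℚ
  ι n = mkℚ (+ n) 0 (ℕ.sym (ℕ.1-coprimeTo n))

  -- 1/(n+1)
  unit : ℕ → ℚ
  unit n = mkℚ (+ 1) n (ℕ.1-coprimeTo (suc n))

  ι-mono : ∀ {m n} → m ℕ.≤ n → ι m ≤ ι n
  ι-mono m≤n = *≤* (ℤ.*-monoʳ-≤-nonNeg (+ 1) (ℤ.+≤+ m≤n))

  0≤ι : ∀ n → 0ℚ ≤ ι n
  0≤ι n = ι-mono {0} {n} ℕ.z≤n

  ι-suc : ∀ n → ι (suc n) ≡ 1ℚ + ι n
  ι-suc n = sym (trans
    (ℚ./-cong {q₁ = 1} {q₂ = 1} (cong (λ a → + 1 ℤ.+ a) (ℤ.*-identityʳ (+ n))) refl)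
    (ℚ.↥p/↧p≡p (ι (suc n))))

  0<unit : ∀ n → 0ℚ < unit n
  0<unit n = *<* (ℤ.+<+ (ℕ.s≤s ℕ.z≤n))

  unit≤1 : ∀ n → unit n ≤ 1ℚ
  unit≤1 n = *≤* (ℤ.+≤+ (ℕ.s≤s ℕ.z≤n))

  0<1 : 0ℚ < 1ℚ
  0<1 = 0<unit 0

  0≤1 : 0ℚ ≤ 1ℚ
  0≤1 = ℚ.<⇒≤ 0<1

  0<½ : 0ℚ < ½
  0<½ = 0<unit 1

  0<ι : ∀ n → 0ℚ < ι (suc n)
  0<ι n = subst (0ℚ <_) (sym (ι-suc n)) (pos+ 0<1 (0≤ι n))

  ι-unit : ∀ n → ι (suc n) * unit n ≡ 1ℚ
  ι-unit n = ℚ.*-inverseʳ (ι (suc n))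

  ≤ι : ∀ q → q ≤ ι ℤ.∣ ↥ q ∣
  ≤ι (mkℚ (+ n) d c) = *≤* (ℤ.*-monoˡ-≤-nonNeg (+ n) (ℤ.+≤+ (ℕ.s≤s ℕ.z≤n)))
  ≤ι q@(mkℚ (ℤ.-[1+ n ]) d c) = *≤* ℤ.-≤+

  recip : ℚ → ℚ
  recip q with q ℚ.≟ 0ℚ
  ... | yes _ = 0ℚ
  ... | no q≢0 = (1/ q) {{ℚ.≢-nonZero q≢0}}

  recip-inv : ∀ {q} → 0ℚ < q → q * recip q ≡ 1ℚ
  recip-inv {q} 0<q with q ℚ.≟ 0ℚ
  ... | yes refl = contradiction 0<q (ℚ.<-irrefl refl)
  ... | no q≢0 = ℚ.*-inverseʳ q {{ℚ.≢-nonZero q≢0}}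

  recip-nn : ∀ {q} → 0ℚ < q → 0ℚ ≤ recip q
  recip-nn {q} 0<q = ℚ.*-cancelˡ-≤-pos q {{ℚ.positive 0<q}}
    (subst₂ _≤_ (sym (ℚ.*-zeroʳ q)) (sym (recip-inv 0<q)) 0≤1)

  recip-pos : ∀ {q} → 0ℚ < q → 0ℚ < recip q
  recip-pos {q} 0<q = ℚ.*-cancelˡ-<-nonNeg q {{ℚ.nonNegative (ℚ.<⇒≤ 0<q)}}
    (subst₂ _<_ (sym (ℚ.*-zeroʳ q)) (sym (recip-inv 0<q)) 0<1)

  recip-anti : ∀ {p q} → 0ℚ < p → p ≤ q → recip q ≤ recip p
  recip-anti {p} {q} 0<p p≤q =
    le (nn* (nn-sub p≤q) (nn* (recip-nn 0<p) (recip-nn 0<q)))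
       (trans (solve 4 (λ p q p' q' →
                 q' :+ (q :- p) :* (p' :* q') := q' :+ ((q :* q') :* p' :- (p :* p') :* q'))
                 refl p q (recip p) (recip q))
        (trans (cong₂ (λ a b → recip q + (a * recip p - b * recip q))
                  (recip-inv 0<q) (recip-inv 0<p))
          (solve 2 (λ p' q' → q' :+ (con 1ℚ :* p' :- con 1ℚ :* q') := p') refl
             (recip p) (recip q))))
    where 0<q = ℚ.<-≤-trans 0<p p≤q

  unit-small : ∀ ε → 0ℚ < ε → ∃ λ M → ∀ n → M ℕ.≤ n → unit n ≤ ε
  unit-small ε 0<ε = M , λ n M≤n →
    ℚ.*-cancelˡ-≤-pos (ι (suc n)) {{ℚ.positive (0<ι n)}}
      (subst₂ _≤_ (trans (ℚ.*-comm (recip ε) ε) (trans (recip-inv 0<ε) (sym (ι-unit n)))) refl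
        (mono* (recip-nn 0<ε) (ℚ.<⇒≤ 0<ε)
          (ℚ.≤-trans (≤ι (recip ε)) (ι-mono (ℕ.≤-trans M≤n (ℕ.n≤1+n n)))) ℚ.≤-refl))
    where M = ℤ.∣ ↥ (recip ε) ∣

  infixr 8 _^ℚ_

  _^ℚ_ : ℚ → ℕ → ℚ
  q ^ℚ zero  = 1ℚ
  q ^ℚ suc n = q * q ^ℚ n

  ^ℚ-nn : ∀ {r} → 0ℚ ≤ r → ∀ j → 0ℚ ≤ r ^ℚ j
  ^ℚ-nn 0≤r zero    = 0≤1
  ^ℚ-nn 0≤r (suc j) = nn* 0≤r (^ℚ-nn 0≤r j)

  ^ℚ-abs : ∀ {z r} → ∣ z ∣ ≤ r → ∀ j → ∣ z ^ℚ j ∣ ≤ r ^ℚ j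
  ^ℚ-abs h zero = ℚ.≤-refl
  ^ℚ-abs {z} {r} h (suc j) = subst (_≤ r * r ^ℚ j) (sym (ℚ.∣p*q∣≡∣p∣*∣q∣ z (z ^ℚ j)))
    (mono* (ℚ.0≤∣p∣ z) (ℚ.0≤∣p∣ (z ^ℚ j)) h (^ℚ-abs h j))

-- Cauchy sequences of rationals with a modulus, compared up to null
-- sequences.

IsCauchy : (ℕ → ℚ) → Set
IsCauchy x = ∀ ε → 0ℚ < ε →
  ∃ λ M → ∀ m n → M ℕ.≤ m → M ℕ.≤ n → ∣ x m - x n ∣ ≤ ε

record ℝ : Set where
  constructor mkℝ
  field
    seq    : ℕ → ℚ
    cauchy : IsCauchy seq

open ℝ public

infix 4 _≃ᴿ_ _≤ᴿ_ _<ᴿ_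

_≤ᴿ_ : ℝ → ℝ → Set
x ≤ᴿ y = ∀ ε → 0ℚ < ε → ∃ λ M → ∀ n → M ℕ.≤ n → seq x n ≤ seq y n + ε

_<ᴿ_ : ℝ → ℝ → Set
x <ᴿ y = ∃ λ ε → 0ℚ < ε × ∃ λ M → ∀ n → M ℕ.≤ n → seq x n + ε ≤ seq y n

_≃ᴿ_ : ℝ → ℝ → Set
x ≃ᴿ y = x ≤ᴿ y × y ≤ᴿ x

module _ where
  open +-*-Solver

  scaled : ∀ {x} C → 0ℚ < C →
    (∀ ε → 0ℚ < ε → ∃ λ M → ∀ m n → M ℕ.≤ m → M ℕ.≤ n → ∣ x m - x n ∣ ≤ C * ε) →
    IsCauchy x
  scaled {x} C 0<C h ε 0<ε with h (recip C * ε) (pos* (recip-pos 0<C) 0<ε)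
  ... | M , b = M , λ m n p q → subst (∣ x m - x n ∣ ≤_) eq (b m n p q)
    where
    eq : C * (recip C * ε) ≡ ε
    eq = trans (sym (ℚ.*-assoc C (recip C) ε))
      (trans (cong (_* ε) (recip-inv 0<C)) (ℚ.*-identityˡ ε))

  ∣+-∣ : ∀ a b c d → ∣ (a + b) - (c + d) ∣ ≤ ∣ a - c ∣ + ∣ b - d ∣
  ∣+-∣ a b c d = subst (λ t → ∣ t ∣ ≤ ∣ a - c ∣ + ∣ b - d ∣)
    (solve 4 (λ a b c d → (a :- c) :+ (b :- d) := (a :+ b) :- (c :+ d)) refl a b c d)
    (ℚ.∣p+q∣≤∣p∣+∣q∣ (a - c) (b - d))

  +-cauchy : ∀ {x y} → IsCauchy x → IsCauchy y → IsCauchy (λ n → x n + y n)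
  +-cauchy {x} {y} cx cy = scaled {λ n → x n + y n} (1ℚ + 1ℚ) (pos+ 0<1 0≤1) λ ε 0<ε →
    let M₁ , b₁ = cx ε 0<ε
        M₂ , b₂ = cy ε 0<ε
    in M₁ ℕ.⊔ M₂ , λ m n p q →
      ℚ.≤-trans (∣+-∣ (x m) (y m) (x n) (y n))
        (subst (∣ x m - x n ∣ + ∣ y m - y n ∣ ≤_)
          (solve 1 (λ e → e :+ e := (con 1ℚ :+ con 1ℚ) :* e) refl ε)
          (ℚ.+-mono-≤
            (b₁ m n (ℕ.m⊔n≤o⇒m≤o M₁ M₂ p) (ℕ.m⊔n≤o⇒m≤o M₁ M₂ q))
            (b₂ m n (ℕ.m⊔n≤o⇒n≤o M₁ M₂ p) (ℕ.m⊔n≤o⇒n≤o M₁ M₂ q))))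

  neg-cauchy : ∀ {x} → IsCauchy x → IsCauchy (λ n → - x n)
  neg-cauchy {x} cx ε 0<ε =
    let M , b = cx ε 0<ε in M , λ m n p q → subst (λ t → ∣ t ∣ ≤ ε)
    (solve 2 (λ a b → b :- a := (:- a) :- (:- b)) refl (x m) (x n)) (b n m q p)

  const-cauchy : ∀ q → IsCauchy (const q)
  const-cauchy q ε 0<ε = 0 , λ _ _ _ _ →
    subst (λ t → ∣ t ∣ ≤ ε) (sym (ℚ.+-inverseʳ q)) (ℚ.<⇒≤ 0<ε)

  bounded : ∀ {x} → IsCauchy x →
    ∃ λ K → 0ℚ < K × ∃ λ M → ∀ n → M ℕ.≤ n → ∣ x n ∣ ≤ K
  bounded {x} cx with cx 1ℚ 0<1
  ... | M , b = 1ℚ + ∣ x M ∣ , pos+ 0<1 (ℚ.0≤∣p∣ (x M)) , M , λ n p →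
    ℚ.≤-trans
      (subst (λ t → ∣ t ∣ ≤ ∣ x n - x M ∣ + ∣ x M ∣)
        (solve 2 (λ a b → (a :- b) :+ b := a) refl (x n) (x M))
        (ℚ.∣p+q∣≤∣p∣+∣q∣ (x n - x M) (x M)))
      (ℚ.+-monoˡ-≤ ∣ x M ∣ (b n M p ℕ.≤-refl))

  *-step : ∀ {K L} ε a b c d → ∣ a ∣ ≤ K → ∣ d ∣ ≤ L → ∣ a - c ∣ ≤ ε → ∣ b - d ∣ ≤ ε →
    ∣ a * b - c * d ∣ ≤ (K + L) * ε
  *-step {K} {L} ε a b c d ha hd hac hbd = subst₂ _≤_
    (cong ∣_∣ (solve 4 (λ a b c d → a :* (b :- d) :+ (a :- c) :* d := a :* b :- c :* d)
      refl a b c d))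
    (solve 3 (λ k l e → k :* e :+ e :* l := (k :+ l) :* e) refl K L ε)
    (ℚ.≤-trans (ℚ.∣p+q∣≤∣p∣+∣q∣ (a * (b - d)) ((a - c) * d))
      (subst (_≤ K * ε + ε * L)
        (sym (cong₂ _+_ (ℚ.∣p*q∣≡∣p∣*∣q∣ a (b - d)) (ℚ.∣p*q∣≡∣p∣*∣q∣ (a - c) d)))
        (ℚ.+-mono-≤
          (mono* (ℚ.0≤∣p∣ a) (ℚ.0≤∣p∣ (b - d)) ha hbd)
          (mono* (ℚ.0≤∣p∣ (a - c)) (ℚ.0≤∣p∣ d) hac hd))))

  *-cauchy : ∀ {x y} → IsCauchy x → IsCauchy y → IsCauchy (λ n → x n * y n)
  *-cauchy {x} {y} cx cy =
    let K , 0<K , M₁ , bx = bounded cx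
        L , 0<L , M₂ , by = bounded cy
    in scaled {λ n → x n * y n} (K + L) (pos+ 0<K (ℚ.<⇒≤ 0<L)) λ ε 0<ε →
      let M₃ , dx = cx ε 0<ε
          M₄ , dy = cy ε 0<ε
      in M₁ ℕ.⊔ M₂ ℕ.⊔ (M₃ ℕ.⊔ M₄) , λ m n p q →
        *-step {K} {L} ε (x m) (y m) (x n) (y n)
          (bx m (ℕ.m⊔n≤o⇒m≤o M₁ M₂ (ℕ.m⊔n≤o⇒m≤o _ (M₃ ℕ.⊔ M₄) p)))
          (by n (ℕ.m⊔n≤o⇒n≤o M₁ M₂ (ℕ.m⊔n≤o⇒m≤o _ (M₃ ℕ.⊔ M₄) q)))
          (dx m n (ℕ.m⊔n≤o⇒m≤o M₃ M₄ (ℕ.m⊔n≤o⇒n≤o (M₁ ℕ.⊔ M₂) _ p))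
                  (ℕ.m⊔n≤o⇒m≤o M₃ M₄ (ℕ.m⊔n≤o⇒n≤o (M₁ ℕ.⊔ M₂) _ q)))
          (dy m n (ℕ.m⊔n≤o⇒n≤o M₃ M₄ (ℕ.m⊔n≤o⇒n≤o (M₁ ℕ.⊔ M₂) _ p))
                  (ℕ.m⊔n≤o⇒n≤o M₃ M₄ (ℕ.m⊔n≤o⇒n≤o (M₁ ℕ.⊔ M₂) _ q)))

infixl 6 _+ᴿ_ _-ᴿ_
infixl 7 _*ᴿ_
infixr 8 _^ᴿ_
infix  8 -ᴿ_

fromℚ : ℚ → ℝ
fromℚ q = mkℝ (const q) (const-cauchy q)

fromℕ : ℕ → ℝ
fromℕ n = fromℚ (ι n)

0ᴿ 1ᴿ : ℝ
0ᴿ = fromℚ 0ℚ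
1ᴿ = fromℚ 1ℚ

_+ᴿ_ _*ᴿ_ : ℝ → ℝ → ℝ
x +ᴿ y = mkℝ (λ n → seq x n + seq y n) (+-cauchy {seq x} {seq y} (cauchy x) (cauchy y))
x *ᴿ y = mkℝ (λ n → seq x n * seq y n) (*-cauchy {seq x} {seq y} (cauchy x) (cauchy y))

-ᴿ_ : ℝ → ℝ
-ᴿ x = mkℝ (λ n → - seq x n) (neg-cauchy {seq x} (cauchy x))

_-ᴿ_ : ℝ → ℝ → ℝ
x -ᴿ y = x +ᴿ (-ᴿ y)

_^ᴿ_ : ℝ → ℕ → ℝ
x ^ᴿ zero  = 1ᴿ
x ^ᴿ suc n = x *ᴿ x ^ᴿ n

module _ where
  open +-*-Solver

  lower : ∀ {x} → 0ᴿ <ᴿ x → ∃ λ η → 0ℚ < η × ∃ λ M → ∀ n → M ℕ.≤ n → η ≤ seq x n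
  lower {x} (η , 0<η , M , b) = η , 0<η , M , λ n p →
    subst (_≤ seq x n) (ℚ.+-identityˡ η) (b n p)

  positive : ∀ {x} η → 0ℚ < η → ∀ M → (∀ n → M ℕ.≤ n → η ≤ seq x n) → 0ᴿ <ᴿ x
  positive {x} η 0<η M b = η , 0<η , M , λ n p →
    subst (_≤ seq x n) (sym (ℚ.+-identityˡ η)) (b n p)

  recip-cauchy : ∀ {x} → IsCauchy x → ∀ η → 0ℚ < η → ∀ M →
    (∀ n → M ℕ.≤ n → η ≤ x n) → IsCauchy (λ n → recip (x n))
  recip-cauchy {x} cx η 0<η M₀ b =
    scaled {λ n → recip (x n)} (recip η * recip η) (pos* (recip-pos 0<η) (recip-pos 0<η)) λ ε 0<ε →
    let M₁ , d = cx ε 0<ε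
    in M₀ ℕ.⊔ M₁ , λ m n p q → step (x m) (x n) ε
         (b m (ℕ.m⊔n≤o⇒m≤o M₀ M₁ p)) (b n (ℕ.m⊔n≤o⇒m≤o M₀ M₁ q))
         (d n m (ℕ.m⊔n≤o⇒n≤o M₀ M₁ q) (ℕ.m⊔n≤o⇒n≤o M₀ M₁ p))
    where
    step : ∀ u v ε → η ≤ u → η ≤ v → ∣ v - u ∣ ≤ ε →
      ∣ recip u - recip v ∣ ≤ recip η * recip η * ε
    step u v ε hu hv h = subst (_≤ recip η * recip η * ε) (sym eq)
      (mono* (nn* 0≤u' 0≤v') (ℚ.0≤∣p∣ (v - u))
        (mono* 0≤u' 0≤v' (recip-anti 0<η hu) (recip-anti 0<η hv)) h)
      where
      0<u = ℚ.<-≤-trans 0<η hu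
      0<v = ℚ.<-≤-trans 0<η hv
      0≤u' = recip-nn 0<u
      0≤v' = recip-nn 0<v
      eq : ∣ recip u - recip v ∣ ≡ recip u * recip v * ∣ v - u ∣
      eq = trans (cong ∣_∣ (trans
             (solve 2 (λ a b → a :- b := con 1ℚ :* a :- con 1ℚ :* b) refl (recip u) (recip v))
             (trans (cong₂ (λ a b → a * recip u - b * recip v)
                (sym (recip-inv 0<v)) (sym (recip-inv 0<u)))
               (solve 4 (λ u v a b → (v :* b) :* a :- (u :* a) :* b := (a :* b) :* (v :- u))
                  refl u v (recip u) (recip v)))))
        (trans (ℚ.∣p*q∣≡∣p∣*∣q∣ (recip u * recip v) (v - u))
          (cong (_* ∣ v - u ∣) (ℚ.0≤p⇒∣p∣≡p (nn* 0≤u' 0≤v'))))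

inv : (x : ℝ) → 0ᴿ <ᴿ x → ℝ
inv x 0<x = mkℝ (λ n → recip (seq x n))
  (let η , 0<η , M , b = lower {x} 0<x in recip-cauchy {seq x} (cauchy x) η 0<η M b)

infixl 7 _÷_[_]

_÷_[_] : (x y : ℝ) → 0ᴿ <ᴿ y → ℝ
x ÷ y [ 0<y ] = x *ᴿ inv y 0<y

0<*ᴿ : ∀ {x y} → 0ᴿ <ᴿ x → 0ᴿ <ᴿ y → 0ᴿ <ᴿ x *ᴿ y
0<*ᴿ {x} {y} 0<x 0<y =
  let η , 0<η , M , b = lower {x} 0<x
      θ , 0<θ , L , c = lower {y} 0<y
  in positive {x *ᴿ y} (η * θ) (pos* 0<η 0<θ) (M ℕ.⊔ L) λ n p →
    mono* (ℚ.<⇒≤ 0<η) (ℚ.<⇒≤ 0<θ) (b n (ℕ.m⊔n≤o⇒m≤o M L p)) (c n (ℕ.m⊔n≤o⇒n≤o M L p))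

0<inv : ∀ {x} (0<x : 0ᴿ <ᴿ x) → 0ᴿ <ᴿ inv x 0<x
0<inv {x} 0<x =
  let η , 0<η , M , b = lower {x} 0<x
      K , 0<K , L , c = bounded {seq x} (cauchy x)
  in positive {inv x 0<x} (recip K) (recip-pos 0<K) (M ℕ.⊔ L) λ n p →
    recip-anti (ℚ.<-≤-trans 0<η (b n (ℕ.m⊔n≤o⇒m≤o M L p)))
      (ℚ.≤-trans (≤∣∣ (seq x n)) (c n (ℕ.m⊔n≤o⇒n≤o M L p)))

0<÷ : ∀ {x y} → 0ᴿ <ᴿ x → (0<y : 0ᴿ <ᴿ y) → 0ᴿ <ᴿ x ÷ y [ 0<y ]
0<÷ {x} {y} 0<x 0<y = 0<*ᴿ {x} {inv y 0<y} 0<x (0<inv {y} 0<y)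

0<fromℕ : ∀ n → .{{ℕ.NonZero n}} → 0ᴿ <ᴿ fromℕ n
0<fromℕ (suc n) = positive {fromℕ (suc n)} (ι (suc n)) (0<ι n) 0 λ _ _ → ℚ.≤-refl

0<1≤ : ∀ {x} → 1ᴿ ≤ᴿ x → 0ᴿ <ᴿ x
0<1≤ {x} 1≤x =
  let M , b = 1≤x ½ 0<½
  in positive {x} ½ 0<½ M λ n p → cancel (seq x n) (b n p)
  where
  open +-*-Solver
  cancel : ∀ q → 1ℚ ≤ q + ½ → ½ ≤ q
  cancel q h = le (nn-sub h)
    (solve 1 (λ q → con ½ :+ ((q :+ con ½) :- con 1ℚ) := q) refl q)

pick : {A B : Set} → Dec A → B → B → B
pick (yes _) a b = a
pick (no _)  a b = b

pick-elim : {A B : Set} (P : B → Set) (d : Dec A) → ∀ {a b} →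
  (A → P a) → (¬ A → P b) → P (pick d a b)
pick-elim P (yes x) f g = f x
pick-elim P (no ¬x) f g = g ¬x

sq : ℚ → ℚ
sq q = q * q

-- ⌊√q · (n+1)⌋ / (n+1) for q ≥ 0, found by searching downwards from an
-- upper bound.
√-search : ℚ → ℕ → ℕ → ℕ
√-search q n zero    = zero
√-search q n (suc a) =
  pick (sq (ι (suc a) * unit n) ℚ.≤? q) (suc a) (√-search q n a)

√-bound : ℚ → ℕ → ℕ
√-bound q n = suc n ℕ.* suc ℤ.∣ ↥ q ∣

√-approx : ℚ → ℕ → ℚ
√-approx q n = ι (√-search q n (√-bound q n)) * unit n

module _ where
  open +-*-Solver

  √-low : ∀ q n a → 0ℚ ≤ q → sq (ι (√-search q n a) * unit n) ≤ q
  √-low q n zero 0≤q = subst (_≤ q) (sym eq) 0≤q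
    where
    eq : sq (ι 0 * unit n) ≡ 0ℚ
    eq = trans (cong sq (ℚ.*-zeroˡ (unit n))) refl
  √-low q n (suc a) 0≤q =
    pick-elim (λ b → sq (ι b * unit n) ≤ q) (sq (ι (suc a) * unit n) ℚ.≤? q)
      (λ h → h) (λ _ → √-low q n a 0≤q)

  √-high′ : ∀ q n a → q < sq (ι (suc a) * unit n) →
    q < sq (ι (suc (√-search q n a)) * unit n)
  √-high′ q n zero h = h
  √-high′ q n (suc a) h =
    pick-elim (λ b → q < sq (ι (suc b) * unit n)) (sq (ι (suc a) * unit n) ℚ.≤? q)
      (λ _ → h) (λ ¬h → √-high′ q n a (ℚ.≰⇒> ¬h))

  ι-+ : ∀ m n → ι (m ℕ.+ n) ≡ ι m + ι n
  ι-+ zero n = sym (ℚ.+-identityˡ (ι n))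
  ι-+ (suc m) n = trans (ι-suc (m ℕ.+ n)) (trans (cong (λ t → 1ℚ + t) (ι-+ m n))
    (trans (sym (ℚ.+-assoc 1ℚ (ι m) (ι n))) (cong (_+ ι n) (sym (ι-suc m)))))

  ι-* : ∀ m n → ι (m ℕ.* n) ≡ ι m * ι n
  ι-* zero n = sym (ℚ.*-zeroˡ (ι n))
  ι-* (suc m) n = trans (ι-+ n (m ℕ.* n)) (trans (cong (λ t → ι n + t) (ι-* m n))
    (trans (solve 2 (λ a b → b :+ a :* b := (con 1ℚ :+ a) :* b) refl (ι m) (ι n))
      (cong (_* ι n) (sym (ι-suc m)))))

  sq-mono : ∀ {p q} → 0ℚ ≤ p → p ≤ q → sq p ≤ sq q
  sq-mono 0≤p p≤q = mono* 0≤p 0≤p p≤q p≤q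

  √-high : ∀ q n → 0ℚ ≤ q → q < sq (√-approx q n + unit n)
  √-high q n 0≤q = subst (λ t → q < sq t) eq
    (√-high′ q n (√-bound q n) (ℚ.<-≤-trans (ℚ.≤-<-trans (≤ι q) k<1+k) big))
    where
    k = ℤ.∣ ↥ q ∣
    K = ι (suc k)
    a = √-search q n (√-bound q n)
    k<1+k : ι k < K
    k<1+k = subst₂ _<_ (ℚ.+-identityˡ (ι k)) (sym (ι-suc k)) (ℚ.+-monoˡ-< (ι k) 0<1)
    1≤K : 1ℚ ≤ K
    1≤K = ι-mono {1} (ℕ.s≤s ℕ.z≤n)
    K-eq : ι (√-bound q n) * unit n ≡ K
    K-eq = trans (cong (_* unit n) (ι-* (suc n) (suc k)))
      (trans (solve 3 (λ a b c → (a :* b) :* c := (a :* c) :* b) refl (ι (suc n)) K (unit n))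
        (trans (cong (_* K) (ι-unit n)) (ℚ.*-identityˡ K)))
    K≤ : K ≤ ι (suc (√-bound q n)) * unit n
    K≤ = subst (_≤ ι (suc (√-bound q n)) * unit n) K-eq
      (mono* (0≤ι (√-bound q n)) (ℚ.<⇒≤ (0<unit n)) (ι-mono (ℕ.n≤1+n (√-bound q n))) ℚ.≤-refl)
    big : K ≤ sq (ι (suc (√-bound q n)) * unit n)
    big = ℚ.≤-trans
      (subst (_≤ sq K) (ℚ.*-identityˡ K) (mono* 0≤1 (0≤ι (suc k)) 1≤K ℚ.≤-refl))
      (sq-mono (0≤ι (suc k)) K≤)
    eq : ι (suc a) * unit n ≡ √-approx q n + unit n
    eq = trans (cong (_* unit n) (ι-suc a))
      (solve 2 (λ a u → (con 1ℚ :+ a) :* u := a :* u :+ u) refl (ι a) (unit n))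

  0≤√ : ∀ q n → 0ℚ ≤ √-approx q n
  0≤√ q n = nn* (0≤ι (√-search q n (√-bound q n))) (ℚ.<⇒≤ (0<unit n))

  pos-part : ∀ {p q ε} → 0ℚ ≤ ε → p ≤ q + ε → 0ℚ ⊔ p ≤ (0ℚ ⊔ q) + ε
  pos-part {p} {q} {ε} 0≤ε h = ℚ.⊔-lub
    (nn+ (ℚ.p≤p⊔q 0ℚ q) 0≤ε)
    (ℚ.≤-trans h (ℚ.+-monoˡ-≤ ε (ℚ.p≤q⊔p 0ℚ q)))

  √-close : ∀ p q m n e → 0ℚ ≤ p → 0ℚ ≤ q → 0ℚ < e → unit n ≤ e → p ≤ q + sq e →
    √-approx p m ≤ √-approx q n + (e + e)
  √-close p q m n e 0≤p 0≤q 0<e u≤e h =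
    ℚ.≮⇒≥ λ r → ℚ.<-irrefl refl (ℚ.<-≤-trans lt (ge r))
    where
    s = √-approx p m
    t = √-approx q n
    u = unit n
    0≤e = ℚ.<⇒≤ 0<e
    0≤t = 0≤√ q n
    0≤u = ℚ.<⇒≤ (0<unit n)
    lt : p < sq (t + u) + sq e
    lt = ℚ.≤-<-trans h (ℚ.+-monoˡ-< (sq e) (√-high q n 0≤q))
    ge : t + (e + e) < s → sq (t + u) + sq e ≤ p
    ge r = ℚ.≤-trans (ℚ.≤-trans
      (le {sq (t + u) + sq e} {sq ((t + u) + e)} (nn+ (nn* (nn+ 0≤t 0≤u) 0≤e) (nn* (nn+ 0≤t 0≤u) 0≤e))
        (solve 2 (λ a e → (a :* a :+ e :* e) :+ (a :* e :+ a :* e) := (a :+ e) :* (a :+ e))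
          refl (t + u) e))
      (sq-mono (nn+ (nn+ 0≤t 0≤u) 0≤e)
        (ℚ.≤-trans
          (le (nn-sub u≤e) (solve 3 (λ t u e → ((t :+ u) :+ e) :+ (e :- u) := t :+ (e :+ e))
             refl t u e))
          (ℚ.<⇒≤ r))))
      (√-low p m (√-bound p m) 0≤p)

-- Negative rationals are truncated to 0, so that √ is total; √ x is the
-- square root only for x ≥ 0.
√-seq : (ℕ → ℚ) → ℕ → ℚ
√-seq x n = √-approx (0ℚ ⊔ x n) n

√-cauchy : ∀ {x} → IsCauchy x → IsCauchy (√-seq x)
√-cauchy {x} cx = scaled {√-seq x} (1ℚ + 1ℚ) (pos+ 0<1 0≤1) λ e 0<e →
  let M₁ , b = cx (sq e) (pos* 0<e 0<e)
      M₂ , u = unit-small e 0<e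
  in M₁ ℕ.⊔ M₂ , λ m n p q → subst (∣ √-seq x m - √-seq x n ∣ ≤_) {e + e} {(1ℚ + 1ℚ) * e}
       (double e) (≤⇒∣∣ {√-seq x m} {√-seq x n} {e + e}
         (half e 0<e m n (u n (ℕ.m⊔n≤o⇒n≤o M₁ M₂ q))
           (b m n (ℕ.m⊔n≤o⇒m≤o M₁ M₂ p) (ℕ.m⊔n≤o⇒m≤o M₁ M₂ q)))
         (half e 0<e n m (u m (ℕ.m⊔n≤o⇒n≤o M₁ M₂ p))
           (b n m (ℕ.m⊔n≤o⇒m≤o M₁ M₂ q) (ℕ.m⊔n≤o⇒m≤o M₁ M₂ p))))
  where
  open +-*-Solver
  double : ∀ e → e + e ≡ (1ℚ + 1ℚ) * e
  double = solve 1 (λ e → e :+ e := (con 1ℚ :+ con 1ℚ) :* e) refl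
  half : ∀ e → 0ℚ < e → ∀ m n → unit n ≤ e → ∣ x m - x n ∣ ≤ sq e →
    √-seq x m ≤ √-seq x n + (e + e)
  half e 0<e m n u h = √-close (0ℚ ⊔ x m) (0ℚ ⊔ x n) m n e
    (ℚ.p≤p⊔q 0ℚ (x m)) (ℚ.p≤p⊔q 0ℚ (x n)) 0<e u
    (pos-part {x m} {x n} (nn* (ℚ.<⇒≤ 0<e) (ℚ.<⇒≤ 0<e)) (∣∣⇒≤ {x m} {x n} h))

√ : ℝ → ℝ
√ x = mkℝ (√-seq (seq x)) (√-cauchy {seq x} (cauchy x))

-- The 2ˢ-th root.
root2^ : ℕ → ℝ → ℝ
root2^ zero    x = x
root2^ (suc s) x = √ (root2^ s x)

module _ where
  open +-*-Solver

  0<√ : ∀ {x} → 0ᴿ <ᴿ x → 0ᴿ <ᴿ √ x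
  0<√ {x} 0<x =
    let η , 0<η , M₁ , b = lower {x} 0<x
        θ , 0<θ , θ≤1 , θ≤η = below η 0<η
        e = ½ * θ
        0<e = pos* 0<½ 0<θ
        M₂ , u = unit-small e 0<e
    in positive {√ x} e 0<e (M₁ ℕ.⊔ M₂) λ n p →
         final n θ 0<θ θ≤1
           (ℚ.≤-trans θ≤η (ℚ.≤-trans (b n (ℕ.m⊔n≤o⇒m≤o M₁ M₂ p)) (ℚ.p≤q⊔p 0ℚ (seq x n))))
           (u n (ℕ.m⊔n≤o⇒n≤o M₁ M₂ p))
    where
    below : ∀ η → 0ℚ < η → ∃ λ θ → 0ℚ < θ × θ ≤ 1ℚ × θ ≤ η
    below η 0<η with ℚ.≤-total η 1ℚ
    ... | inj₁ h = η , 0<η , h , ℚ.≤-refl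
    ... | inj₂ h = 1ℚ , 0<1 , ℚ.≤-refl , h
    final : ∀ n θ → 0ℚ < θ → θ ≤ 1ℚ → θ ≤ 0ℚ ⊔ seq x n → unit n ≤ ½ * θ →
      ½ * θ ≤ √-seq (seq x) n
    final n θ 0<θ θ≤1 θ≤q u≤ = ℚ.≮⇒≥ λ r → ℚ.<-irrefl {q} refl
      (ℚ.<-≤-trans {q} {sq (√-approx q n + unit n)} {q} (√-high q n (ℚ.p≤p⊔q 0ℚ (seq x n)))
        (ℚ.≤-trans {sq (√-approx q n + unit n)} {sq θ} {q} (sq-mono {√-approx q n + unit n} {θ} (nn+ (0≤√ q n) (ℚ.<⇒≤ (0<unit n)))
            (subst (√-approx q n + unit n ≤_)
              (solve 1 (λ t → con ½ :* t :+ con ½ :* t := t) refl θ)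
              (ℚ.+-mono-≤ (ℚ.<⇒≤ r) u≤)))
          (ℚ.≤-trans {sq θ} {θ} {q} (subst (sq θ ≤_) (ℚ.*-identityˡ θ)
              (mono* (ℚ.<⇒≤ 0<θ) (ℚ.<⇒≤ 0<θ) θ≤1 ℚ.≤-refl))
            θ≤q)))
      where q = 0ℚ ⊔ seq x n

0<root2^ : ∀ s {x} → 0ᴿ <ᴿ x → 0ᴿ <ᴿ root2^ s x
0<root2^ zero    0<x = 0<x
0<root2^ (suc s) {x} 0<x = 0<√ {root2^ s x} (0<root2^ s 0<x)

partial : (ℕ → ℚ) → ℕ → ℚ → ℚ
partial a zero    w = 0ℚ
partial a (suc J) w = partial a J w + a J * w ^ℚ J

module _ (a : ℕ → ℚ) (a≤1 : ∀ j → ∣ a j ∣ ≤ 1ℚ) where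
  open +-*-Solver

  partialᴿ : ℕ → ℝ → ℝ
  partialᴿ zero    w = 0ᴿ
  partialᴿ (suc J) w = partialᴿ J w +ᴿ fromℚ (a J) *ᴿ w ^ᴿ J

  seq-^ : ∀ w J n → seq (w ^ᴿ J) n ≡ seq w n ^ℚ J
  seq-^ w zero    n = refl
  seq-^ w (suc J) n = cong (λ t → seq w n * t) (seq-^ w J n)

  seq-partial : ∀ J w n → seq (partialᴿ J w) n ≡ partial a J (seq w n)
  seq-partial zero    w n = refl
  seq-partial (suc J) w n =
    cong₂ (λ s t → s + a J * t) (seq-partial J w n) (seq-^ w J n)

  tail-bound : ∀ {r} → 0ℚ ≤ r → r ≤ 1ℚ → ∀ {z} → ∣ z ∣ ≤ r → ∀ J i →
    ∣ partial a (i ℕ.+ J) z - partial a J z ∣ * (1ℚ - r) + r ^ℚ (i ℕ.+ J) ≤ r ^ℚ J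
  tail-bound {r} 0≤r r≤1 {z} z≤r J zero = ℚ.≤-reflexive
    (trans (cong (λ t → ∣ t ∣ * (1ℚ - r) + r ^ℚ J) (ℚ.+-inverseʳ (partial a J z)))
      (trans (cong (_+ r ^ℚ J) (ℚ.*-zeroˡ (1ℚ - r))) (ℚ.+-identityˡ (r ^ℚ J))))
  tail-bound {r} 0≤r r≤1 {z} z≤r J (suc i) = step
    (partial a (i ℕ.+ J) z) (partial a J z) (a (i ℕ.+ J) * z ^ℚ (i ℕ.+ J)) (r ^ℚ (i ℕ.+ J)) (r ^ℚ J)
    term (tail-bound 0≤r r≤1 z≤r J i)
    where
    term : ∣ a (i ℕ.+ J) * z ^ℚ (i ℕ.+ J) ∣ ≤ r ^ℚ (i ℕ.+ J)
    term = subst₂ _≤_ (sym (ℚ.∣p*q∣≡∣p∣*∣q∣ (a (i ℕ.+ J)) (z ^ℚ (i ℕ.+ J))))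
      (ℚ.*-identityˡ (r ^ℚ (i ℕ.+ J)))
      (mono* (ℚ.0≤∣p∣ (a (i ℕ.+ J))) (ℚ.0≤∣p∣ (z ^ℚ (i ℕ.+ J)))
        (a≤1 (i ℕ.+ J)) (^ℚ-abs z≤r (i ℕ.+ J)))
    step : ∀ p q t ρ σ → ∣ t ∣ ≤ ρ → ∣ p - q ∣ * (1ℚ - r) + ρ ≤ σ →
      ∣ (p + t) - q ∣ * (1ℚ - r) + r * ρ ≤ σ
    step p q t ρ σ ht h = ℚ.≤-trans (ℚ.+-monoˡ-≤ (r * ρ)
        (mono* (ℚ.0≤∣p∣ ((p + t) - q)) (nn-sub r≤1) split ℚ.≤-refl))
      (subst (_≤ σ)
        (solve 3 (λ d ρ r → d :* (con 1ℚ :- r) :+ ρ := (d :+ ρ) :* (con 1ℚ :- r) :+ r :* ρ)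
          refl ∣ p - q ∣ ρ r) h)
      where
      split : ∣ (p + t) - q ∣ ≤ ∣ p - q ∣ + ρ
      split = ℚ.≤-trans
        (subst (λ s → ∣ s ∣ ≤ ∣ p - q ∣ + ∣ t ∣)
          (solve 3 (λ p q t → (p :- q) :+ t := (p :+ t) :- q) refl p q t)
          (ℚ.∣p+q∣≤∣p∣+∣q∣ (p - q) t))
        (ℚ.+-monoʳ-≤ ∣ p - q ∣ ht)

  bernoulli : ∀ {r} → 0ℚ ≤ r → r ≤ 1ℚ → ∀ J → r ^ℚ J * (1ℚ + ι J * (1ℚ - r)) ≤ 1ℚ
  bernoulli {r} 0≤r r≤1 zero = ℚ.≤-reflexive
    (trans (cong (λ t → 1ℚ * (1ℚ + t)) (ℚ.*-zeroˡ (1ℚ - r))) refl)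
  bernoulli {r} 0≤r r≤1 (suc J) = ℚ.≤-trans
    (le {d = r ^ℚ J * ((1ℚ + ι J) * ((1ℚ - r) * (1ℚ - r)))}
      (nn* (^ℚ-nn 0≤r J) (nn* (nn+ 0≤1 (0≤ι J)) (nn* (nn-sub r≤1) (nn-sub r≤1))))
      (trans (cong (λ t → r * r ^ℚ J * (1ℚ + t * (1ℚ - r))
                 + r ^ℚ J * ((1ℚ + ι J) * ((1ℚ - r) * (1ℚ - r)))) (ι-suc J))
        (solve 3 (λ r ρ j →
          r :* ρ :* (con 1ℚ :+ (con 1ℚ :+ j) :* (con 1ℚ :- r))
            :+ ρ :* ((con 1ℚ :+ j) :* ((con 1ℚ :- r) :* (con 1ℚ :- r)))
          := ρ :* (con 1ℚ :+ j :* (con 1ℚ :- r))) refl r (r ^ℚ J) (ι J))))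
    (bernoulli 0≤r r≤1 J)

  pow-small : ∀ {r} → 0ℚ ≤ r → r < 1ℚ → ∀ ε → 0ℚ < ε → ∃ λ J → r ^ℚ J ≤ ε
  pow-small {r} 0≤r r<1 ε 0<ε = J ,
    ℚ.*-cancelʳ-≤-pos D {{ℚ.positive 0<D}}
      (ℚ.≤-trans (bernoulli 0≤r r≤1 J)
        (subst (_≤ ε * D) (recip-inv 0<ε) (mono* (ℚ.<⇒≤ 0<ε) (recip-nn 0<ε) ℚ.≤-refl D-big)))
    where
    r≤1 = ℚ.<⇒≤ r<1
    s = 1ℚ - r
    0<s : 0ℚ < s
    0<s = subst (_< s) (ℚ.+-inverseʳ r) (ℚ.+-monoˡ-< (- r) r<1)
    J = ℤ.∣ ↥ (recip ε * recip s) ∣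
    D = 1ℚ + ι J * s
    0<D : 0ℚ < D
    0<D = pos+ 0<1 (nn* (0≤ι J) (ℚ.<⇒≤ 0<s))
    D-big : recip ε ≤ D
    D-big = ℚ.≤-trans
      (subst (_≤ ι J * s)
        (trans (solve 3 (λ a b c → (a :* b) :* c := a :* (c :* b)) refl (recip ε) (recip s) s)
          (trans (cong (λ t → recip ε * t) (recip-inv 0<s)) (ℚ.*-identityʳ (recip ε))))
        (mono* (nn* (recip-nn 0<ε) (recip-nn 0<s)) (ℚ.<⇒≤ 0<s)
          (≤ι (recip ε * recip s)) ℚ.≤-refl))
      (le 0≤1 (ℚ.+-comm (ι J * s) 1ℚ))

  tail-small : ∀ {r} → 0ℚ ≤ r → r < 1ℚ → ∀ ε → 0ℚ < ε → ∃ λ J → ∀ n → J ℕ.≤ n →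
    ∀ z → ∣ z ∣ ≤ r → ∣ partial a n z - partial a J z ∣ ≤ ε
  tail-small {r} 0≤r r<1 ε 0<ε =
    let J , h = pow-small 0≤r r<1 (ε * s) (pos* 0<ε 0<s) in
    J , λ n J≤n z z≤r → ℚ.*-cancelʳ-≤-pos s {{ℚ.positive 0<s}}
      (subst (λ k → ∣ partial a k z - partial a J z ∣ * s ≤ ε * s) (ℕ.m∸n+n≡m J≤n)
        (ℚ.≤-trans (le (^ℚ-nn 0≤r (n ℕ.∸ J ℕ.+ J)) refl)
          (ℚ.≤-trans (tail-bound 0≤r (ℚ.<⇒≤ r<1) z≤r J (n ℕ.∸ J)) h)))
    where
    s = 1ℚ - r
    0<s : 0ℚ < s
    0<s = subst (_< s) (ℚ.+-inverseʳ r) (ℚ.+-monoˡ-< (- r) r<1)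

  ∣∣-chain : ∀ p q r s {ε} → ∣ p - q ∣ ≤ ε → ∣ q - r ∣ ≤ ε → ∣ s - r ∣ ≤ ε →
    ∣ p - s ∣ ≤ (1ℚ + 1ℚ + 1ℚ) * ε
  ∣∣-chain p q r s {ε} h₁ h₂ h₃ = ≤⇒∣∣ {p} {s}
    (le (nn+ (nn-sub (∣∣⇒≤ {p} {q} h₁)) (nn+ (nn-sub (∣∣⇒≤ {q} {r} h₂))
          (nn-sub (∣∣⇒≤ {r} {s} (subst (_≤ ε) (∣∣-swap s r) h₃)))))
      (solve 5 (λ p q r s e → p :+ (((q :+ e) :- p) :+ (((r :+ e) :- q) :+ ((s :+ e) :- r)))
        := s :+ (con 1ℚ :+ con 1ℚ :+ con 1ℚ) :* e) refl p q r s ε))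
    (le (nn+ (nn-sub (∣∣⇒≤ {s} {r} h₃)) (nn+
          (nn-sub (∣∣⇒≤ {r} {q} (subst (_≤ ε) (∣∣-swap q r) h₂)))
          (nn-sub (∣∣⇒≤ {q} {p} (subst (_≤ ε) (∣∣-swap p q) h₁)))))
      (solve 5 (λ p q r s e → s :+ (((r :+ e) :- s) :+ (((q :+ e) :- r) :+ ((p :+ e) :- q)))
        := p :+ (con 1ℚ :+ con 1ℚ :+ con 1ℚ) :* e) refl p q r s ε))

  series-cauchy : ∀ (w : ℝ) r → 0ℚ ≤ r → r < 1ℚ →
    ∀ M → (∀ n → M ℕ.≤ n → ∣ seq w n ∣ ≤ r) → IsCauchy (λ n → partial a n (seq w n))
  series-cauchy w r 0≤r r<1 M₀ w≤r =
    scaled {λ n → partial a n (seq w n)} (1ℚ + 1ℚ + 1ℚ) (pos+ (pos+ 0<1 0≤1) 0≤1) λ ε 0<ε →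
      let J , tail = tail-small 0≤r r<1 ε 0<ε
          M₁ , head = cauchy (partialᴿ J w) ε 0<ε
          M = M₀ ℕ.⊔ J
      in M ℕ.⊔ M₁ , λ m n p q →
        ∣∣-chain (partial a m (seq w m)) (partial a J (seq w m))
                 (partial a J (seq w n)) (partial a n (seq w n))
          (tail m (ℕ.m⊔n≤o⇒n≤o M₀ J (ℕ.m⊔n≤o⇒m≤o M M₁ p)) (seq w m)
            (w≤r m (ℕ.m⊔n≤o⇒m≤o M₀ J (ℕ.m⊔n≤o⇒m≤o M M₁ p))))
          (subst (_≤ ε)
            (cong₂ (λ s t → ∣ s - t ∣) (seq-partial J w m) (seq-partial J w n))
            (head m n (ℕ.m⊔n≤o⇒n≤o M M₁ p) (ℕ.m⊔n≤o⇒n≤o M M₁ q)))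
          (tail n (ℕ.m⊔n≤o⇒n≤o M₀ J (ℕ.m⊔n≤o⇒m≤o M M₁ q)) (seq w n)
            (w≤r n (ℕ.m⊔n≤o⇒m≤o M₀ J (ℕ.m⊔n≤o⇒m≤o M M₁ q))))

  -- Σⱼ aⱼ wʲ for |w| ≤ r < 1
  series : (w : ℝ) (r : ℚ) → 0ℚ ≤ r → r < 1ℚ →
    ∀ M → (∀ n → M ℕ.≤ n → ∣ seq w n ∣ ≤ r) → ℝ
  series w r 0≤r r<1 M w≤r =
    mkℝ (λ n → partial a n (seq w n)) (series-cauchy w r 0≤r r<1 M w≤r)

∣unit∣≤1 : ∀ j → ∣ unit j ∣ ≤ 1ℚ
∣unit∣≤1 j = unit≤1 j

0<y+1 : ∀ {y} → 0ᴿ <ᴿ y → 0ᴿ <ᴿ y +ᴿ 1ᴿ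
0<y+1 {y} 0<y =
  let η , 0<η , M , b = lower {y} 0<y in
  positive {y +ᴿ 1ᴿ} η 0<η M λ n p → ℚ.≤-trans (b n p) (le 0≤1 refl)

-- (y − 1)/(y + 1)
möbius : (y : ℝ) → 0ᴿ <ᴿ y → ℝ
möbius y 0<y = (y -ᴿ 1ᴿ) ÷ (y +ᴿ 1ᴿ) [ 0<y+1 {y} 0<y ]

module _ where
  open +-*-Solver

  möbius² : ∀ η K y → 0ℚ < η → η ≤ y → y ≤ K →
    let z = (y - 1ℚ) * recip (y + 1ℚ)
        τ = (η ℚ.⊓ 1ℚ) * recip (K + 1ℚ)
    in ∣ z * z ∣ ≤ 1ℚ - τ * τ
  möbius² η K y 0<η η≤y y≤K =
    subst (_≤ 1ℚ - τ * τ) (sym (ℚ.0≤p⇒∣p∣≡p 0≤z²))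
      (le (nn-sub (mono* 0≤τ 0≤τ hi lo))
        (solve 2 (λ z τ → z :* z :+ ((con 1ℚ :- z) :* (con 1ℚ :+ z) :- τ :* τ)
          := con 1ℚ :- τ :* τ) refl z τ))
    where
    v = recip (y + 1ℚ)
    z = (y - 1ℚ) * v
    θ = η ℚ.⊓ 1ℚ
    τ = θ * recip (K + 1ℚ)
    0<y = ℚ.<-≤-trans 0<η η≤y
    0<y+ : 0ℚ < y + 1ℚ
    0<y+ = pos+ 0<y 0≤1
    0≤θ : 0ℚ ≤ θ
    0≤θ = ℚ.⊓-glb (ℚ.<⇒≤ 0<η) 0≤1
    0≤v = recip-nn 0<y+
    0≤τ : 0ℚ ≤ τ
    0≤τ = nn* 0≤θ (recip-nn (ℚ.<-≤-trans 0<y+ (ℚ.+-monoˡ-≤ 1ℚ y≤K)))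
    τ≤ : ∀ c → θ ≤ c → τ ≤ c * v
    τ≤ c θ≤c = mono* 0≤θ (recip-nn (ℚ.<-≤-trans 0<y+ (ℚ.+-monoˡ-≤ 1ℚ y≤K))) θ≤c
      (recip-anti 0<y+ (ℚ.+-monoˡ-≤ 1ℚ y≤K))
    0≤z² : 0ℚ ≤ z * z
    0≤z² = subst (0ℚ ≤_)
      (trans (sym (ℚ.∣p*q∣≡∣p∣*∣q∣ z z)) (abs-sq z)) (nn* (ℚ.0≤∣p∣ z) (ℚ.0≤∣p∣ z))
      where
      abs-sq : ∀ q → ∣ q * q ∣ ≡ q * q
      abs-sq q = ℚ.0≤p⇒∣p∣≡p (by-sign (ℚ.≤-total 0ℚ q))
        where
        by-sign : 0ℚ ≤ q ⊎ q ≤ 0ℚ → 0ℚ ≤ q * q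
        by-sign (inj₁ h) = nn* h h
        by-sign (inj₂ h) = subst (0ℚ ≤_)
          (solve 1 (λ q → (:- q) :* (:- q) := q :* q) refl q)
          (nn* (ℚ.neg-antimono-≤ h) (ℚ.neg-antimono-≤ h))
    hi : τ ≤ 1ℚ - z
    hi = ℚ.≤-trans (τ≤ 1ℚ (ℚ.p⊓q≤q η 1ℚ)) (le (nn* 0≤1 0≤v) eq)
      where
      eq : 1ℚ * v + 1ℚ * v ≡ 1ℚ - z
      eq = trans (solve 2 (λ y v → con 1ℚ :* v :+ con 1ℚ :* v
                    := (y :+ con 1ℚ) :* v :- (y :- con 1ℚ) :* v) refl y v)
        (cong (_- z) (recip-inv 0<y+))
    lo : τ ≤ 1ℚ + z
    lo = ℚ.≤-trans (τ≤ y (ℚ.≤-trans (ℚ.p⊓q≤p η 1ℚ) η≤y)) (le (nn* (ℚ.<⇒≤ 0<y) 0≤v) eq)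
      where
      eq : y * v + y * v ≡ 1ℚ + z
      eq = trans (solve 2 (λ y v → y :* v :+ y :* v
                    := (y :+ con 1ℚ) :* v :+ (y :- con 1ℚ) :* v) refl y v)
        (cong (_+ z) (recip-inv 0<y+))

  1-sq<1 : ∀ {τ} → 0ℚ < τ → 1ℚ - τ * τ < 1ℚ
  1-sq<1 {τ} 0<τ = subst₂ _<_ (ℚ.+-identityˡ (1ℚ - τ * τ))
    (solve 1 (λ t → t :* t :+ (con 1ℚ :- t :* t) := con 1ℚ) refl τ)
    (ℚ.+-monoˡ-< (1ℚ - τ * τ) (pos* 0<τ 0<τ))

-- log y = 2 artanh z = 2 Σⱼ z²ʲ⁺¹/(2j+1) with z = (y − 1)/(y + 1),
-- valid for every y > 0.
log : (y : ℝ) → 0ᴿ <ᴿ y → ℝ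
log y 0<y =
  let z = möbius y 0<y
      η , 0<η , M , b = lower {y} 0<y
      K , 0<K , L , c = bounded {seq y} (cauchy y)
      τ = (η ℚ.⊓ 1ℚ) * recip (K + 1ℚ)
      0<τ = pos* (⊓-pos 0<η 0<1) (recip-pos (pos+ 0<K 0≤1))
      b′ = λ n (p : M ℕ.⊔ L ℕ.≤ n) →
        möbius² η K (seq y n) 0<η (b n (ℕ.m⊔n≤o⇒m≤o M L p))
          (ℚ.≤-trans (≤∣∣ (seq y n)) (c n (ℕ.m⊔n≤o⇒n≤o M L p)))
  in fromℕ 2 *ᴿ z *ᴿ
     series (λ j → unit (2 ℕ.* j)) (λ j → ∣unit∣≤1 (2 ℕ.* j)) (z *ᴿ z) (1ℚ - τ * τ)
       (ℚ.≤-trans (ℚ.0≤∣p∣ (seq (z *ᴿ z) (M ℕ.⊔ L))) (b′ (M ℕ.⊔ L) ℕ.≤-refl))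
       (1-sq<1 0<τ) (M ℕ.⊔ L) b′
  where
  ⊓-pos : ∀ {p q} → 0ℚ < p → 0ℚ < q → 0ℚ < p ℚ.⊓ q
  ⊓-pos {p} {q} 0<p 0<q with ℚ.⊓-sel p q
  ... | inj₁ e = subst (0ℚ <_) (sym e) 0<p
  ... | inj₂ e = subst (0ℚ <_) (sym e) 0<q

record ℂ : Set where
  constructor _+i_
  field
    re im : ℝ

open ℂ public

infix  4 _≃ᶜ_
infixl 6 _+ᶜ_
infixl 7 _*ᶜ_

_≃ᶜ_ : ℂ → ℂ → Set
z ≃ᶜ w = re z ≃ᴿ re w × im z ≃ᴿ im w

0ᶜ 1ᶜ : ℂ
0ᶜ = 0ᴿ +i 0ᴿ
1ᶜ = 1ᴿ +i 0ᴿ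

_+ᶜ_ _*ᶜ_ : ℂ → ℂ → ℂ
z +ᶜ w = (re z +ᴿ re w) +i (im z +ᴿ im w)
z *ᶜ w = (re z *ᴿ re w -ᴿ im z *ᴿ im w) +i (re z *ᴿ im w +ᴿ im z *ᴿ re w)

conj : ℂ → ℂ
conj z = re z +i (-ᴿ im z)

conj^ : ℕ → ℂ → ℂ
conj^ zero    z = z
conj^ (suc n) z = conj (conj^ n z)

∣_∣ᶜ : ℂ → ℝ
∣ z ∣ᶜ = √ (re z ^ᴿ 2 +ᴿ im z ^ᴿ 2)

∑ᶜ ∏ᶜ : {A : Set} → List A → (A → ℂ) → ℂ
∑ᶜ []       F = 0ᶜ
∑ᶜ (x ∷ xs) F = F x +ᶜ ∑ᶜ xs F
∏ᶜ []       F = 1ᶜ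
∏ᶜ (x ∷ xs) F = F x *ᶜ ∏ᶜ xs F

OneBounded : {A : Set} → (A → ℂ) → Set
OneBounded f = ∀ a → ∣ f a ∣ᶜ ≤ᴿ 1ᴿ

SupportedOn : {A : Set} → (A → Set) → (A → ℂ) → Set
SupportedOn S f = ∀ a → ¬ S a → f a ≃ᶜ 0ᶜ

∣_∣≤_ : ℤ → ℕ → Set
∣ a ∣≤ L = ℤ.∣ a ∣ ℕ.≤ L

-- −L, …, L
interval : ℕ → List ℤ
interval L = map (λ j → + j ℤ.- + L) (upTo (suc (L ℕ.+ L)))

-- [−L,L]ᵏ
box : ℕ → (k : ℕ) → List (Vec ℤ k)
box L zero    = [] ∷ []
box L (suc k) = cartesianProductWith _∷_ (interval L) (box L k)

-- 1, …, H
range : ℕ → List ℤ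
range H = map (λ j → + suc j) (upTo H)

infix 4 _∈[_] _∈[_]?

_∈[_] : ℤ → ℕ → Set
x ∈[ M ] = (+ 1 ℤ.≤ x) × (x ℤ.≤ + M)

_∈[_]? : ∀ x M → Dec (x ∈[ M ])
x ∈[ M ]? = (+ 1 ℤ.≤? x) ×-dec (x ℤ.≤? + M)

IsFloor : ℝ → ℕ → Set
IsFloor X M = fromℕ M ≤ᴿ X × X <ᴿ fromℕ (suc M)

Cube : ∀ {k} → ℝ → Vec ℤ k → Set
Cube X = All (λ a → fromℕ ℤ.∣ a ∣ ≤ᴿ X)

-- The witness radius makes the sums below computable; their values do not
-- depend on it.
FinSupp : (ℤ → ℂ) → Set
FinSupp f = Σ ℕ λ L → SupportedOn (∣_∣≤ L) f

FinSuppᵏ : ∀ {k} → (Vec ℤ k → ℂ) → Set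
FinSuppᵏ F = Σ ℕ λ L → SupportedOn (All (∣_∣≤ L)) F

∈⇒∣∣≤ : ∀ {x} M → x ∈[ M ] → ∣ x ∣≤ M
∈⇒∣∣≤ {+ n} M (_ , h) = ℤ.drop‿+≤+ h

interval-finite : ∀ {M f} → SupportedOn (_∈[ M ]) f → SupportedOn (∣_∣≤ M) f
interval-finite {M} h x ¬p = h x λ q → ¬p (∈⇒∣∣≤ M q)

ι-cancel : ∀ {m n} → ι m ≤ ι n → m ℕ.≤ n
ι-cancel {m} {n} h = ℤ.drop‿+≤+
  (subst₂ ℤ._≤_ (ℤ.*-identityʳ (+ m)) (ℤ.*-identityʳ (+ n)) (ℚ.drop-*≤* h))

upper : ∀ X → ∃ λ T → ∀ n → fromℕ n ≤ᴿ X → n ℕ.≤ T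
upper X =
  let K , 0<K , M , b = bounded {seq X} (cauchy X)
  in ℤ.∣ ↥ (K + 1ℚ) ∣ , λ n h →
    let L , c = h 1ℚ 0<1
        m = M ℕ.⊔ L
    in ι-cancel (ℚ.≤-trans (c m (ℕ.m≤n⊔m M L))
         (ℚ.≤-trans
           (ℚ.+-monoˡ-≤ 1ℚ (ℚ.≤-trans (≤∣∣ (seq X m)) (b m (ℕ.m≤m⊔n M L))))
           (≤ι (K + 1ℚ))))

cube-finite : ∀ {k X} {F : Vec ℤ k → ℂ} → SupportedOn (Cube X) F → FinSuppᵏ F
cube-finite {X = X} h =
  let T , t = upper X
  in T , λ v ¬p → h v λ q → ¬p (All.map (λ {a} → t ℤ.∣ a ∣) q)

-- For k ≥ 1 the summand vanishes unless |bᵢ| ≤ T and |x + bᵢm| ≤ L, hence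
-- unless |x| ≤ L + T·H.
R : ∀ {k} → ℕ → (lam : Vec ℤ k → ℂ) → FinSuppᵏ lam →
    (f : Fin k → ℤ → ℂ) → (Σ ℕ λ L → ∀ i → SupportedOn (∣_∣≤ L) (f i)) → ℂ
R {k} H lam (T , _) f (L , _) =
  ∑ᶜ (box T k) λ b → lam b *ᶜ
    ∑ᶜ (interval (L ℕ.+ T ℕ.* H)) λ x → ∑ᶜ (range H) λ m →
      ∏ᶜ (allFin k) λ i → f i (x ℤ.+ Vec.lookup b i ℤ.* m)

cube : (s : ℕ) → List (Vec Bool s)
cube zero    = [] ∷ []
cube (suc s) = cartesianProductWith _∷_ (false ∷ true ∷ []) (cube s)

weight : ∀ {s} → Vec Bool s → ℕ
weight []          = 0
weight (true  ∷ ω) = suc (weight ω)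
weight (false ∷ ω) = weight ω

infix 7 _·_

_·_ : ∀ {s} → Vec Bool s → Vec ℤ s → ℤ
[]          · []      = + 0
(true  ∷ ω) · (a ∷ h) = a ℤ.+ ω · h
(false ∷ ω) · (_ ∷ h) = ω · h

-- If f vanishes outside [−L,L], taking ω = 0 and ω = eⱼ shows that the
-- summand vanishes unless |x| ≤ L and |hⱼ| ≤ 2L.
gowersSum : (s : ℕ) (f : ℤ → ℂ) → FinSupp f → ℂ
gowersSum s f (L , _) =
  ∑ᶜ (box (L ℕ.+ L) (suc s)) λ { (x ∷ h) →
    ∏ᶜ (cube s) λ ω → conj^ (weight ω) (f (x ℤ.+ ω · h)) }

-- For s ≥ 1 the sum is a nonnegative real.
gowersNorm : (s : ℕ) (f : ℤ → ℂ) → FinSupp f → ℝ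
gowersNorm s f fin = root2^ s (re (gowersSum s f fin))

-- f 1_[M]
restrict : ℕ → (ℤ → ℂ) → ℤ → ℂ
restrict M f x = pick (x ∈[ M ]?) (f x) 0ᶜ

≃ᶜ-refl : ∀ z → z ≃ᶜ z
≃ᶜ-refl z = (≤-refl (re z) , ≤-refl (re z)) , (≤-refl (im z) , ≤-refl (im z))
  where
  ≤-refl : ∀ x → x ≤ᴿ x
  ≤-refl x ε 0<ε = 0 , λ n _ → le (ℚ.<⇒≤ 0<ε) refl

restrict-finite : ∀ M f → FinSupp (restrict M f)
restrict-finite M f = M , λ x ¬p →
  pick-elim (_≃ᶜ 0ᶜ) (x ∈[ M ]?)
    (λ q → ⊥-elim (¬p (∈⇒∣∣≤ M q))) (λ _ → ≃ᶜ-refl 0ᶜ)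

-- z is real and at least q, at every index of its representative.
infix 4 _≽_

record _≽_ (z : ℂ) (q : ℚ) : Set where
  constructor _,_
  field
    re≥ : ∀ n → q ≤ seq (re z) n
    im0 : ∀ n → seq (im z) n ≡ 0ℚ

module _ where
  open +-*-Solver

  ≽-* : ∀ {p q z w} → 0ℚ ≤ p → 0ℚ ≤ q → z ≽ p → w ≽ q → (z *ᶜ w) ≽ (p * q)
  ≽-* {p} {q} {z} {w} 0≤p 0≤q (a , b) (c , d) =
    (λ n → subst (p * q ≤_) (sym (real (seq (re z) n) (seq (re w) n) (b n) (d n)))
             (mono* 0≤p 0≤q (a n) (c n))) ,
    (λ n → imag (seq (re z) n) (seq (re w) n) (b n) (d n))
    where
    real : ∀ x y {u v} → u ≡ 0ℚ → v ≡ 0ℚ → x * y + - (u * v) ≡ x * y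
    real x y refl refl =
      solve 2 (λ x y → x :* y :+ :- (con 0ℚ :* con 0ℚ) := x :* y) refl x y
    imag : ∀ x y {u v} → u ≡ 0ℚ → v ≡ 0ℚ → x * v + u * y ≡ 0ℚ
    imag x y refl refl =
      solve 2 (λ x y → x :* con 0ℚ :+ con 0ℚ :* y := con 0ℚ) refl x y

  ≽-+ : ∀ {p q z w} → z ≽ p → w ≽ q → (z +ᶜ w) ≽ (p + q)
  ≽-+ (a , b) (c , d) =
    (λ n → ℚ.+-mono-≤ (a n) (c n)) ,
    (λ n → cong₂ _+_ (b n) (d n))

  ≽-conj : ∀ {q} j {z} → z ≽ q → conj^ j z ≽ q
  ≽-conj zero    h = h
  ≽-conj (suc j) {z} h =
    let a , b = ≽-conj j {z} h in a , λ n → cong -_ (b n)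

  ≽-∏ : ∀ {q} → 0ℚ ≤ q → q * q ≡ q → q ≤ 1ℚ → {A : Set} (xs : List A) {F : A → ℂ} →
    (∀ a → F a ≽ q) → ∏ᶜ xs F ≽ q
  ≽-∏ 0≤q qq q≤1 [] h = (λ _ → q≤1) , λ _ → refl
  ≽-∏ {q} 0≤q qq q≤1 (x ∷ xs) {F} h =
    subst (F x *ᶜ ∏ᶜ xs F ≽_) {q * q} {q} qq
      (≽-* {q} {q} {F x} {∏ᶜ xs F} 0≤q 0≤q (h x) (≽-∏ {q} 0≤q qq q≤1 xs {F} h))

  ≽-∑ : {A : Set} (xs : List A) {F : A → ℂ} → (∀ a → F a ≽ 0ℚ) → ∑ᶜ xs F ≽ 0ℚ
  ≽-∑ [] h = (λ _ → ℚ.≤-refl) , λ _ → refl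
  ≽-∑ (x ∷ xs) {F} h = ≽-+ {0ℚ} {0ℚ} {F x} {∑ᶜ xs F} (h x) (≽-∑ xs {F} h)

  ≽-∑-∈ : {A : Set} {xs : List A} {F : A → ℂ} → (∀ a → F a ≽ 0ℚ) →
    ∀ {a} → a ∈ xs → F a ≽ 1ℚ → ∑ᶜ xs F ≽ 1ℚ
  ≽-∑-∈ {xs = x ∷ xs} {F} h (here refl) k =
    ≽-+ {1ℚ} {0ℚ} {F x} {∑ᶜ xs F} k (≽-∑ xs {F} h)
  ≽-∑-∈ {xs = x ∷ xs} {F} h (there p) k =
    ≽-+ {0ℚ} {1ℚ} {F x} {∑ᶜ xs F} (h x) (≽-∑-∈ {xs = xs} {F} h p k)

0∈interval : ∀ L → + 0 ∈ interval L
0∈interval L = subst (_∈ interval L) (ℤ.+-inverseʳ (+ L))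
  (∈-map⁺ (λ j → + j ℤ.- + L) (∈-upTo⁺ (ℕ.s≤s (ℕ.m≤m+n L L))))

1∈interval : ∀ L → 1 ℕ.≤ L → + 1 ∈ interval L
1∈interval L 1≤L = subst (_∈ interval L)
  (trans (ℤ.+-assoc (+ 1) (+ L) (ℤ.- + L)) (cong (λ t → + 1 ℤ.+ t) (ℤ.+-inverseʳ (+ L))))
  (∈-map⁺ (λ j → + j ℤ.- + L) (∈-upTo⁺ (ℕ.s≤s (ℕ.+-monoˡ-≤ L 1≤L))))

zeros : ∀ s → Vec ℤ s
zeros s = Vec.replicate s (+ 0)

zeros∈box : ∀ L s → zeros s ∈ box L s
zeros∈box L zero    = here refl
zeros∈box L (suc s) = ∈-cartesianProductWith⁺ _∷_ (0∈interval L) (zeros∈box L s)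

·-zeros : ∀ {s} (ω : Vec Bool s) → ω · zeros s ≡ + 0
·-zeros []          = refl
·-zeros (true  ∷ ω) = trans (ℤ.+-identityˡ (ω · zeros _)) (·-zeros ω)
·-zeros (false ∷ ω) = ·-zeros ω

𝟙[_] : ℕ → ℤ → ℂ
𝟙[_] M = restrict M (const 1ᶜ)

0<gowersNorm-1 : ∀ s M → 1 ℕ.≤ M →
  0ᴿ <ᴿ gowersNorm s 𝟙[ M ] (restrict-finite M (const 1ᶜ))
0<gowersNorm-1 s M 1≤M =
  0<root2^ s {re S} (positive {re S} 1ℚ 0<1 0 λ n _ → _≽_.re≥ S≽1 n)
  where
  S = gowersSum s 𝟙[ M ] (restrict-finite M (const 1ᶜ))
  nonneg : ∀ x → 𝟙[ M ] x ≽ 0ℚ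
  nonneg x = pick-elim (_≽ 0ℚ) (x ∈[ M ]?)
    (λ _ → (λ _ → 0≤1) , λ _ → refl) (λ _ → (λ _ → ℚ.≤-refl) , λ _ → refl)
  one : 𝟙[ M ] (+ 1) ≽ 1ℚ
  one = pick-elim (_≽ 1ℚ) (+ 1 ∈[ M ]?)
    (λ _ → (λ _ → ℚ.≤-refl) , λ _ → refl)
    (λ ¬p → ⊥-elim (¬p (ℤ.≤-refl , ℤ.+≤+ 1≤M)))
  S≽1 : S ≽ 1ℚ
  S≽1 = ≽-∑-∈ {xs = box (M ℕ.+ M) (suc s)}
    (λ { (x ∷ h) → ≽-∏ ℚ.≤-refl refl 0≤1 (cube s) λ ω →
           ≽-conj (weight ω) (nonneg (x ℤ.+ ω · h)) })
    (∈-cartesianProductWith⁺ _∷_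
      (1∈interval (M ℕ.+ M) (ℕ.≤-trans 1≤M (ℕ.m≤m+n M M))) (zeros∈box (M ℕ.+ M) s))
    (≽-∏ 0≤1 refl ℚ.≤-refl (cube s) λ ω → ≽-conj (weight ω)
      (subst (λ t → 𝟙[ M ] (+ 1 ℤ.+ t) ≽ 1ℚ) (sym (·-zeros ω)) one))

-- ‖f‖ in Uˢ[N], where M = ⌊N⌋ and hence [N] = {1, …, M}.
gowersNorm[_] : (M : ℕ) → 1 ℕ.≤ M → ℕ → (ℤ → ℂ) → ℝ
gowersNorm[ M ] 1≤M s f =
  gowersNorm s (restrict M f) (restrict-finite M f) ÷
  gowersNorm s 𝟙[ M ] (restrict-finite M (const 1ᶜ)) [ 0<gowersNorm-1 s M 1≤M ]

1≤floor : ∀ {X M} → 1ᴿ ≤ᴿ X → IsFloor X M → 1 ℕ.≤ M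
1≤floor {M = suc M} _ _ = ℕ.s≤s ℕ.z≤n
1≤floor {X} {zero} 1≤X (_ , η , 0<η , M₁ , b) =
  let M₂ , c = 1≤X (½ * η) (pos* 0<½ 0<η)
      m = M₁ ℕ.⊔ M₂
  in ⊥-elim (absurd (seq X m) (b m (ℕ.m≤m⊔n M₁ M₂)) (c m (ℕ.m≤n⊔m M₁ M₂)))
  where
  open +-*-Solver
  absurd : ∀ q → q + η ≤ 1ℚ → 1ℚ ≤ q + ½ * η → ⊥
  absurd q h k = ℚ.<-irrefl refl (ℚ.<-≤-trans (pos* 0<½ 0<η)
    (le (nn+ (nn-sub h) (nn-sub k))
      (solve 2 (λ q e → con ½ :* e :+ ((con 1ℚ :- (q :+ e)) :+ ((q :+ con ½ :* e) :- con 1ℚ))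
        := con 0ℚ) refl q η)))

-- Every sum in the statement is a polynomial in the values of λ and the fᵢ, so
-- it can be estimated over ℚ[i], at one index of the Cauchy sequences at a
-- time; only the roots, the logarithm and the truncations need real numbers.
--
-- Write k = s + 1, g = fᵢ and η = δ^(2^s).  For fixed b, Cauchy–Schwarz removes
-- the functions fⱼ, j ≠ i, one after the other and bounds the 2^s-th power of
-- the count by an average over h of Σₓ Δ_{t₁,…,tₛ} g(x) with tⱼ = (bᵢ − bⱼ)hⱼ.
-- The terms with bᵢ = bⱼ or hⱼ = 0 are negligible by the two size hypotheses.
-- One further Cauchy–Schwarz in each direction replaces a product d h by a
-- difference t = d h − d′h′, which has O(N Σ_{e∣t} 1/e) representations with
-- |d| ≪ B, |h| ≪ H.  The square of this multiplicity sums to O(N³) with no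
-- logarithmic loss, so a last Cauchy–Schwarz in t gives η ≪ ‖g‖ in Uᵏ[N], which
-- is stronger than the claim because log(2/δ) ≥ 1 for δ < 1/4.
module Submission where

open import Defs
import Algebra.Solver.Ring.Simple
open import Algebra.Solver.Ring.AlmostCommutativeRing using (fromCommutativeRing)
open import Algebra.Bundles using (CommutativeRing)
open import Algebra.Structures using (IsCommutativeRing; IsCommutativeSemiring)
open import Data.Bool using (Bool; true; false)
open import Data.Fin using (Fin; zero; suc; punchIn)
open import Data.Integer as ℤ using (ℤ; +_)
import Data.Integer.Divisibility.Signed as ℤ∣
import Data.Integer.Properties as ℤ
import Data.Integer.Solver as ℤ-Solver
open import Data.List as List using (List; []; _∷_; map; upTo; allFin; length; filter; cartesianProduct; cartesianProductWith; _++_)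
open import Data.List.Membership.Propositional using (_∈_; _∉_)
open import Data.List.Membership.Propositional.Properties
open import Data.List.Properties using (length-map; length-upTo; length-filter; upTo-∷ʳ)
open import Data.List.Relation.Unary.All as ListAll using ([]; _∷_)
open import Data.List.Relation.Unary.AllPairs using ([]; _∷_)
open import Data.List.Relation.Unary.Any using (here; there)
open import Data.List.Relation.Unary.Unique.Propositional using (Unique)
import Data.List.Relation.Unary.Unique.Propositional.Properties as Unique
open import Data.Nat as ℕ using (ℕ; zero; suc; NonZero; _^_; _∸_; z≤n; s≤s)
import Data.Nat.Divisibility as ℕ∣
import Data.Nat.DivMod as ℕ÷
import Data.Nat.GCD as GCD
import Data.Nat.Properties as ℕ
import Data.Nat.Solver as ℕ-Solver
open import Data.Product using (Σ; ∃; _×_; _,_; proj₁; proj₂)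
import Data.Product.Properties as Product
open import Data.Rational
  using (ℚ; 0ℚ; 1ℚ; ½; _+_; _*_; _-_; -_; _≤_; _<_; ∣_∣; _⊔_)
import Data.Rational as ℚ
import Data.Rational.Properties as ℚ
import Data.Rational.Solver as ℚ-Solver
open import Data.Sum using (_⊎_; inj₁; inj₂)
open import Data.Vec as Vec using (Vec; []; _∷_)
import Data.Vec.Properties as Vec
open import Data.Vec.Relation.Unary.All as All using (All; []; _∷_)
open import Function using (_∘_; const; id)
open import Relation.Binary.PropositionalEquality
open import Relation.Nullary using (¬_; Dec; yes; no; contradiction)
open import Relation.Nullary.Decidable using (¬?)

-- The hypotheses speak about limits: a 1-bounded value may exceed 1 at every index, and a function
-- may be nonzero outside its support at every index. So λ and the fᵢ are replaced by exact
-- truncations, which changes the count by a null sequence, and at a late index the finitely many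
-- values that remain have modulus at most 2; halving them costs a constant. The parameter δ gives
-- way to a rational d with d ≤ δ ≤ 2d, so that the finite inequality runs at all late indices with
-- the same rational data.
--
-- A pointwise bound for the number of representations of t would lose an iterated logarithm, the
-- maximal size of Σ 1/e over the divisors of t. Only the second moment is used: it leads to the
-- convergent series Σ Hₑ/e², where Hₑ is a harmonic number.
--
-- Every sum carries its normalising factor, 1/H, 1/M or H/M with M = ⌊N⌋, so all constants depend
-- on k and C₀ only. The factor H/M of a coefficient bⱼ times the factor 1/H of its difference
-- variable is the 1/M that one direction of a Gowers norm requires.

-- Finite sums over a commutative semiring

pairs : {A B : Set} → List A → (A → List B) → List (A × B)
pairs []       ys = []
pairs (x ∷ xs) ys = map (x ,_) (ys x) ++ pairs xs ys

-- Stated for an arbitrary semiring because each manipulation of sums occurs twice: over ℚ for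
-- counts and norms, over ℚ[i] for correlations.
module Summation {R : Set} (_⊞_ _⊠_ : R → R → R) (0# 1# : R)
  (isCommutativeSemiring : IsCommutativeSemiring (_≡_ {A = R}) _⊞_ _⊠_ 0# 1#) where

  open IsCommutativeSemiring isCommutativeSemiring
    using (+-identityˡ; +-identityʳ; +-assoc; +-comm; zeroˡ; zeroʳ; distribˡ; *-identityˡ; *-assoc; *-comm)

  ∑ : {A : Set} → List A → (A → R) → R
  ∑ []       F = 0#
  ∑ (x ∷ xs) F = F x ⊞ ∑ xs F

  module _ {A : Set} where

    ∑-cong∈ : ∀ (xs : List A) {F G} → (∀ {x} → x ∈ xs → F x ≡ G x) → ∑ xs F ≡ ∑ xs G
    ∑-cong∈ []       h = refl
    ∑-cong∈ (x ∷ xs) h = cong₂ _⊞_ (h (here refl)) (∑-cong∈ xs (h ∘ there))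

    ∑-cong : ∀ (xs : List A) {F G} → (∀ x → F x ≡ G x) → ∑ xs F ≡ ∑ xs G
    ∑-cong xs h = ∑-cong∈ xs λ {x} _ → h x

    ∑-zero∈ : ∀ (xs : List A) {F} → (∀ {x} → x ∈ xs → F x ≡ 0#) → ∑ xs F ≡ 0#
    ∑-zero∈ []       h = refl
    ∑-zero∈ (x ∷ xs) h =
      trans (cong₂ _⊞_ (h (here refl)) (∑-zero∈ xs (h ∘ there))) (+-identityˡ 0#)

    ∑-zero : ∀ (xs : List A) {F} → (∀ x → F x ≡ 0#) → ∑ xs F ≡ 0#
    ∑-zero xs h = ∑-zero∈ xs λ {x} _ → h x

    ∑-++ : ∀ (xs ys : List A) F → ∑ (xs ++ ys) F ≡ ∑ xs F ⊞ ∑ ys F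
    ∑-++ []       ys F = sym (+-identityˡ _)
    ∑-++ (x ∷ xs) ys F = trans (cong (F x ⊞_) (∑-++ xs ys F)) (sym (+-assoc _ _ _))

    ∑-⊞ : ∀ (xs : List A) F G → ∑ xs (λ x → F x ⊞ G x) ≡ ∑ xs F ⊞ ∑ xs G
    ∑-⊞ []       F G = sym (+-identityˡ 0#)
    ∑-⊞ (x ∷ xs) F G = trans (cong ((F x ⊞ G x) ⊞_) (∑-⊞ xs F G))
      (trans (+-assoc _ _ _) (trans (cong (F x ⊞_)
        (trans (sym (+-assoc _ _ _)) (trans (cong (_⊞ ∑ xs G) (+-comm _ _)) (+-assoc _ _ _))))
        (sym (+-assoc _ _ _))))

    ∑-*ˡ : ∀ c (xs : List A) F → c ⊠ ∑ xs F ≡ ∑ xs λ x → c ⊠ F x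
    ∑-*ˡ c []       F = zeroʳ c
    ∑-*ˡ c (x ∷ xs) F = trans (distribˡ c (F x) (∑ xs F)) (cong ((c ⊠ F x) ⊞_) (∑-*ˡ c xs F))

    ∑-*ʳ : ∀ c (xs : List A) F → ∑ xs F ⊠ c ≡ ∑ xs λ x → F x ⊠ c
    ∑-*ʳ c xs F = trans (*-comm _ c) (trans (∑-*ˡ c xs F) (∑-cong xs λ x → *-comm c (F x)))

    ∑-map : {B : Set} (f : B → A) (xs : List B) (F : A → R) → ∑ (map f xs) F ≡ ∑ xs (F ∘ f)
    ∑-map f []       F = refl
    ∑-map f (x ∷ xs) F = cong (F (f x) ⊞_) (∑-map f xs F)

  ∑-swap : {A B : Set} (xs : List A) (ys : List B) (F : A → B → R) →
    ∑ xs (λ x → ∑ ys (F x)) ≡ ∑ ys λ y → ∑ xs λ x → F x y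
  ∑-swap []       ys F = sym (∑-zero ys λ _ → refl)
  ∑-swap (x ∷ xs) ys F =
    trans (cong (∑ ys (F x) ⊞_) (∑-swap xs ys F)) (sym (∑-⊞ ys (F x) (λ y → ∑ xs λ x → F x y)))

  ∑-product : {A B C : Set} (f : A → B → C) (xs : List A) (ys : List B) (F : C → R) →
    ∑ (cartesianProductWith f xs ys) F ≡ ∑ xs λ x → ∑ ys λ y → F (f x y)
  ∑-product f []       ys F = refl
  ∑-product f (x ∷ xs) ys F = trans (∑-++ (map (f x) ys) _ F)
    (cong₂ _⊞_ (∑-map (f x) ys F) (∑-product f xs ys F))

  ∑-pairs : {A B : Set} (xs : List A) (ys : A → List B) (F : A × B → R) →
    ∑ (pairs xs ys) F ≡ ∑ xs λ x → ∑ (ys x) λ y → F (x , y)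
  ∑-pairs []       ys F = refl
  ∑-pairs (x ∷ xs) ys F = trans (∑-++ (map (x ,_) (ys x)) _ F)
    (cong₂ _⊞_ (∑-map (x ,_) (ys x) F) (∑-pairs xs ys F))

  ∑*∑ : {A B : Set} (xs : List A) (ys : List B) (F : A → R) (G : B → R) →
    ∑ xs F ⊠ ∑ ys G ≡ ∑ xs λ x → ∑ ys λ y → F x ⊠ G y
  ∑*∑ xs ys F G = trans (∑-*ʳ _ xs F) (∑-cong xs λ x → ∑-*ˡ (F x) ys G)

  ⟦_⟧ : {P : Set} → Dec P → R
  ⟦ yes _ ⟧ = 1#
  ⟦ no  _ ⟧ = 0#

  ⟦⟧-yes : {P : Set} (d : Dec P) → P → ⟦ d ⟧ ≡ 1#
  ⟦⟧-yes (yes _) p = refl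
  ⟦⟧-yes (no ¬p) p = contradiction p ¬p

  ⟦⟧-no : {P : Set} (d : Dec P) → ¬ P → ⟦ d ⟧ ≡ 0#
  ⟦⟧-no (yes p) ¬p = contradiction p ¬p
  ⟦⟧-no (no _)  ¬p = refl

  ⟦⟧-cong : {P Q : Set} (d : Dec P) (e : Dec Q) → (P → Q) → (Q → P) → ⟦ d ⟧ ≡ ⟦ e ⟧
  ⟦⟧-cong (yes p) e f g = sym (⟦⟧-yes e (f p))
  ⟦⟧-cong (no ¬p) e f g = sym (⟦⟧-no e (¬p ∘ g))

  ∑-filter : {A : Set} {P : A → Set} (P? : ∀ a → Dec (P a)) (xs : List A) (F : A → R) →
    ∑ (filter P? xs) F ≡ ∑ xs λ x → ⟦ P? x ⟧ ⊠ F x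
  ∑-filter P? []       F = refl
  ∑-filter P? (x ∷ xs) F with P? x
  ... | yes _ = cong₂ _⊞_ (sym (*-identityˡ (F x))) (∑-filter P? xs F)
  ... | no  _ = trans (∑-filter P? xs F) (sym (trans (cong (_⊞ ∑ xs (λ x → ⟦ P? x ⟧ ⊠ F x)) (zeroˡ (F x))) (+-identityˡ _)))

  ∑-split : {A : Set} {P : A → Set} (P? : ∀ a → Dec (P a)) (xs : List A) (F : A → R) →
    ∑ xs F ≡ ∑ (filter P? xs) F ⊞ ∑ (filter (¬? ∘ P?) xs) F
  ∑-split P? []       F = sym (+-identityˡ 0#)
  ∑-split P? (x ∷ xs) F with P? x
  ... | yes _ = trans (cong (F x ⊞_) (∑-split P? xs F)) (sym (+-assoc _ _ _))
  ... | no  _ = trans (cong (F x ⊞_) (trans (∑-split P? xs F) (+-comm _ _)))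
    (trans (sym (+-assoc _ _ _)) (+-comm _ _))

  module _ {A : Set} (_≟_ : ∀ (x y : A) → Dec (x ≡ y)) where

    ∑-δ-∉ : ∀ ys (F : A → R) {z} → z ∉ ys → (∑ ys λ y → ⟦ z ≟ y ⟧ ⊠ F y) ≡ 0#
    ∑-δ-∉ ys F {z} z∉ = ∑-zero∈ ys λ {y} y∈ →
      trans (cong (_⊠ F y) (⟦⟧-no (z ≟ y) λ { refl → z∉ y∈ })) (zeroˡ (F y))

    ∑-δ : ∀ ys (F : A → R) {z} → Unique ys → z ∈ ys → (∑ ys λ y → ⟦ z ≟ y ⟧ ⊠ F y) ≡ F z
    ∑-δ (y ∷ ys) F {z} (y# ∷ u) (here refl) = trans (cong₂ _⊞_
        (trans (cong (_⊠ F z) (⟦⟧-yes (z ≟ z) refl)) (*-identityˡ (F z)))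
        (∑-δ-∉ ys F (λ z∈ → ListAll.lookup y# z∈ refl)))
      (+-identityʳ (F z))
    ∑-δ (y ∷ ys) F {z} (y# ∷ u) (there z∈) = trans (cong₂ _⊞_
        (trans (cong (_⊠ F y) (⟦⟧-no (z ≟ y) λ { refl → ListAll.lookup y# z∈ refl })) (zeroˡ (F y)))
        (∑-δ ys F u z∈))
      (+-identityˡ (F z))

    private
      dec∈ : ∀ z ys → Dec (z ∈ ys)
      dec∈ z []       = no λ ()
      dec∈ z (y ∷ ys) with z ≟ y
      ... | yes refl = yes (here refl)
      ... | no z≢y with dec∈ z ys
      ... | yes z∈ = yes (there z∈)
      ... | no z∉  = no λ { (here e) → z≢y e ; (there z∈) → z∉ z∈ }

    ∑-δ-supported : ∀ ys (F : A → R) z → Unique ys → (z ∉ ys → F z ≡ 0#) →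
      (∑ ys λ y → ⟦ z ≟ y ⟧ ⊠ F y) ≡ F z
    ∑-δ-supported ys F z u h with dec∈ z ys
    ... | yes z∈ = ∑-δ ys F u z∈
    ... | no z∉  = trans (∑-δ-∉ ys F z∉) (sym (h z∉))

    -- Each `F x` is expanded as a delta sum over `ys` and the sums are exchanged, so the inner
    -- factor counts the occurrences of `y` in `xs`. Comparing that count with 1 gives both
    -- `∑-support` and `∑-⊆`.
    ∑-double : ∀ xs ys (F : A → R) → Unique ys → (∀ z → z ∈ xs → z ∉ ys → F z ≡ 0#) →
      ∑ xs F ≡ ∑ ys λ y → (∑ xs λ x → ⟦ y ≟ x ⟧) ⊠ F y
    ∑-double xs ys F uy hy = trans
      (∑-cong∈ xs λ {x} x∈ → sym (∑-δ-supported ys F x uy (hy x x∈)))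
      (trans (∑-swap xs ys _) (∑-cong ys λ y → trans
        (∑-cong xs λ x → cong (_⊠ F y) (⟦⟧-cong (x ≟ y) (y ≟ x) sym sym))
        (sym (∑-*ʳ (F y) xs _))))

    ∑-support : ∀ xs ys (F : A → R) → Unique xs → Unique ys →
      (∀ z → z ∉ xs → F z ≡ 0#) → (∀ z → z ∉ ys → F z ≡ 0#) → ∑ xs F ≡ ∑ ys F
    ∑-support xs ys F ux uy hx hy = trans (∑-double xs ys F uy (λ z _ → hy z))
      (∑-cong ys λ y → trans (∑-*ʳ (F y) xs _)
        (trans (∑-cong xs λ x → shift y x (y ≟ x)) (∑-δ-supported xs F y ux (hx y))))
      where
      shift : ∀ y x (d : Dec (y ≡ x)) → ⟦ d ⟧ ⊠ F y ≡ ⟦ d ⟧ ⊠ F x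
      shift y x (yes refl) = refl
      shift y x (no _)     = trans (zeroˡ (F y)) (sym (zeroˡ (F x)))

open Summation _+_ _*_ 0ℚ 1ℚ
  (IsCommutativeRing.isCommutativeSemiring ℚ.+-*-isCommutativeRing) public

-- Sums of rationals

*-monoˡ : ∀ c {p q} → 0ℚ ≤ c → p ≤ q → c * p ≤ c * q
*-monoˡ c 0≤c = ℚ.*-monoˡ-≤-nonNeg c {{ℚ.nonNegative 0≤c}}

*-monoʳ : ∀ c {p q} → 0ℚ ≤ c → p ≤ q → p * c ≤ q * c
*-monoʳ c 0≤c = ℚ.*-monoʳ-≤-nonNeg c {{ℚ.nonNegative 0≤c}}

∑-mono∈ : {A : Set} (xs : List A) {F G : A → ℚ} → (∀ {x} → x ∈ xs → F x ≤ G x) → ∑ xs F ≤ ∑ xs G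
∑-mono∈ []       h = ℚ.≤-refl
∑-mono∈ (x ∷ xs) h = ℚ.+-mono-≤ (h (here refl)) (∑-mono∈ xs (h ∘ there))

∑-mono : {A : Set} (xs : List A) {F G : A → ℚ} → (∀ x → F x ≤ G x) → ∑ xs F ≤ ∑ xs G
∑-mono xs h = ∑-mono∈ xs λ {x} _ → h x

∑-nn : {A : Set} (xs : List A) {F : A → ℚ} → (∀ x → 0ℚ ≤ F x) → 0ℚ ≤ ∑ xs F
∑-nn []       h = ℚ.≤-refl
∑-nn (x ∷ xs) h = nn+ (h x) (∑-nn xs h)

∑-const : {A : Set} (xs : List A) (c : ℚ) → ∑ xs (const c) ≡ ι (length xs) * c
∑-const []       c = sym (ℚ.*-zeroˡ c)
∑-const (x ∷ xs) c = trans (cong (λ t → c + t) (∑-const xs c))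
  (trans (solve 2 (λ c l → c :+ l :* c := (con 1ℚ :+ l) :* c) refl c (ι (length xs)))
    (cong (_* c) (sym (ι-suc (length xs)))))
  where open ℚ-Solver.+-*-Solver

∑-≤-const : {A : Set} (xs : List A) {F : A → ℚ} (c : ℚ) → (∀ x → F x ≤ c) → ∑ xs F ≤ ι (length xs) * c
∑-≤-const xs c h = ℚ.≤-trans (∑-mono xs h) (ℚ.≤-reflexive (∑-const xs c))

0≤⟦⟧ : {P : Set} (d : Dec P) → 0ℚ ≤ ⟦ d ⟧
0≤⟦⟧ (yes _) = 0≤1
0≤⟦⟧ (no _)  = ℚ.≤-refl

⟦⟧≤1 : {P : Set} (d : Dec P) → ⟦ d ⟧ ≤ 1ℚ
⟦⟧≤1 (yes _) = ℚ.≤-refl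
⟦⟧≤1 (no _)  = 0≤1

⟦⟧-mono : {P Q : Set} (d : Dec P) (e : Dec Q) → (P → Q) → ⟦ d ⟧ ≤ ⟦ e ⟧
⟦⟧-mono (yes p) e f = ℚ.≤-reflexive (sym (⟦⟧-yes e (f p)))
⟦⟧-mono (no _)  e f = 0≤⟦⟧ e

1*≤ : ∀ {c q} → 0ℚ ≤ q → c ≤ 1ℚ → c * q ≤ q
1*≤ {c} {q} 0≤q c≤1 = subst (c * q ≤_) (ℚ.*-identityˡ q)
  (*-monoʳ q 0≤q c≤1)

module _ {A : Set} (_≟_ : ∀ (x y : A) → Dec (x ≡ y)) where

  ∑-δ≤1 : ∀ xs → Unique xs → ∀ z → (∑ xs λ x → ⟦ z ≟ x ⟧) ≤ 1ℚ
  ∑-δ≤1 []       u       z = 0≤1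
  ∑-δ≤1 (x ∷ xs) (x# ∷ u) z with z ≟ x
  ... | yes refl = ℚ.≤-reflexive (trans (cong (λ t → 1ℚ + t)
    (∑-zero∈ xs λ {y} y∈ → ⟦⟧-no (z ≟ y) λ { refl → ListAll.lookup x# y∈ refl }))
    (ℚ.+-identityʳ 1ℚ))
  ... | no _ = subst (_≤ 1ℚ) (sym (ℚ.+-identityˡ _)) (∑-δ≤1 xs u z)

  ∑-⊆ : ∀ xs ys (F : A → ℚ) → Unique xs → Unique ys → (∀ {z} → z ∈ xs → z ∈ ys) →
    (∀ z → 0ℚ ≤ F z) → ∑ xs F ≤ ∑ ys F
  ∑-⊆ xs ys F ux uy sub 0≤F = ℚ.≤-trans
    (ℚ.≤-reflexive (∑-double _≟_ xs ys F uy λ z z∈ z∉ → contradiction (sub z∈) z∉))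
    (∑-mono ys λ y → 1*≤ (0≤F y) (∑-δ≤1 xs ux y))

  ∑-injective : {B : Set} (f : B → A) → (∀ {x y} → f x ≡ f y → x ≡ y) →
    ∀ xs ys (F : A → ℚ) → Unique xs → Unique ys → (∀ {z} → z ∈ xs → f z ∈ ys) →
    (∀ z → 0ℚ ≤ F z) → ∑ xs (F ∘ f) ≤ ∑ ys F
  ∑-injective f inj xs ys F ux uy sub 0≤F = ℚ.≤-trans
    (ℚ.≤-reflexive (sym (∑-map f xs F)))
    (∑-⊆ (map f xs) ys F (Unique.map⁺ inj ux) uy
      (λ z∈ → let x , x∈ , eq = ∈-map⁻ f z∈ in subst (_∈ ys) (sym eq) (sub x∈)) 0≤F)

-- Gaussian rationals

infixl 6 _⊕_
infixl 7 _⊗_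
infix  8 ⊖_
infix  9 _†

-- Without eta, `⊕` and `⊗` reduce only on explicit pairs; long expressions stay in ring form and
-- can be handed to the solver.
record ℚ[i] : Set where
  no-eta-equality
  pattern
  constructor _+𝕚_
  field
    Re Im : ℚ

open ℚ[i] public

_⊕_ _⊗_ : ℚ[i] → ℚ[i] → ℚ[i]
(a +𝕚 b) ⊕ (c +𝕚 d) = (a + c) +𝕚 (b + d)
(a +𝕚 b) ⊗ (c +𝕚 d) = (a * c + - (b * d)) +𝕚 (a * d + b * c)

⊖_ _† : ℚ[i] → ℚ[i]
⊖ (a +𝕚 b) = (- a) +𝕚 (- b)
(a +𝕚 b) † = a +𝕚 (- b)

real : ℚ → ℚ[i]
real q = q +𝕚 0ℚ

0ᵍ 1ᵍ : ℚ[i]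
0ᵍ = real 0ℚ
1ᵍ = real 1ℚ

normSq : ℚ[i] → ℚ
normSq (a +𝕚 b) = a * a + b * b

module _ where
  open ℚ-Solver.+-*-Solver

  ⊕-assoc : ∀ x y z → (x ⊕ y) ⊕ z ≡ x ⊕ (y ⊕ z)
  ⊕-assoc (a +𝕚 b) (c +𝕚 d) (e +𝕚 f) = cong₂ _+𝕚_ (ℚ.+-assoc a c e) (ℚ.+-assoc b d f)

  ⊕-comm : ∀ x y → x ⊕ y ≡ y ⊕ x
  ⊕-comm (a +𝕚 b) (c +𝕚 d) = cong₂ _+𝕚_ (ℚ.+-comm a c) (ℚ.+-comm b d)

  ⊕-identityˡ : ∀ x → 0ᵍ ⊕ x ≡ x
  ⊕-identityˡ (a +𝕚 b) = cong₂ _+𝕚_ (ℚ.+-identityˡ a) (ℚ.+-identityˡ b)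

  ⊕-identityʳ : ∀ x → x ⊕ 0ᵍ ≡ x
  ⊕-identityʳ (a +𝕚 b) = cong₂ _+𝕚_ (ℚ.+-identityʳ a) (ℚ.+-identityʳ b)

  ⊖-inverseˡ : ∀ x → ⊖ x ⊕ x ≡ 0ᵍ
  ⊖-inverseˡ (a +𝕚 b) = cong₂ _+𝕚_ (ℚ.+-inverseˡ a) (ℚ.+-inverseˡ b)

  ⊖-inverseʳ : ∀ x → x ⊕ ⊖ x ≡ 0ᵍ
  ⊖-inverseʳ (a +𝕚 b) = cong₂ _+𝕚_ (ℚ.+-inverseʳ a) (ℚ.+-inverseʳ b)

  ⊗-comm : ∀ x y → x ⊗ y ≡ y ⊗ x
  ⊗-comm (a +𝕚 b) (c +𝕚 d) = cong₂ _+𝕚_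
    (solve 4 (λ a b c d → a :* c :+ :- (b :* d) := c :* a :+ :- (d :* b)) refl a b c d)
    (solve 4 (λ a b c d → a :* d :+ b :* c := c :* b :+ d :* a) refl a b c d)

  ⊗-assoc : ∀ x y z → (x ⊗ y) ⊗ z ≡ x ⊗ (y ⊗ z)
  ⊗-assoc (a +𝕚 b) (c +𝕚 d) (e +𝕚 f) = cong₂ _+𝕚_
    (solve 6 (λ a b c d e f →
      (a :* c :+ :- (b :* d)) :* e :+ :- ((a :* d :+ b :* c) :* f)
      := a :* (c :* e :+ :- (d :* f)) :+ :- (b :* (c :* f :+ d :* e))) refl a b c d e f)
    (solve 6 (λ a b c d e f →
      (a :* c :+ :- (b :* d)) :* f :+ (a :* d :+ b :* c) :* e
      := a :* (c :* f :+ d :* e) :+ b :* (c :* e :+ :- (d :* f))) refl a b c d e f)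

  ⊗-identityˡ : ∀ x → 1ᵍ ⊗ x ≡ x
  ⊗-identityˡ (a +𝕚 b) = cong₂ _+𝕚_
    (solve 2 (λ a b → con 1ℚ :* a :+ :- (con 0ℚ :* b) := a) refl a b)
    (solve 2 (λ a b → con 1ℚ :* b :+ con 0ℚ :* a := b) refl a b)

  ⊗-distribˡ : ∀ x y z → x ⊗ (y ⊕ z) ≡ (x ⊗ y) ⊕ (x ⊗ z)
  ⊗-distribˡ (a +𝕚 b) (c +𝕚 d) (e +𝕚 f) = cong₂ _+𝕚_
    (solve 6 (λ a b c d e f → a :* (c :+ e) :+ :- (b :* (d :+ f))
      := (a :* c :+ :- (b :* d)) :+ (a :* e :+ :- (b :* f))) refl a b c d e f)
    (solve 6 (λ a b c d e f → a :* (d :+ f) :+ b :* (c :+ e)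
      := (a :* d :+ b :* c) :+ (a :* f :+ b :* e)) refl a b c d e f)

  _≟ᵍ_ : ∀ (x y : ℚ[i]) → Dec (x ≡ y)
  (a +𝕚 b) ≟ᵍ (c +𝕚 d) with a ℚ.≟ c | b ℚ.≟ d
  ... | yes refl | yes refl = yes refl
  ... | no a≢c   | _        = no λ { refl → a≢c refl }
  ... | yes _    | no b≢d   = no λ { refl → b≢d refl }

ℚ[i]-isCommutativeRing : IsCommutativeRing _≡_ _⊕_ _⊗_ ⊖_ 0ᵍ 1ᵍ
ℚ[i]-isCommutativeRing = record
  { isRing = record
    { +-isAbelianGroup = record
      { isGroup = record
        { isMonoid = record
          { isSemigroup = record
            { isMagma = record { isEquivalence = isEquivalence ; ∙-cong = cong₂ _⊕_ }
            ; assoc = ⊕-assoc }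
          ; identity = ⊕-identityˡ , ⊕-identityʳ }
        ; inverse = ⊖-inverseˡ , ⊖-inverseʳ
        ; ⁻¹-cong = cong ⊖_ }
      ; comm = ⊕-comm }
    ; *-cong = cong₂ _⊗_
    ; *-assoc = ⊗-assoc
    ; *-identity = ⊗-identityˡ , λ x → trans (⊗-comm x 1ᵍ) (⊗-identityˡ x)
    ; distrib = ⊗-distribˡ , λ x y z → trans (⊗-comm (y ⊕ z) x)
        (trans (⊗-distribˡ x y z) (cong₂ _⊕_ (⊗-comm x y) (⊗-comm x z))) }
  ; *-comm = ⊗-comm }

ℚ[i]-commutativeRing : CommutativeRing _ _
ℚ[i]-commutativeRing = record { isCommutativeRing = ℚ[i]-isCommutativeRing }

open CommutativeRing ℚ[i]-commutativeRing
  using () renaming (zeroˡ to ⊗-zeroˡ; zeroʳ to ⊗-zeroʳ) public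

module ℚ[i]-Solver =
  Algebra.Solver.Ring.Simple (fromCommutativeRing ℚ[i]-commutativeRing) _≟ᵍ_

module ∑ᵍ = Summation _⊕_ _⊗_ 0ᵍ 1ᵍ
  (IsCommutativeRing.isCommutativeSemiring ℚ[i]-isCommutativeRing)

open ∑ᵍ using () renaming (∑ to ∑ᵍ) public

module _ where
  open ℚ-Solver.+-*-Solver

  †-⊗ : ∀ x y → (x ⊗ y) † ≡ x † ⊗ y †
  †-⊗ (a +𝕚 b) (c +𝕚 d) = cong₂ _+𝕚_
    (solve 4 (λ a b c d → a :* c :+ :- (b :* d) := a :* c :+ :- (:- b :* :- d)) refl a b c d)
    (solve 4 (λ a b c d → :- (a :* d :+ b :* c) := a :* :- d :+ :- b :* c) refl a b c d)

  †-⊕ : ∀ x y → (x ⊕ y) † ≡ x † ⊕ y †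
  †-⊕ (a +𝕚 b) (c +𝕚 d) = cong ((a + c) +𝕚_) (ℚ.neg-distrib-+ b d)

  normSq-⊗ : ∀ x y → normSq (x ⊗ y) ≡ normSq x * normSq y
  normSq-⊗ (a +𝕚 b) (c +𝕚 d) = solve 4 (λ a b c d →
    (a :* c :+ :- (b :* d)) :* (a :* c :+ :- (b :* d)) :+ (a :* d :+ b :* c) :* (a :* d :+ b :* c)
    := (a :* a :+ b :* b) :* (c :* c :+ d :* d)) refl a b c d

  normSq-† : ∀ x → normSq (x †) ≡ normSq x
  normSq-† (a +𝕚 b) = solve 2 (λ a b → a :* a :+ :- b :* :- b := a :* a :+ b :* b) refl a b

  normSq-real : ∀ q → normSq (real q) ≡ sq q
  normSq-real q = solve 1 (λ q → q :* q :+ con 0ℚ :* con 0ℚ := q :* q) refl q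

  Re-⊕ : ∀ x y → Re (x ⊕ y) ≡ Re x + Re y
  Re-⊕ (a +𝕚 b) (c +𝕚 d) = refl

  Re-⊗† : ∀ x → Re (x ⊗ x †) ≡ normSq x
  Re-⊗† (a +𝕚 b) = solve 2 (λ a b → a :* a :+ :- (b :* :- b) := a :* a :+ b :* b) refl a b

  Re-real : ∀ q x → Re (real q ⊗ x) ≡ q * Re x
  Re-real q (a +𝕚 b) = solve 3 (λ q a b → q :* a :+ :- (con 0ℚ :* b) := q :* a) refl q a b

  sq-nn : ∀ q → 0ℚ ≤ sq q
  sq-nn q with ℚ.≤-total 0ℚ q
  ... | inj₁ h = nn* h h
  ... | inj₂ h = subst (0ℚ ≤_) (solve 1 (λ q → :- q :* :- q := q :* q) refl q)
                   (nn* (ℚ.neg-antimono-≤ h) (ℚ.neg-antimono-≤ h))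

  normSq-nn : ∀ x → 0ℚ ≤ normSq x
  normSq-nn (a +𝕚 b) = nn+ (sq-nn a) (sq-nn b)

  Re²≤normSq : ∀ x → sq (Re x) ≤ normSq x
  Re²≤normSq (a +𝕚 b) = le (sq-nn b) refl

  ≤-from-sq : ∀ {a b} → 0ℚ ≤ b → sq a ≤ sq b → a ≤ b
  ≤-from-sq {a} {b} 0≤b h = ℚ.≮⇒≥ λ b<a → ℚ.<-irrefl refl (ℚ.<-≤-trans
    (ℚ.≤-<-trans (mono* 0≤b 0≤b (ℚ.<⇒≤ b<a) ℚ.≤-refl)
      (ℚ.*-monoʳ-<-pos a {{ℚ.positive (ℚ.≤-<-trans 0≤b b<a)}} b<a)) h)

  Re≤ : ∀ {c} x → 0ℚ ≤ c → normSq x ≤ sq c → Re x ≤ c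
  Re≤ x 0≤c h = ≤-from-sq 0≤c (ℚ.≤-trans (Re²≤normSq x) h)

  normSq-⊕ : ∀ x y → normSq (x ⊕ y) ≤ (1ℚ + 1ℚ) * (normSq x + normSq y)
  normSq-⊕ (a +𝕚 b) (c +𝕚 d) = le (nn+ (sq-nn (a - c)) (sq-nn (b - d)))
    (solve 4 (λ a b c d →
      ((a :+ c) :* (a :+ c) :+ (b :+ d) :* (b :+ d)) :+ ((a :- c) :* (a :- c) :+ (b :- d) :* (b :- d))
      := (con 1ℚ :+ con 1ℚ) :* ((a :* a :+ b :* b) :+ (c :* c :+ d :* d))) refl a b c d)

  †-∑ : {A : Set} (xs : List A) (F : A → ℚ[i]) → (∑ᵍ xs F) † ≡ ∑ᵍ xs λ x → F x †
  †-∑ []       F = refl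
  †-∑ (x ∷ xs) F = trans (†-⊕ (F x) (∑ᵍ xs F)) (cong (F x † ⊕_) (†-∑ xs F))

  Re-∑ : {A : Set} (xs : List A) (F : A → ℚ[i]) → Re (∑ᵍ xs F) ≡ ∑ xs λ x → Re (F x)
  Re-∑ []       F = refl
  Re-∑ (x ∷ xs) F = trans (Re-⊕ (F x) (∑ᵍ xs F)) (cong (λ t → Re (F x) + t) (Re-∑ xs F))

  private
    -- Inductive step of Cauchy-Schwarz. The cross term is at most 2√(|x|²|y|²AB), hence at most
    -- |x|²B + |y|²A; the comparison is made between squares, so no root is taken.
    cs-step : ∀ {A B} x y z → normSq z ≤ A * B → 0ℚ ≤ A → 0ℚ ≤ B →
      normSq (x ⊗ y ⊕ z) ≤ (normSq x + A) * (normSq y + B)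
    cs-step {A} {B} x y z h 0≤A 0≤B = subst (_≤ (normSq x + A) * (normSq y + B)) (sym (expand (x ⊗ y) z))
      (ℚ.≤-trans (ℚ.+-mono-≤ (ℚ.+-mono-≤ (ℚ.≤-reflexive (normSq-⊗ x y)) h) cross)
        (ℚ.≤-reflexive (solve 4 (λ a b A B → a :* b :+ A :* B :+ (a :* B :+ b :* A)
          := (a :+ A) :* (b :+ B)) refl (normSq x) (normSq y) A B)))
      where
      expand : ∀ u z → normSq (u ⊕ z) ≡ normSq u + normSq z + (1ℚ + 1ℚ) * Re (u ⊗ z †)
      expand (a +𝕚 b) (c +𝕚 d) = solve 4 (λ a b c d →
        (a :+ c) :* (a :+ c) :+ (b :+ d) :* (b :+ d)
        := (a :* a :+ b :* b) :+ (c :* c :+ d :* d)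
           :+ (con 1ℚ :+ con 1ℚ) :* (a :* c :+ :- (b :* :- d))) refl a b c d
      bound : sq (Re (x ⊗ y ⊗ z †)) ≤ normSq x * normSq y * (A * B)
      bound = ℚ.≤-trans (Re²≤normSq (x ⊗ y ⊗ z †))
        (ℚ.≤-trans (ℚ.≤-reflexive (trans (normSq-⊗ (x ⊗ y) (z †)) (cong₂ _*_ (normSq-⊗ x y) (normSq-† z))))
          (*-monoˡ (normSq x * normSq y) (nn* (normSq-nn x) (normSq-nn y)) h))
      cross : (1ℚ + 1ℚ) * Re (x ⊗ y ⊗ z †) ≤ normSq x * B + normSq y * A
      cross = ≤-from-sq (nn+ (nn* (normSq-nn x) 0≤B) (nn* (normSq-nn y) 0≤A))
        (ℚ.≤-trans
          (subst (_≤ (1ℚ + 1ℚ) * (1ℚ + 1ℚ) * (normSq x * normSq y * (A * B)))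
            (solve 1 (λ r → (con 1ℚ :+ con 1ℚ) :* (con 1ℚ :+ con 1ℚ) :* (r :* r)
              := ((con 1ℚ :+ con 1ℚ) :* r) :* ((con 1ℚ :+ con 1ℚ) :* r)) refl (Re (x ⊗ y ⊗ z †)))
            (ℚ.*-monoˡ-≤-nonNeg ((1ℚ + 1ℚ) * (1ℚ + 1ℚ)) bound))
          (le (sq-nn (normSq x * B - normSq y * A))
            (solve 4 (λ a b A B →
              (con 1ℚ :+ con 1ℚ) :* (con 1ℚ :+ con 1ℚ) :* (a :* b :* (A :* B))
                :+ (a :* B :- b :* A) :* (a :* B :- b :* A)
              := (a :* B :+ b :* A) :* (a :* B :+ b :* A)) refl (normSq x) (normSq y) A B)))

  cauchy-schwarz : {A : Set} (xs : List A) (F G : A → ℚ[i]) →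
    normSq (∑ᵍ xs λ x → F x ⊗ G x) ≤ ∑ xs (normSq ∘ F) * ∑ xs (normSq ∘ G)
  cauchy-schwarz []       F G = ℚ.≤-refl
  cauchy-schwarz (x ∷ xs) F G = cs-step (F x) (G x) (∑ᵍ xs λ x → F x ⊗ G x)
    (cauchy-schwarz xs F G) (∑-nn xs λ x → normSq-nn (F x)) (∑-nn xs λ x → normSq-nn (G x))

  cauchy-schwarz-real : {A : Set} (xs : List A) (c : A → ℚ) (G : A → ℚ[i]) →
    normSq (∑ᵍ xs λ x → real (c x) ⊗ G x) ≤ ∑ xs (λ x → sq (c x)) * ∑ xs (normSq ∘ G)
  cauchy-schwarz-real xs c G = subst (λ t → normSq (∑ᵍ xs λ x → real (c x) ⊗ G x) ≤ t * ∑ xs (normSq ∘ G))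
    (∑-cong xs λ x → normSq-real (c x)) (cauchy-schwarz xs (real ∘ c) G)

  normSq-∑ : {A : Set} (xs : List A) (G : A → ℚ[i]) →
    normSq (∑ᵍ xs G) ≤ ι (length xs) * ∑ xs (normSq ∘ G)
  normSq-∑ xs G = subst₂ (λ s t → normSq s ≤ t * ∑ xs (normSq ∘ G))
    (∑ᵍ.∑-cong xs λ x → ⊗-identityˡ (G x))
    (trans (∑-const xs 1ℚ) (ℚ.*-identityʳ _))
    (cauchy-schwarz-real xs (const 1ℚ) G)

  -- The triangle inequality without square roots: Lagrange's identity bounds the real inner product
  -- of the new term with the remaining sum. It is what keeps averaged weights bounded by 1.
  normSq-weighted : {A : Set} (xs : List A) (c : A → ℚ) (G : A → ℚ[i]) (Z : ℚ) → (∀ x → 0ℚ ≤ c x) →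
    (∀ x → normSq (G x) ≤ Z) → normSq (∑ᵍ xs λ x → real (c x) ⊗ G x) ≤ sq (∑ xs c) * Z
  normSq-weighted []       c G Z 0≤c h = ℚ.≤-reflexive (sym (ℚ.*-zeroˡ Z))
  normSq-weighted (x ∷ xs) c G Z 0≤c h =
    merge (c x) (∑ xs c) (G x) (∑ᵍ xs λ x → real (c x) ⊗ G x) (0≤c x) (∑-nn xs 0≤c) (h x)
      (normSq-weighted xs c G Z 0≤c h)
    where
    merge : ∀ c s u z → 0ℚ ≤ c → 0ℚ ≤ s → normSq u ≤ Z → normSq z ≤ sq s * Z →
      normSq (real c ⊗ u ⊕ z) ≤ sq (c + s) * Z
    merge c s (a +𝕚 b) (p +𝕚 q) 0≤c 0≤s hu hz = ℚ.≤-trans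
      (ℚ.≤-trans (ℚ.≤-reflexive (solve 5 (λ c a b p q →
          (c :* a :+ :- (con 0ℚ :* b) :+ p) :* (c :* a :+ :- (con 0ℚ :* b) :+ p)
            :+ (c :* b :+ con 0ℚ :* a :+ q) :* (c :* b :+ con 0ℚ :* a :+ q)
          := (c :* c :* (a :* a :+ b :* b) :+ (p :* p :+ q :* q))
             :+ (con 1ℚ :+ con 1ℚ) :* c :* (a :* p :+ b :* q)) refl c a b p q))
        (ℚ.+-mono-≤ (ℚ.+-mono-≤
            (*-monoˡ (c * c) (nn* 0≤c 0≤c) hu) hz)
          (*-monoˡ ((1ℚ + 1ℚ) * c) (nn* (nn+ 0≤1 0≤1) 0≤c) inner)))
      (ℚ.≤-reflexive (solve 3 (λ c s Z → c :* c :* Z :+ s :* s :* Z :+ (con 1ℚ :+ con 1ℚ) :* c :* (s :* Z)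
        := (c :+ s) :* (c :+ s) :* Z) refl c s Z))
      where
      0≤Z = ℚ.≤-trans (normSq-nn (a +𝕚 b)) hu
      inner : a * p + b * q ≤ s * Z
      inner = ≤-from-sq (nn* 0≤s 0≤Z) (ℚ.≤-trans
        (le (sq-nn (a * q - b * p)) (solve 4 (λ a b p q →
          (a :* p :+ b :* q) :* (a :* p :+ b :* q) :+ (a :* q :- b :* p) :* (a :* q :- b :* p)
          := (a :* a :+ b :* b) :* (p :* p :+ q :* q)) refl a b p q))
        (ℚ.≤-trans (mono* (normSq-nn (a +𝕚 b)) (normSq-nn (p +𝕚 q)) hu hz)
          (ℚ.≤-reflexive (solve 2 (λ s Z → Z :* (s :* s :* Z) := (s :* Z) :* (s :* Z)) refl s Z))))

-- Iterated squaring and power means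

-- This is q^(2^j). The square is taken on the inside, so that an inequality for `sq q` obtained
-- from one Cauchy-Schwarz can be inserted under the remaining powers.
tower : ℕ → ℚ → ℚ
tower zero    q = q
tower (suc j) q = tower j (sq q)

tower-nn : ∀ j {q} → 0ℚ ≤ q → 0ℚ ≤ tower j q
tower-nn zero    h = h
tower-nn (suc j) h = tower-nn j (nn* h h)

tower-pos : ∀ j {q} → 0ℚ < q → 0ℚ < tower j q
tower-pos zero    h = h
tower-pos (suc j) h = tower-pos j (pos* h h)

tower-mono : ∀ j {p q} → 0ℚ ≤ p → p ≤ q → tower j p ≤ tower j q
tower-mono zero    0≤p h = h
tower-mono (suc j) 0≤p h = tower-mono j (nn* 0≤p 0≤p) (sq-mono 0≤p h)

module _ where
  open ℚ-Solver.+-*-Solver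

  tower-* : ∀ j p q → tower j (p * q) ≡ tower j p * tower j q
  tower-* zero    p q = refl
  tower-* (suc j) p q = trans
    (cong (tower j) (solve 2 (λ p q → (p :* q) :* (p :* q) := (p :* p) :* (q :* q)) refl p q))
    (tower-* j (sq p) (sq q))

  tower-sq : ∀ j q → tower (suc j) q ≡ sq (tower j q)
  tower-sq j q = tower-* j q q

  tower-^ : ∀ j q → tower j q ≡ q ^ℚ (2 ^ j)
  tower-^ zero    q = sym (ℚ.*-identityʳ q)
  tower-^ (suc j) q = trans (tower-sq j q) (trans (cong sq (tower-^ j q))
    (trans (sym (^-+ (2 ^ j) (2 ^ j))) (cong (λ t → q ^ℚ (2 ^ j ℕ.+ t)) (sym (ℕ.+-identityʳ (2 ^ j))))))
    where
    ^-+ : ∀ m n → q ^ℚ (m ℕ.+ n) ≡ q ^ℚ m * q ^ℚ n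
    ^-+ zero    n = sym (ℚ.*-identityˡ _)
    ^-+ (suc m) n = trans (cong (q *_) (^-+ m n)) (sym (ℚ.*-assoc q _ _))

  sq-∑ : {A : Set} (xs : List A) (F : A → ℚ) → sq (∑ xs F) ≤ ι (length xs) * ∑ xs (sq ∘ F)
  sq-∑ xs F = ℚ.≤-trans
    (subst (λ t → sq t ≤ normSq (∑ᵍ xs (real ∘ F))) (Re-∑ xs (real ∘ F)) (Re²≤normSq (∑ᵍ xs (real ∘ F))))
    (subst (λ t → normSq (∑ᵍ xs (real ∘ F)) ≤ ι (length xs) * t)
      (∑-cong xs λ x → normSq-real (F x)) (normSq-∑ xs (real ∘ F)))

-- The product collects to c^(2^j - 1), the loss in Jensen's inequality for the power 2^j when the
-- total mass is c.
meanConst : ℕ → ℚ → ℚ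
meanConst zero    c = 1ℚ
meanConst (suc j) c = tower j c * meanConst j c

meanConst-nn : ∀ j {c} → 0ℚ ≤ c → 0ℚ ≤ meanConst j c
meanConst-nn zero    h = 0≤1
meanConst-nn (suc j) h = nn* (tower-nn j h) (meanConst-nn j h)

module _ {v c : ℚ} (0≤v : 0ℚ ≤ v) (0≤c : 0ℚ ≤ c) where
  open ℚ-Solver.+-*-Solver

  -- Jensen's inequality for x ↦ x^(2^j), by repeated Cauchy-Schwarz. The weight `v` normalises the
  -- sum, but its total mass is only known to be at most `c`.
  power-mean : ∀ j {A : Set} (xs : List A) (F : A → ℚ) → v * ι (length xs) ≤ c → (∀ x → 0ℚ ≤ F x) →
    tower j (v * ∑ xs F) ≤ meanConst j c * (v * ∑ xs (tower j ∘ F))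
  power-mean zero    xs F hc 0≤F = ℚ.≤-reflexive (sym (ℚ.*-identityˡ _))
  power-mean (suc j) xs F hc 0≤F = ℚ.≤-trans
    (tower-mono j (nn* 0≤vF 0≤vF) square)
    (ℚ.≤-trans (ℚ.≤-reflexive (tower-* j c (v * ∑ xs (sq ∘ F))))
      (ℚ.≤-trans
        (*-monoˡ (tower j c) (tower-nn j 0≤c)
          (power-mean j xs (sq ∘ F) hc λ x → nn* (0≤F x) (0≤F x)))
        (ℚ.≤-reflexive (sym (ℚ.*-assoc (tower j c) (meanConst j c) _)))))
    where
    0≤vF = nn* 0≤v (∑-nn xs 0≤F)
    square : sq (v * ∑ xs F) ≤ c * (v * ∑ xs (sq ∘ F))
    square = ℚ.≤-trans
      (subst₂ _≤_
        (solve 2 (λ v f → v :* v :* (f :* f) := (v :* f) :* (v :* f)) refl v (∑ xs F))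
        (solve 3 (λ v l f → v :* v :* (l :* f) := (v :* l) :* (v :* f))
           refl v (ι (length xs)) (∑ xs (sq ∘ F)))
        (*-monoˡ (v * v) (nn* 0≤v 0≤v) (sq-∑ xs F)))
      (*-monoʳ (v * ∑ xs (sq ∘ F))
        (nn* 0≤v (∑-nn xs λ x → nn* (0≤F x) (0≤F x))) hc)

-- Sums over intervals

+-cancelʳ : ∀ c {i j} → i ℤ.+ c ≡ j ℤ.+ c → i ≡ j
+-cancelʳ c {i} {j} e = trans (sym (undo i)) (trans (cong (ℤ._- c) e) (undo j))
  where
  undo : ∀ z → z ℤ.+ c ℤ.- c ≡ z
  undo z = trans (ℤ.+-assoc z c (ℤ.- c))
    (trans (cong (λ t → z ℤ.+ t) (ℤ.+-inverseʳ c)) (ℤ.+-identityʳ z))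

interval-unique : ∀ L → Unique (interval L)
interval-unique L = Unique.map⁺
  (λ {i} {j} e → ℤ.+-injective (+-cancelʳ (ℤ.- + L) e)) (Unique.upTo⁺ _)

∈-interval⁺ : ∀ {z L} → ℤ.∣ z ∣ ℕ.≤ L → z ∈ interval L
∈-interval⁺ {z} {L} h = subst (_∈ interval L) eq
  (∈-map⁺ (λ j → + j ℤ.- + L) (∈-upTo⁺ (s≤s (ℕ.≤-trans (ℤ.∣i+j∣≤∣i∣+∣j∣ z (+ L)) (ℕ.+-monoˡ-≤ L h)))))
  where
  nonneg : ∀ z → ℤ.∣ z ∣ ℕ.≤ L → + 0 ℤ.≤ z ℤ.+ + L
  nonneg (+ n) h = ℤ.+≤+ z≤n
  nonneg (ℤ.-[1+ n ]) h = subst (ℤ._≤ ℤ.-[1+ n ] ℤ.+ + L) (ℤ.+-inverseʳ ℤ.-[1+ n ])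
    (ℤ.+-monoʳ-≤ ℤ.-[1+ n ] (ℤ.+≤+ h))
  eq : + ℤ.∣ z ℤ.+ + L ∣ ℤ.- + L ≡ z
  eq = trans (cong (ℤ._- + L) (ℤ.0≤i⇒+∣i∣≡i (nonneg z h)))
    (trans (ℤ.+-assoc z (+ L) (ℤ.- + L)) (trans (cong (λ t → z ℤ.+ t) (ℤ.+-inverseʳ (+ L))) (ℤ.+-identityʳ z)))

∈-interval⁻ : ∀ {z L} → z ∈ interval L → ℤ.∣ z ∣ ℕ.≤ L
∈-interval⁻ {z} {L} z∈ with ∈-map⁻ (λ j → + j ℤ.- + L) z∈
... | j , j∈ , refl = bound (ℕ.≤-total j L)
  where
  j≤ : j ℕ.≤ L ℕ.+ L
  j≤ = ℕ.s≤s⁻¹ (∈-upTo⁻ j∈)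
  bound : j ℕ.≤ L ⊎ L ℕ.≤ j → ℤ.∣ + j ℤ.- + L ∣ ℕ.≤ L
  bound (inj₁ h) = subst (ℕ._≤ L) (sym (trans (cong ℤ.∣_∣ (ℤ.m-n≡m⊖n j L)) (ℤ.∣⊖∣-≤ h)))
    (ℕ.m∸n≤m L j)
  bound (inj₂ h) = subst (ℕ._≤ L) (cong ℤ.∣_∣ (sym (trans (ℤ.m-n≡m⊖n j L) (ℤ.⊖-≥ h))))
    (ℕ.m≤n+o⇒m∸n≤o j L j≤)

length-interval : ∀ L → length (interval L) ≡ suc (L ℕ.+ L)
length-interval L = trans (length-map _ (upTo (suc (L ℕ.+ L)))) (length-upTo _)

-- Intervals with a non-computing definition, so that sums over them stay
-- folded during type checking.
opaque
  window : ℕ → List ℤ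
  window = interval

  window≡interval : ∀ L → window L ≡ interval L
  window≡interval L = refl

  window-unique : ∀ L → Unique (window L)
  window-unique = interval-unique

  ∈-window⁺ : ∀ {z L} → ℤ.∣ z ∣ ℕ.≤ L → z ∈ window L
  ∈-window⁺ = ∈-interval⁺

  ∈-window⁻ : ∀ {z L} → z ∈ window L → ℤ.∣ z ∣ ℕ.≤ L
  ∈-window⁻ = ∈-interval⁻

  length-window : ∀ L → length (window L) ≡ suc (L ℕ.+ L)
  length-window = length-interval

module IntervalSums {R : Set} (_⊞_ _⊠_ : R → R → R) (0# 1# : R)
  (isCommutativeSemiring : IsCommutativeSemiring (_≡_ {A = R}) _⊞_ _⊠_ 0# 1#) where
  private module S = Summation _⊞_ _⊠_ 0# 1# isCommutativeSemiring

  -- Takes the place of translation invariance of sums over ℤ: once the two windows hold the support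
  -- of `F` and its translate, their lengths no longer matter.
  ∑-shift : ∀ {M N L} c (F : ℤ → R) → (∀ z → ¬ ℤ.∣ z ∣ ℕ.≤ M → F z ≡ 0#) →
    M ℕ.≤ N → M ℕ.+ ℤ.∣ c ∣ ℕ.≤ L →
    S.∑ (window L) (λ x → F (x ℤ.+ c)) ≡ S.∑ (window N) F
  ∑-shift {M} {N} {L} c F supp M≤N M+c≤L = trans (sym (S.∑-map (ℤ._+ c) (window L) F))
    (S.∑-support ℤ._≟_ (map (ℤ._+ c) (window L)) (window N) F
      (Unique.map⁺ (+-cancelʳ c) (window-unique L)) (window-unique N)
      (λ z z∉ → supp z λ h → z∉ (subst (_∈ map (ℤ._+ c) (window L)) (back z)
        (∈-map⁺ (ℤ._+ c) {z ℤ.- c} (∈-window⁺ (ℕ.≤-trans (ℤ.∣i-j∣≤∣i∣+∣j∣ z c)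
          (ℕ.≤-trans (ℕ.+-monoˡ-≤ ℤ.∣ c ∣ h) M+c≤L))))))
      (λ z z∉ → supp z λ h → z∉ (∈-window⁺ (ℕ.≤-trans h M≤N))))
    where
    back : ∀ z → z ℤ.- c ℤ.+ c ≡ z
    back z = trans (ℤ.+-assoc z (ℤ.- c) c)
      (trans (cong (λ t → z ℤ.+ t) (ℤ.+-inverseˡ c)) (ℤ.+-identityʳ z))

open IntervalSums _+_ _*_ 0ℚ 1ℚ
  (IsCommutativeRing.isCommutativeSemiring ℚ.+-*-isCommutativeRing) public
open IntervalSums _⊕_ _⊗_ 0ᵍ 1ᵍ
  (IsCommutativeRing.isCommutativeSemiring ℚ[i]-isCommutativeRing) public
  using () renaming (∑-shift to ∑ᵍ-shift)

-- Differencing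

Supported : ℕ → (ℤ → ℚ[i]) → Set
Supported M f = ∀ x → ¬ ℤ.∣ x ∣ ℕ.≤ M → f x ≡ 0ᵍ

UnitBounded : {A : Set} → (A → ℚ[i]) → Set
UnitBounded f = ∀ a → normSq (f a) ≤ 1ℚ

Δ : ℤ → (ℤ → ℚ[i]) → ℤ → ℚ[i]
Δ t f x = f x ⊗ f (x ℤ.+ t) †

Δ* : ∀ {s} → Vec ℤ s → (ℤ → ℚ[i]) → ℤ → ℚ[i]
Δ* []       f = f
Δ* (t ∷ ts) f = Δ* ts (Δ t f)

⊗-UnitBounded : ∀ {x y} → normSq x ≤ 1ℚ → normSq y ≤ 1ℚ → normSq (x ⊗ y) ≤ 1ℚ
⊗-UnitBounded {x} {y} hx hy = subst (_≤ 1ℚ) (sym (normSq-⊗ x y))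
  (mono* (normSq-nn x) (normSq-nn y) hx hy)

†-UnitBounded : ∀ {x} → normSq x ≤ 1ℚ → normSq (x †) ≤ 1ℚ
†-UnitBounded {x} = subst (_≤ 1ℚ) (sym (normSq-† x))

Δ-UnitBounded : ∀ t {f} → UnitBounded f → UnitBounded (Δ t f)
Δ-UnitBounded t {f} h x =
  ⊗-UnitBounded {f x} {f (x ℤ.+ t) †} (h x) (†-UnitBounded {f (x ℤ.+ t)} (h (x ℤ.+ t)))

Δ-Supported : ∀ {M} t {f} → Supported M f → Supported M (Δ t f)
Δ-Supported t {f} h x ¬p = trans (cong (_⊗ f (x ℤ.+ t) †) (h x ¬p)) (⊗-zeroˡ _)

Δ*-UnitBounded : ∀ {s} (ts : Vec ℤ s) {f} → UnitBounded f → UnitBounded (Δ* ts f)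
Δ*-UnitBounded []       h = h
Δ*-UnitBounded (t ∷ ts) {f} h = Δ*-UnitBounded ts {Δ t f} (Δ-UnitBounded t {f} h)

Δ*-Supported : ∀ {s M} (ts : Vec ℤ s) {f} → Supported M f → Supported M (Δ* ts f)
Δ*-Supported []       h = h
Δ*-Supported (t ∷ ts) h = Δ*-Supported ts (Δ-Supported t h)

Δ*-cong : ∀ {s} (ts : Vec ℤ s) {f g} → (∀ x → f x ≡ g x) → ∀ x → Δ* ts f x ≡ Δ* ts g x
Δ*-cong []       h x = h x
Δ*-cong (t ∷ ts) h x = Δ*-cong ts (λ y → cong₂ _⊗_ (h y) (cong _† (h (y ℤ.+ t)))) x

module _ where
  open ℤ-Solver.+-*-Solver

  Δ-comm : ∀ s t f x → Δ s (Δ t f) x ≡ Δ t (Δ s f) x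
  Δ-comm s t f x = trans
    (trans (cong (λ u → f x ⊗ f (x ℤ.+ t) † ⊗ u) (†-⊗ _ _))
      (trans (swap (f x) (f (x ℤ.+ t) †) (f (x ℤ.+ s) †) (f (x ℤ.+ s ℤ.+ t) † †))
        (cong (λ u → f x ⊗ f (x ℤ.+ s) † ⊗ (f (x ℤ.+ t) † ⊗ f u † †))
          (solve 3 (λ x s t → x :+ s :+ t := x :+ t :+ s) refl x s t))))
    (sym (cong (λ u → f x ⊗ f (x ℤ.+ s) † ⊗ u) (†-⊗ _ _)))
    where
    swap : ∀ a b c d → a ⊗ b ⊗ (c ⊗ d) ≡ a ⊗ c ⊗ (b ⊗ d)
    swap a b c d = ℚ[i]-Solver.solve 4 (λ a b c d → a R.:* b R.:* (c R.:* d) R.:= a R.:* c R.:* (b R.:* d))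
      refl a b c d
      where module R = ℚ[i]-Solver

  -- Any chosen direction can thus be applied last, where it appears as the correlation of `Δ* ts f`
  -- with its own translate.
  Δ*-Δ : ∀ {s} (ts : Vec ℤ s) t f x → Δ* ts (Δ t f) x ≡ Δ t (Δ* ts f) x
  Δ*-Δ []       t f x = refl
  Δ*-Δ (u ∷ ts) t f x = trans (Δ*-cong ts (Δ-comm u t f) x) (Δ*-Δ ts t (Δ u f) x)

max-bound : {A : Set} (xs : List A) (c : A → ℕ) → ∃ λ C → ∀ {x} → x ∈ xs → c x ℕ.≤ C
max-bound []       c = 0 , λ ()
max-bound (x ∷ xs) c = let C , h = max-bound xs c in c x ℕ.⊔ C , λ where
  (here refl) → ℕ.m≤m⊔n (c x) C
  (there x∈)  → ℕ.≤-trans (h x∈) (ℕ.m≤n⊔m (c x) C)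

module _ {M N : ℕ} (M≤N : M ℕ.≤ N) where

  private
    I = window N
  open ℤ-Solver.+-*-Solver

  -- Substituting y = x + cⱼ makes φ independent of j, so that Cauchy–Schwarz
  -- in y removes it.
  cauchy-schwarz-shift : {J : Set} (js : List J) (c : J → ℤ) (φ : ℤ → ℚ[i]) (G : J → ℤ → ℚ[i]) →
    Supported M φ → UnitBounded φ → (∀ j → Supported M (G j)) →
    normSq (∑ᵍ js λ j → ∑ᵍ I λ x → φ (x ℤ.+ c j) ⊗ G j x) ≤
    ι (length I) * Re (∑ᵍ js λ i → ∑ᵍ js λ j → ∑ᵍ I λ x → G i x ⊗ G j (x ℤ.+ (c i ℤ.- c j)) †)
  cauchy-schwarz-shift js c φ G φ-supp φ-bdd G-supp = ℚ.≤-trans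
    (ℚ.≤-reflexive (cong normSq moved))
    (ℚ.≤-trans (cauchy-schwarz Y φ S)
      (ℚ.≤-trans
        (*-monoʳ (∑ Y (normSq ∘ S)) (∑-nn Y λ y → normSq-nn (S y)) φ-mass)
        (ℚ.≤-reflexive (cong (λ t → ι (length I) * t) correlation))))
    where
    C = proj₁ (max-bound js λ j → ℤ.∣ c j ∣)
    C-bound = proj₂ (max-bound js λ j → ℤ.∣ c j ∣)
    Y = window (M ℕ.+ C)
    S : ℤ → ℚ[i]
    S y = ∑ᵍ js λ j → G j (y ℤ.+ ℤ.- c j)

    M+c≤ : ∀ {j} → j ∈ js → M ℕ.+ ℤ.∣ ℤ.- c j ∣ ℕ.≤ M ℕ.+ C
    M+c≤ {j} j∈ = ℕ.+-monoʳ-≤ M (subst (ℕ._≤ C) (sym (ℤ.∣-i∣≡∣i∣ (c j))) (C-bound j∈))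

    shift-back : ∀ {j} → j ∈ js → (∑ᵍ I λ x → φ (x ℤ.+ c j) ⊗ G j x) ≡ ∑ᵍ Y λ y → φ y ⊗ G j (y ℤ.+ ℤ.- c j)
    shift-back {j} j∈ = sym (trans
      (∑ᵍ.∑-cong Y λ y → cong (λ u → φ u ⊗ G j (y ℤ.+ ℤ.- c j))
        (solve 2 (λ y c → y := y :+ :- c :+ c) refl y (c j)))
      (∑ᵍ-shift (ℤ.- c j) (λ x → φ (x ℤ.+ c j) ⊗ G j x)
        (λ z ¬p → trans (cong (φ (z ℤ.+ c j) ⊗_) (G-supp j z ¬p)) (⊗-zeroʳ _)) M≤N (M+c≤ j∈)))

    moved : (∑ᵍ js λ j → ∑ᵍ I λ x → φ (x ℤ.+ c j) ⊗ G j x) ≡ ∑ᵍ Y λ y → φ y ⊗ S y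
    moved = trans (∑ᵍ.∑-cong∈ js shift-back)
      (trans (∑ᵍ.∑-swap js Y _) (∑ᵍ.∑-cong Y λ y → sym (∑ᵍ.∑-*ˡ (φ y) js _)))

    -- `Y` may be much longer than `I`, since `C` depends on the shifts; `φ` vanishes beyond M, so
    -- only the length of `I` is paid for.
    φ-mass : ∑ Y (normSq ∘ φ) ≤ ι (length I)
    φ-mass = ℚ.≤-trans
      (ℚ.≤-reflexive (trans
        (∑-cong Y λ y → cong (normSq ∘ φ) (sym (ℤ.+-identityʳ y)))
        (∑-shift (+ 0) (normSq ∘ φ) (λ z ¬p → cong normSq (φ-supp z ¬p)) M≤N
          (ℕ.+-monoʳ-≤ M z≤n))))
      (ℚ.≤-trans (∑-≤-const I 1ℚ φ-bdd) (ℚ.≤-reflexive (ℚ.*-identityʳ _)))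

    pair : ∀ i j → i ∈ js →
      (∑ᵍ Y λ y → G i (y ℤ.+ ℤ.- c i) ⊗ G j (y ℤ.+ ℤ.- c j) †) ≡
      (∑ᵍ I λ x → G i x ⊗ G j (x ℤ.+ (c i ℤ.- c j)) †)
    pair i j i∈ = trans
      (∑ᵍ.∑-cong Y λ y → cong (λ u → G i (y ℤ.+ ℤ.- c i) ⊗ G j u †)
        (solve 3 (λ y a b → y :+ :- b := (y :+ :- a) :+ (a :- b)) refl y (c i) (c j)))
      (∑ᵍ-shift (ℤ.- c i) (λ x → G i x ⊗ G j (x ℤ.+ (c i ℤ.- c j)) †)
        (λ z ¬p → trans (cong (_⊗ G j (z ℤ.+ (c i ℤ.- c j)) †) (G-supp i z ¬p)) (⊗-zeroˡ _))
        M≤N (M+c≤ i∈))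

    correlation : ∑ Y (normSq ∘ S) ≡
      Re (∑ᵍ js λ i → ∑ᵍ js λ j → ∑ᵍ I λ x → G i x ⊗ G j (x ℤ.+ (c i ℤ.- c j)) †)
    correlation = trans (∑-cong Y λ y → sym (Re-⊗† (S y)))
      (trans (sym (Re-∑ Y λ y → S y ⊗ S y †)) (cong Re (trans
        (∑ᵍ.∑-cong Y λ y → trans (cong (S y ⊗_) (†-∑ js _)) (∑ᵍ.∑*∑ js js _ _))
        (trans (∑ᵍ.∑-swap Y js _) (∑ᵍ.∑-cong∈ js λ {i} i∈ →
          trans (∑ᵍ.∑-swap Y js _) (∑ᵍ.∑-cong js λ j → pair i j i∈))))))

-- The generalised von Neumann inequality

vecs : {A : Set} → List A → (s : ℕ) → List (Vec A s)
vecs xs zero    = [] ∷ []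
vecs xs (suc s) = cartesianProductWith _∷_ xs (vecs xs s)

∑-vecs : {A : Set} (xs : List A) (s : ℕ) (F : Vec A (suc s) → ℚ) →
  ∑ (vecs xs (suc s)) F ≡ ∑ xs λ x → ∑ (vecs xs s) λ v → F (x ∷ v)
∑-vecs xs s F = ∑-product _∷_ xs (vecs xs s) F

∑ᵍ-vecs : {A : Set} (xs : List A) (s : ℕ) (F : Vec A (suc s) → ℚ[i]) →
  ∑ᵍ (vecs xs (suc s)) F ≡ ∑ᵍ xs λ x → ∑ᵍ (vecs xs s) λ v → F (x ∷ v)
∑ᵍ-vecs xs s F = ∑ᵍ.∑-product _∷_ xs (vecs xs s) F

∏ : ∀ {s} → (Fin s → ℚ[i]) → ℚ[i]
∏ {zero}  F = 1ᵍ
∏ {suc s} F = F zero ⊗ ∏ (F ∘ suc)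

∏-cong : ∀ {s} {F G : Fin s → ℚ[i]} → (∀ j → F j ≡ G j) → ∏ F ≡ ∏ G
∏-cong {zero}  h = refl
∏-cong {suc s} h = cong₂ _⊗_ (h zero) (∏-cong (h ∘ suc))

⊗-interchange : ∀ a b c d → (a ⊗ b) ⊗ (c ⊗ d) ≡ (a ⊗ c) ⊗ (b ⊗ d)
⊗-interchange = solve 4 (λ a b c d → (a :* b) :* (c :* d) := (a :* c) :* (b :* d)) refl
  where open ℚ[i]-Solver

∏-⊗† : ∀ {s} (F G : Fin s → ℚ[i]) → ∏ F ⊗ (∏ G) † ≡ ∏ λ j → F j ⊗ G j †
∏-⊗† {zero}  F G = ⊗-identityˡ _
∏-⊗† {suc s} F G = trans (cong (∏ F ⊗_) (†-⊗ (G zero) (∏ (G ∘ suc))))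
  (trans (⊗-interchange (F zero) (∏ (F ∘ suc)) (G zero †) (∏ (G ∘ suc) †))
    (cong (F zero ⊗ G zero † ⊗_) (∏-⊗† (F ∘ suc) (G ∘ suc))))

∏-UnitBounded : ∀ {s} (F : Fin s → ℚ[i]) → UnitBounded F → normSq (∏ F) ≤ 1ℚ
∏-UnitBounded {zero}  F h = ℚ.≤-refl
∏-UnitBounded {suc s} F h = ⊗-UnitBounded {F zero} {∏ (F ∘ suc)} (h zero) (∏-UnitBounded (F ∘ suc) (h ∘ suc))

steps : ∀ {s} → Vec ℤ s → Vec ℤ s → Vec ℤ s
steps = Vec.zipWith λ d n → ℤ.- (d ℤ.* n)

-- Here `a` and `b` bound the normalised lengths of the windows for x and for a difference variable
-- n. A step costs (a²b)^(2^r) for its Cauchy-Schwarz and b^(2^r - 1) for moving the power inside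
-- the average over n.
vonNeumannConst : ℚ → ℚ → ℕ → ℚ
vonNeumannConst a b zero    = a
vonNeumannConst a b (suc r) = tower r (sq a * b) * meanConst r b * vonNeumannConst a b r

module VonNeumann {M N : ℕ} (M≤N : M ℕ.≤ N) (H : ℕ) where

  private
    I = window N
    𝓜 = window H
    𝓝 = window (H ℕ.+ H)

  -- The count for one vector b after translating x by bᵢm: `g` is evaluated at x itself and `ds`
  -- holds the differences bⱼ - bᵢ. The weight `lam` begins as the indicator of [H] and turns into
  -- its own derivatives.
  progressionSum : ∀ {s} → (ℤ → ℚ[i]) → (ℤ → ℚ[i]) → Vec ℤ s → (Fin s → ℤ → ℚ[i]) → ℚ[i]
  progressionSum lam g ds φ =
    ∑ᵍ 𝓜 λ m → lam m ⊗ ∑ᵍ I λ x → g x ⊗ ∏ λ j → φ j (x ℤ.+ Vec.lookup ds j ℤ.* m)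

  Δφ : ∀ {s} → ℤ → Vec ℤ s → (Fin s → ℤ → ℚ[i]) → ℤ → Fin s → ℤ → ℚ[i]
  Δφ d ds φ n j = Δ ((Vec.lookup ds j ℤ.- d) ℤ.* n) (φ j)

  Δλ : (ℤ → ℚ[i]) → ℤ → ℤ → ℚ[i]
  Δλ lam n m = lam m ⊗ lam (n ℤ.+ m) †

  private
    open ℤ-Solver.+-*-Solver using (solve; _:=_; _:+_; _:*_; _:-_; :-_)

    -- With m′ = n + m the shift dm - dm′ is -dn, and the argument of φⱼ moves by (eⱼ - d)n. A pair
    -- correlation is therefore again the integrand of a progression sum, with every function
    -- differentiated once.
    correlate : ∀ {s} lam g d (ds : Vec ℤ s) φ x m n →
      let G = λ m x → lam m ⊗ (g x ⊗ ∏ λ j → φ j (x ℤ.+ Vec.lookup ds j ℤ.* m)) in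
      G m x ⊗ G (n ℤ.+ m) (x ℤ.+ (d ℤ.* m ℤ.- d ℤ.* (n ℤ.+ m))) † ≡
      Δλ lam n m ⊗ (Δ (ℤ.- (d ℤ.* n)) g x ⊗ ∏ λ j → Δφ d ds φ n j (x ℤ.+ Vec.lookup ds j ℤ.* m))
    correlate lam g d ds φ x m n = trans
      (cong (lam m ⊗ (g x ⊗ P) ⊗_) (trans (†-⊗ (lam (n ℤ.+ m)) (g x′ ⊗ P′)) (cong (lam (n ℤ.+ m) † ⊗_) (†-⊗ (g x′) P′))))
      (trans (⊗-interchange (lam m) (g x ⊗ P) (lam (n ℤ.+ m) †) (g x′ † ⊗ P′ †))
        (cong (Δλ lam n m ⊗_) (trans (⊗-interchange (g x) P (g x′ †) (P′ †))
          (cong₂ _⊗_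
            (cong (λ u → g x ⊗ g u †) (solve 4 (λ x d m n →
              x :+ (d :* m :- d :* (n :+ m)) := x :+ :- (d :* n)) refl x d m n))
            (trans (∏-⊗† (λ j → φ j (x ℤ.+ Vec.lookup ds j ℤ.* m)) (λ j → φ j (x′ ℤ.+ Vec.lookup ds j ℤ.* (n ℤ.+ m))))
              (∏-cong λ j → cong (λ u → φ j (x ℤ.+ Vec.lookup ds j ℤ.* m) ⊗ φ j u †)
                (solve 5 (λ x d m n e →
                  (x :+ (d :* m :- d :* (n :+ m))) :+ e :* (n :+ m)
                  := (x :+ e :* m) :+ (e :- d) :* n) refl x d m n (Vec.lookup ds j))))))))
      where
      x′ = x ℤ.+ (d ℤ.* m ℤ.- d ℤ.* (n ℤ.+ m))
      P  = ∏ λ j → φ j (x ℤ.+ Vec.lookup ds j ℤ.* m)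
      P′ = ∏ λ j → φ j (x′ ℤ.+ Vec.lookup ds j ℤ.* (n ℤ.+ m))

  -- Cauchy-Schwarz in y = x + dm discards `φ zero`. The difference n = m′ - m of the two copies of
  -- m remains as a parameter with |n| ≤ 2H, and the other functions form a shorter progression.
  vanDerCorput : ∀ {s} lam g d (ds : Vec ℤ s) φ → Supported H lam → Supported M g →
    Supported M (φ zero) → UnitBounded (φ zero) →
    normSq (progressionSum lam g (d ∷ ds) φ) ≤ ι (length I) *
      Re (∑ᵍ 𝓝 λ n → progressionSum (Δλ lam n) (Δ (ℤ.- (d ℤ.* n)) g) ds (Δφ d ds (φ ∘ suc) n))
  vanDerCorput {s} lam g d ds φ lam-supp g-supp φ-supp φ-bdd =
    subst₂ (λ a b → normSq a ≤ ι (length I) * Re b) front back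
      (cauchy-schwarz-shift M≤N 𝓜 (λ m → d ℤ.* m) (φ zero) G φ-supp φ-bdd G-supp)
    where
    G : ℤ → ℤ → ℚ[i]
    G m x = lam m ⊗ (g x ⊗ ∏ λ j → φ (suc j) (x ℤ.+ Vec.lookup ds j ℤ.* m))
    G-supp : ∀ m → Supported M (G m)
    G-supp m x ¬p = trans (cong (λ u → lam m ⊗ u) (trans (cong (_⊗ _) (g-supp x ¬p)) (⊗-zeroˡ _))) (⊗-zeroʳ _)

    front : (∑ᵍ 𝓜 λ m → ∑ᵍ I λ x → φ zero (x ℤ.+ d ℤ.* m) ⊗ G m x) ≡ progressionSum lam g (d ∷ ds) φ
    front = ∑ᵍ.∑-cong 𝓜 λ m → trans
      (∑ᵍ.∑-cong I λ x → rearrange (φ zero (x ℤ.+ d ℤ.* m)) (lam m) (g x) _)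
      (sym (∑ᵍ.∑-*ˡ (lam m) I _))
      where
      rearrange : ∀ a b c e → a ⊗ (b ⊗ (c ⊗ e)) ≡ b ⊗ (c ⊗ (a ⊗ e))
      rearrange = R.solve 4 (λ a b c e → a R.:* (b R.:* (c R.:* e)) R.:= b R.:* (c R.:* (a R.:* e))) refl
        where module R = ℚ[i]-Solver

    C : ℤ → ℤ → ℚ[i]
    C m m′ = ∑ᵍ I λ x → G m x ⊗ G m′ (x ℤ.+ (d ℤ.* m ℤ.- d ℤ.* m′)) †
    C-supp : ∀ m → Supported H (C m)
    C-supp m m′ ¬p = ∑ᵍ.∑-zero I λ x → let
        y = x ℤ.+ (d ℤ.* m ℤ.- d ℤ.* m′)
        P = λ y → ∏ λ j → φ (suc j) (y ℤ.+ Vec.lookup ds j ℤ.* m′)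
      in trans (cong (λ u → G m x ⊗ u †) (trans (cong (_⊗ (g y ⊗ P y)) (lam-supp m′ ¬p)) (⊗-zeroˡ _))) (⊗-zeroʳ _)

    back : (∑ᵍ 𝓜 λ m → ∑ᵍ 𝓜 (C m)) ≡
      ∑ᵍ 𝓝 λ n → progressionSum (Δλ lam n) (Δ (ℤ.- (d ℤ.* n)) g) ds (Δφ d ds (φ ∘ suc) n)
    back = trans
      (∑ᵍ.∑-cong∈ 𝓜 λ {m} m∈ → sym (∑ᵍ-shift m (C m) (C-supp m) ℕ.≤-refl
        (ℕ.+-monoʳ-≤ H (∈-window⁻ m∈))))
      (trans (∑ᵍ.∑-swap 𝓜 𝓝 _) (∑ᵍ.∑-cong 𝓝 λ n → ∑ᵍ.∑-cong 𝓜 λ m → trans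
        (∑ᵍ.∑-cong I λ x → correlate lam g d ds (φ ∘ suc) x m n)
        (sym (∑ᵍ.∑-*ˡ (Δλ lam n m) I _))))

  Δλ-Supported : ∀ {lam} n → Supported H lam → Supported H (Δλ lam n)
  Δλ-Supported {lam} n h m ¬p = trans (cong (_⊗ lam (n ℤ.+ m) †) (h m ¬p)) (⊗-zeroˡ _)

  Δλ-UnitBounded : ∀ {lam} n → UnitBounded lam → UnitBounded (Δλ lam n)
  Δλ-UnitBounded {lam} n h m =
    ⊗-UnitBounded {lam m} {lam (n ℤ.+ m) †} (h m) (†-UnitBounded {lam (n ℤ.+ m)} (h (n ℤ.+ m)))

  boxSum : ∀ {s} → (Vec ℤ s → ℚ[i]) → (ℤ → ℚ[i]) → Vec ℤ s → ℚ[i]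
  boxSum {s} Λ g ds = ∑ᵍ (vecs 𝓝 s) λ ns → Λ ns ⊗ ∑ᵍ I (Δ* (steps ds ns) g)

  module _ {v w a b : ℚ} (0≤v : 0ℚ ≤ v) (0≤w : 0ℚ ≤ w) (0≤a : 0ℚ ≤ a) (0≤b : 0ℚ ≤ b)
    (wI≤a : w * ι (length I) ≤ a) (v𝓝≤b : v * ι (length 𝓝) ≤ b) where

    private
      rescale : ∀ {X Y} → 0ℚ ≤ X → X ≤ ι (length I) * Y → X * w ≤ a * Y
      rescale {X} {Y} 0≤X h = ℚ.≤-trans (*-monoʳ w 0≤w h)
        (ℚ.≤-trans (ℚ.≤-reflexive (Q.solve 3 (λ l y w → l Q.:* y Q.:* w Q.:= w Q.:* l Q.:* y) refl (ι (length I)) Y w))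
          (*-monoʳ Y 0≤Y wI≤a))
        where
        module Q = ℚ-Solver.+-*-Solver
        0≤Y : 0ℚ ≤ Y
        0≤Y = ℚ.*-cancelˡ-≤-pos (ι (length I))
          {{ℚ.positive (subst (λ l → 0ℚ < ι l) (sym (length-window N)) (0<ι (N ℕ.+ N)))}}
          (subst (_≤ ι (length I) * Y) (sym (ℚ.*-zeroʳ (ι (length I)))) (ℚ.≤-trans 0≤X h))

    -- Induction on the number of functions. With `v` = 1/H and `w` = 1/M both sides are averages:
    -- the r + 2 factors `v` belong to the r + 1 difference variables and to the sum over m hidden
    -- in `Λ`. Of `Λ` only its size is needed later, so it is produced existentially.
    vonNeumann : ∀ r lam g (ds : Vec ℤ (suc r)) φ → Supported H lam → UnitBounded lam → Supported M g →
      (∀ j → Supported M (φ j)) → (∀ j → UnitBounded (φ j)) →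
      ∃ λ (Λ : Vec ℤ (suc r) → ℚ[i]) → (∀ ns → normSq (Λ ns) ≤ sq (ι (length 𝓜))) ×
        tower r (normSq (progressionSum lam g ds φ) * sq (v * w)) ≤
        vonNeumannConst a b r * (v ^ℚ suc (suc r) * w * Re (boxSum Λ g ds))
    vonNeumann zero lam g (d ∷ []) φ lam-supp lam-bdd g-supp φ-supp φ-bdd = Λ , Λ-bdd , (begin
      normSq S * sq (v * w)                  ≡⟨ Q.solve 3 (λ s v w → s Q.:* ((v Q.:* w) Q.:* (v Q.:* w))
                  Q.:= s Q.:* w Q.:* (v Q.:* v Q.:* w)) refl (normSq S) v w ⟩
      normSq S * w * (v * v * w)             ≤⟨ *-monoʳ (v * v * w) (nn* (nn* 0≤v 0≤v) 0≤w)
                  (rescale (normSq-nn S)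
                    (vanDerCorput lam g d [] φ lam-supp g-supp (φ-supp zero) (φ-bdd zero))) ⟩
      a * Re (∑ᵍ 𝓝 S′) * (v * v * w)         ≡⟨ cong (λ t → a * Re t * (v * v * w)) final ⟩
      a * Re (boxSum Λ g (d ∷ [])) * (v * v * w)
                  ≡⟨ Q.solve 4 (λ a s v w → a Q.:* s Q.:* (v Q.:* v Q.:* w)
                       Q.:= a Q.:* ((v Q.:* (v Q.:* Q.con 1ℚ)) Q.:* w Q.:* s)) refl a (Re (boxSum Λ g (d ∷ []))) v w ⟩
      a * (v ^ℚ 2 * w * Re (boxSum Λ g (d ∷ []))) ∎)
      where
      open ℚ.≤-Reasoning
      module Q = ℚ-Solver.+-*-Solver
      S = progressionSum lam g (d ∷ []) φ
      S′ : ℤ → ℚ[i]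
      S′ n = progressionSum (Δλ lam n) (Δ (ℤ.- (d ℤ.* n)) g) [] (Δφ d [] (φ ∘ suc) n)
      Λ : Vec ℤ 1 → ℚ[i]
      Λ (n ∷ []) = ∑ᵍ 𝓜 (Δλ lam n)
      Λ-bdd : ∀ ns → normSq (Λ ns) ≤ sq (ι (length 𝓜))
      Λ-bdd (n ∷ []) = ℚ.≤-trans (normSq-∑ 𝓜 (Δλ lam n))
        (*-monoˡ (ι (length 𝓜)) (0≤ι (length 𝓜))
          (ℚ.≤-trans (∑-≤-const 𝓜 1ℚ (Δλ-UnitBounded {lam} n lam-bdd)) (ℚ.≤-reflexive (ℚ.*-identityʳ (ι (length 𝓜))))))
      final : ∑ᵍ 𝓝 S′ ≡ boxSum Λ g (d ∷ [])
      final = sym (trans (∑ᵍ-vecs 𝓝 0 _) (∑ᵍ.∑-cong 𝓝 λ n → trans (⊕-identityʳ _)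
        (trans (∑ᵍ.∑-*ʳ _ 𝓜 (Δλ lam n)) (∑ᵍ.∑-cong 𝓜 λ m → cong (Δλ lam n m ⊗_)
          (∑ᵍ.∑-cong I λ x → sym (trans (⊗-comm _ 1ᵍ) (⊗-identityˡ _)))))))

    vonNeumann (suc r) lam g (d ∷ ds) φ lam-supp lam-bdd g-supp φ-supp φ-bdd = Λ , Λ-bdd , (begin
      tower r (sq (normSq S * sq (v * w)))                 ≤⟨ tower-mono r (sq-nn (normSq S * sq (v * w))) square ⟩
      tower r (sq a * b * (v * ∑ 𝓝 X))                     ≡⟨ tower-* r (sq a * b) (v * ∑ 𝓝 X) ⟩
      tower r (sq a * b) * tower r (v * ∑ 𝓝 X)             ≤⟨ *-monoˡ (tower r (sq a * b))
                  (tower-nn r (nn* (nn* 0≤a 0≤a) 0≤b))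
                  (power-mean 0≤v 0≤b r 𝓝 X v𝓝≤b X-nn) ⟩
      tower r (sq a * b) * (meanConst r b * (v * ∑ 𝓝 (tower r ∘ X)))
                  ≤⟨ *-monoˡ (tower r (sq a * b))
                       (tower-nn r (nn* (nn* 0≤a 0≤a) 0≤b))
                       (*-monoˡ (meanConst r b) (meanConst-nn r 0≤b)
                         (*-monoˡ v 0≤v
                           (∑-mono 𝓝 λ n → proj₂ (proj₂ (IH n))))) ⟩
      tower r (sq a * b) * (meanConst r b * (v * ∑ 𝓝 λ n → K * (v ^ℚ suc (suc r) * w * Re (Y n))))
                  ≡⟨ collect ⟩
      vonNeumannConst a b (suc r) * (v ^ℚ suc (suc (suc r)) * w * Re (boxSum Λ g (d ∷ ds))) ∎)
      where
      open ℚ.≤-Reasoning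
      module Q = ℚ-Solver.+-*-Solver
      K = vonNeumannConst a b r
      S = progressionSum lam g (d ∷ ds) φ
      S′ : ℤ → ℚ[i]
      S′ n = progressionSum (Δλ lam n) (Δ (ℤ.- (d ℤ.* n)) g) ds (Δφ d ds (φ ∘ suc) n)
      X : ℤ → ℚ
      X n = normSq (S′ n) * sq (v * w)
      X-nn : ∀ n → 0ℚ ≤ X n
      X-nn n = nn* (normSq-nn (S′ n)) (sq-nn (v * w))
      IH : ∀ n → _
      IH n = vonNeumann r (Δλ lam n) (Δ (ℤ.- (d ℤ.* n)) g) ds (Δφ d ds (φ ∘ suc) n)
        (Δλ-Supported {lam} n lam-supp) (Δλ-UnitBounded {lam} n lam-bdd) (Δ-Supported _ {g} g-supp)
        (λ j → Δ-Supported _ {φ (suc j)} (φ-supp (suc j))) (λ j → Δ-UnitBounded _ {φ (suc j)} (φ-bdd (suc j)))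
      Λ : Vec ℤ (suc (suc r)) → ℚ[i]
      Λ (n ∷ ns) = proj₁ (IH n) ns
      Λ-bdd : ∀ ns → normSq (Λ ns) ≤ sq (ι (length 𝓜))
      Λ-bdd (n ∷ ns) = proj₁ (proj₂ (IH n)) ns
      Y : ℤ → ℚ[i]
      Y n = boxSum (proj₁ (IH n)) (Δ (ℤ.- (d ℤ.* n)) g) ds

      first : normSq S * w ≤ a * Re (∑ᵍ 𝓝 S′)
      first = rescale (normSq-nn S)
        (vanDerCorput lam g d ds φ lam-supp g-supp (φ-supp zero) (φ-bdd zero))
      square : sq (normSq S * sq (v * w)) ≤ sq a * b * (v * ∑ 𝓝 X)
      square = begin
        sq (normSq S * sq (v * w))            ≡⟨ Q.solve 3 (λ s v w →
                  (s Q.:* ((v Q.:* w) Q.:* (v Q.:* w))) Q.:* (s Q.:* ((v Q.:* w) Q.:* (v Q.:* w)))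
                  Q.:= (s Q.:* w) Q.:* (s Q.:* w) Q.:* (v Q.:* v Q.:* ((v Q.:* w) Q.:* (v Q.:* w))))
                  refl (normSq S) v w ⟩
        sq (normSq S * w) * (v * v * sq (v * w))
                  ≤⟨ *-monoʳ (v * v * sq (v * w)) nn
                       (sq-mono (nn* (normSq-nn S) 0≤w) first) ⟩
        sq (a * Re (∑ᵍ 𝓝 S′)) * (v * v * sq (v * w))
                  ≡⟨ Q.solve 4 (λ a z v u → (a Q.:* z) Q.:* (a Q.:* z) Q.:* (v Q.:* v Q.:* u)
                       Q.:= a Q.:* a Q.:* (v Q.:* v Q.:* u) Q.:* (z Q.:* z)) refl a (Re (∑ᵍ 𝓝 S′)) v (sq (v * w)) ⟩
        sq a * (v * v * sq (v * w)) * sq (Re (∑ᵍ 𝓝 S′))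
                  ≤⟨ *-monoˡ (sq a * (v * v * sq (v * w))) (nn* (nn* 0≤a 0≤a) nn)
                       (ℚ.≤-trans (Re²≤normSq (∑ᵍ 𝓝 S′)) (normSq-∑ 𝓝 S′)) ⟩
        sq a * (v * v * sq (v * w)) * (ι (length 𝓝) * ∑ 𝓝 (normSq ∘ S′))
                  ≡⟨ Q.solve 5 (λ A v u l s → A Q.:* (v Q.:* v Q.:* u) Q.:* (l Q.:* s)
                       Q.:= A Q.:* (v Q.:* l) Q.:* (v Q.:* (s Q.:* u)))
                       refl (sq a) v (sq (v * w)) (ι (length 𝓝)) (∑ 𝓝 (normSq ∘ S′)) ⟩
        sq a * (v * ι (length 𝓝)) * (v * (∑ 𝓝 (normSq ∘ S′) * sq (v * w)))
                  ≡⟨ cong (λ t → sq a * (v * ι (length 𝓝)) * (v * t)) (∑-*ʳ (sq (v * w)) 𝓝 (normSq ∘ S′)) ⟩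
        sq a * (v * ι (length 𝓝)) * (v * ∑ 𝓝 X)
                  ≤⟨ *-monoʳ (v * ∑ 𝓝 X) (nn* 0≤v (∑-nn 𝓝 X-nn))
                       (*-monoˡ (sq a) (nn* 0≤a 0≤a) v𝓝≤b) ⟩
        sq a * b * (v * ∑ 𝓝 X)                ∎
        where
        nn = nn* (nn* 0≤v 0≤v) (sq-nn (v * w))

      collect : tower r (sq a * b) * (meanConst r b * (v * ∑ 𝓝 λ n → K * (v ^ℚ suc (suc r) * w * Re (Y n))))
        ≡ vonNeumannConst a b (suc r) * (v ^ℚ suc (suc (suc r)) * w * Re (boxSum Λ g (d ∷ ds)))
      collect = trans
        (cong (λ t → tower r (sq a * b) * (meanConst r b * (v * t))) (trans
          (sym (∑-*ˡ K 𝓝 _)) (cong (λ t → K * t) (trans (sym (∑-*ˡ (v ^ℚ suc (suc r) * w) 𝓝 (Re ∘ Y)))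
            (cong (λ t → v ^ℚ suc (suc r) * w * t) (trans (sym (Re-∑ 𝓝 Y)) (cong Re (sym (∑ᵍ-vecs 𝓝 (suc r) _)))))))))
        (Q.solve 7 (λ t m v k p w y → t Q.:* (m Q.:* (v Q.:* (k Q.:* (p Q.:* w Q.:* y))))
          Q.:= t Q.:* m Q.:* k Q.:* (v Q.:* p Q.:* w Q.:* y)) refl
          (tower r (sq a * b)) (meanConst r b) v K (v ^ℚ suc (suc r)) w (Re (boxSum Λ g (d ∷ ds))))

-- Gowers norms control averages over box derivatives

∑ᵍ-⟦⟧ : {P : Set} (d : Dec P) → ∑ᵍ.⟦ d ⟧ ≡ real ⟦ d ⟧
∑ᵍ-⟦⟧ (yes _) = refl
∑ᵍ-⟦⟧ (no _)  = refl

ι-length : {A : Set} (xs : List A) → ι (length xs) ≡ ∑ xs (const 1ℚ)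
ι-length xs = trans (sym (ℚ.*-identityʳ _)) (sym (∑-const xs 1ℚ))

ι-length-vecs : {A : Set} (xs : List A) → ∀ s → ι (length (vecs xs (suc s))) ≡ ι (length xs) * ι (length (vecs xs s))
ι-length-vecs xs s = trans (ι-length (vecs xs (suc s))) (trans (∑-vecs xs s (const 1ℚ))
  (trans (∑-cong xs λ _ → sym (ι-length (vecs xs s))) (∑-const xs _)))

length-vecs-≤ : {A : Set} {w α : ℚ} (xs : List A) → 0ℚ ≤ w → w * ι (length xs) ≤ α → ∀ s →
  w ^ℚ s * ι (length (vecs xs s)) ≤ α ^ℚ s
length-vecs-≤ xs 0≤w h zero    = ℚ.≤-refl
length-vecs-≤ {w = w} {α} xs 0≤w h (suc s) = ℚ.≤-trans
  (ℚ.≤-reflexive (trans (cong (λ t → w * w ^ℚ s * t) (ι-length-vecs xs s))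
    (solve 4 (λ w p l q → w :* p :* (l :* q) := w :* l :* (p :* q)) refl w (w ^ℚ s) (ι (length xs)) (ι (length (vecs xs s))))))
  (mono* (nn* 0≤w (0≤ι (length xs))) (nn* (^ℚ-nn 0≤w s) (0≤ι (length (vecs xs s)))) h (length-vecs-≤ xs 0≤w h s))
  where open ℚ-Solver.+-*-Solver

-- Here `a` and `α` bound the normalised lengths of the window and of the set of directions, and `ε`
-- bounds the normalised second moment of the multiplicity. Smoothing one direction contributes
-- (α^(2s) a² ε)^(2^s), averaging over t contributes a^(2^s - 1).
gowersConst : ℚ → ℚ → ℚ → ℕ → ℚ
gowersConst a α ε zero    = 1ℚ
gowersConst a α ε (suc s) = tower s (sq (α ^ℚ s) * sq a * ε) * meanConst s a * gowersConst a α ε s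

gowersConst-nn : ∀ {a α ε} → 0ℚ ≤ a → 0ℚ ≤ α → 0ℚ ≤ ε → ∀ s → 0ℚ ≤ gowersConst a α ε s
gowersConst-nn 0≤a 0≤α 0≤ε zero    = 0≤1
gowersConst-nn {a} {α} 0≤a 0≤α 0≤ε (suc s) =
  nn* (nn* (tower-nn s (nn* (nn* (sq-nn (α ^ℚ s)) (sq-nn a)) 0≤ε)) (meanConst-nn s 0≤a)) (gowersConst-nn 0≤a 0≤α 0≤ε s)

module _ {A : Set} (Ω : List A) (τ : A → ℤ) where

  multiplicity : ℤ → ℚ
  multiplicity t = ∑ (cartesianProduct Ω Ω) λ ω → ⟦ τ (proj₁ ω) ℤ.- τ (proj₂ ω) ℤ.≟ t ⟧

  multiplicity-nn : ∀ t → 0ℚ ≤ multiplicity t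
  multiplicity-nn t = ∑-nn (cartesianProduct Ω Ω) λ ω → 0≤⟦⟧ (τ (proj₁ ω) ℤ.- τ (proj₂ ω) ℤ.≟ t)

module Gowers {M N : ℕ} (2M≤N : M ℕ.+ M ℕ.≤ N) where

  private
    I = window N
    M≤N : M ℕ.≤ N
    M≤N = ℕ.≤-trans (ℕ.m≤m+n M M) 2M≤N

  -- The 2^s-th power of the unnormalised Gowers norm, in its inductive form. The hypothesis 2M ≤ N
  -- puts every difference of two points of the support into the window for t.
  U : ℕ → (ℤ → ℚ[i]) → ℚ[i]
  U zero    f = ∑ᵍ I f
  U (suc s) f = ∑ᵍ I λ t → U s (Δ t f)

  U1≡normSq : ∀ f → Supported M f → Re (U 1 f) ≡ normSq (∑ᵍ I f)
  U1≡normSq f f-supp = trans (cong Re factor) (Re-⊗† (∑ᵍ I f))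
    where
    at : ∀ x → Dec (ℤ.∣ x ∣ ℕ.≤ M) → f x ⊗ (∑ᵍ I λ t → f (x ℤ.+ t) †) ≡ f x ⊗ (∑ᵍ I f) †
    at x (yes h) = cong (f x ⊗_) (trans (sym (†-∑ I λ t → f (x ℤ.+ t))) (cong _†
      (trans (∑ᵍ.∑-cong I λ t → cong f (ℤ.+-comm x t))
        (∑ᵍ-shift x f f-supp M≤N (ℕ.≤-trans (ℕ.+-monoʳ-≤ M h) 2M≤N)))))
    at x (no ¬h) = trans (zero-left _) (sym (zero-left _))
      where
      zero-left : ∀ z → f x ⊗ z ≡ 0ᵍ
      zero-left z = trans (cong (_⊗ z) (f-supp x ¬h)) (⊗-zeroˡ z)
    factor : U 1 f ≡ ∑ᵍ I f ⊗ (∑ᵍ I f) †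
    factor = trans (∑ᵍ.∑-swap I I λ t x → f x ⊗ f (x ℤ.+ t) †)
      (trans (∑ᵍ.∑-cong I λ x → trans (sym (∑ᵍ.∑-*ˡ (f x) I _)) (at x (ℤ.∣ x ∣ ℕ.≤? M)))
        (sym (∑ᵍ.∑-*ʳ _ I f)))

  Re-U≤ : ∀ s {f} → UnitBounded f → Re (U s f) ≤ ι (length I) ^ℚ suc s
  Re-U≤ zero {f} h = subst₂ _≤_ (sym (Re-∑ I f)) refl
    (∑-≤-const I 1ℚ λ x → Re≤ (f x) 0≤1 (h x))
  Re-U≤ (suc s) {f} h = subst (_≤ ι (length I) ^ℚ suc (suc s)) (sym (Re-∑ I λ t → U s (Δ t f)))
    (∑-≤-const I _ λ t → Re-U≤ s (Δ-UnitBounded t {f} h))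

  module _ {A : Set} (Ω : List A) (τ : A → ℤ) where

    private
      Ω² = cartesianProduct Ω Ω
      τ² : A × A → ℤ
      τ² p = τ (proj₁ p) ℤ.- τ (proj₂ p)
      μ = multiplicity Ω τ

    derivSum : ∀ {s} → (Vec A s → ℚ[i]) → (ℤ → ℚ[i]) → ℚ[i]
    derivSum {s} wt f = ∑ᵍ (vecs Ω s) λ ω → wt ω ⊗ ∑ᵍ I (Δ* (Vec.map τ ω) f)

    -- Grouping the pairs (α , β) by t = τ α − τ β and averaging the weights in
    -- each group keeps them bounded by 1.
    module _ {s} (wt : Vec A (suc s) → ℚ[i]) (wt-bdd : UnitBounded wt) where

      groupedSum groupedWeight : ℤ → Vec A s → ℚ[i]
      groupedSum t ω = ∑ᵍ Ω² λ p → real ⟦ τ² p ℤ.≟ t ⟧ ⊗ (wt (proj₁ p ∷ ω) ⊗ wt (proj₂ p ∷ ω) †)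
      groupedWeight t ω = real (recip (μ t)) ⊗ groupedSum t ω

      private
        normSq-groupedSum : ∀ t ω → normSq (groupedSum t ω) ≤ sq (μ t)
        normSq-groupedSum t ω = subst (normSq (groupedSum t ω) ≤_) (ℚ.*-identityʳ (sq (μ t)))
          (normSq-weighted Ω² (λ p → ⟦ τ² p ℤ.≟ t ⟧) (λ p → wt (proj₁ p ∷ ω) ⊗ wt (proj₂ p ∷ ω) †) 1ℚ
            (λ p → 0≤⟦⟧ (τ² p ℤ.≟ t))
            λ p → ⊗-UnitBounded {wt (proj₁ p ∷ ω)} {wt (proj₂ p ∷ ω) †} (wt-bdd _)
                    (†-UnitBounded {wt (proj₂ p ∷ ω)} (wt-bdd _)))

        normSq≤0 : ∀ z → normSq z ≤ 0ℚ → z ≡ 0ᵍ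
        normSq≤0 (a +𝕚 b) h = cong₂ _+𝕚_
          (sq≤0 a (ℚ.≤-trans (le (sq-nn b) refl) h))
          (sq≤0 b (ℚ.≤-trans (le (sq-nn a) (ℚ.+-comm (sq b) (sq a))) h))
          where
          sq≤0 : ∀ q → sq q ≤ 0ℚ → q ≡ 0ℚ
          sq≤0 q h = ℚ.≤-antisym (≤-from-sq ℚ.≤-refl h)
            (subst₂ _≤_ refl (Q.solve 1 (λ q → Q.:- (Q.:- q) Q.:= q) refl q)
              (ℚ.neg-antimono-≤ (≤-from-sq { - q} ℚ.≤-refl
                (subst (_≤ 0ℚ) (Q.solve 1 (λ q → q Q.:* q Q.:= Q.:- q Q.:* Q.:- q) refl q) h))))
            where module Q = ℚ-Solver.+-*-Solver

        -- If r = 0 then `recip` returns its default 0, while the hypothesis forces z = 0; both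
        -- claims survive, so an unattained difference t needs no separate treatment.
        recover : ∀ {r} z → 0ℚ ≤ r → normSq z ≤ sq r →
          (real r ⊗ (real (recip r) ⊗ z) ≡ z) × (normSq (real (recip r) ⊗ z) ≤ 1ℚ)
        recover {r} z 0≤r h with r ℚ.≟ 0ℚ
        ... | yes refl rewrite normSq≤0 z h = refl , 0≤1
        ... | no r≢0 = (trans (sym (⊗-assoc (real r) (real r⁻¹) z))
                (trans (cong (_⊗ z) inverse) (⊗-identityˡ z))) ,
              subst (_≤ 1ℚ) (sym (trans (normSq-⊗ (real r⁻¹) z) (cong (_* normSq z) (normSq-real r⁻¹))))
                (ℚ.≤-trans (*-monoˡ (sq r⁻¹) (sq-nn r⁻¹) h)
                  (ℚ.≤-reflexive (trans
                    (Q.solve 2 (λ a b → b Q.:* b Q.:* (a Q.:* a) Q.:= (a Q.:* b) Q.:* (a Q.:* b)) refl r r⁻¹)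
                    (cong sq rr⁻¹))))
          where
          module Q = ℚ-Solver.+-*-Solver
          r⁻¹ = (ℚ.1/ r) {{ℚ.≢-nonZero r≢0}}
          rr⁻¹ : r * r⁻¹ ≡ 1ℚ
          rr⁻¹ = ℚ.*-inverseʳ r {{ℚ.≢-nonZero r≢0}}
          inverse : real r ⊗ real r⁻¹ ≡ 1ᵍ
          inverse = cong₂ _+𝕚_
            (trans (Q.solve 2 (λ a b → a Q.:* b Q.:+ Q.:- (Q.con 0ℚ Q.:* Q.con 0ℚ) Q.:= a Q.:* b) refl r r⁻¹) rr⁻¹)
            (Q.solve 2 (λ a b → a Q.:* Q.con 0ℚ Q.:+ Q.con 0ℚ Q.:* b Q.:= Q.con 0ℚ) refl r r⁻¹)

      groupedWeight-bdd : ∀ t → UnitBounded (groupedWeight t)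
      groupedWeight-bdd t ω = proj₂ (recover (groupedSum t ω) (multiplicity-nn Ω τ t) (normSq-groupedSum t ω))

      groupedWeight-scaled : ∀ t ω → real (μ t) ⊗ groupedWeight t ω ≡ groupedSum t ω
      groupedWeight-scaled t ω = proj₁ (recover (groupedSum t ω) (multiplicity-nn Ω τ t) (normSq-groupedSum t ω))

      -- For fixed `ω` the derivative in the direction `τ α` pairs `F ω` with its translate by
      -- `τ α`, the situation of `cauchy-schwarz-shift` with the conjugate of `F ω` as discarded
      -- factor. The result depends on (α , β) through t = `τ α - τ β` and the weights only, and the
      -- correlation with shift t is once more a derivative of f.
      smoothing : ∀ f → Supported M f → UnitBounded f →
        normSq (derivSum wt f) ≤ ι (length (vecs Ω s)) * (ι (length I) *
          Re (∑ᵍ I λ t → real (μ t) ⊗ derivSum (groupedWeight t) (Δ t f)))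
      smoothing f f-supp f-bdd = begin
        normSq (derivSum wt f)              ≡⟨ cong normSq split ⟩
        normSq (∑ᵍ (vecs Ω s) T)            ≤⟨ normSq-∑ (vecs Ω s) T ⟩
        W * ∑ (vecs Ω s) (normSq ∘ T)       ≤⟨ *-monoˡ W (0≤ι (length (vecs Ω s)))
                  (∑-mono (vecs Ω s) λ ω →
                    cauchy-schwarz-shift M≤N Ω τ (λ x → F ω x †) (G ω)
                      (λ x ¬p → cong _† (F-supp ω x ¬p))
                      (λ x → †-UnitBounded {F ω x} (Δ*-UnitBounded (Vec.map τ ω) {f} f-bdd x))
                      (G-supp ω)) ⟩
        W * (∑ (vecs Ω s) λ ω → ι (length I) * Re (C ω))
                  ≡⟨ cong (W *_) (sym (∑-*ˡ (ι (length I)) (vecs Ω s) (Re ∘ C))) ⟩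
        W * (ι (length I) * ∑ (vecs Ω s) (Re ∘ C))
                  ≡⟨ cong (λ t → W * (ι (length I) * t)) (trans (sym (Re-∑ (vecs Ω s) C)) (cong Re regroup)) ⟩
        W * (ι (length I) * Re (∑ᵍ I λ t → real (μ t) ⊗ derivSum (groupedWeight t) (Δ t f))) ∎
        where
        open ℚ.≤-Reasoning
        W = ι (length (vecs Ω s))
        F : Vec A s → ℤ → ℚ[i]
        F ω = Δ* (Vec.map τ ω) f
        F-supp : ∀ ω → Supported M (F ω)
        F-supp ω = Δ*-Supported (Vec.map τ ω) {f} f-supp
        G : Vec A s → A → ℤ → ℚ[i]
        G ω α x = wt (α ∷ ω) ⊗ F ω x
        G-supp : ∀ ω α → Supported M (G ω α)
        G-supp ω α x ¬p = trans (cong (wt (α ∷ ω) ⊗_) (F-supp ω x ¬p)) (⊗-zeroʳ _)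
        T C : Vec A s → ℚ[i]
        T ω = ∑ᵍ Ω λ α → ∑ᵍ I λ x → F ω (x ℤ.+ τ α) † ⊗ G ω α x
        C ω = ∑ᵍ Ω λ α → ∑ᵍ Ω λ β → ∑ᵍ I λ x → G ω α x ⊗ G ω β (x ℤ.+ (τ α ℤ.- τ β)) †

        split : derivSum wt f ≡ ∑ᵍ (vecs Ω s) T
        split = trans (∑ᵍ-vecs Ω s _) (trans (∑ᵍ.∑-swap Ω (vecs Ω s) _)
          (∑ᵍ.∑-cong (vecs Ω s) λ ω → ∑ᵍ.∑-cong Ω λ α → trans (∑ᵍ.∑-*ˡ (wt (α ∷ ω)) I _)
            (∑ᵍ.∑-cong I λ x → trans (cong (wt (α ∷ ω) ⊗_) (Δ*-Δ (Vec.map τ ω) (τ α) f x))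
              (rotate (wt (α ∷ ω)) (F ω x) (F ω (x ℤ.+ τ α) †)))))
          where
          rotate : ∀ a b c → a ⊗ (b ⊗ c) ≡ c ⊗ (a ⊗ b)
          rotate = R.solve 3 (λ a b c → a R.:* (b R.:* c) R.:= c R.:* (a R.:* b)) refl
            where module R = ℚ[i]-Solver

        E : Vec A s → ℤ → ℚ[i]
        E ω t = ∑ᵍ I (Δ* (Vec.map τ ω) (Δ t f))

        -- The delta sum in `weighted` ranges over `I` only; a larger difference moves the support
        -- off itself.
        E-vanishes : ∀ ω t → t ∉ I → E ω t ≡ 0ᵍ
        E-vanishes ω t t∉ = ∑ᵍ.∑-zero I (zero-deriv (Vec.map τ ω) λ y → vanish y (ℤ.∣ y ∣ ℕ.≤? M))
          where
          vanish : ∀ y → Dec (ℤ.∣ y ∣ ℕ.≤ M) → Δ t f y ≡ 0ᵍ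
          vanish y (no ¬h) = Δ-Supported t {f} f-supp y ¬h
          vanish y (yes h) = trans (cong (λ z → f y ⊗ z †) (f-supp (y ℤ.+ t) λ h′ → t∉ (∈-window⁺
            (ℕ.≤-trans (subst (λ u → ℤ.∣ u ∣ ℕ.≤ M ℕ.+ M) (back y)
              (ℕ.≤-trans (ℤ.∣i-j∣≤∣i∣+∣j∣ (y ℤ.+ t) y) (ℕ.+-mono-≤ h′ h))) 2M≤N)))) (⊗-zeroʳ _)
            where
            back : ∀ y → y ℤ.+ t ℤ.- y ≡ t
            back y = Z.solve 2 (λ y t → y Z.:+ t Z.:- y Z.:= t) refl y t
              where module Z = ℤ-Solver.+-*-Solver
          zero-deriv : ∀ {s} (ts : Vec ℤ s) {g} → (∀ y → g y ≡ 0ᵍ) → ∀ y → Δ* ts g y ≡ 0ᵍ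
          zero-deriv []       h y = h y
          zero-deriv (u ∷ ts) {g} h y = zero-deriv ts {Δ u g} (λ z → trans (cong (_⊗ g (z ℤ.+ u) †) (h z)) (⊗-zeroˡ _)) y

        weighted : ∀ ω α β → (∑ᵍ I λ x → G ω α x ⊗ G ω β (x ℤ.+ (τ α ℤ.- τ β)) †) ≡
          ∑ᵍ I λ t → real ⟦ τ α ℤ.- τ β ℤ.≟ t ⟧ ⊗ (wt (α ∷ ω) ⊗ wt (β ∷ ω) †) ⊗ E ω t
        weighted ω α β = trans
          (∑ᵍ.∑-cong I λ x → trans
            (cong (G ω α x ⊗_) (†-⊗ (wt (β ∷ ω)) _))
            (trans (⊗-interchange (wt (α ∷ ω)) (F ω x) (wt (β ∷ ω) †) _)
              (cong (wt (α ∷ ω) ⊗ wt (β ∷ ω) † ⊗_) (sym (Δ*-Δ (Vec.map τ ω) (τ α ℤ.- τ β) f x)))))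
          (trans (sym (∑ᵍ.∑-*ˡ (wt (α ∷ ω) ⊗ wt (β ∷ ω) †) I _))
            (trans (cong (wt (α ∷ ω) ⊗ wt (β ∷ ω) † ⊗_)
                (sym (∑ᵍ.∑-δ-supported ℤ._≟_ I (E ω) (τ α ℤ.- τ β) (window-unique N) (E-vanishes ω (τ α ℤ.- τ β)))))
              (trans (∑ᵍ.∑-*ˡ (wt (α ∷ ω) ⊗ wt (β ∷ ω) †) I _)
                (∑ᵍ.∑-cong I λ t → trans
                  (cong (λ u → wt (α ∷ ω) ⊗ wt (β ∷ ω) † ⊗ (u ⊗ E ω t)) (∑ᵍ-⟦⟧ (τ α ℤ.- τ β ℤ.≟ t)))
                  (move (wt (α ∷ ω) ⊗ wt (β ∷ ω) †) (real ⟦ τ α ℤ.- τ β ℤ.≟ t ⟧) (E ω t))))))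
          where
          move : ∀ a b c → a ⊗ (b ⊗ c) ≡ b ⊗ a ⊗ c
          move = R.solve 3 (λ a b c → a R.:* (b R.:* c) R.:= b R.:* a R.:* c) refl
            where module R = ℚ[i]-Solver

        regroup : ∑ᵍ (vecs Ω s) C ≡ ∑ᵍ I λ t → real (μ t) ⊗ derivSum (groupedWeight t) (Δ t f)
        regroup = trans
          (∑ᵍ.∑-cong (vecs Ω s) λ ω → trans
            (∑ᵍ.∑-cong Ω λ α → ∑ᵍ.∑-cong Ω λ β → weighted ω α β)
            (trans (sym (∑ᵍ.∑-product _,_ Ω Ω λ p → ∑ᵍ I λ t →
                real ⟦ τ² p ℤ.≟ t ⟧ ⊗ (wt (proj₁ p ∷ ω) ⊗ wt (proj₂ p ∷ ω) †) ⊗ E ω t))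
              (trans (∑ᵍ.∑-swap Ω² I _) (∑ᵍ.∑-cong I λ t → trans (sym (∑ᵍ.∑-*ʳ (E ω t) Ω² _))
                (trans (cong (_⊗ E ω t) (sym (groupedWeight-scaled t ω)))
                  (⊗-assoc (real (μ t)) (groupedWeight t ω) (E ω t)))))))
          (trans (∑ᵍ.∑-swap (vecs Ω s) I _)
            (∑ᵍ.∑-cong I λ t → sym (∑ᵍ.∑-*ˡ (real (μ t)) (vecs Ω s) _)))

    module _ {w a α ε : ℚ} (0≤w : 0ℚ ≤ w) (0≤a : 0ℚ ≤ a) (0≤α : 0ℚ ≤ α) (0≤ε : 0ℚ ≤ ε)
      (wI≤a : w * ι (length I) ≤ a) (wΩ≤α : w * ι (length Ω) ≤ α)
      (energy : w ^ℚ 3 * ∑ I (sq ∘ μ) ≤ ε) where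

      -- Induction on the number of directions. After `smoothing`, Cauchy-Schwarz in t separates the
      -- multiplicity, of which just the second moment enters. The power mean then brings the
      -- exponent under the average over t, where the induction hypothesis applies to each `Δ t f`
      -- with its own grouped weight.
      gowers-bound : ∀ s (wt : Vec A s → ℚ[i]) → UnitBounded wt → ∀ f → Supported M f → UnitBounded f →
        tower s (normSq (derivSum wt f) * sq (w ^ℚ suc s)) ≤
        gowersConst a α ε s * (w ^ℚ suc (suc s) * Re (U (suc s) f))
      gowers-bound zero wt wt-bdd f f-supp f-bdd = begin
        normSq (wt [] ⊗ ∑ᵍ I f ⊕ 0ᵍ) * sq (w * 1ℚ)
          ≡⟨ cong (λ z → normSq z * sq (w * 1ℚ)) (⊕-identityʳ (wt [] ⊗ ∑ᵍ I f)) ⟩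
        normSq (wt [] ⊗ ∑ᵍ I f) * sq (w * 1ℚ)
          ≡⟨ cong (_* sq (w * 1ℚ)) (normSq-⊗ (wt []) (∑ᵍ I f)) ⟩
        normSq (wt []) * normSq (∑ᵍ I f) * sq (w * 1ℚ)
          ≤⟨ *-monoʳ (sq (w * 1ℚ)) (sq-nn (w * 1ℚ)) (1*≤ (normSq-nn (∑ᵍ I f)) (wt-bdd [])) ⟩
        normSq (∑ᵍ I f) * sq (w * 1ℚ)
          ≡⟨ Q.solve 2 (λ n w → n Q.:* ((w Q.:* Q.con 1ℚ) Q.:* (w Q.:* Q.con 1ℚ))
               Q.:= Q.con 1ℚ Q.:* (w Q.:* (w Q.:* Q.con 1ℚ) Q.:* n)) refl (normSq (∑ᵍ I f)) w ⟩
        1ℚ * (w ^ℚ 2 * normSq (∑ᵍ I f))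
          ≡⟨ cong (λ t → 1ℚ * (w ^ℚ 2 * t)) (sym (U1≡normSq f f-supp)) ⟩
        1ℚ * (w ^ℚ 2 * Re (U 1 f)) ∎
        where
        open ℚ.≤-Reasoning
        module Q = ℚ-Solver.+-*-Solver
      gowers-bound (suc s) wt wt-bdd f f-supp f-bdd = begin
        tower s (sq (normSq S * sq (w * (w * p))))  ≤⟨ tower-mono s (sq-nn (normSq S * sq (w * (w * p)))) square ⟩
        tower s (C * (w * ∑ I X))                   ≡⟨ tower-* s C (w * ∑ I X) ⟩
        tower s C * tower s (w * ∑ I X)             ≤⟨ *-monoˡ (tower s C) (tower-nn s 0≤C)
                  (power-mean 0≤w 0≤a s I X wI≤a X-nn) ⟩
        tower s C * (meanConst s a * (w * ∑ I (tower s ∘ X)))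
                  ≤⟨ *-monoˡ (tower s C) (tower-nn s 0≤C)
                       (*-monoˡ (meanConst s a) (meanConst-nn s 0≤a)
                         (*-monoˡ w 0≤w
                           (∑-mono I λ t → gowers-bound s (groupedWeight wt wt-bdd t)
                             (groupedWeight-bdd wt wt-bdd t) (Δ t f)
                             (Δ-Supported t {f} f-supp) (Δ-UnitBounded t {f} f-bdd)))) ⟩
        tower s C * (meanConst s a * (w * ∑ I λ t → K * (w * (w * p) * Re (U (suc s) (Δ t f)))))
                  ≡⟨ collect ⟩
        gowersConst a α ε (suc s) * (w * (w * (w * p)) * Re (U (suc (suc s)) f)) ∎
        where
        open ℚ.≤-Reasoning
        module Q = ℚ-Solver.+-*-Solver
        p = w ^ℚ s
        0≤p = ^ℚ-nn 0≤w s
        K = gowersConst a α ε s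
        S = derivSum wt f
        C = sq (α ^ℚ s) * sq a * ε
        0≤C = nn* (nn* (sq-nn (α ^ℚ s)) (sq-nn a)) 0≤ε
        B : ℤ → ℚ[i]
        B t = derivSum (groupedWeight wt wt-bdd t) (Δ t f)
        X : ℤ → ℚ
        X t = normSq (B t) * sq (w * p)
        X-nn : ∀ t → 0ℚ ≤ X t
        X-nn t = nn* (normSq-nn (B t)) (sq-nn (w * p))
        W = ι (length (vecs Ω s))
        ℓ = ι (length I)
        Z = ∑ᵍ I λ t → real (μ t) ⊗ B t
        r² = ∑ I (sq ∘ μ)
        b² = ∑ I (normSq ∘ B)
        0≤r² = ∑-nn I λ t → sq-nn (μ t)
        0≤b² = ∑-nn I λ t → normSq-nn (B t)

        square : sq (normSq S * sq (w * (w * p))) ≤ C * (w * ∑ I X)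
        square = begin
          sq (normSq S * sq (w * (w * p)))
            ≤⟨ sq-mono (nn* (normSq-nn S) (sq-nn (w * (w * p))))
                 (*-monoʳ (sq (w * (w * p))) (sq-nn (w * (w * p)))
                   (smoothing wt wt-bdd f f-supp f-bdd)) ⟩
          sq (W * (ℓ * Re Z) * sq (w * (w * p)))
            ≡⟨ Q.solve 5 (λ W l z w p →
                 (W Q.:* (l Q.:* z) Q.:* ((w Q.:* (w Q.:* p)) Q.:* (w Q.:* (w Q.:* p))))
                   Q.:* (W Q.:* (l Q.:* z) Q.:* ((w Q.:* (w Q.:* p)) Q.:* (w Q.:* (w Q.:* p))))
                 Q.:= ((p Q.:* W) Q.:* (p Q.:* W)) Q.:* ((w Q.:* l) Q.:* (w Q.:* l)) Q.:* (w Q.:* (w Q.:* (w Q.:* Q.con 1ℚ)) Q.:* w Q.:* ((w Q.:* p) Q.:* (w Q.:* p))) Q.:* (z Q.:* z))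
                 refl W ℓ (Re Z) w p ⟩
          sq (p * W) * sq (w * ℓ) * (w ^ℚ 3 * w * sq (w * p)) * sq (Re Z)
            ≤⟨ mono* (nn* (nn* (sq-nn (p * W)) (sq-nn (w * ℓ))) (nn* (nn* (^ℚ-nn 0≤w 3) 0≤w) (sq-nn (w * p)))) (sq-nn (Re Z))
                 (*-monoʳ (w ^ℚ 3 * w * sq (w * p)) (nn* (nn* (^ℚ-nn 0≤w 3) 0≤w) (sq-nn (w * p)))
                   (mono* (sq-nn (p * W)) (sq-nn (w * ℓ))
                     (sq-mono (nn* 0≤p (0≤ι (length (vecs Ω s)))) (length-vecs-≤ Ω 0≤w wΩ≤α s))
                     (sq-mono (nn* 0≤w (0≤ι (length I))) wI≤a)))
                 (ℚ.≤-trans (Re²≤normSq Z) (cauchy-schwarz-real I μ B)) ⟩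
          sq (α ^ℚ s) * sq a * (w ^ℚ 3 * w * sq (w * p)) * (r² * b²)
            ≡⟨ Q.solve 7 (λ A a k w q r b → A Q.:* a Q.:* (k Q.:* w Q.:* q) Q.:* (r Q.:* b)
                 Q.:= A Q.:* a Q.:* (k Q.:* r) Q.:* (w Q.:* (b Q.:* q))) refl (sq (α ^ℚ s)) (sq a) (w ^ℚ 3) w (sq (w * p)) r² b² ⟩
          sq (α ^ℚ s) * sq a * (w ^ℚ 3 * r²) * (w * (b² * sq (w * p)))
            ≤⟨ *-monoʳ (w * (b² * sq (w * p))) (nn* 0≤w (nn* 0≤b² (sq-nn (w * p))))
                 (*-monoˡ (sq (α ^ℚ s) * sq a) (nn* (sq-nn (α ^ℚ s)) (sq-nn a)) energy) ⟩
          C * (w * (b² * sq (w * p)))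
            ≡⟨ cong (λ t → C * (w * t)) (∑-*ʳ (sq (w * p)) I (normSq ∘ B)) ⟩
          C * (w * ∑ I X) ∎

        collect : tower s C * (meanConst s a * (w * ∑ I λ t → K * (w * (w * p) * Re (U (suc s) (Δ t f))))) ≡
          gowersConst a α ε (suc s) * (w * (w * (w * p)) * Re (U (suc (suc s)) f))
        collect = trans
          (cong (λ t → tower s C * (meanConst s a * (w * t))) (trans (sym (∑-*ˡ K I _))
            (cong (K *_) (trans (sym (∑-*ˡ (w * (w * p)) I λ t → Re (U (suc s) (Δ t f))))
              (cong (λ t → w * (w * p) * t) (sym (Re-∑ I λ t → U (suc s) (Δ t f))))))))
          (Q.solve 6 (λ t m w k q u → t Q.:* (m Q.:* (w Q.:* (k Q.:* (q Q.:* u))))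
            Q.:= t Q.:* m Q.:* k Q.:* (w Q.:* q Q.:* u)) refl
            (tower s C) (meanConst s a) w K (w * (w * p)) (Re (U (suc (suc s)) f)))

-- Additive energy of a set of products

∑-upTo-suc : ∀ n (F : ℕ → ℚ) → ∑ (upTo (suc n)) F ≡ ∑ (upTo n) F + F n
∑-upTo-suc n F = trans (cong (λ xs → ∑ xs F) (sym (upTo-∷ʳ n)))
  (trans (∑-++ (upTo n) (n ∷ []) F) (cong (λ t → ∑ (upTo n) F + t) (ℚ.+-identityʳ (F n))))

term≤∑ : {A : Set} {xs : List A} {F : A → ℚ} → (∀ x → 0ℚ ≤ F x) → ∀ {x} → x ∈ xs → F x ≤ ∑ xs F
term≤∑ {xs = x ∷ xs} {F} h (here refl) = le (∑-nn xs h) refl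
term≤∑ {xs = x ∷ xs} {F} h (there x∈) = ℚ.≤-trans (term≤∑ h x∈) (le (h x) (ℚ.+-comm (∑ xs F) (F x)))

-- The last element counted bounds the number of elements before it.
spaced-upTo : ∀ b m {Q : ℕ → Set} (Q? : ∀ j → Dec (Q j)) →
  (∀ {i j} → i ℕ.< j → Q i → Q j → i ℕ.+ b ℕ.≤ j) →
  ι b * (∑ (upTo (suc m)) λ j → ⟦ Q? j ⟧) ≤ ι m + ι b
spaced-upTo b m {Q} Q? gap = finish (invariant (suc m))
  where
  open ℚ-Solver.+-*-Solver using (solve; _:=_; _:+_; _:*_; con)
  count : ℕ → ℚ
  count n = ∑ (upTo n) λ j → ⟦ Q? j ⟧
  Inv : ℕ → Set
  Inv n = (count n ≡ 0ℚ) ⊎ ∃ λ p → p ℕ.< n × Q p × ι b * count n ≤ ι p + ι b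
  invariant : ∀ n → Inv n
  invariant zero = inj₁ refl
  invariant (suc n) with Q? n in eq
  ... | no ¬q = extend (invariant n)
    where
    same : count (suc n) ≡ count n
    same = trans (∑-upTo-suc n _) (trans (cong (λ d → count n + ⟦ d ⟧) eq) (ℚ.+-identityʳ (count n)))
    extend : Inv n → Inv (suc n)
    extend (inj₁ e) = inj₁ (trans same e)
    extend (inj₂ (p , p<n , q , h)) =
      inj₂ (p , ℕ.m≤n⇒m≤1+n p<n , q , subst (λ c → ι b * c ≤ ι p + ι b) (sym same) h)
  ... | yes q = extend (invariant n)
    where
    next : count (suc n) ≡ count n + 1ℚ
    next = trans (∑-upTo-suc n _) (cong (λ d → count n + ⟦ d ⟧) eq)
    extend : Inv n → Inv (suc n)
    extend (inj₁ e) = inj₂ (n , ℕ.≤-refl , q , subst (_≤ ι n + ι b)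
      (sym (trans (cong (λ c → ι b * c) (trans next (cong (_+ 1ℚ) e)))
        (solve 1 (λ b → b :* (con 0ℚ :+ con 1ℚ) := b) refl (ι b))))
      (le (0≤ι n) (ℚ.+-comm (ι b) (ι n))))
    extend (inj₂ (p , p<n , q′ , h)) = inj₂ (n , ℕ.≤-refl , q , subst (_≤ ι n + ι b)
      (sym (trans (cong (λ c → ι b * c) next)
        (solve 2 (λ b c → b :* (c :+ con 1ℚ) := b :* c :+ b) refl (ι b) (count n))))
      (ℚ.+-monoˡ-≤ (ι b) (ℚ.≤-trans h (subst (_≤ ι n) (ι-+ p b) (ι-mono (gap p<n q′ q))))))
  finish : Inv (suc m) → ι b * count (suc m) ≤ ι m + ι b
  finish (inj₁ e) = subst (_≤ ι m + ι b) (sym (trans (cong (λ c → ι b * c) e) (ℚ.*-zeroʳ (ι b))))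
    (nn+ (0≤ι m) (0≤ι b))
  finish (inj₂ (p , p<m , _ , h)) = ℚ.≤-trans h (ℚ.+-monoˡ-≤ (ι b) (ι-mono (ℕ.s≤s⁻¹ p<m)))

spaced-window : ∀ b p {Q : ℤ → Set} (Q? : ∀ x → Dec (Q x)) →
  (∀ {x y} → Q x → Q y → + b ℤ∣.∣ (x ℤ.- y)) →
  ι b * (∑ (window p) λ x → ⟦ Q? x ⟧) ≤ ι (p ℕ.+ p) + ι b
spaced-window b p {Q} Q? div = subst (λ s → ι b * s ≤ ι (p ℕ.+ p) + ι b)
  (sym (trans (cong (λ xs → ∑ xs λ x → ⟦ Q? x ⟧) (window≡interval p)) (∑-map (λ j → + j ℤ.- + p) (upTo (suc (p ℕ.+ p))) λ x → ⟦ Q? x ⟧)))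
  (spaced-upTo b (p ℕ.+ p) (λ j → Q? (+ j ℤ.- + p)) gap)
  where
  gap : ∀ {i j} → i ℕ.< j → Q (+ i ℤ.- + p) → Q (+ j ℤ.- + p) → i ℕ.+ b ℕ.≤ j
  gap {i} {j} i<j qi qj = subst (i ℕ.+ b ℕ.≤_) (ℕ.m+[n∸m]≡n (ℕ.<⇒≤ i<j))
    (ℕ.+-monoʳ-≤ i (ℕ∣.∣⇒≤ {{ℕ.>-nonZero (ℕ.m<n⇒0<n∸m i<j)}}
      (subst (b ℕ∣.∣_) (cong ℤ.∣_∣ difference) (ℤ∣.∣⇒∣ᵤ (div qj qi)))))
    where
    difference : (+ j ℤ.- + p) ℤ.- (+ i ℤ.- + p) ≡ + (j ℕ.∸ i)
    difference = trans (solve 3 (λ j i p → (j :- p) :- (i :- p) := j :- i) refl (+ j) (+ i) (+ p))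
      (trans (ℤ.m-n≡m⊖n j i) (ℤ.⊖-≥ (ℕ.<⇒≤ i<j)))
      where open ℤ-Solver.+-*-Solver using (solve; _:=_; _:+_; _:*_; _:-_; :-_)

infix 4 _∣ᶻ?_

_∣ᶻ?_ : ∀ e z → Dec (+ e ℤ∣.∣ z)
e ∣ᶻ? z = + e ℤ∣.∣? z

nonzero? : ∀ (n : ℤ) → Dec (¬ n ≡ + 0)
nonzero? n = ¬? (n ℤ.≟ + 0)

nz : ℕ → List ℤ
nz p = filter nonzero? (window p)

nz-unique : ∀ p → Unique (nz p)
nz-unique p = Unique.filter⁺ nonzero? (window-unique p)

∈-nz⁺ : ∀ {p n} → ℤ.∣ n ∣ ℕ.≤ p → ¬ n ≡ + 0 → n ∈ nz p
∈-nz⁺ h n≢0 = ∈-filter⁺ nonzero? (∈-window⁺ h) n≢0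

∈-nz⁻ : ∀ {p n} → n ∈ nz p → ℤ.∣ n ∣ ℕ.≤ p × ¬ n ≡ + 0
∈-nz⁻ n∈ = let w , n≢0 = ∈-filter⁻ nonzero? n∈ in ∈-window⁻ w , n≢0

∑-nz≤∑-window : ∀ p (F : ℤ → ℚ) → (∀ z → 0ℚ ≤ F z) → ∑ (nz p) F ≤ ∑ (window p) F
∑-nz≤∑-window p F 0≤F = ∑-⊆ ℤ._≟_ (nz p) (window p) F (nz-unique p) (window-unique p)
  (λ z∈ → ∈-window⁺ (proj₁ (∈-nz⁻ z∈))) 0≤F

+ℚ-cancelʳ-≤ : ∀ c {p q} → p + c ≤ q + c → p ≤ q
+ℚ-cancelʳ-≤ c {p} {q} h = le (nn-sub h)
  (solve 3 (λ p q c → p :+ ((q :+ c) :- (p :+ c)) := q) refl p q c)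
  where open ℚ-Solver.+-*-Solver using (solve; _:=_; _:+_; _:-_)

-- Zero is a multiple of e and accounts for the additive e in `spaced-window`. Without it the count
-- is at most 2m/e with no error term, even for e > m.
count-multiples : ∀ e m → ι e * (∑ (nz m) λ n → ⟦ e ∣ᶻ? n ⟧) ≤ ι (m ℕ.+ m)
count-multiples e m = +ℚ-cancelʳ-≤ (ι e) (ℚ.≤-trans (ℚ.≤-reflexive with-zero)
  (spaced-window e m (e ∣ᶻ?_) λ {x} {y} p q → ℤ∣.∣m∣n⇒∣m-n p q))
  where
  F : ℤ → ℚ
  F n = ⟦ e ∣ᶻ? n ⟧
  decompose : ∀ n → ⟦ + 0 ℤ.≟ n ⟧ * F n + ⟦ nonzero? n ⟧ * F n ≡ F n
  decompose n with n ℤ.≟ + 0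
  ... | yes refl = trans (cong₂ _+_ (ℚ.*-identityˡ (F (+ 0))) (ℚ.*-zeroˡ (F (+ 0)))) (ℚ.+-identityʳ _)
  ... | no n≢0 = trans (cong₂ _+_ (trans (cong (_* F n) (⟦⟧-no (+ 0 ℤ.≟ n) (n≢0 ∘ sym))) (ℚ.*-zeroˡ (F n)))
                  (ℚ.*-identityˡ (F n))) (ℚ.+-identityˡ (F n))
  with-zero : ι e * ∑ (nz m) F + ι e ≡ ι e * ∑ (window m) F
  with-zero = trans
    (solve 2 (λ e s → e :* s :+ e := e :* (con 1ℚ :+ s)) refl (ι e) (∑ (nz m) F))
    (cong (λ t → ι e * t) (trans
      (cong₂ _+_
        (sym (trans (∑-δ ℤ._≟_ (window m) F (window-unique m) (∈-window⁺ z≤n))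
          (⟦⟧-yes (e ∣ᶻ? + 0) (ℤ∣.divides (+ 0) refl))))
        (∑-filter nonzero? (window m) F))
      (trans (sym (∑-⊞ (window m) _ _)) (∑-cong (window m) decompose))))
    where open ℚ-Solver.+-*-Solver using (solve; _:=_; _:+_; _:*_; con)

count-bounded-multiples : ∀ e q m →
  ι e * (∑ (nz q) λ n → ⟦ ℤ.∣ n ∣ ℕ.≤? m ⟧ * ⟦ e ∣ᶻ? n ⟧) ≤ ι (m ℕ.+ m)
count-bounded-multiples e q m = ℚ.≤-trans
  (*-monoˡ (ι e) (0≤ι e) (ℚ.≤-trans
    (ℚ.≤-reflexive (sym (∑-filter small? (nz q) λ n → ⟦ e ∣ᶻ? n ⟧)))
    (∑-⊆ ℤ._≟_ (filter small? (nz q)) (nz m) (λ n → ⟦ e ∣ᶻ? n ⟧)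
      (Unique.filter⁺ small? (nz-unique q)) (nz-unique m)
      (λ z∈ → let z∈nz , h = ∈-filter⁻ small? z∈ in ∈-nz⁺ h (proj₂ (∈-nz⁻ z∈nz)))
      λ n → 0≤⟦⟧ (e ∣ᶻ? n))))
  (count-multiples e m)
  where
  small? : ∀ n → Dec (ℤ.∣ n ∣ ℕ.≤ m)
  small? n = ℤ.∣ n ∣ ℕ.≤? m

-- Σ 1/e over the divisors e ≤ q of t, with e = j + 1. Up to a factor O(pq) it bounds the number of
-- ways to write t as a difference of two products with factors of size at most p and q.
divisorSum : ℕ → ℤ → ℚ
divisorSum q t = ∑ (upTo q) λ j → ⟦ suc j ∣ᶻ? t ⟧ * unit j

divisorSum-neg : ∀ q t → divisorSum q (ℤ.- t) ≡ divisorSum q t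
divisorSum-neg q t = ∑-cong (upTo q) λ j → cong (_* unit j)
  (⟦⟧-cong (suc j ∣ᶻ? (ℤ.- t)) (suc j ∣ᶻ? t)
    (λ h → subst (+ suc j ℤ∣.∣_) (ℤ.neg-involutive t) (ℤ∣.∣m⇒∣-m h)) ℤ∣.∣m⇒∣-m)

solutions : ℕ → ℤ → ℤ → ℤ → ℚ
solutions p t n₁ n₂ = ∑ (window p) λ d₁ → ∑ (window p) λ d₂ → ⟦ d₁ ℤ.* n₁ ℤ.- d₂ ℤ.* n₂ ℤ.≟ t ⟧

solutions-nn : ∀ p t n₁ n₂ → 0ℚ ≤ solutions p t n₁ n₂
solutions-nn p t n₁ n₂ = ∑-nn (window p) λ d₁ → ∑-nn (window p) λ d₂ → 0≤⟦⟧ (d₁ ℤ.* n₁ ℤ.- d₂ ℤ.* n₂ ℤ.≟ t)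

solutions-swap : ∀ p t n₁ n₂ → solutions p t n₁ n₂ ≡ solutions p (ℤ.- t) n₂ n₁
solutions-swap p t n₁ n₂ = trans (∑-swap (window p) (window p) _)
  (∑-cong (window p) λ d₂ → ∑-cong (window p) λ d₁ →
    ⟦⟧-cong (d₁ ℤ.* n₁ ℤ.- d₂ ℤ.* n₂ ℤ.≟ t) (d₂ ℤ.* n₂ ℤ.- d₁ ℤ.* n₁ ℤ.≟ ℤ.- t)
      (λ e → trans (flip (d₁ ℤ.* n₁) (d₂ ℤ.* n₂)) (cong ℤ.-_ e))
      (λ e → trans (flip (d₂ ℤ.* n₂) (d₁ ℤ.* n₁)) (trans (cong ℤ.-_ e) (ℤ.neg-involutive t))))
  where
  flip : ∀ x y → y ℤ.- x ≡ ℤ.- (x ℤ.- y)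
  flip = solve 2 (λ x y → y :- x := :- (x :- y)) refl
    where open ℤ-Solver.+-*-Solver using (solve; _:=_; _:+_; _:*_; _:-_; :-_)

∣*⇒∣*gcd : ∀ {x m n} → n ℕ∣.∣ x ℕ.* m → n ℕ∣.∣ x ℕ.* GCD.gcd m n
∣*⇒∣*gcd {x} {m} {n} h = subst (n ℕ∣.∣_) (sym (GCD.c*gcd[m,n]≡gcd[cm,cn] x m n))
  (GCD.gcd-greatest h (ℕ∣.n∣m*n x))

-- For fixed d₁ there is at most one d₂, and the admissible d₁ lie in a single
-- residue class modulo n₂ / gcd(n₁, n₂).
solutions-≤ : ∀ p t n₁ n₂ → ¬ n₂ ≡ + 0 → ℤ.∣ n₂ ∣ ℕ.≤ p →
  let g = GCD.gcd ℤ.∣ n₁ ∣ ℤ.∣ n₂ ∣ in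
  ι ℤ.∣ n₂ ∣ * solutions p t n₁ n₂ ≤ ι (p ℕ.+ p ℕ.+ p) * (ι g * ⟦ g ∣ᶻ? t ⟧)
solutions-≤ p t n₁ n₂ n₂≢0 n₂≤p = by-case (g ∣ᶻ? t)
  where
  g = GCD.gcd ℤ.∣ n₁ ∣ ℤ.∣ n₂ ∣
  g∣n₁ : + g ℤ∣.∣ n₁
  g∣n₁ = ℤ∣.∣ᵤ⇒∣ (GCD.gcd[m,n]∣m ℤ.∣ n₁ ∣ ℤ.∣ n₂ ∣)
  g∣n₂ : + g ℤ∣.∣ n₂
  g∣n₂ = ℤ∣.∣ᵤ⇒∣ (GCD.gcd[m,n]∣n ℤ.∣ n₁ ∣ ℤ.∣ n₂ ∣)
  Q : ℤ → Set
  Q d = n₂ ℤ∣.∣ (d ℤ.* n₁ ℤ.- t)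
  Q? : ∀ d → Dec (Q d)
  Q? d = n₂ ℤ∣.∣? (d ℤ.* n₁ ℤ.- t)

  solve-t : ∀ a b → a ℤ.- b ≡ t → a ℤ.- t ≡ b
  solve-t a b refl = solve 2 (λ a b → a :- (a :- b) := b) refl a b
    where open ℤ-Solver.+-*-Solver using (solve; _:=_; _:+_; _:*_; _:-_; :-_)

  inner : ∀ d₁ → (∑ (window p) λ d₂ → ⟦ d₁ ℤ.* n₁ ℤ.- d₂ ℤ.* n₂ ℤ.≟ t ⟧) ≤ ⟦ Q? d₁ ⟧
  inner d₁ with Q? d₁
  ... | yes (ℤ∣.divides k e) = ℚ.≤-trans
    (∑-mono (window p) λ d₂ → ⟦⟧-mono (d₁ ℤ.* n₁ ℤ.- d₂ ℤ.* n₂ ℤ.≟ t) (k ℤ.≟ d₂)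
      λ eq → ℤ.*-cancelʳ-≡ k d₂ n₂ {{ℤ.≢-nonZero n₂≢0}} (trans (sym e) (solve-t (d₁ ℤ.* n₁) (d₂ ℤ.* n₂) eq)))
    (∑-δ≤1 ℤ._≟_ (window p) (window-unique p) k)
  ... | no ¬q = ℚ.≤-reflexive (∑-zero (window p) λ d₂ →
    ⟦⟧-no (d₁ ℤ.* n₁ ℤ.- d₂ ℤ.* n₂ ℤ.≟ t) λ eq → ¬q (ℤ∣.divides d₂ (solve-t (d₁ ℤ.* n₁) (d₂ ℤ.* n₂) eq)))

  b = ℕ∣._∣_.quotient (GCD.gcd[m,n]∣n ℤ.∣ n₁ ∣ ℤ.∣ n₂ ∣)
  n₂≡bg : ℤ.∣ n₂ ∣ ≡ b ℕ.* g
  n₂≡bg = ℕ∣._∣_.equality (GCD.gcd[m,n]∣n ℤ.∣ n₁ ∣ ℤ.∣ n₂ ∣)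
  ∣n₂∣≢0 : ¬ ℤ.∣ n₂ ∣ ≡ 0
  ∣n₂∣≢0 e = n₂≢0 (ℤ.∣i∣≡0⇒i≡0 e)
  g≢0 : ¬ g ≡ 0
  g≢0 = GCD.gcd[m,n]≢0 ℤ.∣ n₁ ∣ ℤ.∣ n₂ ∣ (inj₂ ∣n₂∣≢0)
  b≤p : b ℕ.≤ p
  b≤p = ℕ.≤-trans (subst (b ℕ.≤_) (sym n₂≡bg) (ℕ.m≤m*n b g {{ℕ.≢-nonZero g≢0}})) n₂≤p

  -- n₂ divides (x - y)n₁ and (x - y)n₂, hence (x - y)g; since n₂ is b g up to sign, g cancels.
  spacing : ∀ {x y} → Q x → Q y → + b ℤ∣.∣ (x ℤ.- y)
  spacing {x} {y} qx qy = ℤ∣.∣ᵤ⇒∣ (ℕ∣.*-cancelʳ-∣ g {{ℕ.≢-nonZero g≢0}}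
    (subst (ℕ∣._∣ ℤ.∣ x ℤ.- y ∣ ℕ.* g) n₂≡bg (∣*⇒∣*gcd {ℤ.∣ x ℤ.- y ∣} {ℤ.∣ n₁ ∣} {ℤ.∣ n₂ ∣}
      (subst (ℤ.∣ n₂ ∣ ℕ∣.∣_) (trans (cong ℤ.∣_∣ (diff x y)) (ℤ.∣i*j∣≡∣i∣*∣j∣ (x ℤ.- y) n₁))
        (ℤ∣.∣⇒∣ᵤ (ℤ∣.∣m∣n⇒∣m-n qx qy))))))
    where
    diff : ∀ x y → (x ℤ.* n₁ ℤ.- t) ℤ.- (y ℤ.* n₁ ℤ.- t) ≡ (x ℤ.- y) ℤ.* n₁
    diff x y = solve 4 (λ x y n t → (x :* n :- t) :- (y :* n :- t) := (x :- y) :* n) refl x y n₁ t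
      where open ℤ-Solver.+-*-Solver using (solve; _:=_; _:+_; _:*_; _:-_; :-_)

  -- The additive b of `spaced-window` is absorbed by b ≤ p, which gives 3p.
  residue-class : ι b * solutions p t n₁ n₂ ≤ ι (p ℕ.+ p ℕ.+ p)
  residue-class = ℚ.≤-trans
    (*-monoˡ (ι b) (0≤ι b) (∑-mono (window p) inner))
    (ℚ.≤-trans (spaced-window b p Q? (λ {x} {y} → spacing {x} {y}))
      (subst (_≤ ι (p ℕ.+ p ℕ.+ p)) (ι-+ (p ℕ.+ p) b) (ι-mono (ℕ.+-monoʳ-≤ (p ℕ.+ p) b≤p))))

  by-case : (d : Dec (+ g ℤ∣.∣ t)) →
    ι ℤ.∣ n₂ ∣ * solutions p t n₁ n₂ ≤ ι (p ℕ.+ p ℕ.+ p) * (ι g * ⟦ d ⟧)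
  by-case (yes _) = subst₂ _≤_
    (trans (Q′.solve 3 (λ g b s → g Q′.:* (b Q′.:* s) Q′.:= (b Q′.:* g) Q′.:* s) refl (ι g) (ι b) (solutions p t n₁ n₂))
      (cong (_* solutions p t n₁ n₂) (trans (sym (ι-* b g)) (cong ι (sym n₂≡bg)))))
    (Q′.solve 2 (λ g r → g Q′.:* r Q′.:= r Q′.:* (g Q′.:* Q′.con 1ℚ)) refl (ι g) (ι (p ℕ.+ p ℕ.+ p)))
    (*-monoˡ (ι g) (0≤ι g) residue-class)
    where module Q′ = ℚ-Solver.+-*-Solver
  by-case (no g∤t) = ℚ.≤-trans
    (ℚ.≤-reflexive (trans (cong (λ s → ι ℤ.∣ n₂ ∣ * s) (∑-zero (window p) λ d₁ → ∑-zero (window p) λ d₂ →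
      ⟦⟧-no (d₁ ℤ.* n₁ ℤ.- d₂ ℤ.* n₂ ℤ.≟ t) λ { refl → g∤t
        (ℤ∣.∣m∣n⇒∣m-n (ℤ∣.∣n⇒∣m*n d₁ g∣n₁) (ℤ∣.∣n⇒∣m*n d₂ g∣n₂)) })) (ℚ.*-zeroʳ (ι ℤ.∣ n₂ ∣))))
    (nn* (0≤ι (p ℕ.+ p ℕ.+ p)) (nn* (0≤ι g) ℚ.≤-refl))

-- The restriction |n₁| ≤ |n₂| is where a logarithm is avoided. The bound for `solutions` carries
-- 1/|n₂|, and the multiples n₁ of e with |n₁| ≤ |n₂| number at most 2|n₂|/e, so |n₂| cancels before
-- the sum over n₂ is taken.
halfSum : ℕ → ℕ → ℤ → ℚ
halfSum p q t = ∑ (nz q) λ n₂ → ∑ (nz q) λ n₁ → ⟦ ℤ.∣ n₁ ∣ ℕ.≤? ℤ.∣ n₂ ∣ ⟧ * solutions p t n₁ n₂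

module _ {p q : ℕ} (q≤p : q ℕ.≤ p) (t : ℤ) where

  private
    module Q = ℚ-Solver.+-*-Solver
    3p = ι (p ℕ.+ p ℕ.+ p)
    0≤3p = 0≤ι (p ℕ.+ p ℕ.+ p)

  -- The gcd couples n₁ and n₂. Its single term is dominated by a sum over all e ≤ q of a product of
  -- three separate divisibility conditions; e = gcd occurs there because the gcd is at most |n₂| ≤
  -- q.
  solutions-divisors : ∀ n₁ n₂ → n₂ ∈ nz q → ι ℤ.∣ n₂ ∣ * solutions p t n₁ n₂ ≤
    3p * ∑ (upTo q) λ j → ι (suc j) * (⟦ suc j ∣ᶻ? n₁ ⟧ * ⟦ suc j ∣ᶻ? n₂ ⟧ * ⟦ suc j ∣ᶻ? t ⟧)
  solutions-divisors n₁ n₂ n₂∈ = ℚ.≤-trans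
    (solutions-≤ p t n₁ n₂ (proj₂ (∈-nz⁻ n₂∈)) (ℕ.≤-trans (proj₁ (∈-nz⁻ n₂∈)) q≤p))
    (*-monoˡ 3p 0≤3p (gcd-term g refl))
    where
    g = GCD.gcd ℤ.∣ n₁ ∣ ℤ.∣ n₂ ∣
    ∣n₂∣≢0 : ¬ ℤ.∣ n₂ ∣ ≡ 0
    ∣n₂∣≢0 e = proj₂ (∈-nz⁻ n₂∈) (ℤ.∣i∣≡0⇒i≡0 e)
    F : ℕ → ℚ
    F j = ι (suc j) * (⟦ suc j ∣ᶻ? n₁ ⟧ * ⟦ suc j ∣ᶻ? n₂ ⟧ * ⟦ suc j ∣ᶻ? t ⟧)
    F-nn : ∀ j → 0ℚ ≤ F j
    F-nn j = nn* (0≤ι (suc j)) (nn* (nn* (0≤⟦⟧ (suc j ∣ᶻ? n₁)) (0≤⟦⟧ (suc j ∣ᶻ? n₂))) (0≤⟦⟧ (suc j ∣ᶻ? t)))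
    gcd-term : ∀ g′ → g ≡ g′ → ι g′ * ⟦ g′ ∣ᶻ? t ⟧ ≤ ∑ (upTo q) F
    gcd-term zero e = contradiction e (GCD.gcd[m,n]≢0 ℤ.∣ n₁ ∣ ℤ.∣ n₂ ∣ (inj₂ ∣n₂∣≢0))
    gcd-term (suc j) e = ℚ.≤-trans
      (ℚ.≤-reflexive (cong (λ u → ι (suc j) * u) (sym (trans
        (cong (_* ⟦ suc j ∣ᶻ? t ⟧) (cong₂ _*_
          (⟦⟧-yes (suc j ∣ᶻ? n₁) (ℤ∣.∣ᵤ⇒∣ (subst (ℕ∣._∣ ℤ.∣ n₁ ∣) e (GCD.gcd[m,n]∣m ℤ.∣ n₁ ∣ ℤ.∣ n₂ ∣))))
          (⟦⟧-yes (suc j ∣ᶻ? n₂) (ℤ∣.∣ᵤ⇒∣ (subst (ℕ∣._∣ ℤ.∣ n₂ ∣) e (GCD.gcd[m,n]∣n ℤ.∣ n₁ ∣ ℤ.∣ n₂ ∣))))))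
        (ℚ.*-identityˡ ⟦ suc j ∣ᶻ? t ⟧)))))
      (term≤∑ {F = F} F-nn (∈-upTo⁺ (ℕ.≤-trans
        (subst (ℕ._≤ ℤ.∣ n₂ ∣) e (ℕ∣.∣⇒≤ {{ℕ.≢-nonZero ∣n₂∣≢0}} (GCD.gcd[m,n]∣n ℤ.∣ n₁ ∣ ℤ.∣ n₂ ∣)))
        (proj₁ (∈-nz⁻ n₂∈)))))

  private
    row : ∀ {n₂} → n₂ ∈ nz q →
      (∑ (nz q) λ n₁ → ⟦ ℤ.∣ n₁ ∣ ℕ.≤? ℤ.∣ n₂ ∣ ⟧ * solutions p t n₁ n₂) ≤
      (3p + 3p) * ∑ (upTo q) λ j → ⟦ suc j ∣ᶻ? n₂ ⟧ * ⟦ suc j ∣ᶻ? t ⟧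
    row {n₂} n₂∈ = ℚ.*-cancelˡ-≤-pos (ι m) {{ℚ.positive 0<m}} (begin
      ι m * ∑ (nz q) (λ n₁ → S n₁ * solutions p t n₁ n₂)
        ≡⟨ ∑-*ˡ (ι m) (nz q) _ ⟩
      ∑ (nz q) (λ n₁ → ι m * (S n₁ * solutions p t n₁ n₂))
        ≤⟨ ∑-mono (nz q) (λ n₁ → subst₂ _≤_
             (Q.solve 3 (λ s m c → s Q.:* (m Q.:* c) Q.:= m Q.:* (s Q.:* c)) refl (S n₁) (ι m) (solutions p t n₁ n₂))
             (Q.solve 3 (λ s k f → s Q.:* (k Q.:* f) Q.:= k Q.:* (s Q.:* f)) refl (S n₁) 3p (∑ (upTo q) (F n₁)))
             (*-monoˡ (S n₁) (0≤⟦⟧ (ℤ.∣ n₁ ∣ ℕ.≤? m)) (solutions-divisors n₁ n₂ n₂∈))) ⟩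
      ∑ (nz q) (λ n₁ → 3p * (S n₁ * ∑ (upTo q) (F n₁)))
        ≡⟨ sym (∑-*ˡ 3p (nz q) _) ⟩
      3p * ∑ (nz q) (λ n₁ → S n₁ * ∑ (upTo q) (F n₁))
        ≡⟨ cong (λ t → 3p * t) (trans (∑-cong (nz q) λ n₁ → ∑-*ˡ (S n₁) (upTo q) (F n₁)) (∑-swap (nz q) (upTo q) _)) ⟩
      3p * ∑ (upTo q) (λ j → ∑ (nz q) λ n₁ → S n₁ * F n₁ j)
        ≡⟨ cong (λ t → 3p * t) (∑-cong (upTo q) λ j → trans
             (∑-cong (nz q) λ n₁ → Q.solve 5 (λ s e a b c → s Q.:* (e Q.:* (a Q.:* b Q.:* c))
               Q.:= b Q.:* c Q.:* (e Q.:* (s Q.:* a))) refl (S n₁) (ι (suc j)) ⟦ suc j ∣ᶻ? n₁ ⟧ ⟦ suc j ∣ᶻ? n₂ ⟧ ⟦ suc j ∣ᶻ? t ⟧)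
             (trans (sym (∑-*ˡ (G j) (nz q) _)) (cong (λ t → G j * t) (sym (∑-*ˡ (ι (suc j)) (nz q) _))))) ⟩
      3p * ∑ (upTo q) (λ j → G j * (ι (suc j) * ∑ (nz q) λ n₁ → S n₁ * ⟦ suc j ∣ᶻ? n₁ ⟧))
        ≤⟨ *-monoˡ 3p 0≤3p (∑-mono (upTo q) λ j →
             *-monoˡ (G j) (nn* (0≤⟦⟧ (suc j ∣ᶻ? n₂)) (0≤⟦⟧ (suc j ∣ᶻ? t)))
               (count-bounded-multiples (suc j) q m)) ⟩
      3p * ∑ (upTo q) (λ j → G j * ι (m ℕ.+ m))
        ≡⟨ cong (λ t → 3p * t) (trans (sym (∑-*ʳ (ι (m ℕ.+ m)) (upTo q) G)) (cong (λ t → ∑ (upTo q) G * t) (ι-+ m m))) ⟩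
      3p * (∑ (upTo q) G * (ι m + ι m))
        ≡⟨ Q.solve 3 (λ k g m → k Q.:* (g Q.:* (m Q.:+ m)) Q.:= m Q.:* ((k Q.:+ k) Q.:* g)) refl 3p (∑ (upTo q) G) (ι m) ⟩
      ι m * ((3p + 3p) * ∑ (upTo q) G) ∎)
      where
      open ℚ.≤-Reasoning
      m = ℤ.∣ n₂ ∣
      0<m : 0ℚ < ι m
      0<m with ℤ.∣ n₂ ∣ in e
      ... | zero  = contradiction (ℤ.∣i∣≡0⇒i≡0 e) (proj₂ (∈-nz⁻ n₂∈))
      ... | suc n = 0<ι n
      S : ℤ → ℚ
      S n₁ = ⟦ ℤ.∣ n₁ ∣ ℕ.≤? m ⟧
      F : ℤ → ℕ → ℚ
      F n₁ j = ι (suc j) * (⟦ suc j ∣ᶻ? n₁ ⟧ * ⟦ suc j ∣ᶻ? n₂ ⟧ * ⟦ suc j ∣ᶻ? t ⟧)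
      G : ℕ → ℚ
      G j = ⟦ suc j ∣ᶻ? n₂ ⟧ * ⟦ suc j ∣ᶻ? t ⟧

  -- The number of multiples n₂ of e, at most 2q/e, supplies the weight 1/e of `divisorSum`.
  halfSum-≤ : halfSum p q t ≤ (3p + 3p) * (ι (q ℕ.+ q) * divisorSum q t)
  halfSum-≤ = begin
    halfSum p q t
      ≤⟨ ∑-mono∈ (nz q) row ⟩
    ∑ (nz q) (λ n₂ → (3p + 3p) * ∑ (upTo q) λ j → ⟦ suc j ∣ᶻ? n₂ ⟧ * ⟦ suc j ∣ᶻ? t ⟧)
      ≡⟨ sym (∑-*ˡ (3p + 3p) (nz q) _) ⟩
    (3p + 3p) * ∑ (nz q) (λ n₂ → ∑ (upTo q) λ j → ⟦ suc j ∣ᶻ? n₂ ⟧ * ⟦ suc j ∣ᶻ? t ⟧)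
      ≡⟨ cong (λ t → (3p + 3p) * t) (trans (∑-swap (nz q) (upTo q) _) (∑-cong (upTo q) λ j → sym (∑-*ʳ ⟦ suc j ∣ᶻ? t ⟧ (nz q) _))) ⟩
    (3p + 3p) * ∑ (upTo q) (λ j → ∑ (nz q) (λ n₂ → ⟦ suc j ∣ᶻ? n₂ ⟧) * ⟦ suc j ∣ᶻ? t ⟧)
      ≤⟨ *-monoˡ (3p + 3p) (nn+ 0≤3p 0≤3p) (∑-mono (upTo q) λ j →
           ℚ.*-monoʳ-≤-nonNeg ⟦ suc j ∣ᶻ? t ⟧ {{ℚ.nonNegative (0≤⟦⟧ (suc j ∣ᶻ? t))}} (multiples j)) ⟩
    (3p + 3p) * ∑ (upTo q) (λ j → ι (q ℕ.+ q) * unit j * ⟦ suc j ∣ᶻ? t ⟧)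
      ≡⟨ cong (λ t → (3p + 3p) * t) (trans
           (∑-cong (upTo q) λ j → Q.solve 3 (λ q u d → q Q.:* u Q.:* d Q.:= q Q.:* (d Q.:* u)) refl (ι (q ℕ.+ q)) (unit j) ⟦ suc j ∣ᶻ? t ⟧)
           (sym (∑-*ˡ (ι (q ℕ.+ q)) (upTo q) _))) ⟩
    (3p + 3p) * (ι (q ℕ.+ q) * divisorSum q t) ∎
    where
    open ℚ.≤-Reasoning
    multiples : ∀ j → ∑ (nz q) (λ n₂ → ⟦ suc j ∣ᶻ? n₂ ⟧) ≤ ι (q ℕ.+ q) * unit j
    multiples j = subst (_≤ ι (q ℕ.+ q) * unit j)
      (trans (Q.solve 3 (λ e s u → e Q.:* s Q.:* u Q.:= s Q.:* (e Q.:* u)) refl (ι (suc j)) s (unit j))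
        (trans (cong (λ u → s * u) (ι-unit j)) (ℚ.*-identityʳ s)))
      (*-monoʳ (unit j) (ℚ.<⇒≤ (0<unit j)) (count-multiples (suc j) q))
      where s = ∑ (nz q) λ n₂ → ⟦ suc j ∣ᶻ? n₂ ⟧

-- Pairs with |n₂| ≤ |n₁| come under `halfSum` by exchanging the two products, which replaces t by
-- -t; `divisorSum` is even, so this costs a factor 2.
solutions-total : ∀ p q t →
  (∑ (nz q) λ n₁ → ∑ (nz q) λ n₂ → solutions p t n₁ n₂) ≤ halfSum p q t + halfSum p q (ℤ.- t)
solutions-total p q t = begin
  ∑ (nz q) (λ n₁ → ∑ (nz q) λ n₂ → solutions p t n₁ n₂)
    ≤⟨ ∑-mono (nz q) (λ n₁ → ∑-mono (nz q) λ n₂ → either n₁ n₂) ⟩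
  ∑ (nz q) (λ n₁ → ∑ (nz q) λ n₂ → S n₁ n₂ + S′ n₁ n₂)
    ≡⟨ trans (∑-cong (nz q) λ n₁ → ∑-⊞ (nz q) (S n₁) (S′ n₁)) (∑-⊞ (nz q) _ _) ⟩
  ∑ (nz q) (λ n₁ → ∑ (nz q) (S n₁)) + halfSum p q (ℤ.- t)
    ≡⟨ cong (_+ halfSum p q (ℤ.- t)) (∑-swap (nz q) (nz q) S) ⟩
  halfSum p q t + halfSum p q (ℤ.- t) ∎
  where
  open ℚ.≤-Reasoning
  S S′ : ℤ → ℤ → ℚ
  S n₁ n₂ = ⟦ ℤ.∣ n₁ ∣ ℕ.≤? ℤ.∣ n₂ ∣ ⟧ * solutions p t n₁ n₂
  S′ n₁ n₂ = ⟦ ℤ.∣ n₂ ∣ ℕ.≤? ℤ.∣ n₁ ∣ ⟧ * solutions p (ℤ.- t) n₂ n₁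
  either : ∀ n₁ n₂ → solutions p t n₁ n₂ ≤ S n₁ n₂ + S′ n₁ n₂
  either n₁ n₂ with ℕ.≤-total ℤ.∣ n₁ ∣ ℤ.∣ n₂ ∣
  ... | inj₁ h = le (nn* (0≤⟦⟧ (ℤ.∣ n₂ ∣ ℕ.≤? ℤ.∣ n₁ ∣)) (solutions-nn p (ℤ.- t) n₂ n₁))
    (cong (_+ S′ n₁ n₂) (sym (trans (cong (_* solutions p t n₁ n₂) (⟦⟧-yes (ℤ.∣ n₁ ∣ ℕ.≤? ℤ.∣ n₂ ∣) h)) (ℚ.*-identityˡ (solutions p t n₁ n₂)))))
  ... | inj₂ h = le (nn* (0≤⟦⟧ (ℤ.∣ n₁ ∣ ℕ.≤? ℤ.∣ n₂ ∣)) (solutions-nn p t n₁ n₂))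
    (trans (ℚ.+-comm (solutions p t n₁ n₂) (S n₁ n₂)) (cong (λ u → S n₁ n₂ + u) (sym (trans
      (cong₂ _*_ (⟦⟧-yes (ℤ.∣ n₂ ∣ ℕ.≤? ℤ.∣ n₁ ∣) h) (sym (solutions-swap p t n₁ n₂))) (ℚ.*-identityˡ (solutions p t n₁ n₂))))))

-- The factors `d` and `n` are arguments because the shorter range must be the one called q, and
-- which factor that is varies. The constant is 2 halves times 6p times 2q.
multiplicity-≤ : ∀ {A : Set} {p q} → q ℕ.≤ p → (_≟_ : ∀ (x y : A) → Dec (x ≡ y)) →
  ∀ (Ω : List A) τ (d n : A → ℤ) → Unique Ω →
  (∀ {x y} → d x ≡ d y → n x ≡ n y → x ≡ y) → (∀ x → τ x ≡ d x ℤ.* n x) →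
  (∀ {x} → x ∈ Ω → d x ∈ nz p) → (∀ {x} → x ∈ Ω → n x ∈ nz q) →
  ∀ t → multiplicity Ω τ t ≤ ι 24 * (ι p * ι q) * divisorSum q t
multiplicity-≤ {A} {p} {q} q≤p _≟_ Ω τ d n uΩ injective factor d∈ n∈ t = begin
  multiplicity Ω τ t
    ≡⟨ ∑-cong (cartesianProduct Ω Ω) (λ xy → cong (λ u → ⟦ u ℤ.≟ t ⟧) (cong₂ ℤ._-_ (factor (proj₁ xy)) (factor (proj₂ xy)))) ⟩
  ∑ (cartesianProduct Ω Ω) (Φ ∘ f)
    ≤⟨ ∑-injective (Product.≡-dec (Product.≡-dec ℤ._≟_ ℤ._≟_) (Product.≡-dec ℤ._≟_ ℤ._≟_)) f f-injective
         (cartesianProduct Ω Ω) (cartesianProduct Γ Γ) Φ (Unique.cartesianProduct⁺ uΩ uΩ)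
         (Unique.cartesianProduct⁺ uΓ uΓ)
         (λ z∈ → let x∈ , y∈ = ∈-cartesianProduct⁻ Ω Ω z∈ in
           ∈-cartesianProduct⁺ (∈-cartesianProduct⁺ (n∈ x∈) (d∈ x∈)) (∈-cartesianProduct⁺ (n∈ y∈) (d∈ y∈)))
         (λ z → 0≤⟦⟧ (proj₂ (proj₁ z) ℤ.* proj₁ (proj₁ z) ℤ.- proj₂ (proj₂ z) ℤ.* proj₁ (proj₂ z) ℤ.≟ t)) ⟩
  ∑ (cartesianProduct Γ Γ) Φ
    ≡⟨ trans (∑-product _,_ Γ Γ Φ) (trans (∑-product _,_ (nz q) (nz p) _)
         (∑-cong (nz q) λ n₁ → trans (∑-cong (nz p) λ d₁ → ∑-product _,_ (nz q) (nz p) _)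
           (∑-swap (nz p) (nz q) _))) ⟩
  ∑ (nz q) (λ n₁ → ∑ (nz q) λ n₂ → ∑ (nz p) λ d₁ → ∑ (nz p) λ d₂ → ⟦ d₁ ℤ.* n₁ ℤ.- d₂ ℤ.* n₂ ℤ.≟ t ⟧)
    ≤⟨ ∑-mono (nz q) (λ n₁ → ∑-mono (nz q) λ n₂ → ℚ.≤-trans
         (∑-nz≤∑-window p _ λ d₁ → ∑-nn (nz p) λ d₂ → 0≤⟦⟧ (d₁ ℤ.* n₁ ℤ.- d₂ ℤ.* n₂ ℤ.≟ t))
         (∑-mono (window p) λ d₁ → ∑-nz≤∑-window p _ λ d₂ → 0≤⟦⟧ (d₁ ℤ.* n₁ ℤ.- d₂ ℤ.* n₂ ℤ.≟ t))) ⟩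
  ∑ (nz q) (λ n₁ → ∑ (nz q) λ n₂ → solutions p t n₁ n₂)
    ≤⟨ solutions-total p q t ⟩
  halfSum p q t + halfSum p q (ℤ.- t)
    ≤⟨ ℚ.+-mono-≤ (halfSum-≤ q≤p t) (halfSum-≤ q≤p (ℤ.- t)) ⟩
  (3p + 3p) * (ι (q ℕ.+ q) * divisorSum q t) + (3p + 3p) * (ι (q ℕ.+ q) * divisorSum q (ℤ.- t))
    ≡⟨ cong (λ u → (3p + 3p) * (ι (q ℕ.+ q) * divisorSum q t) + (3p + 3p) * (ι (q ℕ.+ q) * u)) (divisorSum-neg q t) ⟩
  (3p + 3p) * (ι (q ℕ.+ q) * divisorSum q t) + (3p + 3p) * (ι (q ℕ.+ q) * divisorSum q t)
    ≡⟨ cong₂ (λ x y → (x + x) * (y * divisorSum q t) + (x + x) * (y * divisorSum q t))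
         (trans (ι-+ (p ℕ.+ p) p) (cong (_+ ι p) (ι-+ p p))) (ι-+ q q) ⟩
  ((ι p + ι p + ι p) + (ι p + ι p + ι p)) * ((ι q + ι q) * divisorSum q t) + ((ι p + ι p + ι p) + (ι p + ι p + ι p)) * ((ι q + ι q) * divisorSum q t)
    ≡⟨ Q.solve 3 (λ p q s → ((p Q.:+ p Q.:+ p) Q.:+ (p Q.:+ p Q.:+ p)) Q.:* ((q Q.:+ q) Q.:* s)
         Q.:+ ((p Q.:+ p Q.:+ p) Q.:+ (p Q.:+ p Q.:+ p)) Q.:* ((q Q.:+ q) Q.:* s)
         Q.:= Q.con (ι 24) Q.:* (p Q.:* q) Q.:* s) refl (ι p) (ι q) (divisorSum q t) ⟩
  ι 24 * (ι p * ι q) * divisorSum q t ∎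
  where
  open ℚ.≤-Reasoning
  module Q = ℚ-Solver.+-*-Solver
  3p = ι (p ℕ.+ p ℕ.+ p)
  Γ = cartesianProduct (nz q) (nz p)
  uΓ = Unique.cartesianProduct⁺ (nz-unique q) (nz-unique p)
  f : A × A → (ℤ × ℤ) × (ℤ × ℤ)
  f (x , y) = (n x , d x) , (n y , d y)
  Φ : (ℤ × ℤ) × (ℤ × ℤ) → ℚ
  Φ ((n₁ , d₁) , (n₂ , d₂)) = ⟦ d₁ ℤ.* n₁ ℤ.- d₂ ℤ.* n₂ ℤ.≟ t ⟧
  f-injective : ∀ {x y} → f x ≡ f y → x ≡ y
  f-injective {x , x′} {y , y′} e = cong₂ _,_
    (injective (cong (proj₂ ∘ proj₁) e) (cong (proj₁ ∘ proj₁) e))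
    (injective (cong (proj₂ ∘ proj₂) e) (cong (proj₁ ∘ proj₂) e))

-- The pairs (i , j) are ordered by their larger index, with the diagonal counted twice. For divisor
-- sums this allows the condition on the smaller divisor to be dropped.
sq-∑-prefix : ∀ q (x : ℕ → ℚ) → (∀ j → 0ℚ ≤ x j) →
  sq (∑ (upTo q) x) ≤ ι 2 * ∑ (upTo q) λ j → x j * ∑ (upTo (suc j)) x
sq-∑-prefix zero    x 0≤x = ℚ.≤-refl
sq-∑-prefix (suc q) x 0≤x = begin
  sq (∑ (upTo (suc q)) x)                    ≡⟨ cong sq (∑-upTo-suc q x) ⟩
  sq (s + x q)                               ≤⟨ le (sq-nn (x q)) (Q.solve 2 (λ s x →
                  (s Q.:+ x) Q.:* (s Q.:+ x) Q.:+ x Q.:* x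
                  Q.:= s Q.:* s Q.:+ Q.con (ι 2) Q.:* (x Q.:* (s Q.:+ x))) refl s (x q)) ⟩
  sq s + ι 2 * (x q * (s + x q))             ≤⟨ ℚ.+-monoˡ-≤ (ι 2 * (x q * (s + x q))) (sq-∑-prefix q x 0≤x) ⟩
  ι 2 * ∑ (upTo q) F + ι 2 * (x q * (s + x q)) ≡⟨ sym (ℚ.*-distribˡ-+ (ι 2) (∑ (upTo q) F) (x q * (s + x q))) ⟩
  ι 2 * (∑ (upTo q) F + x q * (s + x q))     ≡⟨ cong (λ t → ι 2 * (∑ (upTo q) F + x q * t)) (sym (∑-upTo-suc q x)) ⟩
  ι 2 * (∑ (upTo q) F + F q)                 ≡⟨ cong (λ t → ι 2 * t) (sym (∑-upTo-suc q F)) ⟩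
  ι 2 * ∑ (upTo (suc q)) F                   ∎
  where
  open ℚ.≤-Reasoning
  module Q = ℚ-Solver.+-*-Solver
  s = ∑ (upTo q) x
  F : ℕ → ℚ
  F j = x j * ∑ (upTo (suc j)) x

harmonic : ℕ → ℚ
harmonic j = ∑ (upTo (suc j)) unit

harmonic-nn : ∀ j → 0ℚ ≤ harmonic j
harmonic-nn j = ∑-nn (upTo (suc j)) λ i → ℚ.<⇒≤ (0<unit i)

unit-difference : ∀ m → unit m ≡ unit (suc m) + unit m * unit (suc m)
unit-difference m = begin
  z                                    ≡⟨ trans (sym (ℚ.*-identityʳ z)) (cong (λ t → z * t) (sym (ι-unit (suc m)))) ⟩
  z * (ι (suc (suc m)) * y)            ≡⟨ cong (λ t → z * (t * y)) (ι-suc (suc m)) ⟩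
  z * ((1ℚ + ι (suc m)) * y)           ≡⟨ Q.solve 3 (λ z i y → z Q.:* ((Q.con 1ℚ Q.:+ i) Q.:* y) Q.:= i Q.:* z Q.:* y Q.:+ z Q.:* y) refl z (ι (suc m)) y ⟩
  ι (suc m) * z * y + z * y            ≡⟨ cong (λ t → t * y + z * y) (ι-unit m) ⟩
  1ℚ * y + z * y                       ≡⟨ cong (_+ z * y) (ℚ.*-identityˡ y) ⟩
  y + z * y                            ∎
  where
  open ≡-Reasoning
  module Q = ℚ-Solver.+-*-Solver
  z = unit m
  y = unit (suc m)

-- The telescoping term (Hₘ + 2)/m dominates the tail of Σ Hₑ/e².
harmonic-series : ∀ m →
  (∑ (upTo (suc m)) λ j → sq (unit j) * harmonic j) + (harmonic m + ι 2) * unit m ≤ ι 4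
harmonic-series zero    = ℚ.≤-reflexive refl
harmonic-series (suc m) = ℚ.≤-trans (begin
  ∑ (upTo (suc (suc m))) F + (harmonic (suc m) + ι 2) * y
    ≡⟨ cong₂ (λ s h → s + (h + ι 2) * y) (∑-upTo-suc (suc m) F) (∑-upTo-suc (suc m) unit) ⟩
  S + sq y * harmonic (suc m) + (h + y + ι 2) * y
    ≡⟨ cong (λ t → S + sq y * t + (h + y + ι 2) * y) (∑-upTo-suc (suc m) unit) ⟩
  S + sq y * (h + y) + (h + y + ι 2) * y
    ≤⟨ le (nn+ (nn* 0≤h (nn* 0≤y 0≤z-y)) (nn+ (nn* 0≤y 0≤z-y) (nn* 0≤y (nn+ 0≤z-y (nn* 0≤y 0≤1-y)))))
         (Q.solve 4 (λ S h y z → S Q.:+ y Q.:* y Q.:* (h Q.:+ y) Q.:+ (h Q.:+ y Q.:+ Q.con (ι 2)) Q.:* y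
             Q.:+ (h Q.:* (y Q.:* (z Q.:- y)) Q.:+ (y Q.:* (z Q.:- y) Q.:+ y Q.:* ((z Q.:- y) Q.:+ y Q.:* (Q.con 1ℚ Q.:- y))))
           Q.:= S Q.:+ (h Q.:+ Q.con (ι 2)) Q.:* (y Q.:+ z Q.:* y)) refl S h y z) ⟩
  S + (h + ι 2) * (y + z * y)
    ≡⟨ cong (λ t → S + (h + ι 2) * t) (sym (unit-difference m)) ⟩
  S + (h + ι 2) * z ∎)
  (harmonic-series m)
  where
  open ℚ.≤-Reasoning
  module Q = ℚ-Solver.+-*-Solver
  F : ℕ → ℚ
  F j = sq (unit j) * harmonic j
  S = ∑ (upTo (suc m)) F
  h = harmonic m
  y = unit (suc m)
  z = unit m
  0≤h = harmonic-nn m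
  0≤y = ℚ.<⇒≤ (0<unit (suc m))
  0≤1-y = nn-sub (unit≤1 (suc m))
  0≤z-y : 0ℚ ≤ z - y
  0≤z-y = nn-sub {y} {z} (le {y} {z} {z * y} (nn* (ℚ.<⇒≤ (0<unit m)) 0≤y) (sym (unit-difference m)))

harmonic-series-≤4 : ∀ q → (∑ (upTo q) λ j → sq (unit j) * harmonic j) ≤ ι 4
harmonic-series-≤4 zero    = 0≤ι 4
harmonic-series-≤4 (suc m) = ℚ.≤-trans
  (le (nn* (nn+ (harmonic-nn m) (0≤ι 2)) (ℚ.<⇒≤ (0<unit m))) refl) (harmonic-series m)

-- Of two divisors of t only divisibility by the larger, e, is kept; the smaller ones then sum to a
-- harmonic number. The window has at most (2N + q)/e multiples of e, so what is left is the
-- convergent series Σ Hₑ/e², and no logarithm appears.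
divisorSum-second-moment : ∀ q N →
  ∑ (window N) (sq ∘ divisorSum q) ≤ ι 8 * ι (N ℕ.+ N ℕ.+ q)
divisorSum-second-moment q N = begin
  ∑ (window N) (sq ∘ divisorSum q)
    ≤⟨ ∑-mono (window N) pointwise ⟩
  ∑ (window N) (λ t → ι 2 * ∑ (upTo q) λ j → ⟦ suc j ∣ᶻ? t ⟧ * (unit j * harmonic j))
    ≡⟨ trans (sym (∑-*ˡ (ι 2) (window N) _)) (cong (λ s → ι 2 * s) (trans (∑-swap (window N) (upTo q) _)
         (∑-cong (upTo q) λ j → sym (∑-*ʳ (unit j * harmonic j) (window N) _)))) ⟩
  ι 2 * ∑ (upTo q) (λ j → ∑ (window N) (λ t → ⟦ suc j ∣ᶻ? t ⟧) * (unit j * harmonic j))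
    ≤⟨ ℚ.*-monoˡ-≤-nonNeg (ι 2) (∑-mono∈ (upTo q) λ {j} j∈ →
         *-monoʳ (unit j * harmonic j) (nn* (ℚ.<⇒≤ (0<unit j)) (harmonic-nn j)) (multiples j (∈-upTo⁻ j∈))) ⟩
  ι 2 * ∑ (upTo q) (λ j → L * unit j * (unit j * harmonic j))
    ≡⟨ cong (λ s → ι 2 * s) (trans
         (∑-cong (upTo q) λ j → Q.solve 3 (λ l u h → l Q.:* u Q.:* (u Q.:* h) Q.:= l Q.:* (u Q.:* u Q.:* h)) refl L (unit j) (harmonic j))
         (sym (∑-*ˡ L (upTo q) _))) ⟩
  ι 2 * (L * ∑ (upTo q) λ j → sq (unit j) * harmonic j)
    ≤⟨ ℚ.*-monoˡ-≤-nonNeg (ι 2) (*-monoˡ L (0≤ι (N ℕ.+ N ℕ.+ q)) (harmonic-series-≤4 q)) ⟩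
  ι 2 * (L * ι 4)
    ≡⟨ Q.solve 1 (λ l → Q.con (ι 2) Q.:* (l Q.:* Q.con (ι 4)) Q.:= Q.con (ι 8) Q.:* l) refl L ⟩
  ι 8 * L ∎
  where
  open ℚ.≤-Reasoning
  module Q = ℚ-Solver.+-*-Solver
  L = ι (N ℕ.+ N ℕ.+ q)
  pointwise : ∀ t → sq (divisorSum q t) ≤ ι 2 * ∑ (upTo q) λ j → ⟦ suc j ∣ᶻ? t ⟧ * (unit j * harmonic j)
  pointwise t = ℚ.≤-trans
    (sq-∑-prefix q (λ j → ⟦ suc j ∣ᶻ? t ⟧ * unit j) λ j → nn* (0≤⟦⟧ (suc j ∣ᶻ? t)) (ℚ.<⇒≤ (0<unit j)))
    (ℚ.*-monoˡ-≤-nonNeg (ι 2) (∑-mono (upTo q) λ j → subst (⟦ suc j ∣ᶻ? t ⟧ * unit j * ∑ (upTo (suc j)) (λ i → ⟦ suc i ∣ᶻ? t ⟧ * unit i) ≤_)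
      (ℚ.*-assoc ⟦ suc j ∣ᶻ? t ⟧ (unit j) (harmonic j))
      (*-monoˡ (⟦ suc j ∣ᶻ? t ⟧ * unit j) (nn* (0≤⟦⟧ (suc j ∣ᶻ? t)) (ℚ.<⇒≤ (0<unit j)))
        (∑-mono (upTo (suc j)) λ i → 1*≤ (ℚ.<⇒≤ (0<unit i)) (⟦⟧≤1 (suc i ∣ᶻ? t))))))
  multiples : ∀ j → j ℕ.< q → ∑ (window N) (λ t → ⟦ suc j ∣ᶻ? t ⟧) ≤ L * unit j
  multiples j j<q = subst (_≤ L * unit j)
    (trans (Q.solve 3 (λ e s u → e Q.:* s Q.:* u Q.:= s Q.:* (e Q.:* u)) refl (ι (suc j)) s (unit j))
      (trans (cong (λ u → s * u) (ι-unit j)) (ℚ.*-identityʳ s)))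
    (*-monoʳ (unit j) (ℚ.<⇒≤ (0<unit j)) (ℚ.≤-trans
      (spaced-window (suc j) N (suc j ∣ᶻ?_) λ {x} {y} p q → ℤ∣.∣m∣n⇒∣m-n p q)
      (subst (_≤ L) (ι-+ (N ℕ.+ N) (suc j)) (ι-mono (ℕ.+-monoʳ-≤ (N ℕ.+ N) j<q)))))
    where s = ∑ (window N) λ t → ⟦ suc j ∣ᶻ? t ⟧

-- Degenerate vectors and normalised cardinalities

normSq-∑-const : {A : Set} (xs : List A) (G : A → ℚ[i]) (Z : ℚ) → (∀ x → normSq (G x) ≤ Z) →
  normSq (∑ᵍ xs G) ≤ sq (ι (length xs)) * Z
normSq-∑-const xs G Z h = ℚ.≤-trans (normSq-∑ xs G)
  (ℚ.≤-trans (*-monoˡ (ι (length xs)) (0≤ι (length xs)) (∑-≤-const xs Z h))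
    (ℚ.≤-reflexive (sym (ℚ.*-assoc (ι (length xs)) (ι (length xs)) Z))))

ι-length-product : {A B C : Set} (f : A → B → C) (xs : List A) (ys : List B) →
  ι (length (cartesianProductWith f xs ys)) ≡ ι (length xs) * ι (length ys)
ι-length-product f xs ys = trans (ι-length (cartesianProductWith f xs ys))
  (trans (∑-product f xs ys (const 1ℚ)) (trans (∑-cong xs λ _ → sym (ι-length ys)) (∑-const xs (ι (length ys)))))

ι-length-++ : {A : Set} (xs ys : List A) → ι (length (xs ++ ys)) ≡ ι (length xs) + ι (length ys)
ι-length-++ xs ys = trans (ι-length (xs ++ ys)) (trans (∑-++ xs ys (const 1ℚ))
  (cong₂ _+_ (sym (ι-length xs)) (sym (ι-length ys))))

length-pairs-≤ : {A B : Set} {v w α β : ℚ} (xs : List A) (ys : A → List B) → 0ℚ ≤ v → 0ℚ ≤ w → 0ℚ ≤ β →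
  v * ι (length xs) ≤ α → (∀ x → w * ι (length (ys x)) ≤ β) →
  v * w * ι (length (pairs xs ys)) ≤ α * β
length-pairs-≤ {v = v} {w} {α} {β} xs ys 0≤v 0≤w 0≤β hv hw = begin
  v * w * ι (length (pairs xs ys))                ≡⟨ cong (λ t → v * w * t) (trans (ι-length (pairs xs ys))
                  (trans (∑-pairs xs ys (const 1ℚ)) (∑-cong xs λ x → sym (ι-length (ys x))))) ⟩
  v * w * ∑ xs (λ x → ι (length (ys x)))          ≡⟨ trans (ℚ.*-assoc v w _) (cong (λ t → v * t) (∑-*ˡ w xs _)) ⟩
  v * ∑ xs (λ x → w * ι (length (ys x)))          ≤⟨ *-monoˡ v 0≤v (∑-≤-const xs β hw) ⟩
  v * (ι (length xs) * β)                         ≡⟨ sym (ℚ.*-assoc v (ι (length xs)) β) ⟩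
  v * ι (length xs) * β                           ≤⟨ *-monoʳ β 0≤β hv ⟩
  α * β                                           ∎
  where open ℚ.≤-Reasoning

module _ {A : Set} {P : A → Set} (P? : ∀ a → Dec (P a)) (xs : List A) where

  -- Bad vectors are enumerated by their first failing entry. Each is thereby listed with the right
  -- multiplicity, and the splitting of a sum is an identity.
  badVecs : ∀ s → List (Vec A s)
  badVecs zero    = []
  badVecs (suc s) = cartesianProductWith _∷_ (filter (¬? ∘ P?) xs) (vecs xs s)
    ++ cartesianProductWith _∷_ (filter P? xs) (badVecs s)

  ∑ᵍ-vecs-split : ∀ s (F : Vec A s → ℚ[i]) →
    ∑ᵍ (vecs xs s) F ≡ ∑ᵍ (vecs (filter P? xs) s) F ⊕ ∑ᵍ (badVecs s) F
  ∑ᵍ-vecs-split zero    F = sym (⊕-identityʳ _)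
  ∑ᵍ-vecs-split (suc s) F = begin
    ∑ᵍ (vecs xs (suc s)) F
      ≡⟨ trans (∑ᵍ-vecs xs s F) (∑ᵍ.∑-split P? xs _) ⟩
    ∑ᵍ good (λ x → ∑ᵍ (vecs xs s) λ v → F (x ∷ v)) ⊕ B
      ≡⟨ cong (_⊕ B) (trans (∑ᵍ.∑-cong good λ x → ∑ᵍ-vecs-split s λ v → F (x ∷ v)) (∑ᵍ.∑-⊞ good _ _)) ⟩
    ∑ᵍ good (λ x → ∑ᵍ (vecs good s) λ v → F (x ∷ v)) ⊕ C ⊕ B
      ≡⟨ cong (λ z → z ⊕ C ⊕ B) (sym (∑ᵍ-vecs good s F)) ⟩
    ∑ᵍ (vecs good (suc s)) F ⊕ C ⊕ B
      ≡⟨ trans (⊕-assoc _ C B) (cong (∑ᵍ (vecs good (suc s)) F ⊕_) (⊕-comm C B)) ⟩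
    ∑ᵍ (vecs good (suc s)) F ⊕ (B ⊕ C)
      ≡⟨ cong (∑ᵍ (vecs good (suc s)) F ⊕_) (sym (trans (∑ᵍ.∑-++ (cartesianProductWith _∷_ bad (vecs xs s)) _ F)
           (cong₂ _⊕_ (∑ᵍ.∑-product _∷_ bad (vecs xs s) F) (∑ᵍ.∑-product _∷_ good (badVecs s) F)))) ⟩
    ∑ᵍ (vecs good (suc s)) F ⊕ ∑ᵍ (badVecs (suc s)) F ∎
    where
    open ≡-Reasoning
    good = filter P? xs
    bad = filter (¬? ∘ P?) xs
    B = ∑ᵍ bad λ x → ∑ᵍ (vecs xs s) λ v → F (x ∷ v)
    C = ∑ᵍ good λ x → ∑ᵍ (badVecs s) λ v → F (x ∷ v)

  -- A union bound over the s positions of the first failing entry, each of density β. The other s -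
  -- 1 entries contribute powers of α, padded to α^s by means of 1 ≤ α.
  length-badVecs-≤ : ∀ {v α β} → 0ℚ ≤ v → 1ℚ ≤ α → v * ι (length xs) ≤ α →
    v * ι (length (filter (¬? ∘ P?) xs)) ≤ β → ∀ s →
    v ^ℚ s * ι (length (badVecs s)) ≤ ι s * α ^ℚ s * β
  length-badVecs-≤ {v} {α} {β} 0≤v 1≤α hα hβ zero = ℚ.≤-reflexive
    (solve 1 (λ b → con 1ℚ :* con 0ℚ := con 0ℚ :* con 1ℚ :* b) refl β)
    where open ℚ-Solver.+-*-Solver
  length-badVecs-≤ {v} {α} {β} 0≤v 1≤α hα hβ (suc s) = begin
    v * p * ι (length (badVecs (suc s)))
      ≡⟨ cong (λ t → v * p * t) (trans (ι-length-++ (cartesianProductWith _∷_ bad (vecs xs s)) _)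
           (cong₂ _+_ (ι-length-product _∷_ bad (vecs xs s)) (ι-length-product _∷_ (filter P? xs) (badVecs s)))) ⟩
    v * p * (ι (length bad) * V + G * B)
      ≡⟨ Q.solve 6 (λ v p b V G B → v Q.:* p Q.:* (b Q.:* V Q.:+ G Q.:* B)
           Q.:= p Q.:* V Q.:* (v Q.:* b) Q.:+ v Q.:* G Q.:* (p Q.:* B)) refl v p (ι (length bad)) V G B ⟩
    p * V * (v * ι (length bad)) + v * G * (p * B)
      ≤⟨ ℚ.+-mono-≤
           (mono* (nn* 0≤p (0≤ι (length (vecs xs s)))) (nn* 0≤v (0≤ι (length bad))) (length-vecs-≤ xs 0≤v hα s) hβ)
           (mono* (nn* 0≤v (0≤ι (length (filter P? xs)))) (nn* 0≤p (0≤ι (length (badVecs s))))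
             (ℚ.≤-trans (*-monoˡ v 0≤v (ι-mono (length-filter P? xs))) hα)
             (length-badVecs-≤ 0≤v 1≤α hα hβ s)) ⟩
    α ^ℚ s * β + α * (ι s * α ^ℚ s * β)
      ≤⟨ ℚ.+-monoˡ-≤ (α * (ι s * α ^ℚ s * β)) (le {α ^ℚ s * β} {α * (α ^ℚ s * β)} {(α - 1ℚ) * (α ^ℚ s * β)} (nn* (nn-sub 1≤α) (nn* (^ℚ-nn 0≤α s) 0≤β))
           (Q.solve 2 (λ a x → x Q.:+ (a Q.:- Q.con 1ℚ) Q.:* x Q.:= a Q.:* x) refl α (α ^ℚ s * β))) ⟩
    α * (α ^ℚ s * β) + α * (ι s * α ^ℚ s * β)
      ≡⟨ Q.solve 4 (λ a q b s → a Q.:* (q Q.:* b) Q.:+ a Q.:* (s Q.:* q Q.:* b)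
           Q.:= (Q.con 1ℚ Q.:+ s) Q.:* (a Q.:* q) Q.:* b) refl α (α ^ℚ s) β (ι s) ⟩
    (1ℚ + ι s) * (α * α ^ℚ s) * β
      ≡⟨ cong (λ t → t * (α * α ^ℚ s) * β) (sym (ι-suc s)) ⟩
    ι (suc s) * α ^ℚ suc s * β ∎
    where
    open ℚ.≤-Reasoning
    module Q = ℚ-Solver.+-*-Solver
    p = v ^ℚ s
    0≤p = ^ℚ-nn 0≤v s
    0≤α = ℚ.≤-trans 0≤1 1≤α
    0≤β = ℚ.≤-trans (nn* 0≤v (0≤ι (length (filter (¬? ∘ P?) xs)))) hβ
    bad = filter (¬? ∘ P?) xs
    V = ι (length (vecs xs s))
    G = ι (length (filter P? xs))
    B = ι (length (badVecs s))

∑ᵍ-vecs-product : {A B : Set} (xs : List A) (ys : List B) → ∀ s (F : Vec A s → Vec B s → ℚ[i]) →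
  (∑ᵍ (vecs xs s) λ u → ∑ᵍ (vecs ys s) (F u)) ≡
  ∑ᵍ (vecs (cartesianProduct xs ys) s) λ ω → F (Vec.map proj₁ ω) (Vec.map proj₂ ω)
∑ᵍ-vecs-product xs ys zero    F = ⊕-identityʳ (F [] [] ⊕ 0ᵍ)
∑ᵍ-vecs-product xs ys (suc s) F = begin
  ∑ᵍ (vecs xs (suc s)) (λ u → ∑ᵍ (vecs ys (suc s)) (F u))
    ≡⟨ trans (∑ᵍ-vecs xs s _) (∑ᵍ.∑-cong xs λ x → ∑ᵍ.∑-cong (vecs xs s) λ u → ∑ᵍ-vecs ys s (F (x ∷ u))) ⟩
  ∑ᵍ xs (λ x → ∑ᵍ (vecs xs s) λ u → ∑ᵍ ys λ y → ∑ᵍ (vecs ys s) λ v → F (x ∷ u) (y ∷ v))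
    ≡⟨ ∑ᵍ.∑-cong xs (λ x → trans (∑ᵍ.∑-swap (vecs xs s) ys _)
         (∑ᵍ.∑-cong ys λ y → ∑ᵍ-vecs-product xs ys s λ u v → F (x ∷ u) (y ∷ v))) ⟩
  ∑ᵍ xs (λ x → ∑ᵍ ys λ y → ∑ᵍ (vecs (cartesianProduct xs ys) s) λ ω → F (x ∷ Vec.map proj₁ ω) (y ∷ Vec.map proj₂ ω))
    ≡⟨ sym (trans (∑ᵍ-vecs (cartesianProduct xs ys) s _) (∑ᵍ.∑-product _,_ xs ys _)) ⟩
  ∑ᵍ (vecs (cartesianProduct xs ys) (suc s)) (λ ω → F (Vec.map proj₁ ω) (Vec.map proj₂ ω)) ∎
  where open ≡-Reasoning

unit-scale : ∀ {n} c M → n ℕ.≤ c ℕ.* suc M → unit M * ι n ≤ ι c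
unit-scale {n} c M h = ℚ.≤-trans
  (*-monoˡ (unit M) (ℚ.<⇒≤ (0<unit M)) (ι-mono h))
  (ℚ.≤-reflexive (trans (cong (λ t → unit M * t) (ι-* c (suc M)))
    (trans (solve 3 (λ u c m → u :* (c :* m) := c :* (m :* u)) refl (unit M) (ι c) (ι (suc M)))
      (trans (cong (λ t → ι c * t) (ι-unit M)) (ℚ.*-identityʳ (ι c))))))
  where open ℚ-Solver.+-*-Solver

1+2n+2n≤5n : ∀ n → suc ((suc n ℕ.+ suc n) ℕ.+ (suc n ℕ.+ suc n)) ℕ.≤ 5 ℕ.* suc n
1+2n+2n≤5n n = subst (suc ((suc n ℕ.+ suc n) ℕ.+ (suc n ℕ.+ suc n)) ℕ.≤_)
  (solve 1 (λ n → n :+ ((n :+ n) :+ (n :+ n)) := con 5 :* n) refl (suc n))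
  (ℕ.+-monoˡ-≤ ((suc n ℕ.+ suc n) ℕ.+ (suc n ℕ.+ suc n)) (s≤s {0} {n} z≤n))
  where open ℕ-Solver.+-*-Solver

1+2n≤3n : ∀ n → suc (suc n ℕ.+ suc n) ℕ.≤ 3 ℕ.* suc n
1+2n≤3n n = subst (suc (suc n ℕ.+ suc n) ℕ.≤_)
  (solve 1 (λ n → n :+ (n :+ n) := con 3 :* n) refl (suc n))
  (ℕ.+-monoˡ-≤ (suc n ℕ.+ suc n) (s≤s {0} {n} z≤n))
  where open ℕ-Solver.+-*-Solver

-- The multiplicity is at most 24 pq times the divisor sum with pq ≤ 4AM, and the second moment of
-- the divisor sum on the window of radius 2M is at most 8(4M + q) with q ≤ 2AM. The three powers of
-- M cancel against `w ^ℚ 3`.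
energyConst : ℕ → ℚ
energyConst A = sq (ι 24 * ι (4 ℕ.* A)) * (ι 8 * ι (4 ℕ.+ 2 ℕ.* A))

-- Here `a` is the coefficient bᵢ of g. An element (b , n) of `Ω` is another coefficient with its
-- difference variable, and `τ` is the resulting step in which g is differentiated. The hypothesis T
-- H ≤ A M says that coefficients are of order at most M/H.
module Directions (A T H′ M′ : ℕ) (TH≤AM : T ℕ.* suc H′ ℕ.≤ A ℕ.* suc M′) (H≤M : suc H′ ℕ.≤ suc M′)
  (a : ℤ) (a≤T : ℤ.∣ a ∣ ℕ.≤ T) where

  private
    H = suc H′
    M = suc M′
    w = unit M′
    0≤w = ℚ.<⇒≤ (0<unit M′)

  other? : ∀ b → Dec (¬ b ≡ a)
  other? b = ¬? (b ℤ.≟ a)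

  others : List ℤ
  others = filter other? (window T)

  Ω : List (ℤ × ℤ)
  Ω = cartesianProduct others (nz (H ℕ.+ H))

  τ : ℤ × ℤ → ℤ
  τ (b , n) = ℤ.- ((b ℤ.- a) ℤ.* n)

  private
    Ω-unique : Unique Ω
    Ω-unique = Unique.cartesianProduct⁺ (Unique.filter⁺ other? (window-unique T)) (nz-unique (H ℕ.+ H))

    d n : ℤ × ℤ → ℤ
    d (b , _) = a ℤ.- b
    n (_ , n) = n

    factor : ∀ x → τ x ≡ d x ℤ.* n x
    factor (b , n) = solve 3 (λ a b n → :- ((b :- a) :* n) := (a :- b) :* n) refl a b n
      where open ℤ-Solver.+-*-Solver using (solve; _:=_; _:*_; _:-_; :-_)

    back : ∀ b → a ℤ.- (a ℤ.- b) ≡ b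
    back b = solve 2 (λ a b → a :- (a :- b) := b) refl a b
      where open ℤ-Solver.+-*-Solver using (solve; _:=_; _:-_)

    injective : ∀ {x y} → d x ≡ d y → n x ≡ n y → x ≡ y
    injective {b , _} {c , _} e refl =
      cong (_, _) (trans (sym (back b)) (trans (cong (λ t → a ℤ.- t) e) (back c)))

    d∈ : ∀ {x} → x ∈ Ω → d x ∈ nz (T ℕ.+ T)
    d∈ {b , n} x∈ =
      let b∈ , _ = ∈-cartesianProduct⁻ others (nz (H ℕ.+ H)) x∈
          b∈T , b≢a = ∈-filter⁻ other? b∈
      in ∈-nz⁺ (ℕ.≤-trans (ℤ.∣i-j∣≤∣i∣+∣j∣ a b) (ℕ.+-mono-≤ a≤T (∈-window⁻ b∈T)))
           λ e → b≢a (trans (sym (back b)) (trans (cong (λ t → a ℤ.- t) e) (ℤ.+-identityʳ a)))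

    n∈ : ∀ {x} → x ∈ Ω → n x ∈ nz (H ℕ.+ H)
    n∈ x∈ = proj₂ (∈-cartesianProduct⁻ others (nz (H ℕ.+ H)) x∈)

    second-moment : ∀ p q → (∀ t → multiplicity Ω τ t ≤ ι 24 * (ι p * ι q) * divisorSum q t) →
      p ℕ.* q ℕ.≤ 4 ℕ.* A ℕ.* M → q ℕ.≤ 2 ℕ.* A ℕ.* M →
      w ^ℚ 3 * ∑ (window (M ℕ.+ M)) (sq ∘ multiplicity Ω τ) ≤ energyConst A
    second-moment p q h pq≤ q≤ = begin
      w ^ℚ 3 * ∑ (window N) (sq ∘ multiplicity Ω τ)
        ≤⟨ *-monoˡ (w ^ℚ 3) (^ℚ-nn 0≤w 3) (ℚ.≤-trans
             (∑-mono (window N) λ t → subst (sq (multiplicity Ω τ t) ≤_)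
               (Q.solve 2 (λ k s → (k Q.:* s) Q.:* (k Q.:* s) Q.:= k Q.:* k Q.:* (s Q.:* s)) refl (ι 24 * (ι p * ι q)) (divisorSum q t))
               (sq-mono (multiplicity-nn Ω τ t) (h t)))
             (ℚ.≤-reflexive (sym (∑-*ˡ (sq (ι 24 * (ι p * ι q))) (window N) _)))) ⟩
      w ^ℚ 3 * (sq (ι 24 * (ι p * ι q)) * ∑ (window N) (sq ∘ divisorSum q))
        ≤⟨ *-monoˡ (w ^ℚ 3) (^ℚ-nn 0≤w 3)
             (*-monoˡ (sq (ι 24 * (ι p * ι q))) (sq-nn (ι 24 * (ι p * ι q)))
               (divisorSum-second-moment q N)) ⟩
      w ^ℚ 3 * (sq (ι 24 * (ι p * ι q)) * (ι 8 * ι (N ℕ.+ N ℕ.+ q)))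
        ≡⟨ Q.solve 3 (λ w x y → (w Q.:* (w Q.:* (w Q.:* Q.con 1ℚ))) Q.:* ((Q.con (ι 24) Q.:* x) Q.:* (Q.con (ι 24) Q.:* x) Q.:* (Q.con (ι 8) Q.:* y))
             Q.:= (Q.con (ι 24) Q.:* (w Q.:* x)) Q.:* (Q.con (ι 24) Q.:* (w Q.:* x)) Q.:* (Q.con (ι 8) Q.:* (w Q.:* y)))
             refl w (ι p * ι q) (ι (N ℕ.+ N ℕ.+ q)) ⟩
      sq (ι 24 * (w * (ι p * ι q))) * (ι 8 * (w * ι (N ℕ.+ N ℕ.+ q)))
        ≤⟨ mono* (sq-nn (ι 24 * (w * (ι p * ι q)))) (nn* (0≤ι 8) (nn* 0≤w (0≤ι (N ℕ.+ N ℕ.+ q))))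
             (sq-mono (nn* (0≤ι 24) (nn* 0≤w (nn* (0≤ι p) (0≤ι q))))
               (ℚ.*-monoˡ-≤-nonNeg (ι 24) (subst (λ t → w * t ≤ ι (4 ℕ.* A)) (ι-* p q) (unit-scale (4 ℕ.* A) M′ pq≤))))
             (ℚ.*-monoˡ-≤-nonNeg (ι 8) (unit-scale (4 ℕ.+ 2 ℕ.* A) M′ size)) ⟩
      energyConst A ∎
      where
      open ℚ.≤-Reasoning
      module Q = ℚ-Solver.+-*-Solver
      N = M ℕ.+ M
      size : N ℕ.+ N ℕ.+ q ℕ.≤ (4 ℕ.+ 2 ℕ.* A) ℕ.* M
      size = subst (N ℕ.+ N ℕ.+ q ℕ.≤_)
        (solve 2 (λ A M → (M :+ M) :+ (M :+ M) :+ con 2 :* A :* M := (con 4 :+ con 2 :* A) :* M) refl A M)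
        (ℕ.+-monoʳ-≤ (N ℕ.+ N) q≤)
        where open ℕ-Solver.+-*-Solver

    double≤ : ∀ {x} → x ℕ.≤ A ℕ.* M → x ℕ.+ x ℕ.≤ 2 ℕ.* A ℕ.* M
    double≤ {x} h = subst (x ℕ.+ x ℕ.≤_) (solve 2 (λ A M → A :* M :+ A :* M := con 2 :* A :* M) refl A M)
      (ℕ.+-mono-≤ h h)
      where open ℕ-Solver.+-*-Solver

    4TH≤ : (T ℕ.+ T) ℕ.* (H ℕ.+ H) ℕ.≤ 4 ℕ.* A ℕ.* M
    4TH≤ = subst₂ ℕ._≤_
      (solve 2 (λ T H → con 4 :* (T :* H) := (T :+ T) :* (H :+ H)) refl T H)
      (sym (ℕ.*-assoc 4 A M)) (ℕ.*-monoʳ-≤ 4 TH≤AM)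
      where open ℕ-Solver.+-*-Solver

  -- The coefficients and the difference variables may each have the longer range. The shorter one
  -- plays the role of q, and since the other is at least 1, the product bound T H ≤ A M also gives
  -- q ≤ 2AM.
  energy : w ^ℚ 3 * ∑ (window (M ℕ.+ M)) (sq ∘ multiplicity Ω τ) ≤ energyConst A
  energy with ℕ.≤-total H T
  ... | inj₁ H≤T = second-moment (T ℕ.+ T) (H ℕ.+ H)
    (multiplicity-≤ (ℕ.+-mono-≤ H≤T H≤T) (Product.≡-dec ℤ._≟_ ℤ._≟_) Ω τ d n Ω-unique
      (λ {x} {y} → injective {x} {y}) factor (λ {x} → d∈ {x}) (λ {x} → n∈ {x}))
    4TH≤ (double≤ (ℕ.≤-trans (ℕ.m≤n*m H T {{ℕ.>-nonZero (ℕ.≤-trans (s≤s z≤n) H≤T)}}) TH≤AM))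
  ... | inj₂ T≤H = second-moment (H ℕ.+ H) (T ℕ.+ T)
    (multiplicity-≤ (ℕ.+-mono-≤ T≤H T≤H) (Product.≡-dec ℤ._≟_ ℤ._≟_) Ω τ n d Ω-unique
      (λ {x} {y} e₁ e₂ → injective {x} {y} e₂ e₁) (λ x → trans (factor x) (ℤ.*-comm (d x) (n x))) (λ {x} → n∈ {x}) (λ {x} → d∈ {x}))
    (subst (ℕ._≤ 4 ℕ.* A ℕ.* M) (ℕ.*-comm (T ℕ.+ T) (H ℕ.+ H)) 4TH≤)
    (double≤ (ℕ.≤-trans (ℕ.m≤m*n T H) TH≤AM))

  H[2T+1]≤ : suc (T ℕ.+ T) ℕ.* H ℕ.≤ (A ℕ.+ A ℕ.+ 1) ℕ.* M
  H[2T+1]≤ = subst₂ ℕ._≤_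
    (solve 2 (λ T H → T :* H :+ T :* H :+ con 1 :* H := (con 1 :+ (T :+ T)) :* H) refl T H)
    (solve 2 (λ A M → A :* M :+ A :* M :+ con 1 :* M := (A :+ A :+ con 1) :* M) refl A M)
    (ℕ.+-mono-≤ (ℕ.+-mono-≤ TH≤AM TH≤AM) (ℕ.*-monoʳ-≤ 1 H≤M))
    where open ℕ-Solver.+-*-Solver

  size-Ω : w * ι (length Ω) ≤ ι (5 ℕ.* (A ℕ.+ A ℕ.+ 1))
  size-Ω = ℚ.≤-trans
    (*-monoˡ w 0≤w (ℚ.≤-trans
      (ℚ.≤-reflexive (ι-length-product _,_ others (nz (H ℕ.+ H))))
      (ℚ.≤-trans (mono* (0≤ι (length others)) (0≤ι (length (nz (H ℕ.+ H))))
          (ι-mono (ℕ.≤-trans (length-filter other? (window T)) (ℕ.≤-reflexive (length-window T))))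
          (ι-mono (ℕ.≤-trans (length-filter nonzero? (window (H ℕ.+ H)))
            (ℕ.≤-trans (ℕ.≤-reflexive (length-window (H ℕ.+ H))) (1+2n+2n≤5n H′)))))
        (ℚ.≤-reflexive (sym (ι-* (suc (T ℕ.+ T)) (5 ℕ.* H)))))))
    (unit-scale (5 ℕ.* (A ℕ.+ A ℕ.+ 1)) M′ (subst₂ ℕ._≤_
      (solve 2 (λ t H → con 5 :* (t :* H) := t :* (con 5 :* H)) refl (suc (T ℕ.+ T)) H)
      (sym (ℕ.*-assoc 5 (A ℕ.+ A ℕ.+ 1) M)) (ℕ.*-monoʳ-≤ 5 H[2T+1]≤)))
    where open ℕ-Solver.+-*-Solver

-- The inequality over ℚ[i]

^ℚ-* : ∀ p q n → (p * q) ^ℚ n ≡ p ^ℚ n * q ^ℚ n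
^ℚ-* p q zero    = refl
^ℚ-* p q (suc n) = trans (cong (λ t → p * q * t) (^ℚ-* p q n))
  (solve 4 (λ p q x y → p :* q :* (x :* y) := p :* x :* (q :* y)) refl p q (p ^ℚ n) (q ^ℚ n))
  where open ℚ-Solver.+-*-Solver

^ℚ-pos : ∀ {q} → 0ℚ < q → ∀ n → 0ℚ < q ^ℚ n
^ℚ-pos h zero    = 0<1
^ℚ-pos h (suc n) = pos* h (^ℚ-pos h n)

meanConst-pos : ∀ j {c} → 0ℚ < c → 0ℚ < meanConst j c
meanConst-pos zero    h = 0<1
meanConst-pos (suc j) h = pos* (tower-pos j h) (meanConst-pos j h)

vonNeumannConst-pos : ∀ {a b} → 0ℚ < a → 0ℚ < b → ∀ r → 0ℚ < vonNeumannConst a b r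
vonNeumannConst-pos 0<a 0<b zero    = 0<a
vonNeumannConst-pos 0<a 0<b (suc r) =
  pos* (pos* (tower-pos r (pos* (pos* 0<a 0<a) 0<b)) (meanConst-pos r 0<b)) (vonNeumannConst-pos 0<a 0<b r)

module Constants (A r : ℕ) where

  s : ℕ
  s = suc r

  ¼ : ℚ
  ¼ = ½ * ½

  -- `α` bounds the normalised number of values of one coefficient and `αΩ` that of the pairs (b ,
  -- n). `Kᵦ` belongs to vectors with some bⱼ = bᵢ, `K₂` to vectors with some nⱼ = 0, `K₁` to the
  -- von Neumann step and `K₃` to the passage to the Gowers norm. The factors 3 and 5 arise from 2H
  -- + 1 ≤ 3H and 4M + 1 ≤ 5M.
  α αΩ αˢ K₁ K₂ K₃ Kᵦ : ℚ
  α  = ι (A ℕ.+ A ℕ.+ 1)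
  αΩ = ι (5 ℕ.* (A ℕ.+ A ℕ.+ 1))
  αˢ = α * α ^ℚ s
  Kᵦ = α * (ι s * α ^ℚ s)
  K₁ = tower r αˢ * meanConst r αˢ * vonNeumannConst (ι 5) (ι 5) r
  K₂ = αˢ * (ι s * ι 5 ^ℚ s) * ι 15
  K₃ = tower s (ι 9 * α) * meanConst s α * (α * gowersConst (ι 5) αΩ (energyConst A) s)

  0≤α : 0ℚ ≤ α
  0≤α = 0≤ι (A ℕ.+ A ℕ.+ 1)
  0≤αˢ : 0ℚ ≤ αˢ
  0≤αˢ = ^ℚ-nn 0≤α (suc s)
  0≤Kᵦ : 0ℚ ≤ Kᵦ
  0≤Kᵦ = nn* 0≤α (nn* (0≤ι s) (^ℚ-nn 0≤α s))
  1≤α : 1ℚ ≤ α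
  1≤α = ι-mono {1} (ℕ.m≤n+m 1 (A ℕ.+ A))
  0<αˢ : 0ℚ < αˢ
  0<αˢ = ^ℚ-pos (ℚ.<-≤-trans 0<1 1≤α) (suc s)
  0<K₁ : 0ℚ < K₁
  0<K₁ = pos* (pos* (tower-pos r 0<αˢ) (meanConst-pos r 0<αˢ)) (vonNeumannConst-pos (0<ι 4) (0<ι 4) r)
  0≤K₂ : 0ℚ ≤ K₂
  0≤K₂ = nn* (nn* 0≤αˢ (nn* (0≤ι s) (^ℚ-nn (0≤ι 5) s))) (0≤ι 15)
  0≤energyConst : 0ℚ ≤ energyConst A
  0≤energyConst = nn* (sq-nn (ι 24 * ι (4 ℕ.* A))) (nn* (0≤ι 8) (0≤ι (4 ℕ.+ 2 ℕ.* A)))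
  0≤K₃ : 0ℚ ≤ K₃
  0≤K₃ = nn* (nn* (tower-nn s (nn* (0≤ι 9) 0≤α)) (meanConst-nn s 0≤α))
    (nn* 0≤α (gowersConst-nn (0≤ι 5) (0≤ι (5 ℕ.* (A ℕ.+ A ℕ.+ 1))) 0≤energyConst s))

-- The coefficient bᵢ is split off as the first argument of `lam`; the remaining s = r + 1 form the
-- vector. `H′` and `M′` are predecessors, so that `unit H′` and `unit M′` are 1/H and 1/M.
module Discrete (A r T H′ M′ : ℕ) (TH≤AM : T ℕ.* suc H′ ℕ.≤ A ℕ.* suc M′) (H≤M : suc H′ ℕ.≤ suc M′)
  (lam : ℤ → Vec ℤ (suc r) → ℚ[i]) (lam-bdd : ∀ a b → normSq (lam a b) ≤ 1ℚ)
  (μ g : ℤ → ℚ[i]) (μ-supp : Supported (suc H′) μ) (μ-bdd : UnitBounded μ)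
  (g-supp : Supported (suc M′) g) (g-bdd : UnitBounded g)
  (φ : Fin (suc r) → ℤ → ℚ[i]) (φ-supp : ∀ j → Supported (suc M′) (φ j)) (φ-bdd : ∀ j → UnitBounded (φ j))
  where

  open Constants A r

  private
    module Q = ℚ-Solver.+-*-Solver
    H = suc H′
    M = suc M′
    N = M ℕ.+ M
    I = window N
    𝓜 = window H
    𝓝 = window (H ℕ.+ H)
    v = unit H′
    w = unit M′
    ξ = ι H * w
    0≤v = ℚ.<⇒≤ (0<unit H′)
    0≤w = ℚ.<⇒≤ (0<unit M′)
    0≤ξ = nn* (0≤ι H) 0≤w
    ξˢ = ξ ^ℚ s
    0≤ξˢ = ^ℚ-nn 0≤ξ s
    ℓT = ι (length (window T))
    ℓH = ι (length 𝓜)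
    ℓI = ι (length I)
    0≤ℓH = 0≤ι (length 𝓜)
    0≤ℓI = 0≤ι (length I)
  open VonNeumann {M} {N} (ℕ.m≤m+n M M) H
  open Gowers {M} {N} ℕ.≤-refl

  differences : ∀ {s} → ℤ → Vec ℤ s → Vec ℤ s
  differences a = Vec.map (ℤ._- a)

  count : ℤ → Vec ℤ s → ℚ[i]
  count a b = progressionSum μ g (differences a b) φ

  total : ℚ[i]
  total = ∑ᵍ (window T) λ a → ∑ᵍ (vecs (window T) s) λ b → lam a b ⊗ count a b

  private
    ξv≡w : ξ * v ≡ w
    ξv≡w = trans (Q.solve 3 (λ h w v → h Q.:* w Q.:* v Q.:= w Q.:* (h Q.:* v)) refl (ι H) w v)
      (trans (cong (λ t → w * t) (ι-unit H′)) (ℚ.*-identityʳ w))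

    wℓI≤5 : w * ℓI ≤ ι 5
    wℓI≤5 = unit-scale 5 M′ (subst (ℕ._≤ 5 ℕ.* M) (sym (length-window N)) (1+2n+2n≤5n M′))
    vℓN≤5 : v * ι (length 𝓝) ≤ ι 5
    vℓN≤5 = unit-scale 5 H′ (subst (ℕ._≤ 5 ℕ.* H) (sym (length-window (H ℕ.+ H))) (1+2n+2n≤5n H′))
    ℓH≤3H : ℓH ≤ ι (3 ℕ.* H)
    ℓH≤3H = ι-mono (subst (ℕ._≤ 3 ℕ.* H) (sym (length-window H)) (1+2n≤3n H′))
    vℓH≤3 : v * ℓH ≤ ι 3
    vℓH≤3 = unit-scale 3 H′ (subst (ℕ._≤ 3 ℕ.* H) (sym (length-window H)) (1+2n≤3n H′))

    H[2T+1]≤ : suc (T ℕ.+ T) ℕ.* H ℕ.≤ (A ℕ.+ A ℕ.+ 1) ℕ.* M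
    H[2T+1]≤ = Directions.H[2T+1]≤ A T H′ M′ TH≤AM H≤M (+ 0) z≤n

    ξℓT≤α : ξ * ℓT ≤ α
    ξℓT≤α = subst (_≤ α)
      (trans (cong (λ t → w * t) (ι-* (suc (T ℕ.+ T)) H))
        (trans (Q.solve 3 (λ w t h → w Q.:* (t Q.:* h) Q.:= h Q.:* w Q.:* t) refl w (ι (suc (T ℕ.+ T))) (ι H))
          (cong (λ t → ξ * ι t) (sym (length-window T)))))
      (unit-scale (A ℕ.+ A ℕ.+ 1) M′ H[2T+1]≤)

    length-δ : ∀ z L → ι (length (filter (λ x → ¬? (¬? (x ℤ.≟ z))) (window L))) ≤ 1ℚ
    length-δ z L = ℚ.≤-trans
      (ℚ.≤-reflexive (trans (ι-length (filter (λ x → ¬? (¬? (x ℤ.≟ z))) (window L))) (trans (∑-filter (λ x → ¬? (¬? (x ℤ.≟ z))) (window L) (const 1ℚ))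
        (∑-cong (window L) λ x → ℚ.*-identityʳ ⟦ ¬? (¬? (x ℤ.≟ z)) ⟧))))
      (ℚ.≤-trans (∑-mono (window L) λ x → ⟦⟧-mono (¬? (¬? (x ℤ.≟ z))) (z ℤ.≟ x) (double-negation x))
        (∑-δ≤1 ℤ._≟_ (window L) (window-unique L) z))
      where
      double-negation : ∀ x → ¬ ¬ x ≡ z → z ≡ x
      double-negation x ¬¬e with x ℤ.≟ z
      ... | yes e = sym e
      ... | no ¬e = contradiction ¬e ¬¬e

    other? : ∀ a b → Dec (¬ b ≡ a)
    other? a b = ¬? (b ℤ.≟ a)
    others : ℤ → List ℤ
    others a = filter (other? a) (window T)

    good bad : List (ℤ × Vec ℤ s)
    good = pairs (window T) λ a → vecs (others a) s
    bad  = pairs (window T) λ a → badVecs (other? a) (window T) s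

    size-good : ξ * ξˢ * ι (length good) ≤ αˢ
    size-good = length-pairs-≤ (window T) (λ a → vecs (others a) s) 0≤ξ 0≤ξˢ (^ℚ-nn 0≤α s) ξℓT≤α λ a →
      length-vecs-≤ (others a) 0≤ξ (ℚ.≤-trans
        (*-monoˡ ξ 0≤ξ (ι-mono (length-filter (other? a) (window T)))) ξℓT≤α) s

    size-bad : ξ * ξˢ * ι (length bad) ≤ Kᵦ * ξ
    size-bad = subst (ξ * ξˢ * ι (length bad) ≤_) (sym (ℚ.*-assoc α (ι s * α ^ℚ s) ξ))
      (length-pairs-≤ (window T) (λ a → badVecs (other? a) (window T) s) 0≤ξ 0≤ξˢ
        (nn* (nn* (0≤ι s) (^ℚ-nn 0≤α s)) 0≤ξ) ξℓT≤α λ a →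
        length-badVecs-≤ (other? a) (window T) 0≤ξ 1≤α ξℓT≤α
          (ℚ.≤-trans (*-monoˡ ξ 0≤ξ (length-δ a T)) (ℚ.≤-reflexive (ℚ.*-identityʳ ξ))) s)

    badSteps : List (Vec ℤ s)
    badSteps = badVecs nonzero? 𝓝 s

    size-badSteps : v ^ℚ s * ι (length badSteps) ≤ ι s * ι 5 ^ℚ s * v
    size-badSteps = length-badVecs-≤ nonzero? 𝓝 0≤v (ι-mono {1} {5} (s≤s z≤n)) vℓN≤5
      (ℚ.≤-trans (*-monoˡ v 0≤v (length-δ (+ 0) (H ℕ.+ H))) (ℚ.≤-reflexive (ℚ.*-identityʳ v))) s

    term : ℤ × Vec ℤ s → ℚ[i]
    term (a , b) = lam a b ⊗ count a b

    total-split : total ≡ ∑ᵍ good term ⊕ ∑ᵍ bad term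
    total-split = trans
      (∑ᵍ.∑-cong (window T) λ a → ∑ᵍ-vecs-split (other? a) (window T) s λ b → term (a , b))
      (trans (∑ᵍ.∑-⊞ (window T) _ _) (sym (cong₂ _⊕_ (∑ᵍ.∑-pairs (window T) _ term) (∑ᵍ.∑-pairs (window T) _ term))))

    inner-bdd : ∀ (F : ℤ → ℚ[i]) → UnitBounded F → normSq (∑ᵍ I F) ≤ sq ℓI
    inner-bdd F h = subst (normSq (∑ᵍ I F) ≤_) (ℚ.*-identityʳ (sq ℓI)) (normSq-∑-const I F 1ℚ h)

    count-bdd : ∀ a b → normSq (count a b) ≤ sq ℓH * sq ℓI
    count-bdd a b = normSq-∑-const 𝓜 (λ m → μ m ⊗ ∑ᵍ I λ x → g x ⊗ Φ m x) (sq ℓI) λ m → subst (_≤ sq ℓI)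
      (sym (normSq-⊗ (μ m) (∑ᵍ I λ x → g x ⊗ Φ m x)))
      (ℚ.≤-trans (1*≤ (normSq-nn (∑ᵍ I λ x → g x ⊗ Φ m x)) (μ-bdd m))
        (inner-bdd (λ x → g x ⊗ Φ m x) λ x → ⊗-UnitBounded {g x} {Φ m x} (g-bdd x)
          (∏-UnitBounded (λ j → φ j (x ℤ.+ Vec.lookup (differences a b) j ℤ.* m)) λ j → φ-bdd j (x ℤ.+ Vec.lookup (differences a b) j ℤ.* m))))
      where
      Φ : ℤ → ℤ → ℚ[i]
      Φ m x = ∏ λ j → φ j (x ℤ.+ Vec.lookup (differences a b) j ℤ.* m)

    term-≤ : ∀ ab → normSq (term ab) ≤ normSq (count (proj₁ ab) (proj₂ ab))
    term-≤ (a , b) = subst (_≤ normSq (count a b)) (sym (normSq-⊗ (lam a b) (count a b)))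
      (1*≤ (normSq-nn (count a b)) (lam-bdd a b))

    normalisation = sq (ξ * ξˢ * (v * w))
    0≤normalisation = sq-nn (ξ * ξˢ * (v * w))

    -- Each term is bounded trivially. A coincidence bⱼ = bᵢ costs one factor ξ = H/M in the number
    -- of vectors, and 15 = 3 · 5 is the bound for a normalised count.
    bad-small : normSq (∑ᵍ bad term) * normalisation ≤ sq (Kᵦ * ξ * ι 15)
    bad-small = begin
      normSq (∑ᵍ bad term) * normalisation
        ≤⟨ *-monoʳ normalisation 0≤normalisation
             (normSq-∑-const bad term (sq ℓH * sq ℓI) λ ab → ℚ.≤-trans (term-≤ ab) (count-bdd (proj₁ ab) (proj₂ ab))) ⟩
      sq (ι (length bad)) * (sq ℓH * sq ℓI) * normalisation
        ≡⟨ Q.solve 6 (λ l h i x v w → l Q.:* l Q.:* (h Q.:* h Q.:* (i Q.:* i)) Q.:* ((x Q.:* (v Q.:* w)) Q.:* (x Q.:* (v Q.:* w)))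
             Q.:= ((x Q.:* l) Q.:* ((v Q.:* h) Q.:* (w Q.:* i))) Q.:* ((x Q.:* l) Q.:* ((v Q.:* h) Q.:* (w Q.:* i))))
             refl (ι (length bad)) ℓH ℓI (ξ * ξˢ) v w ⟩
      sq (ξ * ξˢ * ι (length bad) * (v * ℓH * (w * ℓI)))
        ≤⟨ sq-mono (nn* (nn* (nn* 0≤ξ 0≤ξˢ) (0≤ι (length bad))) (nn* (nn* 0≤v 0≤ℓH) (nn* 0≤w 0≤ℓI)))
             (mono* (nn* (nn* 0≤ξ 0≤ξˢ) (0≤ι (length bad))) (nn* (nn* 0≤v 0≤ℓH) (nn* 0≤w 0≤ℓI)) size-bad
               (mono* (nn* 0≤v 0≤ℓH) (nn* 0≤w 0≤ℓI) vℓH≤3 wℓI≤5)) ⟩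
      sq (Kᵦ * ξ * ι 15) ∎
      where open ℚ.≤-Reasoning

    vN : ∀ a b → ∃ λ (Λ : Vec ℤ s → ℚ[i]) → (∀ ns → normSq (Λ ns) ≤ sq ℓH) ×
      tower r (normSq (count a b) * sq (v * w)) ≤
      vonNeumannConst (ι 5) (ι 5) r * (v ^ℚ suc s * w * Re (boxSum Λ g (differences a b)))
    vN a b = vonNeumann 0≤v 0≤w (0≤ι 5) (0≤ι 5) wℓI≤5 vℓN≤5 r μ g (differences a b) φ
      μ-supp μ-bdd g-supp φ-supp φ-bdd

    Λ : ℤ → Vec ℤ s → Vec ℤ s → ℚ[i]
    Λ a b = proj₁ (vN a b)
    Λ-bdd : ∀ a b ns → normSq (Λ a b ns) ≤ sq ℓH
    Λ-bdd a b = proj₁ (proj₂ (vN a b))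

    D : ℤ → Vec ℤ s → Vec ℤ s → ℚ[i]
    D a b ns = Λ a b ns ⊗ ∑ᵍ I (Δ* (steps (differences a b) ns) g)

    D-bdd : ∀ a b ns → normSq (D a b ns) ≤ sq ℓH * sq ℓI
    D-bdd a b ns = subst (_≤ sq ℓH * sq ℓI) (sym (normSq-⊗ (Λ a b ns) (∑ᵍ I (Δ* (steps (differences a b) ns) g))))
      (mono* (normSq-nn (Λ a b ns)) (normSq-nn (∑ᵍ I (Δ* (steps (differences a b) ns) g))) (Λ-bdd a b ns)
        (inner-bdd (Δ* (steps (differences a b) ns) g) (Δ*-UnitBounded (steps (differences a b) ns) {g} g-bdd)))

    Y Ygood Ybad : ℚ[i]
    Y     = ∑ᵍ good λ ab → boxSum (Λ (proj₁ ab) (proj₂ ab)) g (differences (proj₁ ab) (proj₂ ab))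
    Ygood = ∑ᵍ good λ ab → ∑ᵍ (vecs (nz (H ℕ.+ H)) s) (D (proj₁ ab) (proj₂ ab))
    Ybad  = ∑ᵍ (cartesianProduct good badSteps) λ p → D (proj₁ (proj₁ p)) (proj₂ (proj₁ p)) (proj₂ p)

    Y-split : Y ≡ Ygood ⊕ Ybad
    Y-split = trans (∑ᵍ.∑-cong good λ ab → ∑ᵍ-vecs-split nonzero? 𝓝 s (D (proj₁ ab) (proj₂ ab)))
      (trans (∑ᵍ.∑-⊞ good _ _) (cong (Ygood ⊕_) (sym (∑ᵍ.∑-product _,_ good badSteps _))))

    -- Despite its name this is w^(s+2): the sum for the norm of order s + 1 runs over x and s + 1
    -- shifts.
    w² = w ^ℚ suc (suc s)

    w²≡ : ξ * ξˢ * (v ^ℚ suc s * w) ≡ w²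
    w²≡ = trans (sym (ℚ.*-assoc (ξ * ξˢ) (v ^ℚ suc s) w))
      (trans (cong (_* w) (trans (sym (^ℚ-* ξ v (suc s))) (cong (_^ℚ suc s) ξv≡w))) (ℚ.*-comm (w ^ℚ suc s) w))

    -- Again a trivial bound: the condition nⱼ = 0 for some j leaves a proportion O(1/H) of the
    -- difference vectors.
    Ybad-small : w² * Re Ybad ≤ K₂ * v
    Ybad-small = ≤-from-sq (nn* 0≤K₂ 0≤v) (begin
      sq (w² * Re Ybad)
        ≡⟨ Q.solve 2 (λ a b → (a Q.:* b) Q.:* (a Q.:* b) Q.:= a Q.:* a Q.:* (b Q.:* b)) refl w² (Re Ybad) ⟩
      sq w² * sq (Re Ybad)
        ≤⟨ *-monoˡ (sq w²) (sq-nn w²) (ℚ.≤-trans (Re²≤normSq Ybad)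
             (normSq-∑-const (cartesianProduct good badSteps) _ (sq ℓH * sq ℓI) λ p → D-bdd (proj₁ (proj₁ p)) (proj₂ (proj₁ p)) (proj₂ p))) ⟩
      sq w² * (sq (ι (length (cartesianProduct good badSteps))) * (sq ℓH * sq ℓI))
        ≡⟨ cong₂ (λ a b → sq a * (sq b * (sq ℓH * sq ℓI))) (sym w²≡) (ι-length-product _,_ good badSteps) ⟩
      sq (ξ * ξˢ * (v * vˢ * w)) * (sq (G * B) * (sq ℓH * sq ℓI))
        ≡⟨ Q.solve 8 (λ x v p w g b h i →
             (x Q.:* (v Q.:* p Q.:* w)) Q.:* (x Q.:* (v Q.:* p Q.:* w)) Q.:* ((g Q.:* b) Q.:* (g Q.:* b) Q.:* (h Q.:* h Q.:* (i Q.:* i)))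
             Q.:= ((x Q.:* g) Q.:* (p Q.:* b) Q.:* ((v Q.:* h) Q.:* (w Q.:* i))) Q.:* ((x Q.:* g) Q.:* (p Q.:* b) Q.:* ((v Q.:* h) Q.:* (w Q.:* i))))
             refl (ξ * ξˢ) v vˢ w G B ℓH ℓI ⟩
      sq (ξ * ξˢ * G * (vˢ * B) * (v * ℓH * (w * ℓI)))
        ≤⟨ sq-mono (nn* (nn* 0≤G 0≤B) 0≤ℓ) (mono* (nn* 0≤G 0≤B) 0≤ℓ
             (mono* 0≤G 0≤B size-good size-badSteps)
             (mono* (nn* 0≤v 0≤ℓH) (nn* 0≤w 0≤ℓI) vℓH≤3 wℓI≤5)) ⟩
      sq (αˢ * (ι s * ι 5 ^ℚ s * v) * ι 15)
        ≡⟨ cong sq (Q.solve 4 (λ a b v c → a Q.:* (b Q.:* v) Q.:* c Q.:= a Q.:* b Q.:* c Q.:* v) refl αˢ (ι s * ι 5 ^ℚ s) v (ι 15)) ⟩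
      sq (K₂ * v) ∎)
      where
      open ℚ.≤-Reasoning
      vˢ = v ^ℚ s
      G = ι (length good)
      B = ι (length badSteps)
      0≤G = nn* (nn* 0≤ξ 0≤ξˢ) (0≤ι (length good))
      0≤B = nn* (^ℚ-nn 0≤v s) (0≤ι (length badSteps))
      0≤ℓ = nn* (nn* 0≤v 0≤ℓH) (nn* 0≤w 0≤ℓI)

    -- Cauchy-Schwarz over the vectors discards λ, and the power mean raises each count to the power
    -- 2^(r+1) at which `vonNeumann` bounds it. The factors ξ and v then combine to w by `w²≡`.
    good-bound : tower r (normSq (∑ᵍ good term) * normalisation) ≤ K₁ * (w² * Re Y)
    good-bound = begin
      tower r (normSq (∑ᵍ good term) * normalisation)
        ≤⟨ tower-mono r (nn* (normSq-nn (∑ᵍ good term)) 0≤normalisation) spread ⟩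
      tower r (αˢ * (ξ * ξˢ * ∑ good X))
        ≡⟨ tower-* r αˢ (ξ * ξˢ * ∑ good X) ⟩
      tower r αˢ * tower r (ξ * ξˢ * ∑ good X)
        ≤⟨ *-monoˡ (tower r αˢ) (tower-nn r 0≤αˢ)
             (power-mean (nn* 0≤ξ 0≤ξˢ) 0≤αˢ r good X size-good X-nn) ⟩
      tower r αˢ * (meanConst r αˢ * (ξ * ξˢ * ∑ good (tower r ∘ X)))
        ≤⟨ *-monoˡ (tower r αˢ) (tower-nn r 0≤αˢ)
             (*-monoˡ (meanConst r αˢ) (meanConst-nn r 0≤αˢ)
               (*-monoˡ (ξ * ξˢ) (nn* 0≤ξ 0≤ξˢ)
                 (∑-mono good λ ab → proj₂ (proj₂ (vN (proj₁ ab) (proj₂ ab)))))) ⟩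
      tower r αˢ * (meanConst r αˢ * (ξ * ξˢ * ∑ good λ ab → Kᵥ * (v ^ℚ suc s * w * Re (boxAt ab))))
        ≡⟨ cong (λ t → tower r αˢ * (meanConst r αˢ * (ξ * ξˢ * t))) (trans (sym (∑-*ˡ Kᵥ good _))
             (cong (λ t → Kᵥ * t) (trans (sym (∑-*ˡ (v ^ℚ suc s * w) good (Re ∘ boxAt))) (cong (λ t → v ^ℚ suc s * w * t) (sym (Re-∑ good boxAt)))))) ⟩
      tower r αˢ * (meanConst r αˢ * (ξ * ξˢ * (Kᵥ * (v ^ℚ suc s * w * Re Y))))
        ≡⟨ Q.solve 6 (λ t m x k p y → t Q.:* (m Q.:* (x Q.:* (k Q.:* (p Q.:* y))))
             Q.:= t Q.:* m Q.:* k Q.:* (x Q.:* p Q.:* y)) refl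
             (tower r αˢ) (meanConst r αˢ) (ξ * ξˢ) Kᵥ (v ^ℚ suc s * w) (Re Y) ⟩
      K₁ * (ξ * ξˢ * (v ^ℚ suc s * w) * Re Y)
        ≡⟨ cong (λ t → K₁ * (t * Re Y)) w²≡ ⟩
      K₁ * (w² * Re Y) ∎
      where
      open ℚ.≤-Reasoning
      Kᵥ = vonNeumannConst (ι 5) (ι 5) r
      boxAt : ℤ × Vec ℤ s → ℚ[i]
      boxAt ab = boxSum (Λ (proj₁ ab) (proj₂ ab)) g (differences (proj₁ ab) (proj₂ ab))
      X : ℤ × Vec ℤ s → ℚ
      X ab = normSq (count (proj₁ ab) (proj₂ ab)) * sq (v * w)
      X-nn : ∀ ab → 0ℚ ≤ X ab
      X-nn ab = nn* (normSq-nn (count (proj₁ ab) (proj₂ ab))) (sq-nn (v * w))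
      G = ι (length good)
      counts = ∑ good λ ab → normSq (count (proj₁ ab) (proj₂ ab))
      spread : normSq (∑ᵍ good term) * normalisation ≤ αˢ * (ξ * ξˢ * ∑ good X)
      spread = begin
        normSq (∑ᵍ good term) * normalisation
          ≤⟨ *-monoʳ normalisation 0≤normalisation (ℚ.≤-trans (normSq-∑ good term)
               (*-monoˡ G (0≤ι (length good)) (∑-mono good term-≤))) ⟩
        G * counts * normalisation
          ≡⟨ Q.solve 4 (λ g c x u → g Q.:* c Q.:* ((x Q.:* u) Q.:* (x Q.:* u)) Q.:= x Q.:* g Q.:* (x Q.:* (c Q.:* (u Q.:* u))))
               refl G counts (ξ * ξˢ) (v * w) ⟩
        ξ * ξˢ * G * (ξ * ξˢ * (counts * sq (v * w)))
          ≡⟨ cong (λ t → ξ * ξˢ * G * (ξ * ξˢ * t)) (∑-*ʳ (sq (v * w)) good _) ⟩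
        ξ * ξˢ * G * (ξ * ξˢ * ∑ good X)
          ≤⟨ *-monoʳ (ξ * ξˢ * ∑ good X) (nn* (nn* 0≤ξ 0≤ξˢ) (∑-nn good X-nn)) size-good ⟩
        αˢ * (ξ * ξˢ * ∑ good X) ∎

    -- `Λ` is a sum over m, of size up to |𝓜|; dividing by that length gives the bounded weights
    -- that `gowers-bound` expects.
    weight′ : ℤ → Vec (ℤ × ℤ) s → ℚ[i]
    weight′ a ω = real (recip ℓH) ⊗ Λ a (Vec.map proj₁ ω) (Vec.map proj₂ ω)

    0<ℓH : 0ℚ < ℓH
    0<ℓH = subst (λ l → 0ℚ < ι l) (sym (length-window H)) (0<ι (H ℕ.+ H))

    weight′-bdd : ∀ a → UnitBounded (weight′ a)
    weight′-bdd a ω = begin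
      normSq (real (recip ℓH) ⊗ L)      ≡⟨ trans (normSq-⊗ (real (recip ℓH)) L) (cong (_* normSq L) (normSq-real (recip ℓH))) ⟩
      sq (recip ℓH) * normSq L          ≤⟨ *-monoˡ (sq (recip ℓH)) (sq-nn (recip ℓH))
                  (Λ-bdd a (Vec.map proj₁ ω) (Vec.map proj₂ ω)) ⟩
      sq (recip ℓH) * sq ℓH             ≡⟨ Q.solve 2 (λ r l → r Q.:* r Q.:* (l Q.:* l) Q.:= (l Q.:* r) Q.:* (l Q.:* r)) refl (recip ℓH) ℓH ⟩
      sq (ℓH * recip ℓH)                ≡⟨ cong sq (recip-inv 0<ℓH) ⟩
      1ℚ                                ∎
      where
      open ℚ.≤-Reasoning
      L = Λ a (Vec.map proj₁ ω) (Vec.map proj₂ ω)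

    module _ {a : ℤ} (a≤T : ℤ.∣ a ∣ ℕ.≤ T) where

      module 𝓓 = Directions A T H′ M′ TH≤AM H≤M a a≤T

      E : ℚ[i]
      E = derivSum 𝓓.Ω 𝓓.τ (weight′ a) g

      -- Zipping the coefficients with their difference variables turns two sums over vectors into
      -- one over `Ω`-vectors. Only now does each direction depend on a single summation variable.
      row≡ : (∑ᵍ (vecs (others a) s) λ b → ∑ᵍ (vecs (nz (H ℕ.+ H)) s) (D a b)) ≡ real ℓH ⊗ E
      row≡ = trans (∑ᵍ-vecs-product (others a) (nz (H ℕ.+ H)) s (D a))
        (trans (∑ᵍ.∑-cong (vecs 𝓓.Ω s) λ ω → trans
            (cong (λ u → Λ a (Vec.map proj₁ ω) (Vec.map proj₂ ω) ⊗ ∑ᵍ I (Δ* u g)) (steps≡ ω))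
            (rescale ω (∑ᵍ I (Δ* (Vec.map 𝓓.τ ω) g))))
          (sym (∑ᵍ.∑-*ˡ (real ℓH) (vecs 𝓓.Ω s) _)))
        where
        steps≡ : ∀ {n} (ω : Vec (ℤ × ℤ) n) →
          steps (differences a (Vec.map proj₁ ω)) (Vec.map proj₂ ω) ≡ Vec.map 𝓓.τ ω
        steps≡ []      = refl
        steps≡ (x ∷ ω) = cong (𝓓.τ x ∷_) (steps≡ ω)
        unit-real : real ℓH ⊗ real (recip ℓH) ≡ 1ᵍ
        unit-real = cong₂ _+𝕚_
          (trans (Q.solve 2 (λ a b → a Q.:* b Q.:+ Q.:- (Q.con 0ℚ Q.:* Q.con 0ℚ) Q.:= a Q.:* b) refl ℓH (recip ℓH)) (recip-inv 0<ℓH))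
          (Q.solve 2 (λ a b → a Q.:* Q.con 0ℚ Q.:+ Q.con 0ℚ Q.:* b Q.:= Q.con 0ℚ) refl ℓH (recip ℓH))
        rescale : ∀ ω z → Λ a (Vec.map proj₁ ω) (Vec.map proj₂ ω) ⊗ z ≡ real ℓH ⊗ (weight′ a ω ⊗ z)
        rescale ω z = sym (trans (regroup (real ℓH) (real (recip ℓH)) L z)
          (trans (cong (λ u → u ⊗ (L ⊗ z)) unit-real) (⊗-identityˡ (L ⊗ z))))
          where
          L = Λ a (Vec.map proj₁ ω) (Vec.map proj₂ ω)
          regroup : ∀ a b c d → a ⊗ ((b ⊗ c) ⊗ d) ≡ (a ⊗ b) ⊗ (c ⊗ d)
          regroup = R.solve 4 (λ a b c d → a R.:* ((b R.:* c) R.:* d) R.:= (a R.:* b) R.:* (c R.:* d)) refl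
            where module R = ℚ[i]-Solver

      row-bound : tower s (normSq E * sq (w ^ℚ suc s)) ≤
        gowersConst (ι 5) αΩ (energyConst A) s * (w² * Re (U (suc s) g))
      row-bound = gowers-bound 𝓓.Ω 𝓓.τ 0≤w (0≤ι 5) (0≤ι (5 ℕ.* (A ℕ.+ A ℕ.+ 1))) 0≤energyConst
        wℓI≤5 𝓓.size-Ω 𝓓.energy s (weight′ a) (weight′-bdd a) g g-supp g-bdd

    ∑-window-≤ : (F : ℤ → ℚ) (C : ℚ) → (∀ a → ℤ.∣ a ∣ ℕ.≤ T → F a ≤ C) → ∑ (window T) F ≤ ℓT * C
    ∑-window-≤ F C h = ℚ.≤-trans (∑-mono∈ (window T) {F} {const C} λ {a} a∈ → h a (∈-window⁻ a∈))
      (ℚ.≤-reflexive (∑-const (window T) C))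

    row : ℤ → ℚ[i]
    row a = ∑ᵍ (vecs (others a) s) λ b → ∑ᵍ (vecs (nz (H ℕ.+ H)) s) (D a b)

    Z : ℤ → ℚ
    Z a = sq (recip ℓH) * normSq (row a) * sq (w ^ℚ suc s)
    Z-nn : ∀ a → 0ℚ ≤ Z a
    Z-nn a = nn* (nn* (sq-nn (recip ℓH)) (normSq-nn (row a))) (sq-nn (w ^ℚ suc s))

    Z≡ : ∀ {a} (h : ℤ.∣ a ∣ ℕ.≤ T) → Z a ≡ normSq (E h) * sq (w ^ℚ suc s)
    Z≡ {a} h = cong (_* sq (w ^ℚ suc s)) (trans
      (cong (λ t → sq (recip ℓH) * t) (trans (cong normSq (row≡ h)) (trans (normSq-⊗ (real ℓH) (E h)) (cong (_* normSq (E h)) (normSq-real ℓH)))))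
      (trans (Q.solve 3 (λ r l n → r Q.:* r Q.:* (l Q.:* l Q.:* n) Q.:= (l Q.:* r) Q.:* (l Q.:* r) Q.:* n) refl (recip ℓH) ℓH (normSq (E h)))
        (trans (cong (λ t → sq t * normSq (E h)) (recip-inv 0<ℓH)) (ℚ.*-identityˡ (normSq (E h))))))

    -- The directions depend on the coefficient `a`, so `gowers-bound` is applied for each `a`
    -- separately and the results are averaged with weight ξ.
    Ygood-bound : tower s (sq w² * normSq Ygood) ≤ K₃ * (w² * Re (U (suc s) g))
    Ygood-bound = begin
      tower s (sq w² * normSq Ygood)
        ≤⟨ tower-mono s (nn* (sq-nn w²) (normSq-nn Ygood)) spread ⟩
      tower s (ι 9 * α * (ξ * ∑ (window T) Z))
        ≡⟨ tower-* s (ι 9 * α) (ξ * ∑ (window T) Z) ⟩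
      tower s (ι 9 * α) * tower s (ξ * ∑ (window T) Z)
        ≤⟨ *-monoˡ (tower s (ι 9 * α)) 0≤t (power-mean 0≤ξ 0≤α s (window T) Z ξℓT≤α Z-nn) ⟩
      tower s (ι 9 * α) * (meanConst s α * (ξ * ∑ (window T) (tower s ∘ Z)))
        ≤⟨ *-monoˡ (tower s (ι 9 * α)) 0≤t
             (*-monoˡ (meanConst s α) (meanConst-nn s 0≤α)
               (*-monoˡ ξ 0≤ξ
                 (∑-window-≤ (tower s ∘ Z) B λ a h → subst (_≤ B) (cong (tower s) (sym (Z≡ {a} h))) (row-bound {a} h)))) ⟩
      tower s (ι 9 * α) * (meanConst s α * (ξ * (ℓT * B)))
        ≡⟨ cong (λ t → tower s (ι 9 * α) * (meanConst s α * t)) (sym (ℚ.*-assoc ξ ℓT B)) ⟩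
      tower s (ι 9 * α) * (meanConst s α * (ξ * ℓT * B))
        ≤⟨ *-monoˡ (tower s (ι 9 * α)) 0≤t
             (*-monoˡ (meanConst s α) (meanConst-nn s 0≤α)
               (*-monoʳ B 0≤B ξℓT≤α)) ⟩
      tower s (ι 9 * α) * (meanConst s α * (α * B))
        ≡⟨ Q.solve 5 (λ t m a k u → t Q.:* (m Q.:* (a Q.:* (k Q.:* u))) Q.:= t Q.:* m Q.:* (a Q.:* k) Q.:* u) refl
             (tower s (ι 9 * α)) (meanConst s α) α (gowersConst (ι 5) αΩ (energyConst A) s) (w² * Re (U (suc s) g)) ⟩
      K₃ * (w² * Re (U (suc s) g)) ∎
      where
      open ℚ.≤-Reasoning
      B = gowersConst (ι 5) αΩ (energyConst A) s * (w² * Re (U (suc s) g))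
      0≤t = tower-nn s (nn* (0≤ι 9) 0≤α)
      -- The sign is read off from the row a = 0, which exists for every T.
      0≤B : 0ℚ ≤ B
      0≤B = ℚ.≤-trans (tower-nn s (nn* (normSq-nn (E {+ 0} z≤n)) (sq-nn (w ^ℚ suc s)))) (row-bound {+ 0} z≤n)
      rows = ∑ (window T) (normSq ∘ row)
      0≤rows = ∑-nn (window T) λ a → normSq-nn (row a)
      -- The length |𝓜| carried by `Λ`, times one factor w, is of order H/M: it provides the
      -- normalisation of the average over `a`. Its square is the 9 in `K₃`.
      wℓH≤3ξ : w * ℓH ≤ ι 3 * ξ
      wℓH≤3ξ = ℚ.≤-trans (*-monoˡ w 0≤w ℓH≤3H)
        (ℚ.≤-reflexive (trans (cong (λ t → w * t) (ι-* 3 H)) (Q.solve 3 (λ w c h → w Q.:* (c Q.:* h) Q.:= c Q.:* (h Q.:* w)) refl w (ι 3) (ι H))))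
      insert-recip : ∀ t → t ≡ sq ℓH * (sq (recip ℓH) * t)
      insert-recip t = sym (trans (Q.solve 3 (λ l r t → l Q.:* l Q.:* (r Q.:* r Q.:* t) Q.:= (l Q.:* r) Q.:* (l Q.:* r) Q.:* t) refl ℓH (recip ℓH) t)
        (trans (cong (λ u → sq u * t) (recip-inv 0<ℓH)) (ℚ.*-identityˡ t)))
      spread : sq w² * normSq Ygood ≤ ι 9 * α * (ξ * ∑ (window T) Z)
      spread = begin
        sq w² * normSq Ygood
          ≡⟨ cong (λ z → sq w² * normSq z) (∑ᵍ.∑-pairs (window T) (λ a → vecs (others a) s) _) ⟩
        sq w² * normSq (∑ᵍ (window T) row)
          ≤⟨ *-monoˡ (sq w²) (sq-nn w²) (normSq-∑ (window T) row) ⟩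
        sq w² * (ℓT * rows)
          ≡⟨ cong (λ t → sq w² * (ℓT * t)) (insert-recip rows) ⟩
        sq (w * w ^ℚ suc s) * (ℓT * (sq ℓH * (sq (recip ℓH) * rows)))
          ≡⟨ Q.solve 6 (λ w p t l r n → (w Q.:* p) Q.:* (w Q.:* p) Q.:* (t Q.:* (l Q.:* l Q.:* (r Q.:* r Q.:* n)))
               Q.:= (w Q.:* l) Q.:* (w Q.:* l) Q.:* (t Q.:* (r Q.:* r Q.:* n Q.:* (p Q.:* p)))) refl w (w ^ℚ suc s) ℓT ℓH (recip ℓH) rows ⟩
        sq (w * ℓH) * (ℓT * (sq (recip ℓH) * rows * sq (w ^ℚ suc s)))
          ≡⟨ cong (λ t → sq (w * ℓH) * (ℓT * t)) (trans (cong (_* sq (w ^ℚ suc s)) (∑-*ˡ (sq (recip ℓH)) (window T) _)) (∑-*ʳ (sq (w ^ℚ suc s)) (window T) _)) ⟩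
        sq (w * ℓH) * (ℓT * ∑ (window T) Z)
          ≤⟨ *-monoʳ (ℓT * ∑ (window T) Z) (nn* (0≤ι (length (window T))) (∑-nn (window T) Z-nn))
               (sq-mono (nn* 0≤w 0≤ℓH) wℓH≤3ξ) ⟩
        sq (ι 3 * ξ) * (ℓT * ∑ (window T) Z)
          ≡⟨ Q.solve 3 (λ x t z → (Q.con (ι 3) Q.:* x) Q.:* (Q.con (ι 3) Q.:* x) Q.:* (t Q.:* z) Q.:= Q.con (ι 9) Q.:* (x Q.:* t) Q.:* (x Q.:* z)) refl ξ ℓT (∑ (window T) Z) ⟩
        ι 9 * (ξ * ℓT) * (ξ * ∑ (window T) Z)
          ≤⟨ *-monoʳ (ξ * ∑ (window T) Z) (nn* 0≤ξ (∑-nn (window T) Z-nn)) (ℚ.*-monoˡ-≤-nonNeg (ι 9) ξℓT≤α) ⟩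
        ι 9 * α * (ξ * ∑ (window T) Z) ∎

  module _ {δ : ℚ} (0≤δ : 0ℚ ≤ δ) (degenerate-b : Kᵦ * ξ * ι 30 ≤ δ)
    (degenerate-n : K₁ * (K₂ * v) ≤ ½ * tower r (¼ * sq δ))
    (large : sq δ ≤ normSq total * normalisation) where

    private
      θ = tower r (¼ * sq δ)
      0≤θ : 0ℚ ≤ θ
      0≤θ = tower-nn r (nn* (nn* (ℚ.<⇒≤ 0<½) (ℚ.<⇒≤ 0<½)) (sq-nn δ))

      bad-half : Kᵦ * ξ * ι 15 ≤ ½ * δ
      bad-half = subst (_≤ ½ * δ)
        (Q.solve 1 (λ k → Q.con ½ Q.:* (k Q.:* Q.con (ι 30)) Q.:= k Q.:* Q.con (ι 15)) refl (Kᵦ * ξ))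
        (ℚ.*-monoˡ-≤-nonNeg ½ degenerate-b)

      -- By |x + y|² ≤ 2|x|² + 2|y|² and a bad part of at most δ²/4, the good part retains δ²/2 -
      -- δ²/4. This is why `degenerate-b` asks for 30, twice the 15 of `bad-small`.
      good-large : ¼ * sq δ ≤ normSq (∑ᵍ good term) * normalisation
      good-large = doubled
        where
        G = normSq (∑ᵍ good term) * normalisation
        B = normSq (∑ᵍ bad term) * normalisation
        open ℚ.≤-Reasoning
        B≤ : B ≤ ¼ * sq δ
        B≤ = ℚ.≤-trans bad-small (ℚ.≤-trans (sq-mono (nn* (nn* 0≤Kᵦ 0≤ξ) (0≤ι 15)) bad-half)
          (ℚ.≤-reflexive (Q.solve 1 (λ d → (Q.con ½ Q.:* d) Q.:* (Q.con ½ Q.:* d) Q.:= Q.con ½ Q.:* Q.con ½ Q.:* (d Q.:* d)) refl δ)))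
        sum≤ : sq δ ≤ (1ℚ + 1ℚ) * (G + B)
        sum≤ = ℚ.≤-trans large (ℚ.≤-trans
          (*-monoʳ normalisation 0≤normalisation
            (subst (λ z → normSq z ≤ (1ℚ + 1ℚ) * (normSq (∑ᵍ good term) + normSq (∑ᵍ bad term))) (sym total-split)
              (normSq-⊕ (∑ᵍ good term) (∑ᵍ bad term))))
          (ℚ.≤-reflexive (Q.solve 3 (λ a b n → (Q.con 1ℚ Q.:+ Q.con 1ℚ) Q.:* (a Q.:+ b) Q.:* n
            Q.:= (Q.con 1ℚ Q.:+ Q.con 1ℚ) Q.:* (a Q.:* n Q.:+ b Q.:* n)) refl (normSq (∑ᵍ good term)) (normSq (∑ᵍ bad term)) normalisation)))
        doubled : ¼ * sq δ ≤ G
        doubled = ℚ.*-cancelˡ-≤-pos (1ℚ + 1ℚ) (le (nn+ (nn-sub sum≤) (nn* (nn+ 0≤1 0≤1) (nn-sub B≤)))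
          (Q.solve 3 (λ d g b → (Q.con 1ℚ Q.:+ Q.con 1ℚ) Q.:* (Q.con ½ Q.:* Q.con ½ Q.:* (d Q.:* d))
              Q.:+ ((Q.con 1ℚ Q.:+ Q.con 1ℚ) Q.:* (g Q.:+ b) Q.:- d Q.:* d
              Q.:+ (Q.con 1ℚ Q.:+ Q.con 1ℚ) Q.:* (Q.con ½ Q.:* Q.con ½ Q.:* (d Q.:* d) Q.:- b))
            Q.:= (Q.con 1ℚ Q.:+ Q.con 1ℚ) Q.:* g) refl δ G B))

      θ≤ : θ ≤ K₁ * (w² * Re Y)
      θ≤ = ℚ.≤-trans (tower-mono r (nn* (nn* (ℚ.<⇒≤ 0<½) (ℚ.<⇒≤ 0<½)) (sq-nn δ)) good-large) good-bound

      θ≤good : ½ * θ ≤ K₁ * (w² * Re Ygood)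
      θ≤good = le (nn+ (nn-sub θ≤′) (nn-sub (ℚ.≤-trans
          (*-monoˡ K₁ (ℚ.<⇒≤ 0<K₁) Ybad-small) degenerate-n)))
        (Q.solve 3 (λ t a b → Q.con ½ Q.:* t Q.:+ ((a Q.:+ b Q.:- t) Q.:+ (Q.con ½ Q.:* t Q.:- b)) Q.:= a) refl
          θ (K₁ * (w² * Re Ygood)) (K₁ * (w² * Re Ybad)))
        where
        θ≤′ : θ ≤ K₁ * (w² * Re Ygood) + K₁ * (w² * Re Ybad)
        θ≤′ = ℚ.≤-trans θ≤ (ℚ.≤-reflexive (trans
          (cong (λ t → K₁ * (w² * t)) (trans (cong Re Y-split) (Re-⊕ Ygood Ybad)))
          (Q.solve 4 (λ k w a b → k Q.:* (w Q.:* (a Q.:+ b)) Q.:= k Q.:* (w Q.:* a) Q.:+ k Q.:* (w Q.:* b)) refl K₁ w² (Re Ygood) (Re Ybad))))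

    -- `θ` is a constant times δ^(2^s), so the left side is a constant times the 2^(s+1)-th power of
    -- δ^(2^s), while the right side is the normalised 2^(s+1)-th power of the norm of g.
    gowers-lower-bound : tower s (sq (½ * θ * recip K₁)) ≤ K₃ * (w ^ℚ suc (suc s) * Re (U (suc s) g))
    gowers-lower-bound = ℚ.≤-trans
      (tower-mono s (sq-nn (½ * θ * recip K₁)) (ℚ.≤-trans
        (sq-mono (nn* (nn* (ℚ.<⇒≤ 0<½) 0≤θ) (recip-nn 0<K₁)) ψ≤)
        (subst (_≤ sq w² * normSq Ygood)
          (Q.solve 2 (λ a b → a Q.:* a Q.:* (b Q.:* b) Q.:= (a Q.:* b) Q.:* (a Q.:* b)) refl w² (Re Ygood))
          (*-monoˡ (sq w²) (sq-nn w²) (Re²≤normSq Ygood)))))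
      Ygood-bound
      where
      ψ≤ : ½ * θ * recip K₁ ≤ w² * Re Ygood
      ψ≤ = ℚ.≤-trans (*-monoʳ (recip K₁) (recip-nn 0<K₁) θ≤good)
        (ℚ.≤-reflexive (trans (Q.solve 3 (λ k x r → k Q.:* x Q.:* r Q.:= k Q.:* r Q.:* x) refl K₁ (w² * Re Ygood) (recip K₁))
          (trans (cong (_* (w² * Re Ygood)) (recip-inv 0<K₁)) (ℚ.*-identityˡ (w² * Re Ygood)))))

-- Indices of Cauchy sequences

at : ℕ → ℂ → ℚ[i]
at n z = seq (re z) n +𝕚 seq (im z) n

at-∑ : ∀ n {A : Set} (xs : List A) (F : A → ℂ) → at n (∑ᶜ xs F) ≡ ∑ᵍ xs λ x → at n (F x)
at-∑ n []       F = refl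
at-∑ n (x ∷ xs) F = cong (at n (F x) ⊕_) (at-∑ n xs F)

Close : (ℕ → ℚ) → (ℕ → ℚ) → Set
Close x y = ∀ ε → 0ℚ < ε → ∃ λ K → ∀ n → K ℕ.≤ n → ∣ x n - y n ∣ ≤ ε

Closeᶜ : ℂ → ℂ → Set
Closeᶜ z w = Close (seq (re z)) (seq (re w)) × Close (seq (im z)) (seq (im w))

≃⇒Close : ∀ {x y} → x ≃ᴿ y → Close (seq x) (seq y)
≃⇒Close {x} {y} (x≤y , y≤x) ε 0<ε =
  let K , h = x≤y ε 0<ε
      L , k = y≤x ε 0<ε
  in K ℕ.⊔ L , λ n p → ≤⇒∣∣ {seq x n} {seq y n}
       (h n (ℕ.m⊔n≤o⇒m≤o K L p)) (k n (ℕ.m⊔n≤o⇒n≤o K L p))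

Close-refl : ∀ x → Close x x
Close-refl x ε 0<ε = 0 , λ n _ → subst (λ t → ∣ t ∣ ≤ ε) (sym (ℚ.+-inverseʳ (x n))) (ℚ.<⇒≤ 0<ε)

Close-+ : ∀ {x y x′ y′} → Close x x′ → Close y y′ → Close (λ n → x n + y n) (λ n → x′ n + y′ n)
Close-+ {x} {y} {x′} {y′} hx hy ε 0<ε =
  let K , h = hx (½ * ε) (pos* 0<½ 0<ε)
      L , k = hy (½ * ε) (pos* 0<½ 0<ε)
  in K ℕ.⊔ L , λ n p → ℚ.≤-trans (∣+-∣ (x n) (y n) (x′ n) (y′ n))
       (subst (∣ x n - x′ n ∣ + ∣ y n - y′ n ∣ ≤_) (solve 1 (λ e → con ½ :* e :+ con ½ :* e := e) refl ε)
         (ℚ.+-mono-≤ (h n (ℕ.m⊔n≤o⇒m≤o K L p)) (k n (ℕ.m⊔n≤o⇒n≤o K L p))))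
  where open ℚ-Solver.+-*-Solver

Close-neg : ∀ {x x′} → Close x x′ → Close (λ n → - x n) (λ n → - x′ n)
Close-neg {x} {x′} hx ε 0<ε =
  let K , h = hx ε 0<ε in K , λ n p → subst (_≤ ε)
    (trans (sym (ℚ.∣-p∣≡∣p∣ (x n - x′ n))) (cong ∣_∣ (solve 2 (λ a b → :- (a :- b) := :- a :- :- b) refl (x n) (x′ n))))
    (h n p)
  where open ℚ-Solver.+-*-Solver

Close-* : ∀ {x y x′ y′} → IsCauchy x → IsCauchy y′ → Close x x′ → Close y y′ →
  Close (λ n → x n * y n) (λ n → x′ n * y′ n)
Close-* {x} {y} {x′} {y′} cx cy′ hx hy ε 0<ε =
  let C , 0<C , K₁ , bx = bounded {x} cx
      D , 0<D , K₂ , by = bounded {y′} cy′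
      0<CD = pos+ 0<C (ℚ.<⇒≤ 0<D)
      e = recip (C + D) * ε
      0<e = pos* (recip-pos 0<CD) 0<ε
      K₃ , h = hx e 0<e
      K₄ , k = hy e 0<e
  in K₁ ℕ.⊔ K₂ ℕ.⊔ (K₃ ℕ.⊔ K₄) , λ n p → subst (∣ x n * y n - x′ n * y′ n ∣ ≤_)
       (trans (sym (ℚ.*-assoc (C + D) (recip (C + D)) ε)) (trans (cong (_* ε) (recip-inv 0<CD)) (ℚ.*-identityˡ ε)))
       (*-step e (x n) (y n) (x′ n) (y′ n)
         (bx n (ℕ.m⊔n≤o⇒m≤o K₁ K₂ (ℕ.m⊔n≤o⇒m≤o _ (K₃ ℕ.⊔ K₄) p)))
         (by n (ℕ.m⊔n≤o⇒n≤o K₁ K₂ (ℕ.m⊔n≤o⇒m≤o _ (K₃ ℕ.⊔ K₄) p)))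
         (h n (ℕ.m⊔n≤o⇒m≤o K₃ K₄ (ℕ.m⊔n≤o⇒n≤o (K₁ ℕ.⊔ K₂) _ p)))
         (k n (ℕ.m⊔n≤o⇒n≤o K₃ K₄ (ℕ.m⊔n≤o⇒n≤o (K₁ ℕ.⊔ K₂) _ p))))

Closeᶜ-refl : ∀ z → Closeᶜ z z
Closeᶜ-refl z = Close-refl (seq (re z)) , Close-refl (seq (im z))

≃⇒Closeᶜ : ∀ {z w} → z ≃ᶜ w → Closeᶜ z w
≃⇒Closeᶜ {z} {w} (h , k) = ≃⇒Close {re z} {re w} h , ≃⇒Close {im z} {im w} k

Closeᶜ-+ : ∀ {z w z′ w′} → Closeᶜ z z′ → Closeᶜ w w′ → Closeᶜ (z +ᶜ w) (z′ +ᶜ w′)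
Closeᶜ-+ {z} {w} {z′} {w′} (a , b) (c , d) =
  Close-+ {seq (re z)} {seq (re w)} {seq (re z′)} {seq (re w′)} a c ,
  Close-+ {seq (im z)} {seq (im w)} {seq (im z′)} {seq (im w′)} b d

Closeᶜ-* : ∀ {z w z′ w′} → Closeᶜ z z′ → Closeᶜ w w′ → Closeᶜ (z *ᶜ w) (z′ *ᶜ w′)
Closeᶜ-* {z} {w} {z′} {w′} (a , b) (c , d) =
  Close-+ {seq (re z *ᴿ re w)} {seq (-ᴿ (im z *ᴿ im w))} {seq (re z′ *ᴿ re w′)} {seq (-ᴿ (im z′ *ᴿ im w′))}
    (Close-* {seq (re z)} {seq (re w)} {seq (re z′)} {seq (re w′)} (cauchy (re z)) (cauchy (re w′)) a c)
    (Close-neg {seq (im z *ᴿ im w)} {seq (im z′ *ᴿ im w′)}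
      (Close-* {seq (im z)} {seq (im w)} {seq (im z′)} {seq (im w′)} (cauchy (im z)) (cauchy (im w′)) b d)) ,
  Close-+ {seq (re z *ᴿ im w)} {seq (im z *ᴿ re w)} {seq (re z′ *ᴿ im w′)} {seq (im z′ *ᴿ re w′)}
    (Close-* {seq (re z)} {seq (im w)} {seq (re z′)} {seq (im w′)} (cauchy (re z)) (cauchy (im w′)) a d)
    (Close-* {seq (im z)} {seq (re w)} {seq (im z′)} {seq (re w′)} (cauchy (im z)) (cauchy (re w′)) b c)

Closeᶜ-∑ : {A : Set} (xs : List A) {F G : A → ℂ} → (∀ x → Closeᶜ (F x) (G x)) → Closeᶜ (∑ᶜ xs F) (∑ᶜ xs G)
Closeᶜ-∑ []       h = Closeᶜ-refl 0ᶜ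
Closeᶜ-∑ (x ∷ xs) {F} {G} h = Closeᶜ-+ {F x} {∑ᶜ xs F} {G x} {∑ᶜ xs G} (h x) (Closeᶜ-∑ xs h)

Closeᶜ-∏ : {A : Set} (xs : List A) {F G : A → ℂ} → (∀ x → Closeᶜ (F x) (G x)) → Closeᶜ (∏ᶜ xs F) (∏ᶜ xs G)
Closeᶜ-∏ []       h = Closeᶜ-refl 1ᶜ
Closeᶜ-∏ (x ∷ xs) {F} {G} h = Closeᶜ-* {F x} {∏ᶜ xs F} {G x} {∏ᶜ xs G} (h x) (Closeᶜ-∏ xs h)

-- A bound on a real number holds at its indices only from a place that depends on the number.
-- Finitely many values have a common such place, which suffices for functions of finite support.
eventually-∈ : {A : Set} (xs : List A) (P : A → ℕ → Set) → (∀ x → ∃ λ K → ∀ n → K ℕ.≤ n → P x n) →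
  ∃ λ K → ∀ n → K ℕ.≤ n → ∀ {x} → x ∈ xs → P x n
eventually-∈ []       P h = 0 , λ _ _ ()
eventually-∈ (x ∷ xs) P h =
  let K , p = h x
      L , q = eventually-∈ xs P h
  in K ℕ.⊔ L , λ n k → λ where
       (here refl) → p n (ℕ.m⊔n≤o⇒m≤o K L k)
       (there x∈)  → q n (ℕ.m⊔n≤o⇒n≤o K L k) x∈

-- Approximate square roots and the logarithm

module _ where
  open ℚ-Solver.+-*-Solver

  -- The root of Q at an index is only known as an interval from b to b + u. The resolution u and
  -- the error of the hypothesis contribute e each.
  root-≥ : ∀ {a b e u Q} → 0ℚ ≤ b → 0ℚ ≤ u → 0ℚ ≤ e → u ≤ e → sq a ≤ Q + sq e → Q < sq (b + u) →
    a ≤ b + (e + e)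
  root-≥ {a} {b} {e} {u} {Q} 0≤b 0≤u 0≤e u≤e h Q< = ≤-from-sq (nn+ 0≤b (nn+ 0≤e 0≤e)) (begin
    sq a                          ≤⟨ h ⟩
    Q + sq e                      ≤⟨ ℚ.+-monoˡ-≤ (sq e) (ℚ.<⇒≤ Q<) ⟩
    sq (b + u) + sq e             ≤⟨ ℚ.+-monoˡ-≤ (sq e) (sq-mono (nn+ 0≤b 0≤u) (ℚ.+-monoʳ-≤ b u≤e)) ⟩
    sq (b + e) + sq e             ≤⟨ le (nn* (nn+ 0≤1 0≤1) (nn* (nn+ 0≤b 0≤e) 0≤e)) (solve 2 (λ b e →
                  (b :+ e) :* (b :+ e) :+ e :* e :+ (con 1ℚ :+ con 1ℚ) :* ((b :+ e) :* e)
                  := (b :+ (e :+ e)) :* (b :+ (e :+ e))) refl b e) ⟩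
    sq (b + (e + e))              ∎)
    where open ℚ.≤-Reasoning

  scaled-root-≥ : ∀ {q a b e u X Y} → 0ℚ ≤ q → 0ℚ ≤ a → sq a ≤ 0ℚ ⊔ X → 0ℚ ≤ b → 0ℚ ⊔ Y < sq (b + u) →
    0ℚ ≤ u → 0ℚ ≤ e → u ≤ e → sq q * X ≤ Y + sq e → q * a ≤ b + (e + e)
  scaled-root-≥ {q} {a} {b} {e} {u} {X} {Y} 0≤q 0≤a a²≤ 0≤b Y< 0≤u 0≤e u≤e h =
    root-≥ {q * a} {b} {e} {u} {0ℚ ⊔ Y} 0≤b 0≤u 0≤e u≤e
      (ℚ.≤-trans
        (subst (_≤ sq q * (0ℚ ⊔ X)) (solve 2 (λ q a → q :* q :* (a :* a) := (q :* a) :* (q :* a)) refl q a)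
          (*-monoˡ (sq q) (sq-nn q) a²≤))
        (positive-part X Y h))
      Y<
    where
    positive-part : ∀ x y → sq q * x ≤ y + sq e → sq q * (0ℚ ⊔ x) ≤ 0ℚ ⊔ y + sq e
    positive-part x y h with ℚ.≤-total 0ℚ x
    ... | inj₁ 0≤x = subst (λ t → sq q * t ≤ 0ℚ ⊔ y + sq e) (sym (ℚ.p≤q⇒p⊔q≡q 0≤x))
      (ℚ.≤-trans h (ℚ.+-monoˡ-≤ (sq e) (ℚ.p≤q⊔p 0ℚ y)))
    ... | inj₂ x≤0 = subst (_≤ 0ℚ ⊔ y + sq e) (sym (trans (cong (λ t → sq q * t) (ℚ.p≥q⇒p⊔q≡p x≤0)) (ℚ.*-zeroʳ (sq q))))
      (nn+ (ℚ.p≤p⊔q 0ℚ y) (sq-nn e))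

  halves : ∀ {p b ε} → p ≤ b + (½ * ε + ½ * ε) → p ≤ b + ε
  halves {p} {b} {ε} = subst (λ t → p ≤ b + t) (solve 1 (λ e → con ½ :* e :+ con ½ :* e := e) refl ε)

opaque
  -- An opaque copy of the approximation, so that the search defining it is never unfolded in a
  -- goal.
  √ᵒ : ℚ → ℕ → ℚ
  √ᵒ q n = √-approx (0ℚ ⊔ q) n

  √ᵒ-def : ∀ q n → √ᵒ q n ≡ √-approx (0ℚ ⊔ q) n
  √ᵒ-def q n = refl

  √ᵒ-nn : ∀ q n → 0ℚ ≤ √ᵒ q n
  √ᵒ-nn q n = 0≤√ (0ℚ ⊔ q) n

  √ᵒ-low : ∀ q n → sq (√ᵒ q n) ≤ 0ℚ ⊔ q
  √ᵒ-low q n = √-low (0ℚ ⊔ q) n (√-bound (0ℚ ⊔ q) n) (ℚ.p≤p⊔q 0ℚ q)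

  √ᵒ-high : ∀ q n → 0ℚ ⊔ q < sq (√ᵒ q n + unit n)
  √ᵒ-high q n = √-high (0ℚ ⊔ q) n (ℚ.p≤p⊔q 0ℚ q)

√-scaled : ∀ {q x y} → 0ℚ ≤ q → fromℚ (sq q) *ᴿ x ≤ᴿ y → fromℚ q *ᴿ √ x ≤ᴿ √ y
√-scaled {q} {x} {y} 0≤q h ε 0<ε =
  let e = ½ * ε
      0<e = pos* 0<½ 0<ε
      K , k = h (sq e) (pos* 0<e 0<e)
      L , u = unit-small e 0<e
  in K ℕ.⊔ L , λ n p →
       subst₂ (λ a b → q * a ≤ b + ε) (√ᵒ-def (seq x n) n) (√ᵒ-def (seq y n) n)
         (halves {q * √ᵒ (seq x n) n} {√ᵒ (seq y n) n} {ε}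
           (scaled-root-≥ {q} {√ᵒ (seq x n) n} {√ᵒ (seq y n) n} {e} {unit n} {seq x n} {seq y n} 0≤q
             (√ᵒ-nn (seq x n) n) (√ᵒ-low (seq x n) n) (√ᵒ-nn (seq y n) n) (√ᵒ-high (seq y n) n)
             (ℚ.<⇒≤ (0<unit n)) (ℚ.<⇒≤ 0<e) (u n (ℕ.m⊔n≤o⇒n≤o K L p)) (k n (ℕ.m⊔n≤o⇒m≤o K L p))))

root-scaled : ∀ s {q x y} → 0ℚ ≤ q → fromℚ (tower s q) *ᴿ x ≤ᴿ y → fromℚ q *ᴿ root2^ s x ≤ᴿ root2^ s y
root-scaled zero    0≤q h = h
root-scaled (suc s) {q} {x} {y} 0≤q h =
  √-scaled {q} {root2^ s x} {root2^ s y} 0≤q (root-scaled s {sq q} {x} {y} (sq-nn q) h)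

1≤√ : ∀ {x} → 1ᴿ ≤ᴿ x → 1ᴿ ≤ᴿ √ x
1≤√ {x} h ε 0<ε =
  let e = ½ * ε
      0<e = pos* 0<½ 0<ε
      K , k = h (sq e) (pos* 0<e 0<e)
      L , u = unit-small e 0<e
  in K ℕ.⊔ L , λ n p →
       subst (λ b → 1ℚ ≤ b + ε) (√ᵒ-def (seq x n) n)
         (halves {1ℚ} {√ᵒ (seq x n) n} {ε}
           (root-≥ {1ℚ} {√ᵒ (seq x n) n} {e} {unit n} {0ℚ ⊔ seq x n} (√ᵒ-nn (seq x n) n) (ℚ.<⇒≤ (0<unit n)) (ℚ.<⇒≤ 0<e)
             (u n (ℕ.m⊔n≤o⇒n≤o K L p))
             (ℚ.≤-trans (k n (ℕ.m⊔n≤o⇒m≤o K L p)) (ℚ.+-monoˡ-≤ (sq e) (ℚ.p≤q⊔p 0ℚ (seq x n))))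
             (√ᵒ-high (seq x n) n)))

1≤root : ∀ s {x} → 1ᴿ ≤ᴿ x → 1ᴿ ≤ᴿ root2^ s x
1≤root zero    h = h
1≤root (suc s) {x} h = 1≤√ {root2^ s x} (1≤root s {x} h)

1≤^ : ∀ {x} → (∃ λ K → ∀ n → K ℕ.≤ n → 1ℚ ≤ seq x n) → ∀ j → ∃ λ K → ∀ n → K ℕ.≤ n → 1ℚ ≤ seq (x ^ᴿ j) n
1≤^ h zero    = 0 , λ _ _ → ℚ.≤-refl
1≤^ {x} (K , h) (suc j) =
  let L , k = 1≤^ {x} (K , h) j in K ℕ.⊔ L , λ n p →
    ℚ.≤-trans (ℚ.≤-reflexive (sym (ℚ.*-identityˡ 1ℚ)))
      (mono* 0≤1 0≤1 (h n (ℕ.m⊔n≤o⇒m≤o K L p)) (k n (ℕ.m⊔n≤o⇒n≤o K L p)))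

1≤partial : ∀ J {w} → 0ℚ ≤ w → 1ℚ ≤ partial (λ j → unit (2 ℕ.* j)) (suc J) w
1≤partial zero    {w} 0≤w = ℚ.≤-refl
1≤partial (suc J) {w} 0≤w = ℚ.≤-trans (1≤partial J 0≤w)
  (le (nn* (ℚ.<⇒≤ (0<unit (2 ℕ.* suc J))) (^ℚ-nn 0≤w (suc J))) refl)

-- For y ≥ 8 the first term of the series already gives 2 (y − 1)/(y + 1) ≥ 1.
1≤log : ∀ y (0<y : 0ᴿ <ᴿ y) → (∃ λ K → ∀ n → K ℕ.≤ n → ι 8 ≤ seq y n) →
  ∃ λ K → ∀ n → K ℕ.≤ n → 1ℚ ≤ seq (log y 0<y) n
-- Index 0 is avoided because the partial sum of the series is empty there.
1≤log y 0<y (K , h) = suc K , large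
  where
  open ℚ-Solver.+-*-Solver
  bound : ∀ u J → ι 8 ≤ u → let z = (u + - 1ℚ) * recip (u + 1ℚ) in
    1ℚ ≤ ι 2 * z * partial (λ j → unit (2 ℕ.* j)) (suc J) (z * z)
  bound u J 8≤u = ℚ.≤-trans (ℚ.≤-reflexive (sym (ℚ.*-identityˡ 1ℚ)))
    (mono* 0≤1 0≤1 first (1≤partial J (sq-nn z)))
    where
    z = (u + - 1ℚ) * recip (u + 1ℚ)
    0<u+1 : 0ℚ < u + 1ℚ
    0<u+1 = pos+ (ℚ.<-≤-trans (0<ι 7) 8≤u) 0≤1
    first : 1ℚ ≤ ι 2 * z
    first = subst (_≤ ι 2 * z) (recip-inv 0<u+1)
      (ℚ.≤-trans (*-monoʳ (recip (u + 1ℚ)) (recip-nn 0<u+1)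
          (le {u + 1ℚ} {ι 2 * (u + - 1ℚ)} {(u - ι 8) + ι 5} (nn+ (nn-sub 8≤u) (0≤ι 5))
            (solve 1 (λ u → u :+ con 1ℚ :+ ((u :- con (ι 8)) :+ con (ι 5)) := con (ι 2) :* (u :+ :- con 1ℚ)) refl u)))
        (ℚ.≤-reflexive (ℚ.*-assoc (ι 2) (u + - 1ℚ) (recip (u + 1ℚ)))))
  large : ∀ n → suc K ℕ.≤ n → 1ℚ ≤ seq (log y 0<y) n
  large (suc n) (s≤s p) = bound (seq y (suc n)) n (h (suc n) (ℕ.m≤n⇒m≤1+n p))

-- The counting operator with one coefficient singled out

at-∏ : ∀ n {s} {A : Set} (g : Fin s → A) (F : A → ℂ) → at n (∏ᶜ (List.tabulate g) F) ≡ ∏ λ j → at n (F (g j))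
at-∏ n {zero}  g F = refl
at-∏ n {suc s} g F = cong (at n (F (g zero)) ⊗_) (at-∏ n (g ∘ suc) F)

∏-punchIn : ∀ {s} (i : Fin (suc s)) (F : Fin (suc s) → ℚ[i]) → ∏ F ≡ F i ⊗ ∏ (F ∘ punchIn i)
∏-punchIn zero    F = refl
∏-punchIn {suc s} (suc i) F = trans (cong (F zero ⊗_) (∏-punchIn i (F ∘ suc)))
  (solve 3 (λ a b c → a :* (b :* c) := b :* (a :* c)) refl (F zero) (F (suc i)) (∏ (F ∘ suc ∘ punchIn i)))
  where open ℚ[i]-Solver

∑ᵍ-insertAt : ∀ {A : Set} (xs : List A) s (i : Fin (suc s)) (F : Vec A (suc s) → ℚ[i]) →
  ∑ᵍ (vecs xs (suc s)) F ≡ ∑ᵍ xs λ a → ∑ᵍ (vecs xs s) λ b → F (Vec.insertAt b i a)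
∑ᵍ-insertAt xs s       zero    F = ∑ᵍ-vecs xs s F
∑ᵍ-insertAt xs (suc s) (suc i) F = trans (∑ᵍ-vecs xs (suc s) F)
  (trans (∑ᵍ.∑-cong xs λ c → ∑ᵍ-insertAt xs s i λ v → F (c ∷ v))
    (trans (∑ᵍ.∑-swap xs xs _) (∑ᵍ.∑-cong xs λ a → sym (∑ᵍ-vecs xs s _))))

box≡vecs : ∀ L s → box L s ≡ vecs (window L) s
box≡vecs L zero    = refl
box≡vecs L (suc s) = cong₂ (cartesianProductWith _∷_) (sym (window≡interval L)) (box≡vecs L s)

∑ᵍ-vecs-restrict : ∀ {L K} → L ℕ.≤ K → ∀ s (F : Vec ℤ s → ℚ[i]) →
  (∀ v → ¬ All (λ a → ℤ.∣ a ∣ ℕ.≤ L) v → F v ≡ 0ᵍ) →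
  ∑ᵍ (vecs (window K) s) F ≡ ∑ᵍ (vecs (window L) s) F
∑ᵍ-vecs-restrict L≤K zero    F h = refl
∑ᵍ-vecs-restrict {L} {K} L≤K (suc s) F h = begin
  ∑ᵍ (vecs (window K) (suc s)) F
    ≡⟨ ∑ᵍ-vecs (window K) s F ⟩
  ∑ᵍ (window K) (λ x → ∑ᵍ (vecs (window K) s) λ v → F (x ∷ v))
    ≡⟨ ∑ᵍ.∑-cong (window K) (λ x → ∑ᵍ-vecs-restrict L≤K s (λ v → F (x ∷ v)) λ v ¬p → h (x ∷ v) λ { (_ ∷ p) → ¬p p }) ⟩
  ∑ᵍ (window K) G
    ≡⟨ ∑ᵍ.∑-cong (window K) (λ x → cong G (sym (ℤ.+-identityʳ x))) ⟩
  ∑ᵍ (window K) (λ x → G (x ℤ.+ + 0))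
    ≡⟨ ∑ᵍ-shift (+ 0) G (λ x ¬p → ∑ᵍ.∑-zero (vecs (window L) s) λ v → h (x ∷ v) λ { (p ∷ _) → ¬p p })
         ℕ.≤-refl (subst (ℕ._≤ K) (sym (ℕ.+-identityʳ L)) L≤K) ⟩
  ∑ᵍ (window L) G
    ≡⟨ sym (∑ᵍ-vecs (window L) s F) ⟩
  ∑ᵍ (vecs (window L) (suc s)) F ∎
  where
  open ≡-Reasoning
  G : ℤ → ℚ[i]
  G x = ∑ᵍ (vecs (window L) s) λ v → F (x ∷ v)

-- Treating [H] as a weight on a symmetric window lets every differencing step replace it by its own
-- derivative, while the range of m stays the same.
inRange : ℕ → ℤ → ℚ[i]
inRange H m = ∑ᵍ.⟦ m ∈[ H ]? ⟧

inRange-Supported : ∀ H → Supported H (inRange H)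
inRange-Supported H m ¬p = ∑ᵍ.⟦⟧-no (m ∈[ H ]?) λ q → ¬p (∈⇒∣∣≤ H q)

inRange-UnitBounded : ∀ H → UnitBounded (inRange H)
inRange-UnitBounded H m with m ∈[ H ]?
... | yes _ = ℚ.≤-refl
... | no  _ = 0≤1

∑ᵍ-range : ∀ H (G : ℤ → ℚ[i]) → ∑ᵍ (range H) G ≡ ∑ᵍ (window H) λ m → inRange H m ⊗ G m
∑ᵍ-range H G = trans
  (∑ᵍ.∑-cong∈ (range H) λ {m} m∈ → sym (trans (cong (_⊗ G m) (∑ᵍ.⟦⟧-yes (m ∈[ H ]?) (range⁻ m∈))) (⊗-identityˡ (G m))))
  (∑ᵍ.∑-support ℤ._≟_ (range H) (window H) (λ m → inRange H m ⊗ G m)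
    (Unique.map⁺ (λ e → ℕ.suc-injective (ℤ.+-injective e)) (Unique.upTo⁺ H)) (window-unique H)
    (λ m m∉ → vanish m λ q → m∉ (range⁺ q))
    (λ m m∉ → vanish m λ q → m∉ (∈-window⁺ (∈⇒∣∣≤ H q))))
  where
  vanish : ∀ m → ¬ m ∈[ H ] → inRange H m ⊗ G m ≡ 0ᵍ
  vanish m ¬q = trans (cong (_⊗ G m) (∑ᵍ.⟦⟧-no (m ∈[ H ]?) ¬q)) (⊗-zeroˡ (G m))
  range⁻ : ∀ {m} → m ∈ range H → m ∈[ H ]
  range⁻ m∈ with ∈-map⁻ (λ j → + suc j) m∈
  ... | j , j∈ , refl = ℤ.+≤+ (s≤s z≤n) , ℤ.+≤+ (∈-upTo⁻ j∈)
  range⁺ : ∀ {m} → m ∈[ H ] → m ∈ range H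
  range⁺ {+ suc j} (_ , ℤ.+≤+ h) = ∈-map⁺ (λ j → + suc j) (∈-upTo⁺ h)
  range⁺ {+ zero} (ℤ.+≤+ () , _)

∑ᵍ-range∈ : ∀ H {F G : ℤ → ℚ[i]} → (∀ m → ℤ.∣ m ∣ ℕ.≤ H → F m ≡ G m) → ∑ᵍ (range H) F ≡ ∑ᵍ (range H) G
∑ᵍ-range∈ H h = ∑ᵍ.∑-cong∈ (range H) λ m∈ → bounded-entry m∈
  where
  bounded-entry : ∀ {m} → m ∈ range H → _
  bounded-entry m∈ with ∈-map⁻ (λ j → + suc j) m∈
  ... | j , j∈ , refl = h (+ suc j) (∈-upTo⁻ j∈)

module _ {s T L M H : ℕ} (L≤T : L ℕ.≤ T) (lam : Vec ℤ (suc s) → ℚ[i]) (f : Fin (suc s) → ℤ → ℚ[i])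
  (lam-supp : ∀ b → ¬ All (λ a → ℤ.∣ a ∣ ℕ.≤ L) b → lam b ≡ 0ᵍ) (f-supp : ∀ j → Supported M (f j)) (i : Fin (suc s)) where

  open VonNeumann {M} {M ℕ.+ M} (ℕ.m≤m+n M M) H

  configurations : Vec ℤ (suc s) → ℚ[i]
  configurations b = ∑ᵍ (window (M ℕ.+ T ℕ.* H)) λ x → ∑ᵍ (range H) λ m → ∏ λ j → f j (x ℤ.+ Vec.lookup b j ℤ.* m)

  -- Translating x by am moves the selected function to the origin and leaves the differences bⱼ -
  -- a. The window of radius M + TH accommodates the translate because |a| ≤ L ≤ T and |m| ≤ H.
  configurations-insertAt : ∀ a b → ℤ.∣ a ∣ ℕ.≤ L →
    configurations (Vec.insertAt b i a) ≡ progressionSum (inRange H) (f i) (Vec.map (ℤ._- a) b) (f ∘ punchIn i)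
  configurations-insertAt a b a≤L = begin
    configurations (Vec.insertAt b i a)
      ≡⟨ ∑ᵍ.∑-swap (window X) (range H) _ ⟩
    ∑ᵍ (range H) (λ m → ∑ᵍ (window X) λ x → ∏ λ j → f j (x ℤ.+ Vec.lookup (Vec.insertAt b i a) j ℤ.* m))
      ≡⟨ ∑ᵍ-range∈ H (λ m m≤H → trans (∑ᵍ.∑-cong (window X) λ x → trans (∏-punchIn i λ j → f j (x ℤ.+ Vec.lookup (Vec.insertAt b i a) j ℤ.* m)) (factor x m))
           (∑ᵍ-shift (a ℤ.* m) (Ψ m) (Ψ-supp m) (ℕ.m≤m+n M M)
             (ℕ.+-monoʳ-≤ M (subst (ℕ._≤ T ℕ.* H) (sym (ℤ.∣i*j∣≡∣i∣*∣j∣ a m)) (ℕ.*-mono-≤ (ℕ.≤-trans a≤L L≤T) m≤H))))) ⟩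
    ∑ᵍ (range H) (λ m → ∑ᵍ (window (M ℕ.+ M)) (Ψ m))
      ≡⟨ ∑ᵍ-range H _ ⟩
    progressionSum (inRange H) (f i) (Vec.map (ℤ._- a) b) (f ∘ punchIn i) ∎
    where
    open ≡-Reasoning
    X = M ℕ.+ T ℕ.* H
    Ψ : ℤ → ℤ → ℚ[i]
    Ψ m y = f i y ⊗ ∏ λ j → f (punchIn i j) (y ℤ.+ Vec.lookup (Vec.map (ℤ._- a) b) j ℤ.* m)
    Ψ-supp : ∀ m → Supported M (Ψ m)
    Ψ-supp m y ¬p = trans (cong (_⊗ ∏ λ j → f (punchIn i j) (y ℤ.+ Vec.lookup (Vec.map (ℤ._- a) b) j ℤ.* m)) (f-supp i y ¬p)) (⊗-zeroˡ _)
    factor : ∀ x m → f i (x ℤ.+ Vec.lookup (Vec.insertAt b i a) i ℤ.* m)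
      ⊗ ∏ (λ j → f (punchIn i j) (x ℤ.+ Vec.lookup (Vec.insertAt b i a) (punchIn i j) ℤ.* m)) ≡ Ψ m (x ℤ.+ a ℤ.* m)
    factor x m = cong₂ _⊗_
      (cong (λ t → f i (x ℤ.+ t ℤ.* m)) (Vec.insertAt-lookup b i a))
      (∏-cong λ j → cong (f (punchIn i j)) (trans (cong (λ t → x ℤ.+ t ℤ.* m) (Vec.insertAt-punchIn b i a j))
        (trans (solve 4 (λ x y a m → x :+ y :* m := x :+ a :* m :+ (y :- a) :* m) refl x (Vec.lookup b j) a m)
          (cong (λ t → x ℤ.+ a ℤ.* m ℤ.+ t ℤ.* m) (sym (Vec.lookup-map j (ℤ._- a) b))))))
      where open ℤ-Solver.+-*-Solver

  configurations-total : (∑ᵍ (vecs (window T) (suc s)) λ b → lam b ⊗ configurations b) ≡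
    ∑ᵍ (window L) λ a → ∑ᵍ (vecs (window L) s) λ b →
      lam (Vec.insertAt b i a) ⊗ progressionSum (inRange H) (f i) (Vec.map (ℤ._- a) b) (f ∘ punchIn i)
  configurations-total = trans
    (∑ᵍ-vecs-restrict L≤T (suc s) _ λ b ¬p → trans (cong (_⊗ configurations b) (lam-supp b ¬p)) (⊗-zeroˡ _))
    (trans (∑ᵍ-insertAt (window L) s i _)
      (∑ᵍ.∑-cong∈ (window L) λ {a} a∈ → ∑ᵍ.∑-cong (vecs (window L) s) λ b →
        cong (lam (Vec.insertAt b i a) ⊗_) (configurations-insertAt a b (∈-window⁻ a∈))))

scale : {A : Set} → ℚ → (A → ℚ[i]) → A → ℚ[i]
scale c f x = real c ⊗ f x

real-* : ∀ p q → real (p * q) ≡ real p ⊗ real q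
real-* p q = cong₂ _+𝕚_
  (solve 2 (λ p q → p :* q := p :* q :+ :- (con 0ℚ :* con 0ℚ)) refl p q)
  (solve 2 (λ p q → con 0ℚ := p :* con 0ℚ :+ con 0ℚ :* q) refl p q)
  where open ℚ-Solver.+-*-Solver

real-interchange : ∀ p q x y → (real p ⊗ x) ⊗ (real q ⊗ y) ≡ real (p * q) ⊗ (x ⊗ y)
real-interchange p q x y = trans (⊗-interchange (real p) x (real q) y) (cong (_⊗ (x ⊗ y)) (sym (real-* p q)))

∏-scale : ∀ {s} c (F : Fin s → ℚ[i]) → (∏ λ j → real c ⊗ F j) ≡ real (c ^ℚ s) ⊗ ∏ F
∏-scale {zero}  c F = sym (⊗-identityˡ 1ᵍ)
∏-scale {suc s} c F = trans (cong (real c ⊗ F zero ⊗_) (∏-scale c (F ∘ suc)))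
  (real-interchange c (c ^ℚ s) (F zero) (∏ (F ∘ suc)))

scale-Supported : ∀ {M} c {f} → Supported M f → Supported M (scale c f)
scale-Supported c h x ¬p = trans (cong (real c ⊗_) (h x ¬p)) (⊗-zeroʳ (real c))

½-UnitBounded : ∀ z → normSq z ≤ ι 4 → normSq (real ½ ⊗ z) ≤ 1ℚ
½-UnitBounded z h = subst (_≤ 1ℚ) (sym (trans (normSq-⊗ (real ½) z) (cong (_* normSq z) (normSq-real ½))))
  (ℚ.*-monoˡ-≤-nonNeg (sq ½) h)

module _ {M N : ℕ} (M≤N : M ℕ.≤ N) (H : ℕ) where
  open VonNeumann {M} {N} M≤N H

  progressionSum-scale : ∀ {s} c μ g (ds : Vec ℤ s) φ →
    progressionSum μ (scale c g) ds (λ j → scale c (φ j)) ≡ real (c ^ℚ suc s) ⊗ progressionSum μ g ds φ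
  progressionSum-scale {s} c μ g ds φ = trans
    (∑ᵍ.∑-cong (window H) λ m → trans
      (cong (μ m ⊗_) (trans
        (∑ᵍ.∑-cong (window N) λ x → trans (cong (scale c g x ⊗_) (∏-scale c λ j → φ j (x ℤ.+ Vec.lookup ds j ℤ.* m)))
          (real-interchange c (c ^ℚ s) (g x) _))
        (sym (∑ᵍ.∑-*ˡ (real (c ^ℚ suc s)) (window N) _))))
      (solve 3 (λ a b c → a :* (b :* c) := b :* (a :* c)) refl (μ m) (real (c ^ℚ suc s)) _))
    (sym (∑ᵍ.∑-*ˡ (real (c ^ℚ suc s)) (window H) _))
    where open ℚ[i]-Solver

real-† : ∀ q → real q † ≡ real q
real-† q = cong (q +𝕚_) refl

Δ-scale : ∀ c t f x → Δ t (scale c f) x ≡ scale (sq c) (Δ t f) x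
Δ-scale c t f x = trans (cong (scale c f x ⊗_) (trans (†-⊗ (real c) (f (x ℤ.+ t))) (cong (_⊗ f (x ℤ.+ t) †) (real-† c))))
  (real-interchange c c (f x) (f (x ℤ.+ t) †))

module _ {M N : ℕ} (2M≤N : M ℕ.+ M ℕ.≤ N) where
  open Gowers {M} {N} 2M≤N

  U-cong : ∀ s {f g} → (∀ x → f x ≡ g x) → U s f ≡ U s g
  U-cong zero    h = ∑ᵍ.∑-cong (window N) h
  U-cong (suc s) h = ∑ᵍ.∑-cong (window N) λ t → U-cong s λ x → cong₂ _⊗_ (h x) (cong _† (h (x ℤ.+ t)))

  U-scale : ∀ s c f → U s (scale c f) ≡ real (tower s c) ⊗ U s f
  U-scale zero    c f = sym (∑ᵍ.∑-*ˡ (real c) (window N) f)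
  U-scale (suc s) c f = trans
    (∑ᵍ.∑-cong (window N) λ t → trans (U-cong s (Δ-scale c t f)) (U-scale s (sq c) (Δ t f)))
    (sym (∑ᵍ.∑-*ˡ (real (tower (suc s) c)) (window N) _))

-- Gowers sums as sums over cubes

∏ˡ : {A : Set} → List A → (A → ℚ[i]) → ℚ[i]
∏ˡ []       F = 1ᵍ
∏ˡ (x ∷ xs) F = F x ⊗ ∏ˡ xs F

at-∏ˡ : ∀ n {A : Set} (xs : List A) (F : A → ℂ) → at n (∏ᶜ xs F) ≡ ∏ˡ xs λ x → at n (F x)
at-∏ˡ n []       F = refl
at-∏ˡ n (x ∷ xs) F = cong (at n (F x) ⊗_) (at-∏ˡ n xs F)

†^ : ℕ → ℚ[i] → ℚ[i]
†^ zero    z = z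
†^ (suc j) z = (†^ j z) †

at-conj^ : ∀ n j z → at n (conj^ j z) ≡ †^ j (at n z)
at-conj^ n zero    z = refl
at-conj^ n (suc j) z = cong _† (at-conj^ n j z)

†^-⊗ : ∀ j x y → †^ j (x ⊗ y) ≡ †^ j x ⊗ †^ j y
†^-⊗ zero    x y = refl
†^-⊗ (suc j) x y = trans (cong _† (†^-⊗ j x y)) (†-⊗ (†^ j x) (†^ j y))

†^-† : ∀ j x → †^ j (x †) ≡ (†^ j x) †
†^-† zero    x = refl
†^-† (suc j) x = cong _† (†^-† j x)

∏ˡ-cong : {A : Set} (xs : List A) {F G : A → ℚ[i]} → (∀ x → F x ≡ G x) → ∏ˡ xs F ≡ ∏ˡ xs G
∏ˡ-cong []       h = refl
∏ˡ-cong (x ∷ xs) h = cong₂ _⊗_ (h x) (∏ˡ-cong xs h)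

∏ˡ-++ : {A : Set} (xs ys : List A) (F : A → ℚ[i]) → ∏ˡ (xs ++ ys) F ≡ ∏ˡ xs F ⊗ ∏ˡ ys F
∏ˡ-++ []       ys F = sym (⊗-identityˡ _)
∏ˡ-++ (x ∷ xs) ys F = trans (cong (F x ⊗_) (∏ˡ-++ xs ys F)) (sym (⊗-assoc (F x) (∏ˡ xs F) (∏ˡ ys F)))

∏ˡ-map : {A B : Set} (g : A → B) (xs : List A) (F : B → ℚ[i]) → ∏ˡ (map g xs) F ≡ ∏ˡ xs (F ∘ g)
∏ˡ-map g []       F = refl
∏ˡ-map g (x ∷ xs) F = cong (F (g x) ⊗_) (∏ˡ-map g xs F)

∏ˡ-⊗ : {A : Set} (xs : List A) (F G : A → ℚ[i]) → ∏ˡ xs F ⊗ ∏ˡ xs G ≡ ∏ˡ xs λ x → F x ⊗ G x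
∏ˡ-⊗ []       F G = ⊗-identityˡ 1ᵍ
∏ˡ-⊗ (x ∷ xs) F G = trans (⊗-interchange (F x) (∏ˡ xs F) (G x) (∏ˡ xs G)) (cong (F x ⊗ G x ⊗_) (∏ˡ-⊗ xs F G))

cubeProduct : ∀ {s} → (ℤ → ℚ[i]) → ℤ → Vec ℤ s → ℚ[i]
cubeProduct {s} f x h = ∏ˡ (cube s) λ ω → †^ (weight ω) (f (x ℤ.+ ω · h))

-- The two vertices over each ω, with first coordinate `false` and `true`, are paired. The second
-- carries one more conjugation, so the pair is the value of `Δ t f` under the conjugations of ω.
cubeProduct-∷ : ∀ {s} f x t (h : Vec ℤ s) → cubeProduct f x (t ∷ h) ≡ cubeProduct (Δ t f) x h
cubeProduct-∷ {s} f x t h = begin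
  ∏ˡ (cube (suc s)) F
    ≡⟨ trans (∏ˡ-++ (map (false ∷_) (cube s)) _ F) (cong (∏ˡ (map (false ∷_) (cube s)) F ⊗_)
         (trans (∏ˡ-++ (map (true ∷_) (cube s)) [] F) (trans (⊗-comm _ 1ᵍ) (⊗-identityˡ _)))) ⟩
  ∏ˡ (map (false ∷_) (cube s)) F ⊗ ∏ˡ (map (true ∷_) (cube s)) F
    ≡⟨ cong₂ _⊗_ (∏ˡ-map (false ∷_) (cube s) F) (∏ˡ-map (true ∷_) (cube s) F) ⟩
  ∏ˡ (cube s) (λ ω → F (false ∷ ω)) ⊗ ∏ˡ (cube s) (λ ω → F (true ∷ ω))
    ≡⟨ ∏ˡ-⊗ (cube s) _ _ ⟩
  ∏ˡ (cube s) (λ ω → F (false ∷ ω) ⊗ F (true ∷ ω))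
    ≡⟨ ∏ˡ-cong (cube s) (λ ω → sym (trans (†^-⊗ (weight ω) _ _) (cong (†^ (weight ω) (f (x ℤ.+ ω · h)) ⊗_)
         (trans (†^-† (weight ω) _) (cong (λ y → (†^ (weight ω) (f y)) †)
           (solve 3 (λ x t w → x :+ w :+ t := x :+ (t :+ w)) refl x t (ω · h))))))) ⟩
  cubeProduct (Δ t f) x h ∎
  where
  open ≡-Reasoning
  open ℤ-Solver.+-*-Solver
  F : Vec Bool (suc s) → ℚ[i]
  F ω = †^ (weight ω) (f (x ℤ.+ ω · (t ∷ h)))

module _ (M : ℕ) where
  open Gowers {M} {M ℕ.+ M} ℕ.≤-refl

  U≡cubeProducts : ∀ s f → U s f ≡
    ∑ᵍ (window (M ℕ.+ M)) λ x → ∑ᵍ (vecs (window (M ℕ.+ M)) s) (cubeProduct f x)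
  U≡cubeProducts zero    f = ∑ᵍ.∑-cong I λ x → sym (trans (⊕-identityʳ _)
    (trans (⊗-comm (f (x ℤ.+ + 0)) 1ᵍ) (trans (⊗-identityˡ _) (cong f (ℤ.+-identityʳ x)))))
    where I = window (M ℕ.+ M)
  U≡cubeProducts (suc s) f = trans (∑ᵍ.∑-cong I λ t → U≡cubeProducts s (Δ t f))
    (trans (∑ᵍ.∑-swap I I _) (∑ᵍ.∑-cong I λ x → sym (trans (∑ᵍ-vecs I s (cubeProduct f x))
      (∑ᵍ.∑-cong I λ t → ∑ᵍ.∑-cong (vecs I s) (cubeProduct-∷ f x t)))))
    where I = window (M ℕ.+ M)

  at-gowersSum : ∀ n s f (h : SupportedOn (∣_∣≤ M) f) → at n (gowersSum s f (M , h)) ≡ U s (at n ∘ f)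
  at-gowersSum n s f h = trans (at-∑ n (box (M ℕ.+ M) (suc s)) _)
    (trans (same-list (box≡vecs (M ℕ.+ M) (suc s)))
      (trans (∑ᵍ-vecs (window (M ℕ.+ M)) s _)
        (trans (∑ᵍ.∑-cong (window (M ℕ.+ M)) λ x → ∑ᵍ.∑-cong (vecs (window (M ℕ.+ M)) s) λ v →
            trans (at-∏ˡ n (cube s) _) (∏ˡ-cong (cube s) λ ω → at-conj^ n (weight ω) (f (x ℤ.+ ω · v))))
          (sym (U≡cubeProducts s (at n ∘ f))))))
    where
    same-list : ∀ {A : Set} {xs ys : List A} {F : A → ℚ[i]} → xs ≡ ys → ∑ᵍ xs F ≡ ∑ᵍ ys F
    same-list refl = refl

tower-≤ : ∀ j {q} → 0ℚ ≤ q → q ≤ 1ℚ → tower j q ≤ q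
tower-≤ zero    0≤q q≤1 = ℚ.≤-refl
tower-≤ (suc j) 0≤q q≤1 = ℚ.≤-trans (tower-≤ j (nn* 0≤q 0≤q) (ℚ.≤-trans (1*≤ 0≤q q≤1) q≤1)) (1*≤ 0≤q q≤1)

cancel-recip : ∀ {p} → 0ℚ < p → ∀ q → p * (recip p * q) ≡ q
cancel-recip {p} 0<p q = trans (sym (ℚ.*-assoc p (recip p) q)) (trans (cong (_* q) (recip-inv 0<p)) (ℚ.*-identityˡ q))

1^ℚ : ∀ n → 1ℚ ^ℚ n ≡ 1ℚ
1^ℚ zero    = refl
1^ℚ (suc n) = trans (ℚ.*-identityˡ (1ℚ ^ℚ n)) (1^ℚ n)

-- Choice of the constants, and the inequality at one index

module FinalConstants (A r : ℕ) where
  open Constants A r public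

  private
    module Q = ℚ-Solver.+-*-Solver
    k : ℕ
    k = suc s

  -- In `c₀` the power of ½ with exponent k + 1 comes from halving λ and the k functions, the first
  -- `¼` from passing to approximate data, ½^s from B ≥ M/(2H) and the last `¼` from N ≥ M/2. `c₁`
  -- and `c₂` carry it through the inequality, and `F` is the trivial bound for the normalised sum
  -- of the indicator. `C′ᵃ` has 180 = 6 · 30 for coinciding coefficients and `C′ᵇ` has 4 = 2 · 2
  -- for vanishing differences.
  c₀ c₁ c₂ t½ K₃′ F c₃ C′ᵃ C′ᵇ : ℚ
  c₀  = ½ ^ℚ suc k * (¼ * (½ ^ℚ s * ¼))
  c₁  = tower r (¼ * sq c₀)
  c₂  = ½ * c₁ * recip K₁
  t½  = tower k ½
  K₃′ = 1ℚ + K₃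
  F   = ι 5 ^ℚ suc k
  c₃  = tower k c₂ * recip (K₃′ * t½ * F)
  C′ᵃ = ι 180 * Kᵦ * recip c₀
  C′ᵇ = ι 4 * (K₁ * K₂) * recip (tower s ½ * c₁)

  0<¼ : 0ℚ < ¼
  0<¼ = pos* 0<½ 0<½
  0<c₀ : 0ℚ < c₀
  0<c₀ = pos* (^ℚ-pos 0<½ (suc k)) (pos* 0<¼ (pos* (^ℚ-pos 0<½ s) 0<¼))
  0<c₁ : 0ℚ < c₁
  0<c₁ = tower-pos r (pos* 0<¼ (pos* 0<c₀ 0<c₀))
  0<c₂ : 0ℚ < c₂
  0<c₂ = pos* (pos* 0<½ 0<c₁) (recip-pos 0<K₁)
  0<t½ : 0ℚ < t½
  0<t½ = tower-pos k 0<½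
  0<K₃′ : 0ℚ < K₃′
  0<K₃′ = pos+ 0<1 0≤K₃
  0<F : 0ℚ < F
  0<F = ^ℚ-pos (0<ι 4) (suc k)
  0<K₃′t½F : 0ℚ < K₃′ * t½ * F
  0<K₃′t½F = pos* (pos* 0<K₃′ 0<t½) 0<F
  0<c₃ : 0ℚ < c₃
  0<c₃ = pos* (tower-pos k 0<c₂) (recip-pos 0<K₃′t½F)
  0<1+c₃ : 0ℚ < 1ℚ + c₃
  0<1+c₃ = pos+ 0<1 (ℚ.<⇒≤ 0<c₃)
  0≤C′ᵃ : 0ℚ ≤ C′ᵃ
  0≤C′ᵃ = nn* (nn* (0≤ι 180) 0≤Kᵦ) (recip-nn 0<c₀)
  0<tc₁ : 0ℚ < tower s ½ * c₁
  0<tc₁ = pos* (tower-pos s 0<½) 0<c₁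
  0≤C′ᵇ : 0ℚ ≤ C′ᵇ
  0≤C′ᵇ = nn* (nn* (0≤ι 4) (nn* (ℚ.<⇒≤ 0<K₁) 0≤K₂)) (recip-nn 0<tc₁)

  opaque
    κ₀ C′ : ℚ
    -- At most 1 and at most `c₃`; hence also its 2^k-th power is at most `c₃`, and no root of `c₃`
    -- is needed.
    κ₀ = c₃ * recip (1ℚ + c₃)
    -- The 7 secures H ≤ M; the other summands make the two kinds of degenerate terms negligible.
    C′ = ι 7 + (C′ᵃ + C′ᵇ)

    0<κ₀ : 0ℚ < κ₀
    0<κ₀ = pos* 0<c₃ (recip-pos 0<1+c₃)

    7≤C′ : ι 7 ≤ C′
    7≤C′ = le {ι 7} {C′} {C′ᵃ + C′ᵇ} (nn+ 0≤C′ᵃ 0≤C′ᵇ) refl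
    C′ᵃ≤C′ : C′ᵃ ≤ C′
    C′ᵃ≤C′ = le {C′ᵃ} {C′} {ι 7 + C′ᵇ} (nn+ (0≤ι 7) 0≤C′ᵇ) (Q.solve 2 (λ a b → a Q.:+ (Q.con (ι 7) Q.:+ b) Q.:= Q.con (ι 7) Q.:+ (a Q.:+ b)) refl C′ᵃ C′ᵇ)
    C′ᵇ≤C′ : C′ᵇ ≤ C′
    C′ᵇ≤C′ = le {C′ᵇ} {C′} {ι 7 + C′ᵃ} (nn+ (0≤ι 7) 0≤C′ᵃ) (Q.solve 2 (λ a b → b Q.:+ (Q.con (ι 7) Q.:+ a) Q.:= Q.con (ι 7) Q.:+ (a Q.:+ b)) refl C′ᵃ C′ᵇ)

    κ₀≤1 : κ₀ ≤ 1ℚ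
    κ₀≤1 = subst (κ₀ ≤_) (recip-inv 0<1+c₃) (*-monoʳ (recip (1ℚ + c₃)) (recip-nn 0<1+c₃)
      (le {c₃} {1ℚ + c₃} {1ℚ} 0≤1 (ℚ.+-comm c₃ 1ℚ)))

    κ₀≤c₃ : κ₀ ≤ c₃
    κ₀≤c₃ = subst (κ₀ ≤_) (ℚ.*-identityʳ c₃) (*-monoˡ c₃ (ℚ.<⇒≤ 0<c₃)
      (subst₂ _≤_ (ℚ.*-identityˡ (recip (1ℚ + c₃))) (recip-inv 0<1+c₃)
        (*-monoʳ (recip (1ℚ + c₃)) (recip-nn 0<1+c₃) (le {1ℚ} {1ℚ + c₃} {c₃} (ℚ.<⇒≤ 0<c₃) refl))))

module AtIndex (A r T L H′ M′ : ℕ) (L≤T : L ℕ.≤ T) (LH≤AM : L ℕ.* suc H′ ℕ.≤ A ℕ.* suc M′) (H≤M : suc H′ ℕ.≤ suc M′)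
  (lam : Vec ℤ (suc (suc r)) → ℚ[i]) (lam-supp : ∀ b → ¬ All (λ a → ℤ.∣ a ∣ ℕ.≤ L) b → lam b ≡ 0ᵍ)
  (lam-bdd : ∀ b → normSq (lam b) ≤ ι 4)
  (f : Fin (suc (suc r)) → ℤ → ℚ[i]) (f-supp : ∀ j → Supported (suc M′) (f j)) (f-bdd : ∀ j x → normSq (f j x) ≤ ι 4)
  where

  open FinalConstants A r

  private
    module Q = ℚ-Solver.+-*-Solver
    k : ℕ
    k = suc s
    H = suc H′
    M = suc M′
    v = unit H′
    w = unit M′
    h = ι H
    m = ι M
    ξ = h * w
    0≤v = ℚ.<⇒≤ (0<unit H′)
    0≤w = ℚ.<⇒≤ (0<unit M′)
    0≤ξ = nn* (0≤ι H) 0≤w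

  open Gowers {M} {M ℕ.+ M} ℕ.≤-refl

  countSum : ℚ[i]
  countSum = ∑ᵍ (vecs (window T) k) λ b → lam b ⊗
    ∑ᵍ (window (M ℕ.+ T ℕ.* H)) λ x → ∑ᵍ (range H) λ m → ∏ λ j → f j (x ℤ.+ Vec.lookup b j ℤ.* m)

  -- A rational lower bound for δ B^k N²/B = δ B^s N², obtained from B ≥ M/(2H) and N ≥ M/2.
  threshold : ℚ → ℚ
  threshold δ = δ * (½ * (m * v)) ^ℚ s * sq (½ * m)

  module _ {δ : ℚ} (0<δ : 0ℚ < δ) (C′ξ : C′ * ξ ≤ ι 6 * δ) (C′v : v * (C′ * tower s ½) ≤ ι 2 * tower s δ)
    (large : sq (¼ * threshold δ) ≤ normSq countSum) (i : Fin k) where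

    private
      δ′ = c₀ * δ
      0≤δ = ℚ.<⇒≤ 0<δ

      module 𝓓 = Discrete A r L H′ M′ LH≤AM H≤M
        (λ a b → real ½ ⊗ lam (Vec.insertAt b i a)) (λ a b → ½-UnitBounded (lam (Vec.insertAt b i a)) (lam-bdd (Vec.insertAt b i a)))
        (inRange H) (scale ½ (f i)) (inRange-Supported H) (inRange-UnitBounded H)
        (scale-Supported ½ {f i} (f-supp i)) (λ x → ½-UnitBounded (f i x) (f-bdd i x))
        (λ j → scale ½ (f (punchIn i j))) (λ j → scale-Supported ½ {f (punchIn i j)} (f-supp (punchIn i j)))
        (λ j x → ½-UnitBounded (f (punchIn i j) x) (f-bdd (punchIn i j) x))

      total≡ : 𝓓.total ≡ real (½ ^ℚ suc k) ⊗ countSum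
      total≡ = trans
        (∑ᵍ.∑-cong (window L) λ a → trans
          (∑ᵍ.∑-cong (vecs (window L) s) λ b → trans
            (cong (real ½ ⊗ lam (Vec.insertAt b i a) ⊗_)
              (progressionSum-scale (ℕ.m≤m+n M M) H ½ (inRange H) (f i) (Vec.map (ℤ._- a) b) (f ∘ punchIn i)))
            (real-interchange ½ (½ ^ℚ k) (lam (Vec.insertAt b i a)) _))
          (sym (∑ᵍ.∑-*ˡ (real (½ ^ℚ suc k)) (vecs (window L) s) _)))
        (trans (sym (∑ᵍ.∑-*ˡ (real (½ ^ℚ suc k)) (window L) _))
          (cong (real (½ ^ℚ suc k) ⊗_) (sym (configurations-total {M = M} {H = H} L≤T lam f lam-supp f-supp i))))

      normalised : δ′ ≡ ½ ^ℚ suc k * (¼ * threshold δ) * (ξ * ξ ^ℚ s * (v * w))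
      normalised = sym (begin
        ½ᵏ * (¼ * (δ * (½ * (m * v)) ^ℚ s * sq (½ * m))) * (ξ * ξ ^ℚ s * (v * w))
          ≡⟨ cong (λ t → ½ᵏ * (¼ * (δ * t * sq (½ * m))) * (ξ * ξ ^ℚ s * (v * w))) (^ℚ-* ½ (m * v) s) ⟩
        ½ᵏ * (¼ * (δ * (½ ^ℚ s * (m * v) ^ℚ s) * sq (½ * m))) * (h * w * ξ ^ℚ s * (v * w))
          ≡⟨ Q.solve 9 (λ a d p q m h w x v →
               a Q.:* (Q.con ½ Q.:* Q.con ½ Q.:* (d Q.:* (p Q.:* q) Q.:* ((Q.con ½ Q.:* m) Q.:* (Q.con ½ Q.:* m)))) Q.:* (h Q.:* w Q.:* x Q.:* (v Q.:* w))
               Q.:= a Q.:* (Q.con ½ Q.:* Q.con ½ Q.:* (p Q.:* (Q.con ½ Q.:* Q.con ½))) Q.:* d Q.:* ((q Q.:* x) Q.:* ((m Q.:* w) Q.:* (m Q.:* w) Q.:* (h Q.:* v))))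
               refl ½ᵏ δ (½ ^ℚ s) ((m * v) ^ℚ s) m h w (ξ ^ℚ s) v ⟩
        c₀ * δ * ((m * v) ^ℚ s * ξ ^ℚ s * (sq (m * w) * (h * v)))
          ≡⟨ cong₂ (λ x y → c₀ * δ * (x * y)) (trans (sym (^ℚ-* (m * v) ξ s)) (trans (cong (_^ℚ s) mvξ≡1) (1^ℚ s)))
               (cong₂ (λ x y → sq x * y) (ι-unit M′) (ι-unit H′)) ⟩
        c₀ * δ * (1ℚ * (sq 1ℚ * 1ℚ))
          ≡⟨ ℚ.*-identityʳ (c₀ * δ) ⟩
        c₀ * δ ∎)
        where
        open ≡-Reasoning
        ½ᵏ = ½ ^ℚ suc k
        mvξ≡1 : m * v * ξ ≡ 1ℚ
        mvξ≡1 = trans (Q.solve 4 (λ m v h w → m Q.:* v Q.:* (h Q.:* w) Q.:= (m Q.:* w) Q.:* (h Q.:* v)) refl m v h w)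
          (trans (cong₂ _*_ (ι-unit M′) (ι-unit H′)) refl)

      large′ : sq δ′ ≤ normSq 𝓓.total * sq (ξ * ξ ^ℚ s * (v * w))
      large′ = subst₂ _≤_ (trans (Q.solve 3 (λ a b c → a Q.:* a Q.:* (b Q.:* b) Q.:* (c Q.:* c) Q.:= (a Q.:* b Q.:* c) Q.:* (a Q.:* b Q.:* c)) refl
            (½ ^ℚ suc k) (¼ * threshold δ) (ξ * ξ ^ℚ s * (v * w))) (cong sq (sym normalised)))
        (cong (_* sq (ξ * ξ ^ℚ s * (v * w))) (sym (trans (cong normSq total≡)
          (trans (normSq-⊗ (real (½ ^ℚ suc k)) countSum) (cong (_* normSq countSum) (normSq-real (½ ^ℚ suc k)))))))
        (*-monoʳ (sq (ξ * ξ ^ℚ s * (v * w))) (sq-nn (ξ * ξ ^ℚ s * (v * w)))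
          (*-monoˡ (sq (½ ^ℚ suc k)) (sq-nn (½ ^ℚ suc k)) large))

      degenerate-b : Kᵦ * ξ * ι 30 ≤ δ′
      degenerate-b = ℚ.*-cancelˡ-≤-pos (ι 6) (subst₂ _≤_
        (trans (Q.solve 4 (λ c k r x → c Q.:* (Q.con (ι 180) Q.:* k Q.:* r Q.:* x) Q.:= c Q.:* (r Q.:* (Q.con (ι 6) Q.:* (k Q.:* x Q.:* Q.con (ι 30))))) refl c₀ Kᵦ (recip c₀) ξ)
          (cancel-recip 0<c₀ (ι 6 * (Kᵦ * ξ * ι 30))))
        (Q.solve 2 (λ c d → c Q.:* (Q.con (ι 6) Q.:* d) Q.:= Q.con (ι 6) Q.:* (c Q.:* d)) refl c₀ δ)
        (*-monoˡ c₀ (ℚ.<⇒≤ 0<c₀)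
          (ℚ.≤-trans (*-monoʳ ξ 0≤ξ C′ᵃ≤C′) C′ξ)))

      θ≡ : tower r (¼ * sq δ′) ≡ c₁ * tower s δ
      θ≡ = trans (cong (tower r) (Q.solve 2 (λ c d → Q.con ½ Q.:* Q.con ½ Q.:* ((c Q.:* d) Q.:* (c Q.:* d))
          Q.:= Q.con ½ Q.:* Q.con ½ Q.:* (c Q.:* c) Q.:* (d Q.:* d)) refl c₀ δ))
        (tower-* r (¼ * sq c₀) (sq δ))

      degenerate-n : K₁ * (K₂ * v) ≤ ½ * tower r (¼ * sq δ′)
      degenerate-n = ℚ.*-cancelˡ-≤-pos (ι 4) (subst₂ _≤_
        (trans (Q.solve 5 (λ t c k r v → c Q.:* (v Q.:* (Q.con (ι 4) Q.:* k Q.:* r Q.:* t)) Q.:= t Q.:* c Q.:* (r Q.:* (Q.con (ι 4) Q.:* (k Q.:* v)))) refl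
            (tower s ½) c₁ (K₁ * K₂) (recip (tower s ½ * c₁)) v)
          (trans (cancel-recip 0<tc₁ (ι 4 * (K₁ * K₂ * v))) (cong (λ t → ι 4 * t) (ℚ.*-assoc K₁ K₂ v))))
        (trans (Q.solve 2 (λ c t → c Q.:* (Q.con (ι 2) Q.:* t) Q.:= Q.con (ι 4) Q.:* (Q.con ½ Q.:* (c Q.:* t))) refl c₁ (tower s δ))
          (cong (λ t → ι 4 * (½ * t)) (sym θ≡)))
        (*-monoˡ c₁ (ℚ.<⇒≤ 0<c₁)
          (ℚ.≤-trans (*-monoˡ v 0≤v
              (*-monoʳ (tower s ½) (tower-nn s (ℚ.<⇒≤ 0<½)) C′ᵇ≤C′)) C′v)))

      W = w ^ℚ suc k
      τ = tower k (tower s δ)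
      Xf = Re (U k (f i))
      0<W : 0ℚ < W
      0<W = ^ℚ-pos (0<unit M′) (suc k)
      0<τ : 0ℚ < τ
      0<τ = tower-pos k (tower-pos s 0<δ)

      lower-bound : tower k c₂ * τ ≤ K₃ * (W * (t½ * Xf))
      lower-bound = subst₂ _≤_
        (trans (cong (tower k) (trans (cong (λ t → ½ * t * recip K₁) θ≡)
            (Q.solve 3 (λ c t r → Q.con ½ Q.:* (c Q.:* t) Q.:* r Q.:= Q.con ½ Q.:* c Q.:* r Q.:* t) refl c₁ (tower s δ) (recip K₁))))
          (tower-* k c₂ (tower s δ)))
        (cong (λ z → K₃ * (W * z)) (trans (cong Re (U-scale {M} {M ℕ.+ M} ℕ.≤-refl k ½ (f i))) (Re-real t½ (U k (f i)))))
        (𝓓.gowers-lower-bound (nn* (ℚ.<⇒≤ 0<c₀) 0≤δ) degenerate-b degenerate-n large′)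

      -- The sign of the Gowers sum is inferred from `lower-bound` itself, whose left side is
      -- positive, together with K₃ ≥ 0.
      0≤Y : 0ℚ ≤ W * (t½ * Xf)
      0≤Y = ℚ.≮⇒≥ λ Y<0 → ℚ.<-irrefl refl (ℚ.<-≤-trans (pos* (tower-pos k 0<c₂) 0<τ)
        (ℚ.≤-trans lower-bound (subst (K₃ * (W * (t½ * Xf)) ≤_) (ℚ.*-zeroʳ K₃)
          (*-monoˡ K₃ 0≤K₃ (ℚ.<⇒≤ Y<0)))))

    -- The quotient of norms is handled as a comparison of sums. The sum of `𝟏` enters through the
    -- trivial upper bound only, so its sign is treated by cases.
    gowers-ratio : ∀ 𝟏 → UnitBounded 𝟏 → tower k (κ₀ * tower s δ) * Re (U k 𝟏) ≤ Xf
    gowers-ratio 𝟏 𝟏-bdd = by-sign (ℚ.≤-total 0ℚ (Re (U k 𝟏)))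
      where
      X₁ = Re (U k 𝟏)
      0≤q : 0ℚ ≤ tower k (κ₀ * tower s δ)
      0≤q = tower-nn k (nn* (ℚ.<⇒≤ 0<κ₀) (tower-nn s 0≤δ))
      0≤Xf : 0ℚ ≤ Xf
      0≤Xf = ℚ.*-cancelˡ-≤-pos (W * t½) {{ℚ.positive (pos* 0<W 0<t½)}}
        (subst₂ _≤_ (sym (ℚ.*-zeroʳ (W * t½))) (sym (ℚ.*-assoc W t½ Xf)) 0≤Y)
      q≤ : tower k (κ₀ * tower s δ) ≤ c₃ * τ
      q≤ = subst (_≤ c₃ * τ) (sym (tower-* k κ₀ (tower s δ)))
        (*-monoʳ τ (ℚ.<⇒≤ 0<τ)
          (ℚ.≤-trans (tower-≤ k (ℚ.<⇒≤ 0<κ₀) κ₀≤1) κ₀≤c₃))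
      WX₁≤F : W * X₁ ≤ F
      WX₁≤F = ℚ.≤-trans (*-monoˡ W (ℚ.<⇒≤ 0<W) (Re-U≤ k 𝟏-bdd))
        (subst (_≤ F) (^ℚ-* w ℓI (suc k)) (^ℚ-mono (suc k)))
        where
        ℓI = ι (length (window (M ℕ.+ M)))
        wℓI≤5 : w * ℓI ≤ ι 5
        wℓI≤5 = unit-scale 5 M′ (subst (ℕ._≤ 5 ℕ.* M) (sym (length-window (M ℕ.+ M))) (1+2n+2n≤5n M′))
        ^ℚ-mono : ∀ j → (w * ℓI) ^ℚ j ≤ ι 5 ^ℚ j
        ^ℚ-mono zero    = ℚ.≤-refl
        ^ℚ-mono (suc j) = mono* (nn* 0≤w (0≤ι (length (window (M ℕ.+ M))))) (^ℚ-nn (nn* 0≤w (0≤ι (length (window (M ℕ.+ M))))) j) wℓI≤5 (^ℚ-mono j)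
      chain : W * (c₃ * τ * X₁) ≤ W * Xf
      chain = begin
        W * (c₃ * τ * X₁)
          ≡⟨ Q.solve 3 (λ W c x → W Q.:* (c Q.:* x) Q.:= c Q.:* (W Q.:* x)) refl W (c₃ * τ) X₁ ⟩
        c₃ * τ * (W * X₁)
          ≤⟨ *-monoˡ (c₃ * τ) (nn* (ℚ.<⇒≤ 0<c₃) (ℚ.<⇒≤ 0<τ)) WX₁≤F ⟩
        tower k c₂ * R′ * τ * F
          ≡⟨ Q.solve 4 (λ c r t f → c Q.:* r Q.:* t Q.:* f Q.:= c Q.:* t Q.:* (r Q.:* f)) refl (tower k c₂) R′ τ F ⟩
        tower k c₂ * τ * (R′ * F)
          ≤⟨ *-monoʳ (R′ * F) (nn* (recip-nn 0<K₃′t½F) (ℚ.<⇒≤ 0<F))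
               (ℚ.≤-trans lower-bound (*-monoʳ (W * (t½ * Xf)) 0≤Y (le {K₃} {K₃′} {1ℚ} 0≤1 (ℚ.+-comm K₃ 1ℚ)))) ⟩
        K₃′ * (W * (t½ * Xf)) * (R′ * F)
          ≡⟨ Q.solve 6 (λ k w t x r f → k Q.:* (w Q.:* (t Q.:* x)) Q.:* (r Q.:* f) Q.:= k Q.:* t Q.:* f Q.:* (r Q.:* (w Q.:* x))) refl K₃′ W t½ Xf R′ F ⟩
        K₃′ * t½ * F * (R′ * (W * Xf))
          ≡⟨ cancel-recip 0<K₃′t½F (W * Xf) ⟩
        W * Xf ∎
        where
        open ℚ.≤-Reasoning
        R′ = recip (K₃′ * t½ * F)
      by-sign : 0ℚ ≤ X₁ ⊎ X₁ ≤ 0ℚ → tower k (κ₀ * tower s δ) * X₁ ≤ Xf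
      by-sign (inj₁ 0≤X₁) = ℚ.≤-trans (*-monoʳ X₁ 0≤X₁ q≤)
        (ℚ.*-cancelˡ-≤-pos W {{ℚ.positive 0<W}} chain)
      by-sign (inj₂ X₁≤0) = ℚ.≤-trans (subst (tower k (κ₀ * tower s δ) * X₁ ≤_) (ℚ.*-zeroʳ (tower k (κ₀ * tower s δ)))
        (*-monoˡ (tower k (κ₀ * tower s δ)) 0≤q X₁≤0)) 0≤Xf

-- From inequalities of reals to inequalities at late indices

Eventually : (ℕ → Set) → Set
Eventually P = ∃ λ K → ∀ n → K ℕ.≤ n → P n

mapᵉ : ∀ {P Q : ℕ → Set} → (∀ n → P n → Q n) → Eventually P → Eventually Q
mapᵉ f (K , h) = K , λ n p → f n (h n p)

infixr 4 _and_

_and_ : ∀ {P Q : ℕ → Set} → Eventually P → Eventually Q → Eventually λ n → P n × Q n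
(K , h) and (L , k) = K ℕ.⊔ L , λ n p → h n (ℕ.m⊔n≤o⇒m≤o K L p) , k n (ℕ.m⊔n≤o⇒n≤o K L p)

-- Turns a comparison of fixed rationals that was obtained at a late index into an unconditional
-- one.
constantly : {P : Set} → Eventually (λ _ → P) → P
constantly (K , h) = h K ℕ.≤-refl

eventually-≤ : ∀ {x y} → Eventually (λ n → seq x n ≤ seq y n) → x ≤ᴿ y
eventually-≤ {x} {y} (K , h) ε 0<ε = K , λ n p → ℚ.≤-trans (h n p) (le (ℚ.<⇒≤ 0<ε) refl)

seq-^ᴿ : ∀ x j n → seq (x ^ᴿ j) n ≡ seq x n ^ℚ j
seq-^ᴿ x zero    n = refl
seq-^ᴿ x (suc j) n = cong (λ t → seq x n * t) (seq-^ᴿ x j n)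

recip-ι : ∀ n → recip (ι (suc n)) ≡ unit n
recip-ι n = begin
  recip h                  ≡⟨ sym (ℚ.*-identityʳ (recip h)) ⟩
  recip h * 1ℚ             ≡⟨ cong (λ t → recip h * t) (sym (ι-unit n)) ⟩
  recip h * (h * unit n)   ≡⟨ solve 3 (λ r h u → r :* (h :* u) := h :* r :* u) refl (recip h) h (unit n) ⟩
  h * recip h * unit n     ≡⟨ cong (_* unit n) (recip-inv (0<ι n)) ⟩
  1ℚ * unit n              ≡⟨ ℚ.*-identityˡ (unit n) ⟩
  unit n                   ∎
  where
  open ≡-Reasoning
  open ℚ-Solver.+-*-Solver using (solve; _:=_; _:*_)
  h = ι (suc n)

module _ where
  open ℚ-Solver.+-*-Solver

  -- If η is a late lower bound for x and the late terms differ by at most e = η/4, then q = v - e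
  -- with v a late term works: v + e ≤ 2(v - e) as v ≥ 4e. Applied to δ, it gives one rational
  -- parameter valid at all late indices.
  within-factor-2 : ∀ {x} → 0ᴿ <ᴿ x →
    ∃ λ q → 0ℚ < q × Eventually λ n → q ≤ seq x n × seq x n ≤ (1ℚ + 1ℚ) * q
  within-factor-2 {x} 0<x =
    let η , 0<η , K , b = lower {x} 0<x
        e = ½ * ½ * η
        0<e = pos* (pos* 0<½ 0<½) 0<η
        L , c = cauchy x e 0<e
        n₀ = K ℕ.⊔ L
        v = seq x n₀
        η≤v = b n₀ (ℕ.m≤m⊔n K L)
    in v - e , ℚ.<-≤-trans 0<e (le (nn+ (nn-sub η≤v) (nn* (nn* (ℚ.<⇒≤ 0<½) (ℚ.<⇒≤ 0<½)) (nn+ (ℚ.<⇒≤ 0<η) (ℚ.<⇒≤ 0<η))))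
           (solve 2 (λ v n → con ½ :* con ½ :* n :+ ((v :- n) :+ con ½ :* con ½ :* (n :+ n)) := v :- con ½ :* con ½ :* n) refl v η)) ,
       L , λ n p →
         le {d = (seq x n + e) - v} (nn-sub (∣∣⇒≤ {v} {seq x n} (c n₀ n (ℕ.m≤n⊔m K L) p)))
           (solve 3 (λ v e y → v :- e :+ ((y :+ e) :- v) := y) refl v e (seq x n)) ,
         ℚ.≤-trans (∣∣⇒≤ {seq x n} {v} (c n n₀ p (ℕ.m≤n⊔m K L)))
           (le {d = (v - η) + ½ * ½ * η} (nn+ (nn-sub η≤v) (nn* (nn* (ℚ.<⇒≤ 0<½) (ℚ.<⇒≤ 0<½)) (ℚ.<⇒≤ 0<η)))
             (solve 2 (λ v n → v :+ con ½ :* con ½ :* n :+ ((v :- n) :+ con ½ :* con ½ :* n)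
               := (con 1ℚ :+ con 1ℚ) :* (v :- con ½ :* con ½ :* n)) refl v η))

  -- The product inequality is used with error εη, where η is a positive lower bound for y; division
  -- by y leaves an error of at most ε.
  ≤-÷ : ∀ {q} {X x y : ℝ} (0<y : 0ᴿ <ᴿ y) → Eventually (λ n → seq X n ≤ q) → fromℚ q *ᴿ y ≤ᴿ x →
    X ≤ᴿ x ÷ y [ 0<y ]
  ≤-÷ {q} {X} {x} {y} 0<y X≤q h ε 0<ε =
    let η , 0<η , low = lower {y} 0<y
    in mapᵉ (λ n (X≤ , η≤ , q*y≤) → ℚ.≤-trans X≤ (divide (seq x n) (seq y n) η 0<η η≤ q*y≤))
         (X≤q and low and h (ε * η) (pos* 0<ε 0<η))
    where
    divide : ∀ a b η → 0ℚ < η → η ≤ b → q * b ≤ a + ε * η → q ≤ a * recip b + ε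
    divide a b η 0<η η≤b h = begin
      q                              ≡⟨ sym (ℚ.*-identityʳ q) ⟩
      q * 1ℚ                         ≡⟨ cong (λ t → q * t) (sym (recip-inv 0<b)) ⟩
      q * (b * recip b)              ≡⟨ sym (ℚ.*-assoc q b (recip b)) ⟩
      q * b * recip b                ≤⟨ *-monoʳ (recip b) (recip-nn 0<b) h ⟩
      (a + ε * η) * recip b          ≡⟨ solve 4 (λ a e n r → (a :+ e :* n) :* r := a :* r :+ e :* (n :* r)) refl a ε η (recip b) ⟩
      a * recip b + ε * (η * recip b) ≤⟨ ℚ.+-monoʳ-≤ (a * recip b) (*-monoˡ ε (ℚ.<⇒≤ 0<ε)
                  (*-monoʳ (recip b) (recip-nn 0<b) η≤b)) ⟩
      a * recip b + ε * (b * recip b) ≡⟨ cong (λ t → a * recip b + ε * t) (recip-inv 0<b) ⟩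
      a * recip b + ε * 1ℚ           ≡⟨ cong (λ t → a * recip b + t) (ℚ.*-identityʳ ε) ⟩
      a * recip b + ε                ∎
      where
      open ℚ.≤-Reasoning
      0<b = ℚ.<-≤-trans 0<η η≤b

  modulus² : ∀ n z → seq (re z ^ᴿ 2 +ᴿ im z ^ᴿ 2) n ≡ normSq (at n z)
  modulus² n z = solve 2 (λ a b → a :* (a :* con 1ℚ) :+ b :* (b :* con 1ℚ) := a :* a :+ b :* b) refl (seq (re z) n) (seq (im z) n)

  seq-∣∣ᶜ : ∀ n z → seq ∣ z ∣ᶜ n ≡ √ᵒ (normSq (at n z)) n
  seq-∣∣ᶜ n z = trans (sym (√ᵒ-def (seq (re z ^ᴿ 2 +ᴿ im z ^ᴿ 2) n) n)) (cong (λ q → √ᵒ q n) (modulus² n z))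

  -- The bound 4 is (1 + ½ + ½)²: one ½ for the error allowed in `≤ᴿ`, the other for the resolution
  -- of the approximate root.
  modulus-≤1 : ∀ z → ∣ z ∣ᶜ ≤ᴿ 1ᴿ → Eventually λ n → normSq (at n z) ≤ ι 4
  modulus-≤1 z h = mapᵉ (λ n (m≤ , u≤) → bound (normSq (at n z)) n (subst (_≤ 1ℚ + ½) (seq-∣∣ᶜ n z) m≤) u≤)
    (h ½ 0<½ and unit-small ½ 0<½)
    where
    bound : ∀ q n → √ᵒ q n ≤ 1ℚ + ½ → unit n ≤ ½ → q ≤ ι 4
    bound q n m≤ u≤ = ℚ.≤-trans (ℚ.p≤q⊔p 0ℚ q) (ℚ.≤-trans (ℚ.<⇒≤ (√ᵒ-high q n))
      (sq-mono (nn+ (√ᵒ-nn q n) (ℚ.<⇒≤ (0<unit n))) (ℚ.+-mono-≤ m≤ u≤)))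

  modulus-≥ : ∀ z {ρ} {X : ℝ} → 0ℚ < ρ → X ≤ᴿ ∣ z ∣ᶜ → Eventually (λ n → ρ ≤ seq X n) →
    Eventually λ n → sq (½ * ρ) ≤ normSq (at n z)
  modulus-≥ z {ρ} {X} 0<ρ h low =
    mapᵉ (λ n (X≤ , ρ≤) → bound (normSq (at n z)) n (normSq-nn (at n z))
        (ℚ.≤-trans ρ≤ (subst (λ t → seq X n ≤ t + ½ * ρ) (seq-∣∣ᶜ n z) X≤)))
      (h (½ * ρ) (pos* 0<½ 0<ρ) and low)
    where
    bound : ∀ q n → 0ℚ ≤ q → ρ ≤ √ᵒ q n + ½ * ρ → sq (½ * ρ) ≤ q
    bound q n 0≤q h = ℚ.≤-trans
      (sq-mono (nn* (ℚ.<⇒≤ 0<½) (ℚ.<⇒≤ 0<ρ))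
        (le {d = (√ᵒ q n + ½ * ρ) - ρ} (nn-sub h) (solve 2 (λ m r → con ½ :* r :+ ((m :+ con ½ :* r) :- r) := m) refl (√ᵒ q n) ρ)))
      (ℚ.≤-trans (√ᵒ-low q n) (ℚ.≤-reflexive (ℚ.p≤q⇒p⊔q≡q 0≤q)))

  Close-normSq : ∀ z w {ρ} → 0ℚ < ρ → Closeᶜ z w → Eventually (λ n → sq (½ * ρ) ≤ normSq (at n z)) →
    Eventually λ n → sq (½ * ½ * ρ) ≤ normSq (at n w)
  Close-normSq z w {ρ} 0<ρ (cre , cim) low =
    mapᵉ (λ n (a , b , l) → bound (seq (re z) n) (seq (im z) n) (seq (re w) n) (seq (im w) n) a b l)
      (cre e 0<e and cim e 0<e and low)
    where
    -- From |z|² ≤ 2|w|² + 2|z - w|² with |z - w|² ≤ 2e² = ρ²/32 one gets |w|² ≥ 3ρ²/32, which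
    -- exceeds (ρ/4)².
    e = ½ * ½ * ½ * ρ
    0<e = pos* (pos* (pos* 0<½ 0<½) 0<½) 0<ρ
    sq-abs : ∀ d → ∣ d ∣ ≤ e → sq d ≤ sq e
    sq-abs d h = subst (_≤ sq e) (trans (sym (ℚ.∣p*q∣≡∣p∣*∣q∣ d d)) (ℚ.0≤p⇒∣p∣≡p (sq-nn d)))
      (sq-mono (ℚ.0≤∣p∣ d) h)
    bound : ∀ a b c d → ∣ a - c ∣ ≤ e → ∣ b - d ∣ ≤ e → sq (½ * ρ) ≤ a * a + b * b → sq (½ * ½ * ρ) ≤ c * c + d * d
    bound a b c d h k l = ℚ.*-cancelˡ-≤-pos (1ℚ + 1ℚ) (le
      (nn+ (nn-sub l) (nn+ (nn+ (sq-nn ((c + c) - a)) (sq-nn ((d + d) - b)))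
        (nn+ (nn* (nn+ 0≤1 0≤1) (nn+ (nn-sub (sq-abs (a - c) h)) (nn-sub (sq-abs (b - d) k))))
          (nn* (0≤ι 4) (nn* (nn* (nn* (nn* (ℚ.<⇒≤ 0<½) (ℚ.<⇒≤ 0<½)) (nn* (ℚ.<⇒≤ 0<½) (ℚ.<⇒≤ 0<½))) (ℚ.<⇒≤ 0<½)) (nn* (ℚ.<⇒≤ 0<½) (sq-nn ρ)))))))
      (solve 5 (λ r a b c d →
        let e = con ½ :* con ½ :* con ½ :* r in
        (con 1ℚ :+ con 1ℚ) :* ((con ½ :* con ½ :* r) :* (con ½ :* con ½ :* r))
          :+ ((a :* a :+ b :* b :- (con ½ :* r) :* (con ½ :* r))
          :+ ((((c :+ c) :- a) :* ((c :+ c) :- a) :+ ((d :+ d) :- b) :* ((d :+ d) :- b))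
          :+ ((con 1ℚ :+ con 1ℚ) :* ((e :* e :- (a :- c) :* (a :- c)) :+ (e :* e :- (b :- d) :* (b :- d)))
          :+ con (ι 4) :* ((con ½ :* con ½ :* (con ½ :* con ½) :* con ½) :* (con ½ :* (r :* r))))))
        := (con 1ℚ :+ con 1ℚ) :* (c :* c :+ d :* d)) refl ρ a b c d))

∈-vecs : ∀ {L s} {b : Vec ℤ s} → All (λ a → ℤ.∣ a ∣ ℕ.≤ L) b → b ∈ vecs (window L) s
∈-vecs []       = here refl
∈-vecs (p ∷ ps) = ∈-cartesianProductWith⁺ _∷_ (∈-window⁺ p) (∈-vecs ps)

module _ {k : ℕ} (H : ℕ) where

  R-Close : ∀ {lam lam′ : Vec ℤ k → ℂ} (λ-fin : FinSuppᵏ lam) (λ′-supp : SupportedOn (All (∣_∣≤ proj₁ λ-fin)) lam′)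
    {f f′ : Fin k → ℤ → ℂ} (f-fin : Σ ℕ λ L → ∀ i → SupportedOn (∣_∣≤ L) (f i))
    (f′-supp : ∀ i → SupportedOn (∣_∣≤ proj₁ f-fin) (f′ i)) →
    (∀ b → Closeᶜ (lam b) (lam′ b)) → (∀ i x → Closeᶜ (f i x) (f′ i x)) →
    Closeᶜ (R H lam λ-fin f f-fin) (R H lam′ (proj₁ λ-fin , λ′-supp) f′ (proj₁ f-fin , f′-supp))
  R-Close {lam} {lam′} (T , _) _ {f} {f′} (L , _) _ hλ hf = nested (box T k) (interval (L ℕ.+ T ℕ.* H)) (range H)
    where
    nested : ∀ (bs : List (Vec ℤ k)) (xs ms : List ℤ) → Closeᶜ
      (∑ᶜ bs λ b → lam b *ᶜ ∑ᶜ xs λ x → ∑ᶜ ms λ m → ∏ᶜ (allFin k) λ i → f i (x ℤ.+ Vec.lookup b i ℤ.* m))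
      (∑ᶜ bs λ b → lam′ b *ᶜ ∑ᶜ xs λ x → ∑ᶜ ms λ m → ∏ᶜ (allFin k) λ i → f′ i (x ℤ.+ Vec.lookup b i ℤ.* m))
    nested bs xs ms = Closeᶜ-∑ bs λ b → Closeᶜ-*
      {lam b} {∑ᶜ xs λ x → ∑ᶜ ms λ m → ∏ᶜ (allFin k) λ i → f i (x ℤ.+ Vec.lookup b i ℤ.* m)}
      {lam′ b} {∑ᶜ xs λ x → ∑ᶜ ms λ m → ∏ᶜ (allFin k) λ i → f′ i (x ℤ.+ Vec.lookup b i ℤ.* m)} (hλ b)
      (Closeᶜ-∑ xs λ x → Closeᶜ-∑ ms λ m → Closeᶜ-∏ (allFin k) λ i → hf i (x ℤ.+ Vec.lookup b i ℤ.* m))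

  at-R : ∀ n {lam : Vec ℤ k → ℂ} (λ-fin : FinSuppᵏ lam)
    {f : Fin k → ℤ → ℂ} (f-fin : Σ ℕ λ L → ∀ i → SupportedOn (∣_∣≤ L) (f i)) →
    at n (R H lam λ-fin f f-fin) ≡ ∑ᵍ (vecs (window (proj₁ λ-fin)) k) λ b → at n (lam b) ⊗
      ∑ᵍ (window (proj₁ f-fin ℕ.+ proj₁ λ-fin ℕ.* H)) λ x → ∑ᵍ (range H) λ m →
        ∏ λ j → at n (f j (x ℤ.+ Vec.lookup b j ℤ.* m))
  at-R n {lam} (T , _) {f} (L , _) = trans
    (nested (box T k) (interval (L ℕ.+ T ℕ.* H)) (range H))
    (cong₂ (λ bs xs → ∑ᵍ bs λ b → at n (lam b) ⊗ ∑ᵍ xs λ x → ∑ᵍ (range H) λ m →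
        ∏ λ j → at n (f j (x ℤ.+ Vec.lookup b j ℤ.* m)))
      (box≡vecs T k) (sym (window≡interval (L ℕ.+ T ℕ.* H))))
    where
    nested : ∀ (bs : List (Vec ℤ k)) (xs ms : List ℤ) →
      at n (∑ᶜ bs λ b → lam b *ᶜ ∑ᶜ xs λ x → ∑ᶜ ms λ m → ∏ᶜ (allFin k) λ i → f i (x ℤ.+ Vec.lookup b i ℤ.* m)) ≡
      ∑ᵍ bs λ b → at n (lam b) ⊗ ∑ᵍ xs λ x → ∑ᵍ ms λ m → ∏ λ j → at n (f j (x ℤ.+ Vec.lookup b j ℤ.* m))
    nested bs xs ms = trans (at-∑ n bs _) (∑ᵍ.∑-cong bs λ b → cong (at n (lam b) ⊗_)
      (trans (at-∑ n xs _) (∑ᵍ.∑-cong xs λ x → trans (at-∑ n ms _) (∑ᵍ.∑-cong ms λ m →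
        at-∏ n id λ i → f i (x ℤ.+ Vec.lookup b i ℤ.* m)))))

gowersNorm-≥ : ∀ {q X} s M (1≤M : 1 ℕ.≤ M) (g : ℤ → ℂ) → 0ℚ ≤ q → Eventually (λ n → seq X n ≤ q) →
  fromℚ (tower s q) *ᴿ re (gowersSum s 𝟙[ M ] (restrict-finite M (const 1ᶜ))) ≤ᴿ
    re (gowersSum s (restrict M g) (restrict-finite M g)) →
  X ≤ᴿ gowersNorm[ M ] 1≤M s g
gowersNorm-≥ {q} {X} s M 1≤M g 0≤q X≤q h =
  ≤-÷ {q} {X} {gowersNorm s (restrict M g) (restrict-finite M g)} {gowersNorm s 𝟙[ M ] (restrict-finite M (const 1ᶜ))}
    (0<gowersNorm-1 s M 1≤M) X≤q
    (root-scaled s {q} {re (gowersSum s 𝟙[ M ] (restrict-finite M (const 1ᶜ)))}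
      {re (gowersSum s (restrict M g) (restrict-finite M g))} 0≤q h)

gowersSum-compare : ∀ s M g q →
  Eventually (λ n → q * Re (Gowers.U {M} {M ℕ.+ M} ℕ.≤-refl s (at n ∘ 𝟙[ M ])) ≤
    Re (Gowers.U {M} {M ℕ.+ M} ℕ.≤-refl s (at n ∘ restrict M g))) →
  fromℚ q *ᴿ re (gowersSum s 𝟙[ M ] (restrict-finite M (const 1ᶜ))) ≤ᴿ
    re (gowersSum s (restrict M g) (restrict-finite M g))
gowersSum-compare s M g q h = eventually-≤
  {fromℚ q *ᴿ re (gowersSum s 𝟙[ M ] (restrict-finite M (const 1ᶜ)))}
  {re (gowersSum s (restrict M g) (restrict-finite M g))}
  (mapᵉ (λ n → subst₂ (λ x y → q * Re x ≤ Re y)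
    (sym (at-gowersSum M n s 𝟙[ M ] (proj₂ (restrict-finite M (const 1ᶜ)))))
    (sym (at-gowersSum M n s (restrict M g) (proj₂ (restrict-finite M g))))) h)

target-bound : ∀ {κ τ₂ x y τ} → 0ℚ ≤ κ → 0ℚ < τ₂ → 0ℚ ≤ x → x ≤ τ₂ * τ → ½ ≤ y →
  κ * (½ * recip τ₂) * (x * recip y) ≤ κ * τ
target-bound {κ} {τ₂} {x} {y} {τ} 0≤κ 0<τ₂ 0≤x x≤ y≥ = begin
  κ * (½ * recip τ₂) * (x * recip y)
    ≤⟨ *-monoˡ (κ * (½ * recip τ₂)) (nn* 0≤κ (nn* (ℚ.<⇒≤ 0<½) (recip-nn 0<τ₂)))
         (mono* 0≤x (recip-nn (ℚ.<-≤-trans 0<½ y≥)) x≤ (recip-anti 0<½ y≥)) ⟩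
  κ * (½ * recip τ₂) * (τ₂ * τ * (1ℚ + 1ℚ))
    ≡⟨ solve 4 (λ k r t x → k :* (con ½ :* r) :* (t :* x :* (con 1ℚ :+ con 1ℚ)) := t :* r :* (k :* x)) refl κ (recip τ₂) τ₂ τ ⟩
  τ₂ * recip τ₂ * (κ * τ)
    ≡⟨ trans (cong (_* (κ * τ)) (recip-inv 0<τ₂)) (ℚ.*-identityˡ (κ * τ)) ⟩
  κ * τ ∎
  where
  open ℚ.≤-Reasoning
  open ℚ-Solver.+-*-Solver

-- Truncation, rational parameters and the conclusion

module Proof (r : ℕ) (C₀ : ℝ) where

  private
    module Q = ℚ-Solver.+-*-Solver

  C₀-bounded : ∃ λ a → Eventually λ n → seq C₀ n ≤ ι a
  C₀-bounded =
    let K , 0<K , M , b = bounded {seq C₀} (cauchy C₀)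
    in ℤ.∣ ℚ.↥ K ∣ , M , λ n p → ℚ.≤-trans (≤∣∣ (seq C₀ n)) (ℚ.≤-trans (b n p) (≤ι K))

  private
    A₀ A k : ℕ
    A₀ = proj₁ C₀-bounded
    -- A coefficient is at most C₀B ≤ 2A₀M/H up to an error 1/H; multiplied by H this is at most
    -- (2A₀ + 1)M.
    A  = suc (A₀ ℕ.+ A₀)
    k  = suc (suc r)

  open FinalConstants A r

  private
    0<2ˢ : 0ℚ < tower s (1ℚ + 1ℚ)
    0<2ˢ = tower-pos s (pos+ 0<1 0≤1)

  opaque
    κ : ℚ
    -- The factor 2^(-2^s) compensates δ ≤ 2d, and the ½ compensates that D ≥ 1 is used at an index
    -- only as D ≥ ½.
    κ = κ₀ * (½ * recip (tower s (1ℚ + 1ℚ)))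

    κ-def : κ ≡ κ₀ * (½ * recip (tower s (1ℚ + 1ℚ)))
    κ-def = refl

    0<κ : 0ℚ < κ
    0<κ = pos* 0<κ₀ (pos* 0<½ (recip-pos 0<2ˢ))

  -- `B`, `δ⁻¹` and `p` are variables known through equations between rationals or naturals, so that
  -- the quotients and the power in the theorem stay folded until the end.
  module Core (M′ H′ : ℕ) (N : ℝ) (M=⌊N⌋ : IsFloor N (suc M′)) (δ : ℝ) (0<δ : 0ᴿ <ᴿ δ) (δ<¼ : δ <ᴿ fromℚ ¼)
    (B : ℝ) (B≡ : ∀ n → seq B n ≡ seq N n * recip (ι (suc H′)))
    (δ⁻¹ : ℝ) (δ⁻¹≡ : ∀ n → seq δ⁻¹ n ≡ recip (seq δ n)) (p : ℕ) (p≡ : p ≡ 2 ^ s) where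

    private
      M = suc M′
      H = suc H′
      m = ι M
      h = ι H
      v = unit H′
      w = unit M′
      ξ = h * w
      0<m = 0<ι M′
      0<h = 0<ι H′
      0<v = 0<unit H′
      0<w = 0<unit M′
      0≤v = ℚ.<⇒≤ 0<v

    private
      δ≤¼ : Eventually λ n → seq δ n ≤ ¼
      δ≤¼ = let ε , 0<ε , K , b = δ<¼ in K , λ n p → ℚ.≤-trans (le (ℚ.<⇒≤ 0<ε) refl) (b n p)

      δ-approx : ∃ λ q → 0ℚ < q × Eventually λ n → q ≤ seq δ n × seq δ n ≤ (1ℚ + 1ℚ) * q
      δ-approx = within-factor-2 {δ} 0<δ

    d : ℚ
    d = proj₁ δ-approx

    private
      0<d : 0ℚ < d
      0<d = proj₁ (proj₂ δ-approx)
      d≤δ≤2d : Eventually λ n → d ≤ seq δ n × seq δ n ≤ (1ℚ + 1ℚ) * d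
      d≤δ≤2d = proj₂ (proj₂ δ-approx)
      0<2d : 0ℚ < (1ℚ + 1ℚ) * d
      0<2d = pos* (pos+ 0<1 0≤1) 0<d

      1≤m : 1ℚ ≤ m
      1≤m = ι-mono {1} (s≤s z≤n)

      N-bounds : Eventually λ n → ½ * m ≤ seq N n × seq N n ≤ (1ℚ + 1ℚ) * m
      N-bounds = mapᵉ (λ n (lo , hi) → low (seq N n) lo , ℚ.≤-trans hi upper-bound)
        (proj₁ M=⌊N⌋ ½ 0<½ and below (proj₂ M=⌊N⌋))
        where
        below : N <ᴿ fromℕ (suc M) → Eventually λ n → seq N n ≤ ι (suc M)
        below (ε , 0<ε , K , b) = K , λ n p → ℚ.≤-trans (le (ℚ.<⇒≤ 0<ε) refl) (b n p)
        low : ∀ y → m ≤ y + ½ → ½ * m ≤ y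
        low y h = le {d = (y + ½ - m) + ½ * (m - 1ℚ)} (nn+ (nn-sub h) (nn* (ℚ.<⇒≤ 0<½) (nn-sub 1≤m)))
          (Q.solve 2 (λ m y → Q.con ½ Q.:* m Q.:+ ((y Q.:+ Q.con ½ Q.:- m) Q.:+ Q.con ½ Q.:* (m Q.:- Q.con 1ℚ)) Q.:= y) refl m y)
        upper-bound : ι (suc M) ≤ (1ℚ + 1ℚ) * m
        upper-bound = subst (_≤ (1ℚ + 1ℚ) * m) (sym (ι-suc M)) (le (nn-sub 1≤m)
          (Q.solve 1 (λ m → Q.con 1ℚ Q.:+ m Q.:+ (m Q.:- Q.con 1ℚ) Q.:= (Q.con 1ℚ Q.:+ Q.con 1ℚ) Q.:* m) refl m))

      B-bounds : Eventually λ n → ½ * (m * v) ≤ seq B n × seq B n ≤ (1ℚ + 1ℚ) * (m * v)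
      B-bounds = mapᵉ (λ n (lo , hi) → subst (λ b → ½ * (m * v) ≤ b × b ≤ (1ℚ + 1ℚ) * (m * v)) (sym (B≡ n))
        (convert (seq N n) lo hi)) N-bounds
        where
        convert : ∀ y → ½ * m ≤ y → y ≤ (1ℚ + 1ℚ) * m →
          ½ * (m * v) ≤ y * recip h × y * recip h ≤ (1ℚ + 1ℚ) * (m * v)
        convert y lo hi = subst (λ t → ½ * (m * v) ≤ y * t × y * t ≤ (1ℚ + 1ℚ) * (m * v)) (sym (recip-ι H′))
          ( subst (_≤ y * v) (ℚ.*-assoc ½ m v) (*-monoʳ v 0≤v lo)
          , subst (y * v ≤_) (ℚ.*-assoc (1ℚ + 1ℚ) m v) (*-monoʳ v 0≤v hi))

      0<mv = pos* 0<m 0<v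

      mvξ≡1 : m * v * ξ ≡ 1ℚ
      mvξ≡1 = trans (Q.solve 4 (λ m v h w → m Q.:* v Q.:* (h Q.:* w) Q.:= (m Q.:* w) Q.:* (h Q.:* v)) refl m v h w)
        (trans (cong₂ _*_ (ι-unit M′) (ι-unit H′)) refl)

      recip-2d : (1ℚ + 1ℚ) * d * recip ((1ℚ + 1ℚ) * d) ≡ 1ℚ
      recip-2d = recip-inv 0<2d

    module _ (C′δ⁻¹≤B : fromℚ C′ *ᴿ δ⁻¹ ≤ᴿ B) (C′δ⁻ᵖ≤H : fromℚ C′ *ᴿ δ⁻¹ ^ᴿ p ≤ᴿ fromℕ (suc H′)) where

      private
        ρ = recip ((1ℚ + 1ℚ) * d)
        0<ρ = recip-pos 0<2d
        0≤C′ = ℚ.≤-trans (0≤ι 7) 7≤C′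

        ρ≤δ⁻¹ : Eventually λ n → ρ ≤ seq δ⁻¹ n
        ρ≤δ⁻¹ = mapᵉ (λ n (lo , hi) → subst (ρ ≤_) (sym (δ⁻¹≡ n)) (recip-anti (ℚ.<-≤-trans 0<d lo) hi)) d≤δ≤2d

        C′ξ≤ : C′ * ξ ≤ ι 6 * d
        C′ξ≤ = transfer (constantly (mapᵉ
          (λ n (C′≤B , ρ≤ , _ , B≤) → ℚ.≤-trans (*-monoˡ C′ 0≤C′ ρ≤)
            (ℚ.≤-trans C′≤B (ℚ.+-monoˡ-≤ (m * v) B≤)))
          (C′δ⁻¹≤B (m * v) 0<mv and ρ≤δ⁻¹ and B-bounds)))
          where
          transfer : C′ * ρ ≤ (1ℚ + 1ℚ) * (m * v) + m * v → C′ * ξ ≤ ι 6 * d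
          transfer le₁ = subst₂ _≤_
            (trans (Q.solve 4 (λ c r x y → c Q.:* r Q.:* (x Q.:* y) Q.:= c Q.:* x Q.:* (y Q.:* r)) refl C′ ρ ξ ((1ℚ + 1ℚ) * d))
              (trans (cong (λ t → C′ * ξ * t) recip-2d) (ℚ.*-identityʳ (C′ * ξ))))
            (trans (Q.solve 3 (λ b x d → ((Q.con 1ℚ Q.:+ Q.con 1ℚ) Q.:* b Q.:+ b) Q.:* (x Q.:* ((Q.con 1ℚ Q.:+ Q.con 1ℚ) Q.:* d))
                Q.:= b Q.:* x Q.:* (Q.con (ι 6) Q.:* d)) refl (m * v) ξ d)
              (trans (cong (_* (ι 6 * d)) mvξ≡1) (ℚ.*-identityˡ (ι 6 * d))))
            (*-monoʳ (ξ * ((1ℚ + 1ℚ) * d)) (nn* (nn* (ℚ.<⇒≤ 0<h) (ℚ.<⇒≤ 0<w)) (ℚ.<⇒≤ 0<2d)) le₁)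

        C′v≤ : v * (C′ * tower s ½) ≤ ι 2 * tower s d
        C′v≤ = transfer (constantly (mapᵉ
          (λ n (C′≤H , ρ≤) → ℚ.≤-trans
            (*-monoˡ C′ 0≤C′ (ℚ.≤-trans (tower-mono s (ℚ.<⇒≤ 0<ρ) ρ≤)
              (ℚ.≤-reflexive (trans (tower-^ s (seq δ⁻¹ n)) (trans (cong (seq δ⁻¹ n ^ℚ_) (sym p≡)) (sym (seq-^ᴿ δ⁻¹ p n)))))))
            C′≤H)
          (C′δ⁻ᵖ≤H h 0<h and ρ≤δ⁻¹)))
          where
          halfρ : ρ * d ≡ ½
          halfρ = trans (Q.solve 2 (λ r d → r Q.:* d Q.:= Q.con ½ Q.:* ((Q.con 1ℚ Q.:+ Q.con 1ℚ) Q.:* d Q.:* r)) refl ρ d)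
            (cong (λ t → ½ * t) recip-2d)
          transfer : C′ * tower s ρ ≤ h + h → v * (C′ * tower s ½) ≤ ι 2 * tower s d
          transfer le₁ = subst₂ _≤_
            (trans (Q.solve 4 (λ c r v t → c Q.:* r Q.:* (v Q.:* t) Q.:= v Q.:* (c Q.:* (r Q.:* t))) refl C′ (tower s ρ) v (tower s d))
              (cong (λ t → v * (C′ * t)) (trans (sym (tower-* s ρ d)) (cong (tower s) halfρ))))
            (trans (Q.solve 3 (λ h v t → (h Q.:+ h) Q.:* (v Q.:* t) Q.:= h Q.:* v Q.:* (Q.con (ι 2) Q.:* t)) refl h v (tower s d))
              (trans (cong (_* (ι 2 * tower s d)) (ι-unit H′)) (ℚ.*-identityˡ (ι 2 * tower s d))))
            (*-monoʳ (v * tower s d) (nn* 0≤v (tower-nn s (ℚ.<⇒≤ 0<d))) le₁)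

        -- The hypothesis on B does this: 7ξ ≤ C′ξ ≤ 6d with d ≤ 1 gives H/M ≤ 1.
        H≤M : H ℕ.≤ M
        H≤M = ι-cancel (subst₂ _≤_
          (trans (Q.solve 3 (λ h w m → h Q.:* w Q.:* m Q.:= h Q.:* (m Q.:* w)) refl h w m)
            (trans (cong (λ t → h * t) (ι-unit M′)) (ℚ.*-identityʳ h)))
          (ℚ.*-identityˡ m)
          (*-monoʳ m (ℚ.<⇒≤ 0<m) ξ≤1))
          where
          d≤1 : d ≤ 1ℚ
          d≤1 = constantly (mapᵉ (λ n (lo , hi) → ℚ.≤-trans (proj₁ lo) (ℚ.≤-trans hi
            (le {d = ½ + ¼} (nn+ (ℚ.<⇒≤ 0<½) (nn* (ℚ.<⇒≤ 0<½) (ℚ.<⇒≤ 0<½))) refl))) (d≤δ≤2d and δ≤¼))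
          ξ≤1 : ξ ≤ 1ℚ
          ξ≤1 = ℚ.*-cancelˡ-≤-pos (ι 7) (ℚ.≤-trans
            (*-monoʳ ξ (nn* (ℚ.<⇒≤ 0<h) (ℚ.<⇒≤ 0<w)) 7≤C′)
            (ℚ.≤-trans C′ξ≤ (ℚ.≤-trans (ℚ.*-monoˡ-≤-nonNeg (ι 6) d≤1) (ι-mono {6} {7} (ℕ.n≤1+n 6)))))

      module _ (lam : Vec ℤ (suc (suc r)) → ℂ) (lam-bdd : OneBounded lam) (lam-supp : SupportedOn (Cube (C₀ *ᴿ B)) lam)
        (λ-fin : FinSuppᵏ lam) (f : Fin (suc (suc r)) → ℤ → ℂ) (f-bdd : ∀ i → OneBounded (f i))
        (f-supp : ∀ i → SupportedOn (_∈[ suc M′ ]) (f i)) (f-fin : ∀ i → SupportedOn (∣_∣≤ suc M′) (f i)) where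

        private
          -- The sum in `R` runs over the radius `T` that accompanies λ, which may be far larger
          -- than B. `T′` is of order M/H as the estimates require; their minimum `L` fits into the
          -- box and satisfies the size bound.
          T T′ L : ℕ
          T = proj₁ λ-fin
          T′ = A ℕ.* M ℕ./ H
          L = T ℕ.⊓ T′

          LH≤AM : L ℕ.* H ℕ.≤ A ℕ.* M
          LH≤AM = ℕ.≤-trans (ℕ.*-monoˡ-≤ H (ℕ.m⊓n≤n T T′)) (ℕ÷.m/n*n≤m (A ℕ.* M) H)

          small : ∀ {a} → fromℕ ℤ.∣ a ∣ ≤ᴿ C₀ *ᴿ B → ℤ.∣ a ∣ ℕ.≤ T′
          small {a} h₁ =
            subst (ℕ._≤ T′) (ℕ÷.m*n/n≡m ℤ.∣ a ∣ H) (ℕ÷./-monoˡ-≤ H (ι-cancel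
              (constantly (mapᵉ (λ n (a≤ , C₀≤ , lo , hi) → bound (seq C₀ n) (seq B n) a≤ C₀≤
                  (ℚ.≤-trans (nn* (ℚ.<⇒≤ 0<½) (ℚ.<⇒≤ 0<mv)) lo) hi)
                (h₁ v 0<v and proj₂ C₀-bounded and B-bounds)))))
            where
            bound : ∀ c b → ι ℤ.∣ a ∣ ≤ c * b + v → c ≤ ι A₀ → 0ℚ ≤ b → b ≤ (1ℚ + 1ℚ) * (m * v) →
              ι (ℤ.∣ a ∣ ℕ.* H) ≤ ι (A ℕ.* M)
            bound c b a≤ c≤ 0≤b b≤ = begin
              ι (ℤ.∣ a ∣ ℕ.* H)            ≡⟨ ι-* ℤ.∣ a ∣ H ⟩
              ι ℤ.∣ a ∣ * h                ≤⟨ *-monoʳ h (ℚ.<⇒≤ 0<h) (ℚ.≤-trans a≤ (ℚ.+-monoˡ-≤ v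
                  (ℚ.≤-trans (*-monoʳ b 0≤b c≤)
                    (*-monoˡ (ι A₀) (0≤ι A₀) b≤)))) ⟩
              (ι A₀ * ((1ℚ + 1ℚ) * (m * v)) + v) * h
                  ≡⟨ Q.solve 4 (λ a m v h → (a Q.:* ((Q.con 1ℚ Q.:+ Q.con 1ℚ) Q.:* (m Q.:* v)) Q.:+ v) Q.:* h
                       Q.:= (h Q.:* v) Q.:* ((a Q.:+ a) Q.:* m Q.:+ Q.con 1ℚ)) refl (ι A₀) m v h ⟩
              h * v * ((ι A₀ + ι A₀) * m + 1ℚ) ≡⟨ trans (cong (_* ((ι A₀ + ι A₀) * m + 1ℚ)) (ι-unit H′)) (ℚ.*-identityˡ _) ⟩
              (ι A₀ + ι A₀) * m + 1ℚ       ≤⟨ ℚ.+-monoʳ-≤ ((ι A₀ + ι A₀) * m) 1≤m ⟩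
              (ι A₀ + ι A₀) * m + m        ≡⟨ Q.solve 2 (λ a m → (a Q.:+ a) Q.:* m Q.:+ m Q.:= (Q.con 1ℚ Q.:+ (a Q.:+ a)) Q.:* m) refl (ι A₀) m ⟩
              (1ℚ + (ι A₀ + ι A₀)) * m     ≡⟨ cong (_* m) (trans (cong (λ t → 1ℚ + t) (sym (ι-+ A₀ A₀))) (sym (ι-suc (A₀ ℕ.+ A₀)))) ⟩
              ι A * m                      ≡⟨ sym (ι-* A M) ⟩
              ι (A ℕ.* M)                  ∎
              where open ℚ.≤-Reasoning

          small? : ∀ (b : Vec ℤ k) → Dec (All (λ a → ℤ.∣ a ∣ ℕ.≤ L) b)
          small? = All.all? λ a → ℤ.∣ a ∣ ℕ.≤? L

          -- Outside the cube λ is only equal to 0 as a real-number limit; the truncation makes its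
          -- terms exactly 0 there, as finite sums demand.
          lam′ : Vec ℤ k → ℂ
          lam′ b = pick (small? b) (lam b) 0ᶜ

          f′-fin : ∀ i → SupportedOn (∣_∣≤ suc M′) (restrict (suc M′) (f i))
          f′-fin i = proj₂ (restrict-finite (suc M′) (f i))

          λ′-supp : SupportedOn (All (∣_∣≤ proj₁ λ-fin)) lam′
          λ′-supp b ¬p = pick-elim (_≃ᶜ 0ᶜ) (small? b)
            (λ q → contradiction (All.map (λ h → ℕ.≤-trans h (ℕ.m⊓n≤m T T′)) q) ¬p) (λ _ → ≃ᶜ-refl 0ᶜ)

          lam-Close : ∀ b → Closeᶜ (lam b) (lam′ b)
          lam-Close b = pick-elim (Closeᶜ (lam b)) (small? b) (λ _ → Closeᶜ-refl (lam b))
            λ ¬p → ≃⇒Closeᶜ {lam b} {0ᶜ} (vanishes ¬p (All.all? (λ a → ℤ.∣ a ∣ ℕ.≤? T) b))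
            where
            vanishes : ¬ All (λ a → ℤ.∣ a ∣ ℕ.≤ L) b → Dec (All (∣_∣≤ proj₁ λ-fin) b) → lam b ≃ᶜ 0ᶜ
            vanishes ¬p (no ¬q) = proj₂ λ-fin b ¬q
            vanishes ¬p (yes q) = lam-supp b λ c →
              ¬p (All.map (λ (x , y) → ℕ.⊓-glb x y) (All.zip (q , All.map (λ {a} → small {a}) c)))

          f-Close : ∀ i x → Closeᶜ (f i x) (restrict (suc M′) (f i) x)
          f-Close i x = pick-elim (Closeᶜ (f i x)) (x ∈[ M ]?) (λ _ → Closeᶜ-refl (f i x))
            λ ¬p → ≃⇒Closeᶜ {f i x} {0ᶜ} (f-supp i x ¬p)

          -- Uniform over all b, because outside a finite box the values are exactly 0.
          lam′-bdd : Eventually λ n → ∀ b → normSq (at n (lam′ b)) ≤ ι 4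
          lam′-bdd = mapᵉ (λ n h b → pick-elim (λ z → normSq (at n z) ≤ ι 4) (small? b)
              (λ p → h (∈-vecs p)) (λ _ → 0≤ι 4))
            (eventually-∈ (vecs (window L) k) (λ b n → normSq (at n (lam b)) ≤ ι 4) λ b → modulus-≤1 (lam b) (lam-bdd b))

          f′-bdd : Eventually λ n → ∀ i x → normSq (at n (restrict (suc M′) (f i) x)) ≤ ι 4
          f′-bdd = mapᵉ (λ n h i x → pick-elim (λ z → normSq (at n z) ≤ ι 4) (x ∈[ M ]?)
              (λ p → h (∈-cartesianProduct⁺ (∈-allFin i) (∈-window⁺ (∈⇒∣∣≤ M p)))) (λ _ → 0≤ι 4))
            (eventually-∈ (cartesianProduct (allFin k) (window M)) (λ ix n → normSq (at n (f (proj₁ ix) (proj₂ ix))) ≤ ι 4)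
              λ ix → modulus-≤1 (f (proj₁ ix) (proj₂ ix)) (f-bdd (proj₁ ix) (proj₂ ix)))

          lam′-supp : ∀ n b → ¬ All (λ a → ℤ.∣ a ∣ ℕ.≤ L) b → at n (lam′ b) ≡ 0ᵍ
          lam′-supp n b ¬p = pick-elim (λ z → at n z ≡ 0ᵍ) (small? b) (λ p → contradiction p ¬p) (λ _ → refl)

          f′-supp : ∀ n i → Supported M (at n ∘ restrict (suc M′) (f i))
          f′-supp n i x ¬p = pick-elim (λ z → at n z ≡ 0ᵍ) (x ∈[ M ]?) (λ q → contradiction (∈⇒∣∣≤ M q) ¬p) (λ _ → refl)

          t : ℚ
          t = d * (½ * (m * v)) ^ℚ s * sq (½ * m)
          0<t : 0ℚ < t
          0<t = pos* (pos* 0<d (^ℚ-pos (pos* 0<½ 0<mv) s)) (pos* (pos* 0<½ 0<m) (pos* 0<½ 0<m))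

          lhs-large : ∀ Q → (∀ n → seq Q n ≡ seq N n * (seq N n * 1ℚ) * recip (seq B n)) →
            Eventually λ n → t ≤ seq (δ *ᴿ B ^ᴿ suc (suc r) *ᴿ Q) n
          lhs-large Q Q≡ = mapᵉ (λ n ((d≤ , _) , (N≥ , _) , (B≥ , _)) →
              subst₂ (λ y z → t ≤ seq δ n * (seq B n * z) * y) (sym (Q≡ n)) (sym (seq-^ᴿ B s n))
                (bound (seq δ n) (seq N n) (seq B n) d≤ N≥ B≥))
            (d≤δ≤2d and N-bounds and B-bounds)
            where
            pow-mono : ∀ {p q} → 0ℚ ≤ p → p ≤ q → ∀ j → p ^ℚ j ≤ q ^ℚ j
            pow-mono 0≤p p≤q zero    = ℚ.≤-refl
            pow-mono 0≤p p≤q (suc j) = mono* 0≤p (^ℚ-nn 0≤p j) p≤q (pow-mono 0≤p p≤q j)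
            bound : ∀ x y b → d ≤ x → ½ * m ≤ y → ½ * (m * v) ≤ b →
              t ≤ x * (b * b ^ℚ s) * (y * (y * 1ℚ) * recip b)
            bound x y b d≤x m≤y mv≤b = ℚ.≤-trans
              (mono* (nn* (ℚ.<⇒≤ 0<d) (^ℚ-nn 0≤½mv s)) (sq-nn (½ * m))
                (mono* (ℚ.<⇒≤ 0<d) (^ℚ-nn 0≤½mv s) d≤x (pow-mono 0≤½mv mv≤b s))
                (sq-mono (nn* (ℚ.<⇒≤ 0<½) (ℚ.<⇒≤ 0<m)) m≤y))
              (ℚ.≤-reflexive (sym (trans
                (Q.solve 5 (λ x b p y r → x Q.:* (b Q.:* p) Q.:* (y Q.:* (y Q.:* Q.con 1ℚ) Q.:* r) Q.:= b Q.:* r Q.:* (x Q.:* p Q.:* (y Q.:* y)))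
                  refl x b (b ^ℚ s) y (recip b))
                (trans (cong (_* (x * b ^ℚ s * sq y)) (recip-inv (ℚ.<-≤-trans (pos* 0<½ 0<mv) mv≤b))) (ℚ.*-identityˡ _)))))
              where 0≤½mv = nn* (ℚ.<⇒≤ 0<½) (ℚ.<⇒≤ 0<mv)

        gowers-lower-bound : ∀ Q → (∀ n → seq Q n ≡ seq N n * (seq N n * 1ℚ) * recip (seq B n)) →
          δ *ᴿ B ^ᴿ suc (suc r) *ᴿ Q ≤ᴿ ∣ R (suc H′) lam λ-fin f (suc M′ , f-fin) ∣ᶜ → ∀ i →
          fromℚ (tower (suc (suc r)) (κ₀ * tower s d)) *ᴿ
            re (gowersSum (suc (suc r)) 𝟙[ suc M′ ] (restrict-finite (suc M′) (const 1ᶜ))) ≤ᴿ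
            re (gowersSum (suc (suc r)) (restrict (suc M′) (f i)) (restrict-finite (suc M′) (f i)))
        gowers-lower-bound Q Q≡ hyp i = gowersSum-compare (suc (suc r)) (suc M′) (f i) (tower (suc (suc r)) (κ₀ * tower s d))
          (mapᵉ (λ n (l≤ , f≤ , large) →
              AtIndex.gowers-ratio A r (proj₁ λ-fin) L H′ M′ (ℕ.m⊓n≤m T T′) LH≤AM H≤M
                (at n ∘ lam′) (lam′-supp n) l≤ (λ j → at n ∘ restrict (suc M′) (f j)) (f′-supp n) f≤
                0<d C′ξ≤ C′v≤ (subst (λ z → sq (¼ * t) ≤ normSq z)
                  (at-R (suc H′) n {lam′} (proj₁ λ-fin , λ′-supp) {λ j → restrict (suc M′) (f j)} (suc M′ , f′-fin)) large) i
                (at n ∘ 𝟙[ suc M′ ]) (indicator-bdd n))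
            (lam′-bdd and f′-bdd and Close-normSq
              (R (suc H′) lam λ-fin f (suc M′ , f-fin))
              (R (suc H′) lam′ (proj₁ λ-fin , λ′-supp) (λ j → restrict (suc M′) (f j)) (suc M′ , f′-fin)) 0<t
              (R-Close (suc H′) {lam} {lam′} λ-fin λ′-supp {f} {λ j → restrict (suc M′) (f j)} (suc M′ , f-fin) f′-fin lam-Close f-Close)
              (modulus-≥ (R (suc H′) lam λ-fin f (suc M′ , f-fin)) {t} {δ *ᴿ B ^ᴿ suc (suc r) *ᴿ Q} 0<t hyp (lhs-large Q Q≡))))
          where
          indicator-bdd : ∀ n → UnitBounded (λ x → at n (𝟙[ M ] x))
          indicator-bdd n x = pick-elim (λ z → normSq (at n z) ≤ 1ℚ) (x ∈[ M ]?) (λ _ → ℚ.≤-refl) (λ _ → 0≤1)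

    8≤2/δ : Eventually λ n → ι 8 ≤ seq (fromℕ 2 ÷ δ [ 0<δ ]) n
    8≤2/δ = mapᵉ (λ n (δ≤ , (d≤ , _)) → eight (seq δ n) (ℚ.<-≤-trans 0<d d≤) δ≤) (δ≤¼ and d≤δ≤2d)
      where
      eight : ∀ x → 0ℚ < x → x ≤ ¼ → ι 8 ≤ ι 2 * recip x
      eight x 0<x x≤ = ℚ.*-monoˡ-≤-nonNeg (ι 2) (recip-anti 0<x x≤)

    -- The logarithm is used solely through 1 ≤ D: it enlarges the denominator of a bound that
    -- already holds without it.
    target-≤ : ∀ D (0<D : 0ᴿ <ᴿ D) → 1ᴿ ≤ᴿ D →
      Eventually λ n → seq (fromℚ κ *ᴿ (δ ^ᴿ p ÷ D [ 0<D ])) n ≤ κ₀ * tower s d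
    target-≤ D 0<D 1≤D = mapᵉ (λ n ((d≤ , δ≤) , D≥) → subst₂ (λ c z → c * (z * recip (seq D n)) ≤ κ₀ * tower s d) (sym κ-def)
        (trans (tower-^ s (seq δ n)) (trans (cong (seq δ n ^ℚ_) (sym p≡)) (sym (seq-^ᴿ δ p n))))
        (target-bound {κ₀} {tower s (1ℚ + 1ℚ)} {tower s (seq δ n)} {seq D n} {tower s d} (ℚ.<⇒≤ 0<κ₀) 0<2ˢ
          (tower-nn s (ℚ.≤-trans (ℚ.<⇒≤ 0<d) d≤))
          (subst (tower s (seq δ n) ≤_) (tower-* s (1ℚ + 1ℚ) d) (tower-mono s (ℚ.≤-trans (ℚ.<⇒≤ 0<d) d≤) δ≤))
          (cancel (seq D n) D≥)))
      (d≤δ≤2d and 1≤D ½ 0<½)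
      where
      cancel : ∀ q → 1ℚ ≤ q + ½ → ½ ≤ q
      cancel q h = le (nn-sub h) (Q.solve 1 (λ q → Q.con ½ Q.:+ ((q Q.:+ Q.con ½) Q.:- Q.con 1ℚ) Q.:= q) refl q)

    0≤q : 0ℚ ≤ κ₀ * tower s d
    0≤q = nn* (ℚ.<⇒≤ 0<κ₀) (tower-nn s (ℚ.<⇒≤ 0<d))

log-power-root : ∀ k j y (0<y : 0ᴿ <ᴿ y) → Eventually (λ n → ι 8 ≤ seq y n) →
  0ᴿ <ᴿ root2^ k (log y 0<y ^ᴿ j) × 1ᴿ ≤ᴿ root2^ k (log y 0<y ^ᴿ j)
log-power-root k j y 0<y h =
  let K , b = 1≤^ {log y 0<y} (1≤log y 0<y h) j
  in 0<root2^ k {log y 0<y ^ᴿ j} (positive {log y 0<y ^ᴿ j} 1ℚ 0<1 K b) ,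
     1≤root k {log y 0<y ^ᴿ j} (eventually-≤ {1ᴿ} {log y 0<y ^ᴿ j} (K , b))

module _ (r : ℕ) (C₀ : ℝ) where

  private
    module 𝓕 = FinalConstants (suc (proj₁ (Proof.C₀-bounded r C₀) ℕ.+ proj₁ (Proof.C₀-bounded r C₀))) r
    module 𝓟 = Proof r C₀

  sizeConst normConst : ℚ
  sizeConst = 𝓕.C′
  normConst = 𝓟.κ

  0<sizeConst : 0ℚ < sizeConst
  0<sizeConst = ℚ.<-≤-trans (0<ι 6) 𝓕.7≤C′

  0<normConst : 0ℚ < normConst
  0<normConst = 𝓟.0<κ

  large-count⇒large-norm :
    (N : ℝ) (1≤N : 1ᴿ ≤ᴿ N) (M′ : ℕ) (M=⌊N⌋ : IsFloor N (suc M′))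
    (δ : ℝ) (0<δ : 0ᴿ <ᴿ δ) → δ <ᴿ fromℚ (½ * ½) →
    (H′ : ℕ) .{{nz : NonZero (suc H′)}} →
    let 0<H = 0<fromℕ (suc H′) {{nz}}
        B   = N ÷ fromℕ (suc H′) [ 0<H ]
        0<B = 0<÷ {N} {fromℕ (suc H′)} (0<1≤ {N} 1≤N) 0<H
        δ⁻¹ = inv δ 0<δ
    in
    fromℚ sizeConst *ᴿ δ⁻¹ ≤ᴿ B →
    fromℚ sizeConst *ᴿ δ⁻¹ ^ᴿ (2 ^ (suc (suc r) ∸ 1)) ≤ᴿ fromℕ (suc H′) →
    (lam : Vec ℤ (suc (suc r)) → ℂ) → OneBounded lam →
    (lam-supp : SupportedOn (Cube (C₀ *ᴿ B)) lam) →
    (f : Fin (suc (suc r)) → ℤ → ℂ) → (∀ i → OneBounded (f i)) →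
    (f-supp : ∀ i → SupportedOn (_∈[ suc M′ ]) (f i)) →
    δ *ᴿ B ^ᴿ suc (suc r) *ᴿ (N ^ᴿ 2 ÷ B [ 0<B ])
      ≤ᴿ ∣ R (suc H′) lam (cube-finite {suc (suc r)} {C₀ *ᴿ B} {lam} lam-supp)
               f (suc M′ , λ i → interval-finite {suc M′} {f i} (f-supp i)) ∣ᶜ →
    let ℓ = log (fromℕ 2 ÷ δ [ 0<δ ]) (0<÷ {fromℕ 2} {δ} (0<fromℕ 2) 0<δ)
        D = root2^ (suc (suc r)) (ℓ ^ᴿ (2 ^ (suc (suc r) ∸ 1) ∸ 1))
    in
    Σ (0ᴿ <ᴿ D) λ 0<D →
      (i : Fin (suc (suc r))) →
      fromℚ normConst *ᴿ (δ ^ᴿ (2 ^ (suc (suc r) ∸ 1)) ÷ D [ 0<D ]) ≤ᴿ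
        gowersNorm[ suc M′ ] (1≤floor {N} 1≤N M=⌊N⌋) (suc (suc r)) (f i)
  large-count⇒large-norm N 1≤N M′ M=⌊N⌋ δ 0<δ δ<¼ H′ {{nz}} hB hH lam lam-bdd lam-supp f f-bdd f-supp large =
    0<D , λ i → gowersNorm-≥
      {𝓕.κ₀ * tower (suc r) 𝓒.d}
      {fromℚ normConst *ᴿ (δ ^ᴿ (2 ^ (suc (suc r) ∸ 1)) ÷ root2^ (suc (suc r)) (log (fromℕ 2 ÷ δ [ 0<δ ]) (0<÷ {fromℕ 2} {δ} (0<fromℕ 2) 0<δ) ^ᴿ (2 ^ (suc (suc r) ∸ 1) ∸ 1)) [ 0<D ])}
      (suc (suc r)) (suc M′) (1≤floor {N} 1≤N M=⌊N⌋) (f i) 𝓒.0≤q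
      (𝓒.target-≤ (root2^ (suc (suc r)) (log (fromℕ 2 ÷ δ [ 0<δ ]) (0<÷ {fromℕ 2} {δ} (0<fromℕ 2) 0<δ) ^ᴿ (2 ^ (suc (suc r) ∸ 1) ∸ 1))) 0<D 1≤D)
      (𝓒.gowers-lower-bound hB hH lam lam-bdd lam-supp
        (cube-finite {suc (suc r)} {C₀ *ᴿ (N ÷ fromℕ (suc H′) [ 0<fromℕ (suc H′) {{nz}} ])} {lam} lam-supp) f f-bdd f-supp
        (λ j → interval-finite {suc M′} {f j} (f-supp j))
        (N ^ᴿ 2 ÷ (N ÷ fromℕ (suc H′) [ 0<fromℕ (suc H′) {{nz}} ]) [ 0<÷ {N} {fromℕ (suc H′)} (0<1≤ {N} 1≤N) (0<fromℕ (suc H′) {{nz}}) ]) (λ _ → refl) large i)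
    where
    module 𝓒 = 𝓟.Core M′ H′ N M=⌊N⌋ δ 0<δ δ<¼ (N ÷ fromℕ (suc H′) [ 0<fromℕ (suc H′) {{nz}} ]) (λ _ → refl)
      (inv δ 0<δ) (λ _ → refl) (2 ^ (suc (suc r) ∸ 1)) refl
    root-facts = log-power-root (suc (suc r)) (2 ^ (suc (suc r) ∸ 1) ∸ 1) (fromℕ 2 ÷ δ [ 0<δ ]) (0<÷ {fromℕ 2} {δ} (0<fromℕ 2) 0<δ) 𝓒.8≤2/δ
    0<D = proj₁ root-facts
    1≤D = proj₂ root-facts

proposition3p7 : (k : ℕ) (C₀ : ℝ) → 2 ℕ.≤ k → 1ᴿ ≤ᴿ C₀ →
    ∃ λ (c : ℝ) → ∃ λ (C′ : ℝ) → ∃ λ (κ : ℝ) →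
    0ᴿ <ᴿ c × 0ᴿ <ᴿ C′ × 0ᴿ <ᴿ κ ×
    ((N : ℝ) (1≤N : 1ᴿ ≤ᴿ N) (M : ℕ) (M=⌊N⌋ : IsFloor N M)
    (δ : ℝ) (0<δ : 0ᴿ <ᴿ δ) → δ <ᴿ c →
    (H : ℕ) .{{_ : NonZero H}} →
    let 0<H = 0<fromℕ H
        B   = N ÷ fromℕ H [ 0<H ]
        0<B = 0<÷ {N} {fromℕ H} (0<1≤ {N} 1≤N) 0<H
        δ⁻¹ = inv δ 0<δ
    in
    C′ *ᴿ δ⁻¹ ≤ᴿ B →
    C′ *ᴿ δ⁻¹ ^ᴿ (2 ^ (k ∸ 1)) ≤ᴿ fromℕ H →
    (lam : Vec ℤ k → ℂ) → OneBounded lam →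
    (lam-supp : SupportedOn (Cube (C₀ *ᴿ B)) lam) →
    (f : Fin k → ℤ → ℂ) → (∀ i → OneBounded (f i)) →
    (f-supp : ∀ i → SupportedOn (_∈[ M ]) (f i)) →
    δ *ᴿ B ^ᴿ k *ᴿ (N ^ᴿ 2 ÷ B [ 0<B ])
      ≤ᴿ ∣ R H lam (cube-finite {k} {C₀ *ᴿ B} {lam} lam-supp)
               f (M , λ i → interval-finite {M} {f i} (f-supp i)) ∣ᶜ →
    let ℓ = log (fromℕ 2 ÷ δ [ 0<δ ]) (0<÷ {fromℕ 2} {δ} (0<fromℕ 2) 0<δ)
        D = root2^ k (ℓ ^ᴿ (2 ^ (k ∸ 1) ∸ 1))
    in
    Σ (0ᴿ <ᴿ D) λ 0<D →
      (i : Fin k) →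
      κ *ᴿ (δ ^ᴿ (2 ^ (k ∸ 1)) ÷ D [ 0<D ]) ≤ᴿ gowersNorm[ M ] (1≤floor {N} 1≤N M=⌊N⌋) k (f i))
proposition3p7 zero C₀ () 1≤C₀
proposition3p7 (suc zero) C₀ (s≤s ()) 1≤C₀
proposition3p7 (suc (suc r)) C₀ 2≤k 1≤C₀ =
  fromℚ (½ * ½) , fromℚ (sizeConst r C₀) , fromℚ (normConst r C₀) ,
  positive {fromℚ (½ * ½)} (½ * ½) (pos* 0<½ 0<½) 0 (λ _ _ → ℚ.≤-refl) ,
  positive {fromℚ (sizeConst r C₀)} (sizeConst r C₀) (0<sizeConst r C₀) 0 (λ _ _ → ℚ.≤-refl) ,
  positive {fromℚ (normConst r C₀)} (normConst r C₀) (0<normConst r C₀) 0 (λ _ _ → ℚ.≤-refl) ,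
  λ where
    N 1≤N zero M=⌊N⌋ → contradiction (1≤floor {N} 1≤N M=⌊N⌋) λ ()
    N 1≤N (suc M′) M=⌊N⌋ δ 0<δ δ<¼ zero → contradiction refl (ℕ.≢-nonZero⁻¹ zero)
    N 1≤N (suc M′) M=⌊N⌋ δ 0<δ δ<¼ (suc H′) {{nz}} → large-count⇒large-norm r C₀ N 1≤N M′ M=⌊N⌋ δ 0<δ δ<¼ H′ {{nz}}
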